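{- Let $D<-4$ be the discriminant of an imaginary quadratic field, $N=|D|$, $\chi=\chi_D$, $h(D)$ the class number, and let $B>1$ be an integer with $\gcd(B,N)=1$. Let $e$ be the multiplicative order of $B$ modulo $N$, let $X=\{x\in\mathbb{Z}: 1\le x\le N,\ \gcd(x,N)=1\}$, and let $C_1,\dots,C_f$ (with $f=\phi(N)/e$) be the $B$-cycles on $X$. Write $C_j=(x_1^{(j)},x_2^{(j)},\dots,x_e^{(j)})$ for $1\le j\le f$, and let $a_1^{(j)}a_2^{(j)}\cdots a_e^{(j)}$ be the period of the base $B$ expansion of $x_1^{(j)}/N$, i.e. $\frac{x_1^{(j)}}{N}=0.\overline{a_1^{(j)}a_2^{(j)}\cdots a_e^{(j)}}_{(B)}$. (1) If $\chi(B)=-1$ and all the cycles $C_j$ are normalized (that is, the initial term satisfies $\chi(x_1^{(j)})=1$ for every $j$), then $$(B+1)\,h(D)=\sum_{j=1}^{f}\sum_{i=1}^{e}(-1)^i a_i^{(j)}.$$ (2) If $\chi(B)=1$, then $$(B-1)\,h(D)=-\sum_{j=1}^{f}\chi(C_j)\sum_{i=1}^{e}a_i^{(j)},$$ where $\chi(C_j)\in\{1,-1\}$ denotes the common value of $\chi$ on the elements of $C_j$.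
   Context: Discriminant and character: let $K=\mathbb{Q}(\sqrt m)$ with $m$ a negative square-free integer. Its discriminant is $D=m$ if $m\equiv 1\pmod 4$ and $D=4m$ otherwise. $h(D)$ is the order of the ideal class group of $K$. The quadratic character $\chi_D:\mathbb{Z}\to\{0,1,-1\}$ modulo $N=|D|$ satisfies $\chi_D(x)=0$ if $\gcd(x,N)>1$, and for $\gcd(x,N)=1$ it is given by: $\chi_D(x)=\left(\frac{x}{|m|}\right)$ (Jacobi symbol) if $D=m\equiv1\pmod 4$; and for $D=4m$: $\chi_D(x)=\chi_4(x)\left(\frac{x}{|m|}\right)$ if $m\equiv3\pmod4$; $\chi_D(x)=\chi_8(x)\left(\frac{x}{|n|}\right)$ if $m=2n$, $n\equiv1\pmod4$; $\chi_D(x)=\chi_4(x)\chi_8(x)\left(\frac{x}{|n|}\right)$ if $m=2n$, $n\equiv3\pmod4$. Here, for odd $x$, $\chi_4(x)=(-1)^{(x-1)/2}$ and $\chi_8(x)=(-1)^{(x^2-1)/8}$. It is an odd character: $\chi_D(-1)=-1$. Base $B$ expansions and cycles: for $x\in X$, put $x_1=x$ and define recursively $Bx_i=a_iN+x_{i+1}$ by division with remainder, $0\le x_{i+1}<N$. Then each $x_i\in X$, each $a_i\in\{0,1,\dots,B-1\}$, $\frac{x}{N}=\sum_{i\ge1}a_i/B^i$ is the base $B$ expansion of $x/N$, and the sequences $(x_i)$, $(a_i)$ are periodic with period $e$, with $x_1,\dots,x_e$ distinct; one writes $x/N=0.\overline{a_1\cdots a_e}_{(B)}$. The sequence $(x_1,\dots,x_e)$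 is called a $B$-cycle; any of its elements may be chosen as initial term (equivalently, the $B$-cycles are the cycles of the permutation of $X$ sending $x$ to the element of $X$ congruent to $Bx$ modulo $N$). If $\chi(B)=-1$, a cycle is called normalized if its initial term $x_1$ satisfies $\chi(x_1)=1$. If $\chi(B)=1$, then $\chi$ is constant on each cycle $C$, and $\chi(C)$ denotes this constant value. -}

module Defs where

open import Algebra.Bundles using (CommutativeRing)
open import Algebra.Properties.Monoid.Sum as MonoidSum using ()
open import Data.Bool.Base using (if_then_else_)
open import Data.Fin.Base using (Fin; toℕ)
import Data.Fin.Properties as Fin
open import Data.Integer.Base as ℤ using (ℤ; +_; 0ℤ; 1ℤ; -1ℤ; ∣_∣; _%ℕ_; _/ℕ_)
import Data.Integer.Properties as ℤ
open import Data.List.Base using (List; []; _∷_; foldr; map)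
open import Data.List.Relation.Unary.Any using (Any)
open import Data.Nat.Base as ℕ using (ℕ; zero; suc)
open import Data.Nat.Divisibility using (_∣_; _∣?_)
open import Data.Nat.GCD using (gcd)
import Data.Nat.Properties as ℕ
open import Data.Nat.Primality.Factorisation using (factorise; factors)
open import Data.Product.Base using (∃-syntax; _×_; _,_)
open import Data.Rational.Base as ℚ using (ℚ; 0ℚ; 1ℚ)
import Data.Rational.Properties as ℚ
open import Data.Rational.Solver using (module +-*-Solver)
open import Function.Bundles using (_⇔_; mk⇔; Bijection; Equivalence)
open import Level using (0ℓ)
open import Relation.Binary.Bundles using (Setoid)
open import Relation.Binary.PropositionalEquality
  using (_≡_; _≢_; refl; sym; trans; cong; cong₂; subst; isEquivalence)
open import Relation.Binary.PropositionalEquality.Properties using (setoid)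
open import Relation.Nullary.Decidable using (yes; no; does)
open import Relation.Nullary.Negation using (¬_)

------------------------------------------------------------------------
-- Quadratic fields and ideal classes

-- ℚ(√m) as the ring ℚ[T]/(T² - m); it is a field exactly when m is not a
-- square, in particular for every negative m.

module QuadraticField (m : ℤ) where

  infix 5 _+_√m

  record K : Set where
    constructor _+_√m
    field
      re im : ℚ

  m/1 : ℚ
  m/1 = m ℚ./ 1

  infixl 6 _+_
  infixl 7 _*_
  infix  8 -_

  _+_ : K → K → K
  (a + b √m) + (c + d √m) = (a ℚ.+ c) + (b ℚ.+ d) √m

  _*_ : K → K → K
  (a + b √m) * (c + d √m) =
    (a ℚ.* c ℚ.+ m/1 ℚ.* (b ℚ.* d)) + (a ℚ.* d ℚ.+ b ℚ.* c) √m

  -_ : K → K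
  - (a + b √m) = (ℚ.- a) + (ℚ.- b) √m

  0K 1K : K
  0K = 0ℚ + 0ℚ √m
  1K = 1ℚ + 0ℚ √m

  fromℤ : ℤ → K
  fromℤ n = (n ℚ./ 1) + 0ℚ √m

  *-assoc : ∀ x y z → (x * y) * z ≡ x * (y * z)
  *-assoc (a + b √m) (c + d √m) (p + q √m) = cong₂ _+_√m
    (solve 7 (λ a b c d p q k →
      (a :* c :+ k :* (b :* d)) :* p :+ k :* ((a :* d :+ b :* c) :* q) :=
      a :* (c :* p :+ k :* (d :* q)) :+ k :* (b :* (c :* q :+ d :* p)))
      refl a b c d p q m/1)
    (solve 7 (λ a b c d p q k →
      (a :* c :+ k :* (b :* d)) :* q :+ (a :* d :+ b :* c) :* p :=
      a :* (c :* q :+ d :* p) :+ b :* (c :* p :+ k :* (d :* q)))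
      refl a b c d p q m/1)
    where open +-*-Solver

  *-comm : ∀ x y → x * y ≡ y * x
  *-comm (a + b √m) (c + d √m) = cong₂ _+_√m
    (solve 5 (λ a b c d k →
      a :* c :+ k :* (b :* d) := c :* a :+ k :* (d :* b)) refl a b c d m/1)
    (solve 4 (λ a b c d → a :* d :+ b :* c := c :* b :+ d :* a) refl a b c d)
    where open +-*-Solver

  *-identityˡ : ∀ x → 1K * x ≡ x
  *-identityˡ (a + b √m) = cong₂ _+_√m
    (solve 3 (λ a b k →
      con 1ℚ :* a :+ k :* (con 0ℚ :* b) := a) refl a b m/1)
    (solve 2 (λ a b → con 1ℚ :* b :+ con 0ℚ :* a := b) refl a b)
    where open +-*-Solver

  *-distribˡ-+ : ∀ x y z → x * (y + z) ≡ x * y + x * z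
  *-distribˡ-+ (a + b √m) (c + d √m) (p + q √m) = cong₂ _+_√m
    (solve 7 (λ a b c d p q k →
      a :* (c :+ p) :+ k :* (b :* (d :+ q)) :=
      (a :* c :+ k :* (b :* d)) :+ (a :* p :+ k :* (b :* q)))
      refl a b c d p q m/1)
    (solve 6 (λ a b c d p q →
      a :* (d :+ q) :+ b :* (c :+ p) :=
      (a :* d :+ b :* c) :+ (a :* q :+ b :* p)) refl a b c d p q)
    where open +-*-Solver

  commutativeRing : CommutativeRing 0ℓ 0ℓ
  commutativeRing = record
    { Carrier = K ; _≈_ = _≡_ ; _+_ = _+_ ; _*_ = _*_ ; -_ = -_
    ; 0# = 0K ; 1# = 1K
    ; isCommutativeRing = record
      { isRing = record
        { +-isAbelianGroup = record
          { isGroup = record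
            { isMonoid = record
              { isSemigroup = record
                { isMagma = record
                  { isEquivalence = isEquivalence ; ∙-cong = cong₂ _+_ }
                ; assoc = λ { (a + b √m) (c + d √m) (p + q √m) →
                    cong₂ _+_√m (ℚ.+-assoc a c p) (ℚ.+-assoc b d q) }
                }
              ; identity =
                  (λ { (a + b √m) →
                    cong₂ _+_√m (ℚ.+-identityˡ a) (ℚ.+-identityˡ b) })
                , (λ { (a + b √m) →
                    cong₂ _+_√m (ℚ.+-identityʳ a) (ℚ.+-identityʳ b) })
              }
            ; inverse =
                (λ { (a + b √m) →
                  cong₂ _+_√m (ℚ.+-inverseˡ a) (ℚ.+-inverseˡ b) })
              , (λ { (a + b √m) →
                  cong₂ _+_√m (ℚ.+-inverseʳ a) (ℚ.+-inverseʳ b) })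
            ; ⁻¹-cong = cong -_
            }
          ; comm = λ { (a + b √m) (c + d √m) →
              cong₂ _+_√m (ℚ.+-comm a c) (ℚ.+-comm b d) }
          }
        ; *-cong = cong₂ _*_
        ; *-assoc = *-assoc
        ; *-identity =
            *-identityˡ , λ x → trans (*-comm x 1K) (*-identityˡ x)
        ; distrib =
            *-distribˡ-+
          , λ x y z → trans (*-comm (y + z) x) (trans (*-distribˡ-+ x y z)
              (cong₂ _+_ (*-comm x y) (*-comm x z)))
        }
      ; *-comm = *-comm
      }
    }

  -- evalMonic (c₀ ∷ … ∷ cₙ₋₁ ∷ []) α = c₀ + c₁ α + … + cₙ₋₁ αⁿ⁻¹ + αⁿ

  evalMonic : List ℤ → K → K
  evalMonic []       α = 1K
  evalMonic (c ∷ cs) α = fromℤ c + α * evalMonic cs α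

  -- Membership in the ring of integers of K.

  Integral : K → Set
  Integral α = ∃[ cs ] evalMonic cs α ≡ 0K

  -- Membership in the submodule of K over the ring of integers spanned by
  -- a list.

  _∈⟨_⟩ : K → List K → Set
  x ∈⟨ [] ⟩     = x ≡ 0K
  x ∈⟨ g ∷ gs ⟩ = ∃[ c ] ∃[ y ] Integral c × y ∈⟨ gs ⟩ × x ≡ c * g + y

  -- Fractional ideals are the nonzero finitely generated submodules of K
  -- over the ring of integers.

  record FractionalIdeal : Set where
    field
      generators : List K
      nonzero    : Any (_≢ 0K) generators

  infix 4 _∈_ _∼_

  _∈_ : K → FractionalIdeal → Set
  x ∈ I = x ∈⟨ FractionalIdeal.generators I ⟩

  -- J = α I for some α ∈ Kˣ (with inverse β).  Since α is invertible, the
  -- equality of submodules J = α I says that x ∈ I iff α x ∈ J.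

  _∼_ : FractionalIdeal → FractionalIdeal → Set
  I ∼ J = ∃[ α ] ∃[ β ] α * β ≡ 1K × (∀ x → x ∈ I ⇔ α * x ∈ J)

  private
    cancel : ∀ α β → α * β ≡ 1K → ∀ x → α * (β * x) ≡ x
    cancel α β αβ≡1 x =
      trans (sym (*-assoc α β x)) (trans (cong (_* x) αβ≡1) (*-identityˡ x))

    ∼-refl : ∀ {I} → I ∼ I
    ∼-refl {I} = 1K , 1K , *-identityˡ 1K , λ x →
      mk⇔ (subst (_∈ I) (sym (*-identityˡ x))) (subst (_∈ I) (*-identityˡ x))

    ∼-sym : ∀ {I J} → I ∼ J → J ∼ I
    ∼-sym {I} {J} (α , β , αβ≡1 , I⇔J) =
      β , α , trans (*-comm β α) αβ≡1 , λ x → mk⇔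
        (λ x∈J → Equivalence.from (I⇔J (β * x))
                   (subst (_∈ J) (sym (cancel α β αβ≡1 x)) x∈J))
        (λ βx∈I → subst (_∈ J) (cancel α β αβ≡1 x)
                    (Equivalence.to (I⇔J (β * x)) βx∈I))

    ∼-trans : ∀ {I J L} → I ∼ J → J ∼ L → I ∼ L
    ∼-trans {I} {J} {L} (α , β , αβ≡1 , I⇔J) (γ , δ , γδ≡1 , J⇔L) =
      γ * α , β * δ , unit , λ x → mk⇔
        (λ x∈I → subst (_∈ L) (sym (*-assoc γ α x))
                   (Equivalence.to (J⇔L (α * x)) (Equivalence.to (I⇔J x) x∈I)))
        (λ γαx∈L → Equivalence.from (I⇔J x) (Equivalence.from (J⇔L (α * x))
                     (subst (_∈ L) (*-assoc γ α x) γαx∈L)))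
      where
      unit : (γ * α) * (β * δ) ≡ 1K
      unit = trans (*-assoc γ α (β * δ))
                   (trans (cong (γ *_) (cancel α β αβ≡1 δ)) γδ≡1)

  -- The underlying set of the ideal class group: fractional ideals modulo
  -- principal ones.

  idealClasses : Setoid 0ℓ 0ℓ
  idealClasses = record
    { Carrier = FractionalIdeal
    ; _≈_ = _∼_
    ; isEquivalence = record
      { refl  = λ {I} → ∼-refl {I}
      ; sym   = λ {I} {J} → ∼-sym {I} {J}
      ; trans = λ {I} {J} {L} → ∼-trans {I} {J} {L}
      }
    }

IsClassNumber : ℤ → ℕ → Set
IsClassNumber m h = Bijection (setoid (Fin h)) (QuadraticField.idealClasses m)

------------------------------------------------------------------------
-- Discriminant and quadratic character

SquareFree : ℤ → Set
SquareFree m = ∀ d → d ℕ.* d ∣ ∣ m ∣ → d ≡ 1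

disc : ℤ → ℤ
disc m = if does (m %ℕ 4 ℕ.≟ 1) then m else + 4 ℤ.* m

legendre : ℤ → ℕ → ℤ
legendre x p with p ∣? ∣ x ∣
... | yes _ = 0ℤ
... | no  _ =
  if does (Fin.any? {n = p} λ y → p ∣? ∣ x ℤ.- + (toℕ y ℕ.* toℕ y) ∣)
  then 1ℤ else -1ℤ

-- The value at n = 0 is a junk value.

jacobi : ℤ → ℕ → ℤ
jacobi x zero      = 0ℤ
jacobi x n@(suc _) = foldr ℤ._*_ 1ℤ (map (legendre x) (factors (factorise n)))

-- Meaningful for odd x only; an exponent of -1 is replaced by its absolute
-- value, so that χ₄ is also correct at negative x.

χ₄ χ₈ : ℤ → ℤ
χ₄ x = -1ℤ ℤ.^ ∣ (x ℤ.- 1ℤ) /ℕ 2 ∣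
χ₈ x = -1ℤ ℤ.^ ∣ (x ℤ.* x ℤ.- 1ℤ) /ℕ 8 ∣

-- χ m is χ_D for D = disc m.  The catch-all clauses are unreachable for
-- square-free m, where 4 ∤ m.

χ : ℤ → ℤ → ℤ
χ m x with gcd ∣ x ∣ ∣ disc m ∣ ℕ.≟ 1
... | no  _ = 0ℤ
... | yes _ with m %ℕ 4
...   | 1 = jacobi x ∣ m ∣
...   | 3 = χ₄ x ℤ.* jacobi x ∣ m ∣
...   | 2 with (m /ℕ 2) %ℕ 4
...     | 1 = χ₈ x ℤ.* jacobi x ∣ m /ℕ 2 ∣
...     | 3 = χ₄ x ℤ.* χ₈ x ℤ.* jacobi x ∣ m /ℕ 2 ∣
...     | _ = 0ℤ
χ m x | yes _ | _ = 0ℤ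

------------------------------------------------------------------------
-- Base B expansions and cycles

-- For B > 1 and N > 1; B ^ k ∸ 1 is then a genuine difference.

IsMultiplicativeOrder : (B N e : ℕ) → Set
IsMultiplicativeOrder B N e =
    0 ℕ.< e
  × N ∣ B ℕ.^ e ℕ.∸ 1
  × (∀ k → 0 ℕ.< k → k ℕ.< e → ¬ N ∣ B ℕ.^ k ℕ.∸ 1)

_∈X[_] : ℕ → ℕ → Set
x ∈X[ N ] = 1 ℕ.≤ x × x ℕ.≤ N × gcd x N ≡ 1

-- A B-cycle with chosen initial term, together with the base B digits of
-- (initial term)/N.  Indices are shifted by one: x i and a i stand for
-- xᵢ₊₁ and aᵢ₊₁.  The sequences are kept infinite; the cycle proper consists
-- of the terms with index below the order of B modulo N.

record BCycle (B N : ℕ) : Set where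
  field
    x a      : ℕ → ℕ
    initial  : x 0 ∈X[ N ]
    division : ∀ i → B ℕ.* x i ≡ a i ℕ.* N ℕ.+ x (suc i)
    bound    : ∀ i → x (suc i) ℕ.< N

  x₁ : ℕ
  x₁ = x 0

-- C lists all the B-cycles on X, each exactly once.

record AllCycles {B N : ℕ} (e : ℕ) {f : ℕ} (C : Fin f → BCycle B N) : Set where
  field
    covering : ∀ y → y ∈X[ N ] →
               ∃[ j ] ∃[ i ] BCycle.x (C j) (toℕ {e} i) ≡ y
    disjoint : ∀ j k (i i′ : Fin e) →
               BCycle.x (C j) (toℕ i) ≡ BCycle.x (C k) (toℕ i′) → j ≡ k

-- χ is constant on a cycle when χ(B) = 1, so its common value is the one at
-- the initial term.

χ-cycle : ∀ {B N} → ℤ → BCycle B N → ℤ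
χ-cycle m C = χ m (+ BCycle.x₁ C)

open MonoidSum ℤ.+-0-monoid public using (sum)

{-# OPTIONS --safe #-}

-- Multiply N aᵢ = B xᵢ − xᵢ₊₁ by χ(xᵢ) = χ(B) χ(xᵢ₊₁) and sum over all cycles:
-- N Σ χ(xᵢ) aᵢ = (B − χ(B)) Σ x χ(x), the last sum over all residues x.  Both
-- parts are therefore the class number formula N h = − Σ x χ(x), which is
-- Dirichlet's, with his limits replaced by estimates between integers.
--
-- The ideal classes have representatives ℤ + ℤ(ω − r)/a; let f₁, …, f_h be their
-- norm forms.  For n ≥ 1 the number of pairs (j , v) with f_j(v) = n is
-- 2 Σ_{d ∣ n} χ(d): both numbers are twice that of the triples (g , a , r) with
-- g² a = n and r a root modulo a of the minimal polynomial of ω, by the geometry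
-- of the lattices on one side, and by Hensel lifting and quadratic reciprocity
-- on the other.  Now weigh these pairs by 4 s(4n) − s(n), s(z) = (T − z)₊³.
-- Over the lattices, the vectors 2v cancel the main term for the vectors v, and
-- the sum over all v, including the term 3 h T³ of v = 0, is O(T^{5/2}).  Over the
-- divisors d, summation by parts against the periodic function χ shows that
-- the pairs with n ≥ 1 contribute 3 (Σ x χ(x) / N) T³ + O(T^{29/10}).

module Submission where

open import Defs
open import Algebra.Bundles using (CommutativeRing)
import Algebra.Solver.Ring
open import Algebra.Solver.Ring.AlmostCommutativeRing
  using (AlmostCommutativeRing; fromCommutativeRing; _-Raw-AlmostCommutative⟶_)
open import Algebra.Structures using (IsCommutativeRing)
open import Data.Empty using (⊥; ⊥-elim)
open import Data.Fin.Base as Fin using (Fin; toℕ; fromℕ<)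
import Data.Fin.Properties as Fin
open import Data.Integer.Base as ℤ hiding (suc; pred; sign; _≤ᵇ_; NonZero; ≢-nonZero; >-nonZero; _/ℕ_; _%ℕ_)
open import Data.Integer.DivMod using (_%ℕ_; _/ℕ_; n%ℕd<d; a≡a%ℕn+[a/ℕn]*n)
open import Data.Integer.Divisibility.Signed as ℤ∣ using (divides; ∣ᵤ⇒∣; ∣⇒∣ᵤ) renaming (_∣_ to _∣ᶻ_)
open import Data.Integer.Properties
open import Data.Integer.Tactic.RingSolver using (solve-∀)
open import Data.List.Base using (List; []; _∷_; length; map; foldr)
import Data.List.Membership.Propositional as Membership
open import Data.List.Relation.Unary.All as All using (All; []; _∷_)
open import Data.List.Relation.Unary.Any using (Any; here; there)
open import Data.Maybe.Base using (Maybe; just; nothing)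
open import Data.Nat.Base as ℕ using (ℕ; zero; suc; s≤s; z≤n; NonZero)
open import Data.Nat.Coprimality as Coprime
  using (Coprime; coprime?; coprime-divisor; coprime-Bézout; gcd≡1⇒coprime; coprime⇒gcd≡1)
import Data.Nat.DivMod as ℕ
open import Data.Nat.Divisibility as ℕ∣ using (_∣_; _∣?_)
open import Data.Nat.GCD using (gcd; gcd[m,n]∣m; gcd[m,n]∣n; gcd-greatest; c*gcd[m,n]≡gcd[cm,cn]; module Bézout; module GCD)
open import Data.Nat.Induction using (<-rec)
open import Data.Nat.ListAction using (product)
open import Data.Nat.ListAction.Properties using (∈⇒∣product)
open import Data.Nat.Primality
  using (Prime; prime[2]; ¬prime[1]; prime⇒irreducible; prime⇒nonZero; prime⇒nonTrivial; euclidsLemma)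
open import Data.Nat.Primality.Factorisation using (factorise; factors; module PrimeFactorisation)
import Data.Nat.Properties as ℕ
import Data.Nat.Tactic.RingSolver as ℕSolver
open import Data.Product.Base using (_×_; _,_; proj₁; proj₂; ∃; ∃-syntax)
open import Data.Rational.Base as ℚ using (ℚ; 0ℚ; 1ℚ; ½; toℚᵘ; ↥_; ↧_)
import Data.Rational.Properties as ℚ
open import Data.Rational.Solver using (module +-*-Solver)
open import Data.Rational.Unnormalised.Base as ℚᵘ using (ℚᵘ; mkℚᵘ; *≡*)
import Data.Rational.Unnormalised.Properties as ℚᵘ
open import Data.Sum.Base using (_⊎_; inj₁; inj₂; [_,_]′)
open import Function.Base using (_∘_; id)
open import Function.Bundles using (_⇔_; mk⇔; module Equivalence; Bijection; module Bijection)
open import Level using (0ℓ)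
open import Relation.Binary.Definitions using (Tri; tri<; tri≈; tri>)
open import Relation.Binary.PropositionalEquality
  using (_≡_; _≢_; refl; sym; trans; cong; cong₂; subst; subst₂; module ≡-Reasoning)
open import Relation.Nullary.Decidable using (Dec; yes; no; ¬?; does)
open import Relation.Nullary.Negation.Core using (¬_)

-- Finite sums

-- The obstacle is that π, the area of an ellipse and L(1, χ) do not exist over the integers. They
-- are the coefficients of the main terms on the two sides, and the combination 4 s(4n) - s(n)
-- removes both main terms before the coefficients need a name. What survives is the value at 0 of
-- the zeta functions: -1 for each form, from the missing vector v = 0, against 2 ζ(0) L(0, χ) =
-- -L(0, χ) for the divisor sum, where -L(0, χ) = Σ x χ(x) / N. So the formula is obtained at 0
-- rather than at 1.
--
-- The cube is the least power for which pointwise bounds suffice: near the boundary of the ellipse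
-- a third difference of s is O(T^{3/2}), and O(T) lattice points give O(T^{5/2}) against T³. The
-- square would give T² against T².
--
-- The estimates become an equation because the two sides differ by a fixed integer times T³, up to
-- an error of lower order. T runs over the powers t¹⁰ because the divisor sum is cut at about
-- T^{6/10} and T^{7/10}; all exponents of t are then integral, with t²⁹ against t³⁰ at the end.

+-cancelˡ : ∀ k {i j : ℤ} → k + i ≡ k + j → i ≡ j
+-cancelˡ k {i} {j} eq = trans (sym (lemma k i)) (trans (cong (_+_ (- k)) eq) (lemma k j))
  where
  lemma : ∀ a b → - a + (a + b) ≡ b
  lemma = solve-∀

+-cancelʳ : ∀ k {i j : ℤ} → i + k ≡ j + k → i ≡ j
+-cancelʳ k {i} {j} eq = +-cancelˡ k (trans (+-comm k i) (trans eq (+-comm j k)))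

+-cancelˡ-≤ : ∀ k {i j : ℤ} → k + i ≤ k + j → i ≤ j
+-cancelˡ-≤ k {i} {j} le = subst₂ _≤_ (lemma k i) (lemma k j) (+-monoʳ-≤ (- k) le)
  where
  lemma : ∀ a b → - a + (a + b) ≡ b
  lemma = solve-∀

Σ< : ℕ → (ℕ → ℤ) → ℤ
Σ< zero    F = 0ℤ
Σ< (suc n) F = Σ< n F + F n

Σ-cong : ∀ n {F G : ℕ → ℤ} → (∀ i → i ℕ.< n → F i ≡ G i) → Σ< n F ≡ Σ< n G
Σ-cong zero    eq = refl
Σ-cong (suc n) eq =
  cong₂ _+_ (Σ-cong n λ i i<n → eq i (ℕ.m<n⇒m<1+n i<n)) (eq n (ℕ.n<1+n n))

Σ-cong′ : ∀ n {F G : ℕ → ℤ} → (∀ i → F i ≡ G i) → Σ< n F ≡ Σ< n G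
Σ-cong′ n eq = Σ-cong n λ i _ → eq i

Σ-const0 : ∀ n → Σ< n (λ _ → 0ℤ) ≡ 0ℤ
Σ-const0 zero    = refl
Σ-const0 (suc n) = trans (+-identityʳ _) (Σ-const0 n)

Σ-zero : ∀ n {F : ℕ → ℤ} → (∀ i → i ℕ.< n → F i ≡ 0ℤ) → Σ< n F ≡ 0ℤ
Σ-zero n eq = trans (Σ-cong n eq) (Σ-const0 n)

Σ-+ : ∀ n (F G : ℕ → ℤ) → Σ< n (λ i → F i + G i) ≡ Σ< n F + Σ< n G
Σ-+ zero    F G = refl
Σ-+ (suc n) F G = trans (cong (_+ (F n + G n)) (Σ-+ n F G)) (lemma (Σ< n F) (Σ< n G) (F n) (G n))
  where
  lemma : ∀ a b c d → a + b + (c + d) ≡ a + c + (b + d)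
  lemma = solve-∀

Σ-*ˡ : ∀ n c (F : ℕ → ℤ) → Σ< n (λ i → c * F i) ≡ c * Σ< n F
Σ-*ˡ zero    c F = sym (*-zeroʳ c)
Σ-*ˡ (suc n) c F = trans (cong (_+ c * F n) (Σ-*ˡ n c F)) (sym (*-distribˡ-+ c _ _))

Σ-*ʳ : ∀ n c (F : ℕ → ℤ) → Σ< n (λ i → F i * c) ≡ Σ< n F * c
Σ-*ʳ n c F = trans (Σ-cong′ n λ i → *-comm (F i) c) (trans (Σ-*ˡ n c F) (*-comm c _))

Σ-neg : ∀ n (F : ℕ → ℤ) → Σ< n (λ i → - F i) ≡ - Σ< n F
Σ-neg zero    F = refl
Σ-neg (suc n) F = trans (cong (_+ - F n) (Σ-neg n F)) (sym (neg-distrib-+ (Σ< n F) (F n)))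

Σ-- : ∀ n (F G : ℕ → ℤ) → Σ< n (λ i → F i - G i) ≡ Σ< n F - Σ< n G
Σ-- n F G = trans (Σ-+ n F (λ i → - G i)) (cong (_+_ (Σ< n F)) (Σ-neg n G))

Σ-swap : ∀ m n (F : ℕ → ℕ → ℤ) →
         Σ< m (λ i → Σ< n (F i)) ≡ Σ< n (λ j → Σ< m (λ i → F i j))
Σ-swap zero    n F = sym (Σ-const0 n)
Σ-swap (suc m) n F = trans (cong (_+ Σ< n (F m)) (Σ-swap m n F)) (sym (Σ-+ n _ (F m)))

Σ-single : ∀ n {F : ℕ → ℤ} k → k ℕ.< n →
           (∀ i → i ℕ.< n → i ≢ k → F i ≡ 0ℤ) → Σ< n F ≡ F k
Σ-single (suc n) {F} k k<1+n off with k ℕ.≟ n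
... | yes refl = trans (cong (_+ F n) (Σ-zero n λ i i<n →
        off i (ℕ.m<n⇒m<1+n i<n) (ℕ.<⇒≢ i<n))) (+-identityˡ (F n))
... | no k≢n = trans (cong₂ _+_
        (Σ-single n k (ℕ.≤∧≢⇒< (ℕ.s≤s⁻¹ k<1+n) k≢n) λ i i<n → off i (ℕ.m<n⇒m<1+n i<n))
        (off n (ℕ.n<1+n n) (λ n≡k → k≢n (sym n≡k)))) (+-identityʳ (F k))

Σ-pair : ∀ n {F : ℕ → ℤ} k l → k ℕ.< n → l ℕ.< n → k ≢ l →
         (∀ i → i ℕ.< n → i ≢ k → i ≢ l → F i ≡ 0ℤ) → Σ< n F ≡ F k + F l
Σ-pair (suc n) {F} k l k<1+n l<1+n k≢l off with k ℕ.≟ n | l ℕ.≟ n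
... | yes refl | yes refl = ⊥-elim (k≢l refl)
... | yes refl | no l≢n = trans (cong (_+ F n)
        (Σ-single n l (ℕ.≤∧≢⇒< (ℕ.s≤s⁻¹ l<1+n) l≢n)
          λ i i<n i≢l → off i (ℕ.m<n⇒m<1+n i<n) (ℕ.<⇒≢ i<n) i≢l)) (+-comm (F l) (F n))
... | no k≢n | yes refl = cong (_+ F n)
        (Σ-single n k (ℕ.≤∧≢⇒< (ℕ.s≤s⁻¹ k<1+n) k≢n)
          λ i i<n i≢k → off i (ℕ.m<n⇒m<1+n i<n) i≢k (ℕ.<⇒≢ i<n))
... | no k≢n | no l≢n = trans (cong₂ _+_
        (Σ-pair n k l (ℕ.≤∧≢⇒< (ℕ.s≤s⁻¹ k<1+n) k≢n) (ℕ.≤∧≢⇒< (ℕ.s≤s⁻¹ l<1+n) l≢n) k≢l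
          λ i i<n → off i (ℕ.m<n⇒m<1+n i<n))
        (off n (ℕ.n<1+n n) (k≢n ∘ sym) (l≢n ∘ sym))) (+-identityʳ _)

Σ-head : ∀ n (F : ℕ → ℤ) → Σ< (suc n) F ≡ F 0 + Σ< n (F ∘ suc)
Σ-head zero    F = trans (+-identityˡ (F 0)) (sym (+-identityʳ (F 0)))
Σ-head (suc n) F = trans (cong (_+ F (suc n)) (Σ-head n F)) (+-assoc (F 0) _ _)

Σ-split : ∀ m n (F : ℕ → ℤ) → Σ< (m ℕ.+ n) F ≡ Σ< m F + Σ< n (λ i → F (m ℕ.+ i))
Σ-split m zero    F = trans (cong (λ k → Σ< k F) (ℕ.+-identityʳ m)) (sym (+-identityʳ _))
Σ-split m (suc n) F = trans (cong (λ k → Σ< k F) (ℕ.+-suc m n))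
  (trans (cong (_+ F (m ℕ.+ n)) (Σ-split m n F)) (+-assoc (Σ< m F) _ _))

Σ-extend : ∀ {m n} {F : ℕ → ℤ} → m ℕ.≤ n → (∀ i → m ℕ.≤ i → F i ≡ 0ℤ) → Σ< n F ≡ Σ< m F
Σ-extend {m} {n} {F} m≤n off = trans (cong (λ k → Σ< k F) (sym (ℕ.m+[n∸m]≡n m≤n)))
  (trans (Σ-split m (n ℕ.∸ m) F)
    (trans (cong (_+_ (Σ< m F)) (Σ-zero (n ℕ.∸ m) λ i _ → off (m ℕ.+ i) (ℕ.m≤m+n m i)))
      (+-identityʳ _)))

Σ-telescope : ∀ n (F : ℕ → ℤ) → Σ< n (λ i → F (suc i) - F i) ≡ F n - F 0
Σ-telescope zero    F = sym (+-inverseʳ (F 0))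
Σ-telescope (suc n) F = trans (cong (_+ (F (suc n) - F n)) (Σ-telescope n F))
  (lemma (F n) (F 0) (F (suc n)))
  where
  lemma : ∀ a b c → a - b + (c - a) ≡ c - b
  lemma = solve-∀

Σ-const : ∀ n c → Σ< n (λ _ → c) ≡ + n * c
Σ-const zero    c = sym (*-zeroˡ c)
Σ-const (suc n) c = trans (cong (_+ c) (Σ-const n c))
  (trans (+-comm (+ n * c) c) (sym (suc-* (+ n) c)))

Σ-mono : ∀ n {F G : ℕ → ℤ} → (∀ i → i ℕ.< n → F i ≤ G i) → Σ< n F ≤ Σ< n G
Σ-mono zero    le = ≤-refl
Σ-mono (suc n) le =
  +-mono-≤ (Σ-mono n λ i i<n → le i (ℕ.m<n⇒m<1+n i<n)) (le n (ℕ.n<1+n n))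

-- The slack of every term is nonnegative and the slacks sum to 0. This turns one-sided information
-- into equality in the pigeonhole principle and in Euler's criterion.
Σ-≡⇒≡ : ∀ n {F G : ℕ → ℤ} → (∀ i → i ℕ.< n → F i ≤ G i) → Σ< n F ≡ Σ< n G →
        ∀ i → i ℕ.< n → F i ≡ G i
Σ-≡⇒≡ (suc n) {F} {G} le eq = go
  where
  lo = Σ-mono n λ i i<n → le i (ℕ.m<n⇒m<1+n i<n)
  top≥ : G n ≤ F n
  top≥ = +-cancelˡ-≤ (Σ< n F) (≤-trans (+-monoˡ-≤ (G n) lo) (≤-reflexive (sym eq)))
  top : F n ≡ G n
  top = ≤-antisym (le n (ℕ.n<1+n n)) top≥
  eq′ : Σ< n F ≡ Σ< n G
  eq′ = +-cancelʳ (F n) (trans eq (cong (_+_ (Σ< n G)) (sym top)))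
  go : ∀ i → i ℕ.< suc n → F i ≡ G i
  go i i<1+n with i ℕ.≟ n
  ... | yes refl = top
  ... | no i≢n = Σ-≡⇒≡ n (λ j j<n → le j (ℕ.m<n⇒m<1+n j<n)) eq′ i
                   (ℕ.≤∧≢⇒< (ℕ.s≤s⁻¹ i<1+n) i≢n)

∣Σ∣≤ : ∀ n {F : ℕ → ℤ} K → (∀ i → i ℕ.< n → ∣ F i ∣ ℕ.≤ K) → ∣ Σ< n F ∣ ℕ.≤ n ℕ.* K
∣Σ∣≤ zero    K le = z≤n
∣Σ∣≤ (suc n) {F} K le = ℕ.≤-trans (∣i+j∣≤∣i∣+∣j∣ (Σ< n F) (F n))
  (ℕ.≤-trans (ℕ.+-mono-≤ (∣Σ∣≤ n K λ i i<n → le i (ℕ.m<n⇒m<1+n i<n)) (le n (ℕ.n<1+n n)))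
    (ℕ.≤-reflexive (ℕ.+-comm (n ℕ.* K) K)))

𝟙 : ∀ {p} {P : Set p} → Dec P → ℤ
𝟙 (yes _) = 1ℤ
𝟙 (no _)  = 0ℤ

𝟙-yes : ∀ {p} {P : Set p} (d : Dec P) → P → 𝟙 d ≡ 1ℤ
𝟙-yes (yes _) _ = refl
𝟙-yes (no ¬p) p = ⊥-elim (¬p p)

𝟙-no : ∀ {p} {P : Set p} (d : Dec P) → ¬ P → 𝟙 d ≡ 0ℤ
𝟙-no (yes p) ¬p = ⊥-elim (¬p p)
𝟙-no (no _)  _  = refl

𝟙-cong : ∀ {p q} {P : Set p} {Q : Set q} (d : Dec P) (e : Dec Q) →
         (P → Q) → (Q → P) → 𝟙 d ≡ 𝟙 e
𝟙-cong (yes p) e f g = sym (𝟙-yes e (f p))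
𝟙-cong (no ¬p) e f g = sym (𝟙-no e (¬p ∘ g))

𝟙* : ∀ {p} {P : Set p} (d : Dec P) {a b : ℤ} → (P → a ≡ b) → 𝟙 d * a ≡ 𝟙 d * b
𝟙* (yes p) eq = cong (1ℤ *_) (eq p)
𝟙* (no _)  {a} {b} eq = trans (*-zeroˡ a) (sym (*-zeroˡ b))

Σ-δ : ∀ n k → k ℕ.< n → (F : ℕ → ℤ) → Σ< n (λ i → 𝟙 (i ℕ.≟ k) * F i) ≡ F k
Σ-δ n k k<n F = trans (Σ-single n k k<n off)
  (trans (cong (_* F k) (𝟙-yes (k ℕ.≟ k) refl)) (*-identityˡ (F k)))
  where
  off : ∀ i → i ℕ.< n → i ≢ k → 𝟙 (i ℕ.≟ k) * F i ≡ 0ℤ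
  off i _ i≢k = trans (cong (_* F i) (𝟙-no (i ℕ.≟ k) i≢k)) (*-zeroˡ (F i))

-- Each `F (π i)` is spread over all j by an indicator; after the exchange of the sums every j
-- collects exactly one i.
Σ-reindex : ∀ m n (π : ℕ → ℕ) (F : ℕ → ℤ) →
            (∀ i → i ℕ.< m → π i ℕ.< n) →
            (∀ j → j ℕ.< n → ∃[ i ] i ℕ.< m × π i ≡ j) →
            (∀ i i′ → i ℕ.< m → i′ ℕ.< m → π i ≡ π i′ → i ≡ i′) →
            Σ< m (λ i → F (π i)) ≡ Σ< n F
Σ-reindex m n π F into onto inj = begin
  Σ< m (λ i → F (π i))
    ≡⟨ Σ-cong m (λ i i<m → sym (Σ-δ n (π i) (into i i<m) F)) ⟩
  Σ< m (λ i → Σ< n (λ j → 𝟙 (j ℕ.≟ π i) * F j))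
    ≡⟨ Σ-swap m n _ ⟩
  Σ< n (λ j → Σ< m (λ i → 𝟙 (j ℕ.≟ π i) * F j))
    ≡⟨ Σ-cong n inner ⟩
  Σ< n F ∎
  where
  open ≡-Reasoning
  inner : ∀ j → j ℕ.< n → Σ< m (λ i → 𝟙 (j ℕ.≟ π i) * F j) ≡ F j
  inner j j<n with onto j j<n
  ... | i₀ , i₀<m , refl = trans (Σ-single m i₀ i₀<m off)
          (trans (cong (_* F (π i₀)) (𝟙-yes (π i₀ ℕ.≟ π i₀) refl)) (*-identityˡ _))
    where
    off : ∀ i → i ℕ.< m → i ≢ i₀ → 𝟙 (π i₀ ℕ.≟ π i) * F (π i₀) ≡ 0ℤ
    off i i<m i≢i₀ = trans (cong (_* F (π i₀)) (𝟙-no (π i₀ ℕ.≟ π i)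
      (λ eq → i≢i₀ (inj i i₀ i<m i₀<m (sym eq))))) (*-zeroˡ (F (π i₀)))

-- By injectivity each j is hit at most once, while the hits of all j together number n. By `Σ-≡⇒≡`
-- every j is hit exactly once.
injective⇒onto : ∀ n (π : ℕ → ℕ) → (∀ i → i ℕ.< n → π i ℕ.< n) →
  (∀ i i′ → i ℕ.< n → i′ ℕ.< n → π i ≡ π i′ → i ≡ i′) →
  ∀ j → j ℕ.< n → ∃[ i ] i ℕ.< n × π i ≡ j
injective⇒onto n π into inj j j<n with ℕ.anyUpTo? (λ i → π i ℕ.≟ j) n
... | yes found = found
... | no none = ⊥-elim (1≢0 (trans (sym (Σ-≡⇒≡ n {hits} {λ _ → 1ℤ} hits≤1 total j j<n))
        (Σ-zero n λ i i<n → 𝟙-no (j ℕ.≟ π i) λ eq → none (i , i<n , sym eq))))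
  where
  1≢0 : 1ℤ ≢ 0ℤ
  1≢0 ()
  hits : ℕ → ℤ
  hits j = Σ< n λ i → 𝟙 (j ℕ.≟ π i)
  total : Σ< n hits ≡ Σ< n (λ _ → 1ℤ)
  total = trans (Σ-swap n n λ j i → 𝟙 (j ℕ.≟ π i)) (Σ-cong n λ i i<n →
    trans (Σ-single n (π i) (into i i<n) (λ j _ j≢πi → 𝟙-no (j ℕ.≟ π i) j≢πi))
      (𝟙-yes (π i ℕ.≟ π i) refl))
  hits≤1 : ∀ j → j ℕ.< n → hits j ≤ 1ℤ
  hits≤1 j _ with ℕ.anyUpTo? (λ i → π i ℕ.≟ j) n
  ... | no none = ≤-trans (≤-reflexive (Σ-zero n λ i i<n →
          𝟙-no (j ℕ.≟ π i) λ eq → none (i , i<n , sym eq))) (+≤+ z≤n)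
  ... | yes (i₀ , i₀<n , refl) = ≤-reflexive (trans
          (Σ-single n i₀ i₀<n λ i i<n i≢i₀ → 𝟙-no (π i₀ ℕ.≟ π i) λ eq → i≢i₀ (inj i i₀ i<n i₀<n (sym eq)))
          (𝟙-yes (π i₀ ℕ.≟ π i₀) refl))

ΣZ : ℕ → (ℤ → ℤ) → ℤ
ΣZ X F = Σ< (suc (X ℕ.+ X)) λ i → F (+ i - + X)

ΣZ-range : ∀ X i → i ℕ.< suc (X ℕ.+ X) → ∣ + i - + X ∣ ℕ.≤ X
ΣZ-range X i i≤2X with ℕ.≤-total X i
... | inj₁ X≤i = ℕ.≤-trans (ℕ.≤-reflexive (cong ∣_∣ (trans (m-n≡m⊖n i X) (⊖-≥ X≤i))))
                   (ℕ.m≤n+o⇒m∸n≤o i X (ℕ.s≤s⁻¹ i≤2X))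
... | inj₂ i≤X = ℕ.≤-trans (ℕ.≤-reflexive (trans (cong ∣_∣ (m-n≡m⊖n i X))
                   (∣⊖∣-≤ i≤X))) (ℕ.m∸n≤m X i)

ΣZ-index : ∀ X z → ∣ z ∣ ℕ.≤ X → ∃[ i ] i ℕ.< suc (X ℕ.+ X) × + i - + X ≡ z
ΣZ-index X (+ n) n≤X = n ℕ.+ X , s≤s (ℕ.+-monoˡ-≤ X n≤X) ,
  trans (cong (_- + X) (pos-+ n X)) (lemma (+ n) (+ X))
  where
  lemma : ∀ a b → a + b - b ≡ a
  lemma = solve-∀
ΣZ-index X -[1+ n ] n<X = X ℕ.∸ suc n ,
  s≤s (ℕ.≤-trans (ℕ.m∸n≤m X (suc n)) (ℕ.m≤m+n X X)) ,
  trans (m-n≡m⊖n (X ℕ.∸ suc n) X) (trans (⊖-≤ (ℕ.m∸n≤m X (suc n)))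
    (cong (λ k → - + k) (ℕ.m∸[m∸n]≡n n<X)))

ΣZ-cong : ∀ X {F G : ℤ → ℤ} → (∀ z → ∣ z ∣ ℕ.≤ X → F z ≡ G z) → ΣZ X F ≡ ΣZ X G
ΣZ-cong X eq = Σ-cong _ λ i i< → eq _ (ΣZ-range X i i<)

ΣZ-index-injective : ∀ X {i j} → + i - + X ≡ + j - + X → i ≡ j
ΣZ-index-injective X {i} {j} eq = +-injective
  (trans (sym (lemma (+ i) (+ X))) (trans (cong (_+ + X) eq) (lemma (+ j) (+ X))))
  where
  lemma : ∀ a b → a - b + b ≡ a
  lemma = solve-∀

ΣZ-single : ∀ X {F : ℤ → ℤ} z → ∣ z ∣ ℕ.≤ X →
            (∀ w → ∣ w ∣ ℕ.≤ X → w ≢ z → F w ≡ 0ℤ) → ΣZ X F ≡ F z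
ΣZ-single X {F} z z≤X off with ΣZ-index X z z≤X
... | k , k< , refl = Σ-single _ k k<
        λ i i< i≢k → off _ (ΣZ-range X i i<) (λ eq → i≢k (ΣZ-index-injective X eq))

ΣZ-zero : ∀ X {F : ℤ → ℤ} → (∀ z → ∣ z ∣ ℕ.≤ X → F z ≡ 0ℤ) → ΣZ X F ≡ 0ℤ
ΣZ-zero X off = Σ-zero _ λ i i< → off _ (ΣZ-range X i i<)

∣ΣZ∣≤ : ∀ X {F : ℤ → ℤ} K → (∀ z → ∣ z ∣ ℕ.≤ X → ∣ F z ∣ ℕ.≤ K) →
        ∣ ΣZ X F ∣ ℕ.≤ suc (X ℕ.+ X) ℕ.* K
∣ΣZ∣≤ X K le = ∣Σ∣≤ _ K λ i i< → le _ (ΣZ-range X i i<)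

-- Smoothed counts of lattice points

infix 4 _≼_

_≼_ : ℤ → ℕ → Set
x ≼ K = ∣ x ∣ ℕ.≤ K

≼-+ : ∀ {x y K L} → x ≼ K → y ≼ L → x + y ≼ K ℕ.+ L
≼-+ {x} {y} p q = ℕ.≤-trans (∣i+j∣≤∣i∣+∣j∣ x y) (ℕ.+-mono-≤ p q)

≼-neg : ∀ {x K} → x ≼ K → - x ≼ K
≼-neg {x} p = ℕ.≤-trans (ℕ.≤-reflexive (∣-i∣≡∣i∣ x)) p

≼-- : ∀ {x y K L} → x ≼ K → y ≼ L → x - y ≼ K ℕ.+ L
≼-- {x} {y} p q = ≼-+ {x} { - y} p (≼-neg {y} q)

≼-* : ∀ {x y K L} → x ≼ K → y ≼ L → x * y ≼ K ℕ.* L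
≼-* {x} {y} p q = ℕ.≤-trans (ℕ.≤-reflexive (abs-* x y)) (ℕ.*-mono-≤ p q)

i≤∣i∣ : ∀ i → i ≤ + ∣ i ∣
i≤∣i∣ (+ n)    = ≤-refl
i≤∣i∣ -[1+ n ] = -≤+

cub : ℤ → ℤ
cub (+ n)    = + n * + n * + n
cub -[1+ _ ] = 0ℤ

cub-nonNeg : ∀ x → 0ℤ ≤ x → cub x ≡ x * x * x
cub-nonNeg (+ n) _ = refl

cub-nonPos : ∀ x → x ≤ 0ℤ → cub x ≡ 0ℤ
cub-nonPos (+ zero) _ = refl
cub-nonPos -[1+ n ] _ = refl
cub-nonPos (+ suc n) (+≤+ ())

cub-≼ : ∀ x K → x ≤ + K → cub x ≼ K ℕ.* K ℕ.* K
cub-≼ (+ n)    K (+≤+ n≤K) = ≼-* {+ n * + n} (≼-* {+ n} n≤K n≤K) n≤K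
cub-≼ -[1+ n ] K _         = z≤n

-- Bounds the third difference of x ↦ (u x)₊³ for a quadratic u with values
-- u ≤ U, first difference at most M and second difference at most C ≤ M: if
-- all four values are nonnegative the cubes of u leave only terms of the
-- first kind, otherwise all four values are at most 6M.

bnd₁ bnd : ℕ → ℕ → ℕ → ℕ
bnd₁ U C M = 18 ℕ.* (U ℕ.* (C ℕ.* (M ℕ.+ M)))
  ℕ.+ (27 ℕ.* ((M ℕ.+ M) ℕ.* (M ℕ.+ M) ℕ.* (M ℕ.+ M))
    ℕ.+ 3 ℕ.* ((M ℕ.+ M ℕ.+ M) ℕ.* (M ℕ.+ M ℕ.+ M) ℕ.* (M ℕ.+ M ℕ.+ M))
    ℕ.+ 3 ℕ.* (M ℕ.* M ℕ.* M))
bnd U C M = bnd₁ U C M ℕ.+ 8 ℕ.* ((6 ℕ.* M) ℕ.* (6 ℕ.* M) ℕ.* (6 ℕ.* M))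

Δ : (ℕ → ℤ) → ℕ → ℤ
Δ φ i = φ (suc i) - φ i

module ThirdDifference (u d c : ℤ) (U C M : ℕ)
  (u≤U : u ≤ + U) (d≼M : d ≼ M) (c≼C : c ≼ C) (C≤M : C ℕ.≤ M) where

  private
    -- A quadratic sequence with value u, first difference d and second difference c at 0 has the
    -- value `at α β` at α if β = α (α - 1) / 2; hence the pairs (0, 0), (1, 0), (2, 1), (3, 3).
    at : ℕ → ℕ → ℤ
    at α β = u + + α * d + + β * c

    diff≼3 : ∀ {α β} → α ℕ.≤ 3 → β ℕ.≤ 3 → + α - + β ≼ 3
    diff≼3 {α} {β} α≤3 β≤3 with ℕ.≤-total β α
    ... | inj₁ β≤α = ℕ.≤-trans (ℕ.≤-reflexive (cong ∣_∣ (trans (m-n≡m⊖n α β) (⊖-≥ β≤α))))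
                       (ℕ.≤-trans (ℕ.m∸n≤m α β) α≤3)
    ... | inj₂ α≤β = ℕ.≤-trans (ℕ.≤-reflexive (trans (cong ∣_∣ (m-n≡m⊖n α β)) (∣⊖∣-≤ α≤β)))
                       (ℕ.≤-trans (ℕ.m∸n≤m β α) β≤3)

    near : ∀ α β α′ β′ → α ℕ.≤ 3 → β ℕ.≤ 3 → α′ ℕ.≤ 3 → β′ ℕ.≤ 3 →
           at α β ≤ 0ℤ → at α′ β′ ≤ + (6 ℕ.* M)
    near α β α′ β′ α≤ β≤ α′≤ β′≤ neg = begin
      at α′ β′            ≡⟨ identity u d c (+ α) (+ β) (+ α′) (+ β′) ⟩
      at α β + e          ≤⟨ +-monoˡ-≤ e neg ⟩
      0ℤ + e              ≡⟨ +-identityˡ e ⟩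
      e                   ≤⟨ i≤∣i∣ e ⟩
      + ∣ e ∣             ≤⟨ +≤+ (≼-+ {(+ α′ - + α) * d} {(+ β′ - + β) * c}
                                (≼-* {+ α′ - + α} {d} (diff≼3 α′≤ α≤) d≼M)
                                (≼-* {+ β′ - + β} {c} (diff≼3 β′≤ β≤) (ℕ.≤-trans c≼C C≤M))) ⟩
      + (3 ℕ.* M ℕ.+ 3 ℕ.* M) ≡⟨ cong +_ (sym (ℕ.*-distribʳ-+ M 3 3)) ⟩
      + (6 ℕ.* M)         ∎
      where
      open ≤-Reasoning
      e = (+ α′ - + α) * d + (+ β′ - + β) * c
      identity : ∀ u d c α β α′ β′ →
        u + α′ * d + β′ * c ≡ u + α * d + β * c + ((α′ - α) * d + (β′ - β) * c)
      identity = solve-∀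

    L = (6 ℕ.* M) ℕ.* (6 ℕ.* M) ℕ.* (6 ℕ.* M)

    comb : ℤ → ℤ → ℤ → ℤ → ℤ
    comb w x y z = ((w - x) - (x - y)) - ((x - y) - (y - z))

    comb≼ : ∀ {w x y z} → w ≼ L → x ≼ L → y ≼ L → z ≼ L → comb w x y z ≼ 8 ℕ.* L
    comb≼ {w} {x} {y} {z} p q r s = ℕ.≤-trans
      (≼-- {(w - x) - (x - y)} {(x - y) - (y - z)}
        (≼-- {w - x} {x - y} (≼-- {w} {x} p q) (≼-- {x} {y} q r))
        (≼-- {x - y} {y - z} (≼-- {x} {y} q r) (≼-- {y} {z} r s)))
      (ℕ.≤-reflexive (eight L))
      where
      eight : ∀ L → ((L ℕ.+ L) ℕ.+ (L ℕ.+ L)) ℕ.+ ((L ℕ.+ L) ℕ.+ (L ℕ.+ L)) ≡ 8 ℕ.* L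
      eight = ℕSolver.solve-∀

    u₀ = at 0 0
    u₁ = at 1 0
    u₂ = at 2 1
    u₃ = at 3 3

    some-neg : ∀ α β → α ℕ.≤ 3 → β ℕ.≤ 3 → at α β ≤ 0ℤ →
               comb (cub u₃) (cub u₂) (cub u₁) (cub u₀) ≼ bnd U C M
    some-neg α β α≤ β≤ neg = ℕ.≤-trans
      (comb≼ {cub u₃} {cub u₂} {cub u₁} {cub u₀}
        (b 3 3 ℕ.≤-refl ℕ.≤-refl) (b 2 1 (s≤s (s≤s z≤n)) (s≤s z≤n))
        (b 1 0 (s≤s z≤n) z≤n) (b 0 0 z≤n z≤n))
      (ℕ.m≤n+m (8 ℕ.* L) (bnd₁ U C M))
      where
      b : ∀ α′ β′ → α′ ℕ.≤ 3 → β′ ℕ.≤ 3 → cub (at α′ β′) ≼ L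
      b α′ β′ p q = cub-≼ (at α′ β′) (6 ℕ.* M) (near α β α′ β′ α≤ β≤ p q neg)

    polynomial : ∀ u d c →
      (((u + + 3 * d + + 3 * c) * (u + + 3 * d + + 3 * c) * (u + + 3 * d + + 3 * c)
        - (u + + 2 * d + + 1 * c) * (u + + 2 * d + + 1 * c) * (u + + 2 * d + + 1 * c))
       - ((u + + 2 * d + + 1 * c) * (u + + 2 * d + + 1 * c) * (u + + 2 * d + + 1 * c)
        - (u + + 1 * d + + 0 * c) * (u + + 1 * d + + 0 * c) * (u + + 1 * d + + 0 * c)))
      - (((u + + 2 * d + + 1 * c) * (u + + 2 * d + + 1 * c) * (u + + 2 * d + + 1 * c)
        - (u + + 1 * d + + 0 * c) * (u + + 1 * d + + 0 * c) * (u + + 1 * d + + 0 * c))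
       - ((u + + 1 * d + + 0 * c) * (u + + 1 * d + + 0 * c) * (u + + 1 * d + + 0 * c)
        - (u + + 0 * d + + 0 * c) * (u + + 0 * d + + 0 * c) * (u + + 0 * d + + 0 * c)))
      ≡ + 18 * (u * (c * (d + c)))
        + (+ 27 * ((d + c) * (d + c) * (d + c)) - + 3 * ((d + d + c) * (d + d + c) * (d + d + c))
          + + 3 * (d * d * d))
    polynomial = solve-∀

    no-neg : 0ℤ ≤ u → 0ℤ ≤ u₁ → 0ℤ ≤ u₂ → 0ℤ ≤ u₃ →
             comb (cub u₃) (cub u₂) (cub u₁) (cub u₀) ≼ bnd U C M
    no-neg p₀ p₁ p₂ p₃ = ℕ.≤-trans (ℕ.≤-reflexive (cong ∣_∣ (trans
      (cong₂ (λ w x → comb w x (cub u₁) (cub u₀)) (cub-nonNeg u₃ p₃) (cub-nonNeg u₂ p₂))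
      (trans (cong₂ (comb (u₃ * u₃ * u₃) (u₂ * u₂ * u₂)) (cub-nonNeg u₁ p₁)
               (cub-nonNeg u₀ (subst (0ℤ ≤_) (zeroth u d c) p₀)))
             (polynomial u d c)))))
      (ℕ.≤-trans
        (≼-+ {+ 18 * (u * (c * (d + c)))}
             {+ 27 * ((d + c) * (d + c) * (d + c)) - + 3 * ((d + d + c) * (d + d + c) * (d + d + c)) + + 3 * (d * d * d)}
          (≼-* {+ 18} {u * (c * (d + c))} ℕ.≤-refl
            (≼-* {u} {c * (d + c)} u≼U (≼-* {c} {d + c} c≼C dc)))
          (≼-+ {+ 27 * ((d + c) * (d + c) * (d + c)) - + 3 * ((d + d + c) * (d + d + c) * (d + d + c))} {+ 3 * (d * d * d)}
            (≼-- {+ 27 * ((d + c) * (d + c) * (d + c))} {+ 3 * ((d + d + c) * (d + d + c) * (d + d + c))}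
              (≼-* {+ 27} {(d + c) * (d + c) * (d + c)} ℕ.≤-refl (cube {d + c} dc))
              (≼-* {+ 3} {(d + d + c) * (d + d + c) * (d + d + c)} ℕ.≤-refl (cube {d + d + c}
                (≼-+ {d + d} {c} (≼-+ {d} {d} d≼M d≼M) c≼M))))
            (≼-* {+ 3} {d * d * d} ℕ.≤-refl (cube {d} d≼M))))
        (ℕ.m≤m+n (bnd₁ U C M) (8 ℕ.* L)))
      where
      zeroth : ∀ u d c → u ≡ u + + 0 * d + + 0 * c
      zeroth = solve-∀
      c≼M = ℕ.≤-trans c≼C C≤M
      dc : d + c ≼ M ℕ.+ M
      dc = ≼-+ {d} {c} d≼M c≼M
      cube : ∀ {x K} → x ≼ K → x * x * x ≼ K ℕ.* K ℕ.* K
      cube {x} p = ≼-* {x * x} {x} (≼-* {x} {x} p p) p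
      u≼U : u ≼ U
      u≼U = drop‿+≤+ (≤-trans (≤-reflexive (0≤i⇒+∣i∣≡i p₀)) u≤U)

  bound : ((cub u₃ - cub u₂) - (cub u₂ - cub u₁)) - ((cub u₂ - cub u₁) - (cub u₁ - cub u₀))
          ≼ bnd U C M
  bound with ≤-total 0ℤ u | ≤-total 0ℤ u₁ | ≤-total 0ℤ u₂ | ≤-total 0ℤ u₃
  ... | inj₁ p₀ | inj₁ p₁ | inj₁ p₂ | inj₁ p₃ = no-neg p₀ p₁ p₂ p₃
  ... | inj₂ n₀ | _ | _ | _ = some-neg 0 0 z≤n z≤n (subst (_≤ 0ℤ) (zeroth u d c) n₀)
    where
    zeroth : ∀ u d c → u ≡ u + + 0 * d + + 0 * c
    zeroth = solve-∀
  ... | _ | inj₂ n₁ | _ | _ = some-neg 1 0 (s≤s z≤n) z≤n n₁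
  ... | _ | _ | inj₂ n₂ | _ = some-neg 2 1 (s≤s (s≤s z≤n)) (s≤s z≤n) n₂
  ... | _ | _ | _ | inj₂ n₃ = some-neg 3 3 ℕ.≤-refl ℕ.≤-refl n₃

sg : ℕ → ℤ
sg zero    = 1ℤ
sg (suc n) = - sg n

alt : ℕ → (ℕ → ℤ) → ℤ
alt n φ = Σ< n λ i → sg i * φ i

∣sg∣ : ∀ n → ∣ sg n ∣ ≡ 1
∣sg∣ zero    = refl
∣sg∣ (suc n) = trans (∣-i∣≡∣i∣ (sg n)) (∣sg∣ n)

sg-double : ∀ n → sg (n ℕ.+ n) ≡ 1ℤ
sg-double zero    = refl
sg-double (suc n) = trans (cong (λ k → - sg k) (ℕ.+-suc n n))
  (trans (neg-involutive (sg (n ℕ.+ n))) (sg-double n))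

alt-Δ : ∀ n φ → alt n (Δ φ) ≡ - (+ 2 * alt n φ) + φ 0 - sg n * φ n
alt-Δ zero    φ = lemma (φ 0)
  where
  lemma : ∀ a → + 0 ≡ - (+ 2 * + 0) + a - + 1 * a
  lemma = solve-∀
alt-Δ (suc n) φ = trans (cong (_+ sg n * (φ (suc n) - φ n)) (alt-Δ n φ))
  (lemma (alt n φ) (φ 0) (sg n) (φ n) (φ (suc n)))
  where
  lemma : ∀ a z s x y → - (+ 2 * a) + z - s * x + s * (y - x) ≡
                        - (+ 2 * (a + s * x)) + z - (- s) * y
  lemma = solve-∀

-- Shifting the index by one reverses the sign of an alternating sum, so a difference acts as
-- multiplication by -2 once the boundary terms vanish. Three steps express the alternating sum by
-- third differences.
alt-Δ₀ : ∀ n φ → φ 0 ≡ 0ℤ → φ n ≡ 0ℤ → alt n (Δ φ) ≡ - (+ 2 * alt n φ)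
alt-Δ₀ n φ p q = trans (alt-Δ n φ) (trans
  (cong₂ (λ x y → - (+ 2 * alt n φ) + x - sg n * y) p q) (lemma (alt n φ) (sg n)))
  where
  lemma : ∀ a s → - (+ 2 * a) + + 0 - s * + 0 ≡ - (+ 2 * a)
  lemma = solve-∀

alt-Δ³ : ∀ n φ → φ 0 ≡ 0ℤ → φ 1 ≡ 0ℤ → φ 2 ≡ 0ℤ →
         φ n ≡ 0ℤ → φ (1 ℕ.+ n) ≡ 0ℤ → φ (2 ℕ.+ n) ≡ 0ℤ →
         alt n (Δ (Δ (Δ φ))) ≡ - (+ 8 * alt n φ)
alt-Δ³ n φ z₀ z₁ z₂ e₀ e₁ e₂ =
  trans (alt-Δ₀ n (Δ (Δ φ)) (cong₂ _-_ d₁ d₀) (cong₂ _-_ f₁ f₀))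
  (trans (cong (λ x → - (+ 2 * x)) (trans (alt-Δ₀ n (Δ φ) d₀ f₀)
    (cong (λ x → - (+ 2 * x)) (alt-Δ₀ n φ z₀ e₀)))) (lemma (alt n φ)))
  where
  d₀ = cong₂ _-_ z₁ z₀
  d₁ = cong₂ _-_ z₂ z₁
  f₀ = cong₂ _-_ e₁ e₀
  f₁ = cong₂ _-_ e₂ e₁
  lemma : ∀ a → - (+ 2 * - (+ 2 * - (+ 2 * a))) ≡ - (+ 8 * a)
  lemma = solve-∀

alt-split : ∀ M φ → alt (suc (M ℕ.+ M)) φ ≡
            + 2 * Σ< (suc M) (λ i → φ (i ℕ.+ i)) - Σ< (suc (M ℕ.+ M)) φ
alt-split zero φ = lemma (φ 0)
  where
  lemma : ∀ a → + 0 + + 1 * a ≡ + 2 * (+ 0 + a) - (+ 0 + a)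
  lemma = solve-∀
alt-split (suc M) φ = begin
  alt (suc (suc M ℕ.+ suc M)) φ
    ≡⟨ cong (λ k → alt (suc (suc k)) φ) (ℕ.+-suc M M) ⟩
  alt (suc (M ℕ.+ M)) φ + - sg (M ℕ.+ M) * y + - (- sg (M ℕ.+ M)) * z
    ≡⟨ cong₂ (λ a s → a + - s * y + - (- s) * z) (alt-split M φ) (sg-double M) ⟩
  + 2 * Σ< (suc M) (λ i → φ (i ℕ.+ i)) - Σ< (suc (M ℕ.+ M)) φ + - 1ℤ * y + - (- 1ℤ) * z
    ≡⟨ lemma (Σ< (suc M) (λ i → φ (i ℕ.+ i))) (Σ< (suc (M ℕ.+ M)) φ) y z ⟩
  + 2 * (Σ< (suc M) (λ i → φ (i ℕ.+ i)) + z) - (Σ< (suc (M ℕ.+ M)) φ + y + z)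
    ≡⟨ cong (λ k → + 2 * (Σ< (suc M) (λ i → φ (i ℕ.+ i)) + φ (suc k)) - Σ< (suc (suc k)) φ)
         (sym (ℕ.+-suc M M)) ⟩
  + 2 * Σ< (suc (suc M)) (λ i → φ (i ℕ.+ i)) - Σ< (suc (suc M ℕ.+ suc M)) φ ∎
  where
  open ≡-Reasoning
  y = φ (suc (M ℕ.+ M))
  z = φ (suc (suc (M ℕ.+ M)))
  lemma : ∀ s t y z → + 2 * s - t + - (+ 1) * y + - (- (+ 1)) * z ≡ + 2 * (s + z) - (t + y + z)
  lemma = solve-∀

-- The even integers carry half of a smooth sum, up to an alternating sum. The centre X + X is even,
-- so that even indices belong to even integers.
ΣZ-halve : ∀ X G → ΣZ (X ℕ.+ X) G - + 2 * ΣZ X (λ z → G (z + z)) ≡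
           - alt (suc ((X ℕ.+ X) ℕ.+ (X ℕ.+ X))) (λ i → G (+ i - + (X ℕ.+ X)))
ΣZ-halve X G = sym (trans (cong -_ (alt-split (X ℕ.+ X) (λ i → G (+ i - + (X ℕ.+ X)))))
  (trans (lemma _ (ΣZ (X ℕ.+ X) G)) (cong (λ s → ΣZ (X ℕ.+ X) G - + 2 * s)
    (Σ-cong′ (suc (X ℕ.+ X)) λ i → cong G (shift i)))))
  where
  lemma : ∀ a b → - (+ 2 * a - b) ≡ b - + 2 * a
  lemma = solve-∀
  double : ∀ a b → a + a - (b + b) ≡ a - b + (a - b)
  double = solve-∀
  shift : ∀ i → + (i ℕ.+ i) - + (X ℕ.+ X) ≡ + i - + X + (+ i - + X)
  shift i = trans (cong₂ _-_ (pos-+ i i) (pos-+ X X)) (double (+ i) (+ X))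

-- The range reaches to twice the support of G, so all boundary terms of `alt-Δ³` vanish; 2 ≤ X
-- makes room for the indices 0, 1 and 2.
ΣZ-halve-bound : ∀ X K G → 2 ℕ.≤ X → (∀ z → X ℕ.≤ ∣ z ∣ → G z ≡ 0ℤ) →
  (∀ z → z ≼ X ℕ.+ X → ((G (z + + 3) - G (z + + 2)) - (G (z + + 2) - G (z + + 1)))
         - ((G (z + + 2) - G (z + + 1)) - (G (z + + 1) - G z)) ≼ K) →
  ΣZ (X ℕ.+ X) G - + 2 * ΣZ X (λ z → G (z + z)) ≼ suc ((X ℕ.+ X) ℕ.+ (X ℕ.+ X)) ℕ.* K
ΣZ-halve-bound X K G 2≤X far small = ℕ.≤-trans
  (ℕ.≤-reflexive (trans (cong ∣_∣ (ΣZ-halve X G)) (∣-i∣≡∣i∣ (alt n φ))))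
  (ℕ.≤-trans (ℕ.m≤n*m ∣ alt n φ ∣ 8)
    (ℕ.≤-trans (ℕ.≤-reflexive (sym (trans (cong ∣_∣ (alt-Δ³ n φ z₀ z₁ z₂ e₀ e₁ e₂))
      (trans (∣-i∣≡∣i∣ (+ 8 * alt n φ)) (abs-* (+ 8) (alt n φ))))))
      (∣Σ∣≤ n K λ i i<n → ℕ.≤-trans (≼-* {sg i} {Δ (Δ (Δ φ)) i} (ℕ.≤-reflexive (∣sg∣ i)) (third i i<n))
        (ℕ.≤-reflexive (ℕ.*-identityˡ K)))))
  where
  Y = X ℕ.+ X
  n = suc (Y ℕ.+ Y)
  φ : ℕ → ℤ
  φ i = G (+ i - + Y)
  low : ∀ i → i ℕ.≤ 2 → φ i ≡ 0ℤ
  low i i≤2 = far _ (subst (X ℕ.≤_) (sym (trans (cong ∣_∣ (m-n≡m⊖n i Y)) (∣⊖∣-≤ i≤Y)))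
      (ℕ.m+n≤o⇒m≤o∸n X (ℕ.+-monoʳ-≤ X (ℕ.≤-trans i≤2 2≤X))))
    where
    i≤Y : i ℕ.≤ Y
    i≤Y = ℕ.≤-trans i≤2 (ℕ.≤-trans 2≤X (ℕ.m≤m+n X X))
  high : ∀ i → n ℕ.≤ i → φ i ≡ 0ℤ
  high i n≤i = far _ (subst (X ℕ.≤_) (sym (cong ∣_∣ (trans (m-n≡m⊖n i Y) (⊖-≥ Y≤i))))
      (ℕ.m+n≤o⇒m≤o∸n X (ℕ.≤-trans (ℕ.≤-trans (ℕ.+-monoˡ-≤ Y (ℕ.m≤m+n X X)) (ℕ.n≤1+n _)) n≤i)))
    where
    Y≤i : Y ℕ.≤ i
    Y≤i = ℕ.≤-trans (ℕ.≤-trans (ℕ.m≤m+n Y Y) (ℕ.n≤1+n _)) n≤i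
  z₀ = low 0 z≤n
  z₁ = low 1 (s≤s z≤n)
  z₂ = low 2 ℕ.≤-refl
  e₀ = high n ℕ.≤-refl
  e₁ = high (1 ℕ.+ n) (ℕ.n≤1+n n)
  e₂ = high (2 ℕ.+ n) (ℕ.m≤n+m n 2)
  step : ∀ k i → φ (k ℕ.+ i) ≡ G (+ i - + Y + + k)
  step k i = cong G (trans (cong (_- + Y) (pos-+ k i)) (lemma (+ k) (+ i) (+ Y)))
    where
    lemma : ∀ a b c → a + b - c ≡ b - c + a
    lemma = solve-∀
  third : ∀ i → i ℕ.< n → Δ (Δ (Δ φ)) i ≼ K
  third i i<n rewrite step 1 i | step 2 i | step 3 i = small _ (ΣZ-range Y i i<n)

form : ℤ → ℤ → ℤ → ℤ → ℤ → ℤ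
form A B C x y = A * (x * x) + B * (x * y) + C * (y * y)

pow5 : ℕ → ℕ
pow5 τ = τ ℕ.* τ ℕ.* τ ℕ.* τ ℕ.* τ

weight : ℕ → ℤ → ℤ
weight T z = cub (+ T - z)

NonNegForm : (ℤ → ℤ → ℤ) → Set
NonNegForm q = ∀ x y → 0ℤ ≤ q x y

-- Stated for T = τ², which avoids square roots: outside the box of radius κτ the weight vanishes.
FarForm : ℕ → (ℤ → ℤ → ℤ) → Set
FarForm κ q = ∀ τ x y → κ ℕ.* τ ℕ.≤ ∣ x ∣ ⊎ κ ℕ.* τ ℕ.≤ ∣ y ∣ → + (τ ℕ.* τ) ≤ q x y

weight-far : ∀ T z → + T ≤ z → weight T z ≡ 0ℤ
weight-far T z T≤z = cub-nonPos (+ T - z) (i≤j⇒i-j≤0 T≤z)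

-- For values of size t², first differences of size t and bounded second differences, every term of
-- `bnd` is cubic in t.
bnd-scale : ∀ C μ t → bnd (t ℕ.* t) C (μ ℕ.* t) ≡ bnd 1 C μ ℕ.* (t ℕ.* t ℕ.* t)
bnd-scale = lemma
  where
  lemma : ∀ C μ t → 18 ℕ.* (t ℕ.* t ℕ.* (C ℕ.* (μ ℕ.* t ℕ.+ μ ℕ.* t)))
    ℕ.+ (27 ℕ.* ((μ ℕ.* t ℕ.+ μ ℕ.* t) ℕ.* (μ ℕ.* t ℕ.+ μ ℕ.* t) ℕ.* (μ ℕ.* t ℕ.+ μ ℕ.* t))
    ℕ.+ 3 ℕ.* ((μ ℕ.* t ℕ.+ μ ℕ.* t ℕ.+ μ ℕ.* t) ℕ.* (μ ℕ.* t ℕ.+ μ ℕ.* t ℕ.+ μ ℕ.* t) ℕ.* (μ ℕ.* t ℕ.+ μ ℕ.* t ℕ.+ μ ℕ.* t))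
    ℕ.+ 3 ℕ.* (μ ℕ.* t ℕ.* (μ ℕ.* t) ℕ.* (μ ℕ.* t)))
    ℕ.+ 8 ℕ.* ((6 ℕ.* (μ ℕ.* t)) ℕ.* (6 ℕ.* (μ ℕ.* t)) ℕ.* (6 ℕ.* (μ ℕ.* t)))
    ≡ (18 ℕ.* (1 ℕ.* (C ℕ.* (μ ℕ.+ μ)))
    ℕ.+ (27 ℕ.* ((μ ℕ.+ μ) ℕ.* (μ ℕ.+ μ) ℕ.* (μ ℕ.+ μ))
    ℕ.+ 3 ℕ.* ((μ ℕ.+ μ ℕ.+ μ) ℕ.* (μ ℕ.+ μ ℕ.+ μ) ℕ.* (μ ℕ.+ μ ℕ.+ μ))
    ℕ.+ 3 ℕ.* (μ ℕ.* μ ℕ.* μ))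
    ℕ.+ 8 ℕ.* ((6 ℕ.* μ) ℕ.* (6 ℕ.* μ) ℕ.* (6 ℕ.* μ))) ℕ.* (t ℕ.* t ℕ.* t)
  lemma = ℕSolver.solve-∀

ΣZ-swap : ∀ X Y (F : ℤ → ℤ → ℤ) →
          ΣZ X (λ x → ΣZ Y (F x)) ≡ ΣZ Y (λ y → ΣZ X (λ x → F x y))
ΣZ-swap X Y F = Σ-swap (suc (X ℕ.+ X)) (suc (Y ℕ.+ Y)) λ i j → F (+ i - + X) (+ j - + Y)

module HalveFirst (A B C : ℤ) (κ : ℕ) (2≤κ : 2 ℕ.≤ κ)
  (nonNeg : NonNegForm (form A B C)) (far : FarForm κ (form A B C)) where

  -- In units of τ, `four` bounds the number of points on a line and `μ` the first differences of
  -- the form along it. The summand 2 ∣ A ∣ of `μ` keeps the bound for the second difference below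
  -- that for the first, as `ThirdDifference` requires.
  μ four : ℕ
  four = suc ((κ ℕ.+ κ) ℕ.+ (κ ℕ.+ κ))
  μ = (∣ A ∣ ℕ.* four ℕ.+ ∣ B ∣ ℕ.* (κ ℕ.+ κ)) ℕ.+ 2 ℕ.* ∣ A ∣

  halveConst : ℕ
  halveConst = four ℕ.* four ℕ.* bnd 1 (2 ℕ.* ∣ A ∣) μ

  module _ (τ : ℕ) (1≤τ : 1 ℕ.≤ τ) (Y : ℕ) (Y≤ : Y ℕ.≤ κ ℕ.* τ ℕ.+ κ ℕ.* τ) where

    private
      X = κ ℕ.* τ
      T = τ ℕ.* τ

      ≤*τ : ∀ k → k ℕ.≤ k ℕ.* τ
      ≤*τ k = ℕ.m≤m*n k τ {{ℕ.>-nonZero 1≤τ}}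

      count : ∀ Z → Z ℕ.≤ X ℕ.+ X → suc (Z ℕ.+ Z) ℕ.≤ four ℕ.* τ
      count Z Z≤ = ℕ.≤-trans (ℕ.+-mono-≤ 1≤τ (ℕ.+-mono-≤ Z≤ Z≤)) (ℕ.≤-reflexive (lemma κ τ))
        where
        lemma : ∀ κ t → t ℕ.+ ((κ ℕ.* t ℕ.+ κ ℕ.* t) ℕ.+ (κ ℕ.* t ℕ.+ κ ℕ.* t))
                ≡ suc ((κ ℕ.+ κ) ℕ.+ (κ ℕ.+ κ)) ℕ.* t
        lemma = ℕSolver.solve-∀

      2X≥ : 2 ℕ.≤ X
      2X≥ = ℕ.≤-trans 2≤κ (≤*τ κ)

      G : ℤ → ℤ → ℤ
      G y x = weight T (form A B C x y)

      G-far : ∀ y z → X ℕ.≤ ∣ z ∣ → G y z ≡ 0ℤ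
      G-far y z X≤z = weight-far T _ (far τ z y (inj₁ X≤z))

      small : ∀ y → y ≼ Y → ∀ z → z ≼ X ℕ.+ X →
        ((G y (z + + 3) - G y (z + + 2)) - (G y (z + + 2) - G y (z + + 1)))
        - ((G y (z + + 2) - G y (z + + 1)) - (G y (z + + 1) - G y z)) ≼ bnd T (2 ℕ.* ∣ A ∣) (μ ℕ.* τ)
      small y y≼Y z z≼ = subst (_≼ bnd T (2 ℕ.* ∣ A ∣) (μ ℕ.* τ))
        (cong₂ (λ p q → p - q)
          (cong₂ (λ p q → p - q) (cong₂ (λ p q → cub p - cub q) (e₃ A B C (+ T) z y) (e₂ A B C (+ T) z y))
            (cong₂ (λ p q → cub p - cub q) (e₂ A B C (+ T) z y) (e₁ A B C (+ T) z y)))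
          (cong₂ (λ p q → p - q) (cong₂ (λ p q → cub p - cub q) (e₂ A B C (+ T) z y) (e₁ A B C (+ T) z y))
            (cong₂ (λ p q → cub p - cub q) (e₁ A B C (+ T) z y) (e₀ A B C (+ T) z y))))
        (ThirdDifference.bound u d c T (2 ℕ.* ∣ A ∣) (μ ℕ.* τ) u≤T d≼ c≼ C≤)
        where
        -- Value, first and second difference at z of the quadratic x ↦ T - f(x, y).
        u = + T - form A B C z y
        d = - (A * (z + z + + 1) + B * y)
        c = - + 2 * A
        u≤T : u ≤ + T
        u≤T = ≤-trans (+-monoʳ-≤ (+ T) (neg-mono-≤ (nonNeg z y))) (≤-reflexive (+-identityʳ (+ T)))
        d≼ : d ≼ μ ℕ.* τ
        d≼ = ≼-neg {A * (z + z + + 1) + B * y} (ℕ.≤-trans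
          (≼-+ {A * (z + z + + 1)} {B * y}
            (≼-* {A} {z + z + + 1} ℕ.≤-refl (≼-+ {z + z} {+ 1} (≼-+ {z} {z} z≼ z≼) ℕ.≤-refl))
            (≼-* {B} {y} ℕ.≤-refl y≼Y))
          (ℕ.≤-trans (ℕ.+-mono-≤ (ℕ.*-monoʳ-≤ ∣ A ∣ (ℕ.≤-trans (ℕ.≤-reflexive (ℕ.+-comm _ 1)) (count (X ℕ.+ X) ℕ.≤-refl)))
                                 (ℕ.*-monoʳ-≤ ∣ B ∣ Y≤))
            (ℕ.≤-trans (ℕ.≤-reflexive (lemma ∣ A ∣ ∣ B ∣ four κ τ))
              (ℕ.*-monoˡ-≤ τ (ℕ.m≤m+n (∣ A ∣ ℕ.* four ℕ.+ ∣ B ∣ ℕ.* (κ ℕ.+ κ)) (2 ℕ.* ∣ A ∣))))))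
          where
          lemma : ∀ a b f k t → a ℕ.* (f ℕ.* t) ℕ.+ b ℕ.* (k ℕ.* t ℕ.+ k ℕ.* t) ≡
                                (a ℕ.* f ℕ.+ b ℕ.* (k ℕ.+ k)) ℕ.* t
          lemma = ℕSolver.solve-∀
        c≼ : c ≼ 2 ℕ.* ∣ A ∣
        c≼ = ℕ.≤-reflexive (abs-* (- + 2) A)
        C≤ : 2 ℕ.* ∣ A ∣ ℕ.≤ μ ℕ.* τ
        C≤ = ℕ.≤-trans (ℕ.m≤n+m (2 ℕ.* ∣ A ∣) (∣ A ∣ ℕ.* four ℕ.+ ∣ B ∣ ℕ.* (κ ℕ.+ κ))) (≤*τ μ)
        e₀ : ∀ A B C T z y →
          T - (A * (z * z) + B * (z * y) + C * (y * y)) + + 0 * - (A * (z + z + + 1) + B * y) + + 0 * (- + 2 * A) ≡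
          T - (A * (z * z) + B * (z * y) + C * (y * y))
        e₀ = solve-∀
        e₁ : ∀ A B C T z y →
          T - (A * (z * z) + B * (z * y) + C * (y * y)) + + 1 * - (A * (z + z + + 1) + B * y) + + 0 * (- + 2 * A) ≡
          T - (A * ((z + + 1) * (z + + 1)) + B * ((z + + 1) * y) + C * (y * y))
        e₁ = solve-∀
        e₂ : ∀ A B C T z y →
          T - (A * (z * z) + B * (z * y) + C * (y * y)) + + 2 * - (A * (z + z + + 1) + B * y) + + 1 * (- + 2 * A) ≡
          T - (A * ((z + + 2) * (z + + 2)) + B * ((z + + 2) * y) + C * (y * y))
        e₂ = solve-∀
        e₃ : ∀ A B C T z y →
          T - (A * (z * z) + B * (z * y) + C * (y * y)) + + 3 * - (A * (z + z + + 1) + B * y) + + 3 * (- + 2 * A) ≡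
          T - (A * ((z + + 3) * (z + + 3)) + B * ((z + + 3) * y) + C * (y * y))
        e₃ = solve-∀

    -- On each line y = const the weight is the truncated cube of a quadratic, with third
    -- differences O(τ³) by `bnd-scale`. There are O(τ) lines with O(τ) points each, which gives τ⁵
    -- = T^{5/2}.
    halve-first :
      ΣZ (X ℕ.+ X) (λ x → ΣZ Y (λ y → weight T (form A B C x y)))
      - + 2 * ΣZ X (λ x → ΣZ Y (λ y → weight T (form A B C (x + x) y)))
      ≼ halveConst ℕ.* pow5 τ
    halve-first = subst (_≼ halveConst ℕ.* pow5 τ) (sym regroup)
      (ℕ.≤-trans (∣ΣZ∣≤ Y {λ y → ΣZ (X ℕ.+ X) (G y) - + 2 * ΣZ X (λ x → G y (x + x))} _ (λ y y≼Y → ΣZ-halve-bound X _ (G y) 2X≥ (G-far y) (small y y≼Y)))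
        (ℕ.≤-trans (ℕ.*-mono-≤ (count Y Y≤) (ℕ.*-mono-≤ (count (X ℕ.+ X) ℕ.≤-refl)
                     (ℕ.≤-reflexive (bnd-scale (2 ℕ.* ∣ A ∣) μ τ))))
          (ℕ.≤-reflexive (lemma four (bnd 1 (2 ℕ.* ∣ A ∣) μ) τ))))
      where
      lemma : ∀ f b t → f ℕ.* t ℕ.* (f ℕ.* t ℕ.* (b ℕ.* (t ℕ.* t ℕ.* t))) ≡
                        f ℕ.* f ℕ.* b ℕ.* (t ℕ.* t ℕ.* t ℕ.* t ℕ.* t)
      lemma = ℕSolver.solve-∀
      regroup : _ ≡ ΣZ Y (λ y → ΣZ (X ℕ.+ X) (G y) - + 2 * ΣZ X (λ x → G y (x + x)))
      regroup = trans
        (cong₂ (λ a b → a - + 2 * b) (ΣZ-swap (X ℕ.+ X) Y λ x y → G y x)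
                                     (ΣZ-swap X Y λ x y → G y (x + x)))
        (sym (trans (Σ-- (suc (Y ℕ.+ Y)) _ _)
          (cong (λ a → ΣZ Y (λ y → ΣZ (X ℕ.+ X) (G y)) - a)
            (Σ-*ˡ (suc (Y ℕ.+ Y)) (+ 2) _))))

module PositiveDefinite (A B C : ℤ) (0<A : 0ℤ < A) (0<disc : 0ℤ < + 4 * A * C - B * B) where

  private
    Nd = + 4 * A * C - B * B

    sq≥0 : ∀ x → 0ℤ ≤ x * x
    sq≥0 (+ n)    = ≤-trans (+≤+ z≤n) (≤-reflexive (pos-* n n))
    sq≥0 -[1+ n ] = +≤+ z≤n

    0<4* : ∀ E → 0ℤ < E → 0ℤ < + 4 * E
    0<4* E p = *-monoˡ-<-pos (+ 4) p

    4A : 0ℤ < + 4 * A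
    4A = 0<4* A 0<A

    0<C : 0ℤ < C
    0<C = *-cancelˡ-<-nonNeg (+ 4 * A) {{nonNegative (<⇒≤ 4A)}}
      (≤-<-trans (≤-trans (≤-reflexive (*-zeroʳ (+ 4 * A))) (sq≥0 B))
        (0<i-j⇒j<i 0<disc))
      where
      0<i-j⇒j<i : ∀ {i j} → 0ℤ < i - j → j < i
      0<i-j⇒j<i {i} {j} p = subst₂ _<_ (+-identityˡ j) (lemma i j) (+-monoˡ-< j p)
        where
        lemma : ∀ i j → i - j + j ≡ i
        lemma = solve-∀

  4A*form : ∀ A B C x y → + 4 * A * (A * (x * x) + B * (x * y) + C * (y * y)) ≡
    (+ 2 * A * x + B * y) * (+ 2 * A * x + B * y) + (+ 4 * A * C - B * B) * (y * y)
  4A*form = solve-∀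
  4C*form : ∀ A B C x y → + 4 * C * (A * (x * x) + B * (x * y) + C * (y * y)) ≡
    (+ 2 * C * y + B * x) * (+ 2 * C * y + B * x) + (+ 4 * A * C - B * B) * (x * x)
  4C*form = solve-∀

  private
    scale : ∀ x → x * x ≤ Nd * (x * x)
    scale x = ≤-trans (≤-reflexive (sym (*-identityˡ (x * x))))
      (*-monoʳ-≤-nonNeg (x * x) {{nonNegative (sq≥0 x)}} (i<j⇒suc[i]≤j 0<disc))

    y²≤ : ∀ x y → y * y ≤ + 4 * A * form A B C x y
    y²≤ x y = ≤-trans (≤-trans (scale y) (≤-trans (≤-reflexive (sym (+-identityˡ _)))
      (+-monoˡ-≤ (Nd * (y * y)) (sq≥0 (+ 2 * A * x + B * y)))))
      (≤-reflexive (sym (4A*form A B C x y)))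

    x²≤ : ∀ x y → x * x ≤ + 4 * C * form A B C x y
    x²≤ x y = ≤-trans (≤-trans (scale x) (≤-trans (≤-reflexive (sym (+-identityˡ _)))
      (+-monoˡ-≤ (Nd * (x * x)) (sq≥0 (+ 2 * C * y + B * x)))))
      (≤-reflexive (sym (4C*form A B C x y)))

  form-nonNeg : NonNegForm (form A B C)
  form-nonNeg x y = *-cancelˡ-≤-pos 0ℤ _ (+ 4 * A) {{positive 4A}}
    (≤-trans (≤-trans (≤-reflexive (*-zeroʳ (+ 4 * A))) (sq≥0 y)) (y²≤ x y))

  form-definite : ∀ x y → form A B C x y ≡ 0ℤ → x ≡ 0ℤ × y ≡ 0ℤ
  form-definite x y eq =
    sq≡0 x (≤-antisym (≤-trans (x²≤ x y) (≤-reflexive (trans (cong (_*_ (+ 4 * C)) eq) (*-zeroʳ (+ 4 * C))))) (sq≥0 x)) ,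
    sq≡0 y (≤-antisym (≤-trans (y²≤ x y) (≤-reflexive (trans (cong (_*_ (+ 4 * A)) eq) (*-zeroʳ (+ 4 * A))))) (sq≥0 y))
    where
    sq≡0 : ∀ z → z * z ≡ 0ℤ → z ≡ 0ℤ
    sq≡0 z z²≡0 = [ id , id ]′ (i*j≡0⇒i≡0∨j≡0 z z²≡0)

  -- From x² ≤ 4 C f and y² ≤ 4 A f, a coordinate of absolute value at least κτ forces 4 E f ≥ κ² τ²
  -- ≥ 4 E τ², where E is C or A.
  κ : ℕ
  κ = 4 ℕ.* (∣ A ∣ ℕ.+ ∣ C ∣)

  private
    1≤∣A∣ : 1 ℕ.≤ ∣ A ∣
    1≤∣A∣ = drop‿+<+ (subst (0ℤ <_) (sym (0≤i⇒+∣i∣≡i (<⇒≤ 0<A))) 0<A)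

  2≤κ : 2 ℕ.≤ κ
  2≤κ = ℕ.≤-trans (s≤s (s≤s z≤n)) (ℕ.*-monoʳ-≤ 4 (ℕ.≤-trans 1≤∣A∣ (ℕ.m≤m+n ∣ A ∣ ∣ C ∣)))

  form-far : FarForm κ (form A B C)
  form-far τ x y = go
    where
    square : ∀ z → κ ℕ.* τ ℕ.≤ ∣ z ∣ → + (κ ℕ.* τ ℕ.* (κ ℕ.* τ)) ≤ z * z
    square z le = ≤-trans (+≤+ (ℕ.*-mono-≤ le le)) (≤-reflexive (∣z∣² z))
      where
      ∣z∣² : ∀ z → + (∣ z ∣ ℕ.* ∣ z ∣) ≡ z * z
      ∣z∣² (+ n)    = pos-* n n
      ∣z∣² -[1+ n ] = refl
    finish : ∀ E z → 0ℤ < E → 4 ℕ.* ∣ E ∣ ℕ.≤ κ → κ ℕ.* τ ℕ.≤ ∣ z ∣ →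
             z * z ≤ + 4 * E * form A B C x y → + (τ ℕ.* τ) ≤ form A B C x y
    finish E z 0<E E≤κ le z² = *-cancelˡ-≤-pos _ _ (+ 4 * E) {{positive (0<4* E 0<E)}}
      (≤-trans (≤-trans (≤-reflexive lhs) (≤-trans (+≤+ bound′) (square z le))) z²)
      where
      lhs : + 4 * E * + (τ ℕ.* τ) ≡ + (4 ℕ.* ∣ E ∣ ℕ.* (τ ℕ.* τ))
      lhs = sym (trans (pos-* (4 ℕ.* ∣ E ∣) (τ ℕ.* τ)) (cong (_* + (τ ℕ.* τ))
        (trans (pos-* 4 ∣ E ∣) (cong (_*_ (+ 4)) (0≤i⇒+∣i∣≡i (<⇒≤ 0<E))))))
      bound′ : 4 ℕ.* ∣ E ∣ ℕ.* (τ ℕ.* τ) ℕ.≤ κ ℕ.* τ ℕ.* (κ ℕ.* τ)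
      bound′ = ℕ.≤-trans (ℕ.*-monoˡ-≤ (τ ℕ.* τ) (ℕ.≤-trans E≤κ
                 (ℕ.m≤m*n κ κ {{ℕ.>-nonZero (ℕ.≤-trans (s≤s z≤n) 2≤κ)}})))
                 (ℕ.≤-reflexive (lemma κ τ))
        where
        lemma : ∀ k t → k ℕ.* k ℕ.* (t ℕ.* t) ≡ k ℕ.* t ℕ.* (k ℕ.* t)
        lemma = ℕSolver.solve-∀
    go : κ ℕ.* τ ℕ.≤ ∣ x ∣ ⊎ κ ℕ.* τ ℕ.≤ ∣ y ∣ → + (τ ℕ.* τ) ≤ form A B C x y
    go (inj₁ le) = finish C x 0<C (ℕ.*-monoʳ-≤ 4 (ℕ.m≤n+m ∣ C ∣ ∣ A ∣)) le (x²≤ x y)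
    go (inj₂ le) = finish A y 0<A (ℕ.*-monoʳ-≤ 4 (ℕ.m≤m+n ∣ A ∣ ∣ C ∣)) le (y²≤ x y)

  private
    flip : ∀ A B C x y → C * (y * y) + + 2 * B * (y * x) + + 4 * A * (x * x) ≡
                         A * ((x + x) * (x + x)) + B * ((x + x) * y) + C * (y * y)
    flip = solve-∀
    flip₂ : ∀ A B C x y → C * ((y + y) * (y + y)) + + 2 * B * ((y + y) * x) + + 4 * A * (x * x) ≡
                          + 4 * (A * (x * x) + B * (x * y) + C * (y * y))
    flip₂ = solve-∀

    -- The form (x, y) ↦ f(2x, y) with its variables exchanged: after x has been halved,
    -- `HalveFirst` applies to it once more and halves y.
    flipped = form C (+ 2 * B) (+ 4 * A)

    flipped-nonNeg : NonNegForm flipped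
    flipped-nonNeg y x = subst (0ℤ ≤_) (sym (flip A B C x y)) (form-nonNeg (x + x) y)

    flipped-far : FarForm κ flipped
    flipped-far τ y x le = subst (+ (τ ℕ.* τ) ≤_) (sym (flip A B C x y)) (form-far τ (x + x) y (swap le))
      where
      ∣x+x∣ : ∀ z → ∣ z ∣ ℕ.≤ ∣ z + z ∣
      ∣x+x∣ (+ n)    = ℕ.m≤m+n n n
      ∣x+x∣ -[1+ n ] = s≤s (ℕ.≤-trans (ℕ.m≤m+n n n) (ℕ.n≤1+n _))
      swap : κ ℕ.* τ ℕ.≤ ∣ y ∣ ⊎ κ ℕ.* τ ℕ.≤ ∣ x ∣ → κ ℕ.* τ ℕ.≤ ∣ x + x ∣ ⊎ κ ℕ.* τ ℕ.≤ ∣ y ∣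
      swap (inj₁ p) = inj₂ p
      swap (inj₂ p) = inj₁ (ℕ.≤-trans p (∣x+x∣ x))

    module H₁ = HalveFirst A B C κ 2≤κ form-nonNeg form-far
    module H₂ = HalveFirst C (+ 2 * B) (+ 4 * A) κ 2≤κ flipped-nonNeg flipped-far

  latticeConst : ℕ
  latticeConst = H₁.halveConst ℕ.+ 2 ℕ.* H₂.halveConst

  boxSum : ℕ → (ℤ → ℤ) → ℤ
  boxSum X F = ΣZ X λ x → ΣZ X λ y → F (form A B C x y)

  -- A lattice of covolume V has about T/V points v with f(v) ≤ T, and twice
  -- the lattice about a quarter of them: in this combination of smoothed
  -- counts the main terms cancel.

  lattice-bound : ∀ τ → 1 ℕ.≤ τ →
    boxSum (κ ℕ.* τ ℕ.+ κ ℕ.* τ) (weight (τ ℕ.* τ))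
    - + 4 * boxSum (κ ℕ.* τ) (λ n → weight (τ ℕ.* τ) (+ 4 * n)) ≼ latticeConst ℕ.* pow5 τ
  lattice-bound τ 1≤τ = subst (_≼ latticeConst ℕ.* pow5 τ) (combine S₁ S₂ S₃)
    (ℕ.≤-trans (≼-+ {S₁ - + 2 * S₂} {+ 2 * (S₂ - + 2 * S₃)}
        (H₁.halve-first τ 1≤τ (X ℕ.+ X) ℕ.≤-refl)
        (≼-* {+ 2} {S₂ - + 2 * S₃} ℕ.≤-refl
          (subst (_≼ H₂.halveConst ℕ.* pow5 τ) second (H₂.halve-first τ 1≤τ X (ℕ.m≤m+n X X)))))
      (ℕ.≤-reflexive (lemma H₁.halveConst H₂.halveConst (pow5 τ))))
    where
    X = κ ℕ.* τ
    T = τ ℕ.* τ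
    S₁ = boxSum (X ℕ.+ X) (weight T)
    S₂ = ΣZ X λ x → ΣZ (X ℕ.+ X) λ y → weight T (form A B C (x + x) y)
    S₃ = boxSum X (λ n → weight T (+ 4 * n))
    combine : ∀ a b c → a - + 2 * b + + 2 * (b - + 2 * c) ≡ a - + 4 * c
    combine = solve-∀
    lemma : ∀ a b p → a ℕ.* p ℕ.+ 2 ℕ.* (b ℕ.* p) ≡ (a ℕ.+ 2 ℕ.* b) ℕ.* p
    lemma = ℕSolver.solve-∀
    second : ΣZ (X ℕ.+ X) (λ y → ΣZ X (λ x → weight T (flipped y x)))
             - + 2 * ΣZ X (λ y → ΣZ X (λ x → weight T (flipped (y + y) x))) ≡ S₂ - + 2 * S₃
    second = cong₂ (λ a b → a - + 2 * b)
      (trans (ΣZ-swap (X ℕ.+ X) X λ y x → weight T (flipped y x))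
        (ΣZ-cong X λ x _ → ΣZ-cong (X ℕ.+ X) λ y _ → cong (weight T) (flip A B C x y)))
      (trans (ΣZ-swap X X λ y x → weight T (flipped (y + y) x))
        (ΣZ-cong X λ x _ → ΣZ-cong X λ y _ → cong (weight T) (flip₂ A B C x y)))

-- Sums against periodic functions

Periodic : ℕ → (ℕ → ℤ) → Set
Periodic N q = ∀ d → q (d ℕ.+ N) ≡ q d

mean : ℕ → (ℕ → ℤ) → ℤ
mean N q = Σ< N q

-- The summatory function of N q after removal of its mean. It is periodic again, since the
-- increments over a period sum to 0, and so is ready for another summation by parts. Its iterates
-- play the role of the periodic Bernoulli functions; the factor N keeps them integral.
next : ℕ → (ℕ → ℤ) → ℕ → ℤ
next N q d = Σ< (suc d) λ j → + N * q j - Σ< N q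

-- Summation by parts against the periodic function q, after removing its mean.

by-parts : ∀ N q M F → F M ≡ 0ℤ →
  + N * Σ< M (λ d → q d * F d) ≡ Σ< N q * Σ< M F - Σ< M (λ d → next N q d * Δ F d)
by-parts N q M F FM≡0 = trans (general M)
  (trans (cong (λ x → mean N q * Σ< M F - Σ< M (λ d → next N q d * Δ F d) + Σ< M qq * x) FM≡0)
    (trans (cong (_+_ (mean N q * Σ< M F - Σ< M (λ d → next N q d * Δ F d))) (*-zeroʳ (Σ< M qq)))
      (+-identityʳ _)))
  where
  qq : ℕ → ℤ
  qq j = + N * q j - mean N q
  general : ∀ M → + N * Σ< M (λ d → q d * F d) ≡
    mean N q * Σ< M F - Σ< M (λ d → next N q d * Δ F d) + Σ< M qq * F M
  general zero = lemma (+ N) (mean N q) (F 0)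
    where
    lemma : ∀ n s a → n * + 0 ≡ s * + 0 - + 0 + + 0 * a
    lemma = solve-∀
  general (suc M) = trans (*-distribˡ-+ (+ N) _ (q M * F M))
    (trans (cong (_+ + N * (q M * F M)) (general M))
      (lemma (+ N) (mean N q) (Σ< M F) (Σ< M (λ d → next N q d * Δ F d)) (Σ< M qq) (q M) (F M) (F (suc M))))
    where
    lemma : ∀ n s f z c q a b → s * f - z + c * a + n * (q * a) ≡
      s * (f + a) - (z + (c + (n * q - s)) * (b - a)) + (c + (n * q - s)) * b
    lemma = solve-∀

next-periodic : ∀ N q → Periodic N q → Periodic N (next N q)
next-periodic N q per zero = begin
  Σ< N qq + (+ N * q N - mean N q)
    ≡⟨ cong₂ _+_ window (cong (λ x → + N * x - mean N q) (per 0)) ⟩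
  0ℤ + (+ N * q 0 - mean N q) ∎
  where
  open ≡-Reasoning
  qq : ℕ → ℤ
  qq j = + N * q j - mean N q
  window : Σ< N qq ≡ 0ℤ
  window = trans (Σ-- N (λ j → + N * q j) (λ _ → mean N q))
    (trans (cong₂ _-_ (Σ-*ˡ N (+ N) q) (Σ-const N (mean N q))) (+-inverseʳ (+ N * mean N q)))
next-periodic N q per (suc d) =
  cong₂ (λ a x → a + (+ N * x - mean N q)) (next-periodic N q per d) (per (suc d))

periodic-iterate : ∀ N q → Periodic N q → ∀ k r → q (r ℕ.+ k ℕ.* N) ≡ q r
periodic-iterate N q per zero    r = cong q (ℕ.+-identityʳ r)
periodic-iterate N q per (suc k) r = trans
  (cong q (lemma r N (k ℕ.* N)))
  (trans (per (r ℕ.+ k ℕ.* N)) (periodic-iterate N q per k r))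
  where
  lemma : ∀ r n x → r ℕ.+ (n ℕ.+ x) ≡ r ℕ.+ x ℕ.+ n
  lemma = ℕSolver.solve-∀

periodic-% : ∀ N q .{{_ : NonZero N}} → Periodic N q → ∀ d → q d ≡ q (d ℕ.% N)
periodic-% N q per d = trans (cong q (ℕ.m≡m%n+[m/n]*n d N)) (periodic-iterate N q per (d ℕ./ N) (d ℕ.% N))

maxUpTo : ℕ → (ℕ → ℤ) → ℕ
maxUpTo zero    q = 0
maxUpTo (suc n) q = maxUpTo n q ℕ.⊔ ∣ q n ∣

≼-maxUpTo : ∀ n q i → i ℕ.< n → q i ≼ maxUpTo n q
≼-maxUpTo (suc n) q i i<1+n with i ℕ.≟ n
... | yes refl = ℕ.m≤n⊔m (maxUpTo n q) _
... | no i≢n   = ℕ.≤-trans (≼-maxUpTo n q i (ℕ.≤∧≢⇒< (ℕ.s≤s⁻¹ i<1+n) i≢n)) (ℕ.m≤m⊔n (maxUpTo n q) _)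

periodic-≼ : ∀ N q .{{_ : NonZero N}} → Periodic N q → ∀ d → q d ≼ maxUpTo N q
periodic-≼ N q per d = subst (_≼ maxUpTo N q) (sym (periodic-% N q per d))
  (≼-maxUpTo N q (d ℕ.% N) (ℕ.m%n<n d N))

-- (−1, −1, −1, 3) repeated: at k − 1 the value 4·[4 ∣ k] − 1.

c₄ : ℕ → ℤ
c₄ 0 = -1ℤ
c₄ 1 = -1ℤ
c₄ 2 = -1ℤ
c₄ 3 = + 3
c₄ (suc (suc (suc (suc k)))) = c₄ k

c₄-periodic : Periodic 4 c₄
c₄-periodic 0 = refl
c₄-periodic 1 = refl
c₄-periodic 2 = refl
c₄-periodic 3 = refl
c₄-periodic (suc (suc (suc (suc k)))) = c₄-periodic k

-- Moves the combination 4 s(4n) - s(n) into a periodic factor of mean 0 in the codivisor, to which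
-- summation by parts applies.
c₄-sum : ∀ m (G : ℕ → ℤ) → Σ< (m ℕ.* 4) (λ k → c₄ k * G (suc k)) ≡
         + 4 * Σ< m (λ j → G (suc j ℕ.* 4)) - Σ< (m ℕ.* 4) (λ k → G (suc k))
c₄-sum zero    G = refl
c₄-sum (suc m) G = trans
  (cong₂ _+_ (cong₂ _+_ (cong₂ _+_ (cong₂ _+_ (c₄-sum m G) (e 0)) (e 1)) (e 2)) (e 3))
  (lemma (Σ< m (λ j → G (suc j ℕ.* 4))) (Σ< (m ℕ.* 4) (λ k → G (suc k)))
    (G (1 ℕ.+ m ℕ.* 4)) (G (2 ℕ.+ m ℕ.* 4)) (G (3 ℕ.+ m ℕ.* 4)) (G (4 ℕ.+ m ℕ.* 4)))
  where
  e : ∀ i → c₄ (i ℕ.+ m ℕ.* 4) * G (suc i ℕ.+ m ℕ.* 4) ≡ c₄ i * G (suc i ℕ.+ m ℕ.* 4)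
  e i = cong (_* G (suc i ℕ.+ m ℕ.* 4)) (periodic-iterate 4 c₄ c₄-periodic m i)
  lemma : ∀ p q a b c d →
    + 4 * p - q + -1ℤ * a + -1ℤ * b + -1ℤ * c + + 3 * d ≡ + 4 * (p + d) - (q + a + b + c + d)
  lemma = solve-∀

-- If all three arguments are nonnegative, the cubes give exactly 6 d² (u - d). Otherwise u ≤ 2d;
-- two factors of each cube are then bounded by multiples of d and the third by U, so that one bound
-- serves both cases.
second-difference : ∀ u d U → u ≤ + U →
  (cub (u - + d - + d) - cub (u - + d)) - (cub (u - + d) - cub u) ≼ 6 ℕ.* (d ℕ.* d ℕ.* U)
second-difference u d U u≤U with ≤-total 0ℤ (u - + d - + d)
... | inj₁ p = ℕ.≤-trans (ℕ.≤-reflexive (cong ∣_∣ (trans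
      (cong₂ _-_ (cong₂ _-_ (cub-nonNeg _ p) (cub-nonNeg _ p₁)) (cong₂ _-_ (cub-nonNeg _ p₁) (cub-nonNeg _ p₀)))
      (polynomial u (+ d)))))
      (≼-* {+ 6} {+ d * + d * (u - + d)} ℕ.≤-refl (≼-* {+ d * + d} {u - + d} (≼-* {+ d} {+ d} ℕ.≤-refl ℕ.≤-refl)
        (drop‿+≤+ (≤-trans (≤-reflexive (0≤i⇒+∣i∣≡i p₁)) (≤-trans (down u) u≤U)))))
  where
  down : ∀ x → x - + d ≤ x
  down x = i-j≤i x (+ d)
  p₁ : 0ℤ ≤ u - + d
  p₁ = ≤-trans p (down (u - + d))
  p₀ : 0ℤ ≤ u
  p₀ = ≤-trans p₁ (down u)
  polynomial : ∀ u d →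
    ((u - d - d) * (u - d - d) * (u - d - d) - (u - d) * (u - d) * (u - d))
    - ((u - d) * (u - d) * (u - d) - u * u * u) ≡ + 6 * (d * d * (u - d))
  polynomial = solve-∀
... | inj₂ n = ℕ.≤-trans
      (≼-- {cub (u - + d - + d) - cub (u - + d)} {cub (u - + d) - cub u}
        (≼-- {cub (u - + d - + d)} {cub (u - + d)} b₂ b₁) (≼-- {cub (u - + d)} {cub u} b₁ b₀))
      (ℕ.≤-reflexive (lemma (d ℕ.* d ℕ.* U)))
  where
  cub-≼₂ : ∀ x K → x ≤ + K → x ≤ + U → cub x ≼ K ℕ.* K ℕ.* U
  cub-≼₂ (+ n)    K (+≤+ n≤K) (+≤+ n≤U) = ≼-* {+ n * + n} (≼-* {+ n} n≤K n≤K) n≤U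
  cub-≼₂ -[1+ n ] K _         _         = z≤n
  down : ∀ x → x - + d ≤ x
  down x = i-j≤i x (+ d)
  up : ∀ {x K} → x - + d ≤ + K → x ≤ + (K ℕ.+ d)
  up {x} {K} le = subst₂ _≤_ (back x (+ d)) (sym (pos-+ K d)) (+-monoˡ-≤ (+ d) le)
    where
    back : ∀ x d → x - d + d ≡ x
    back = solve-∀
  n₁ : u - + d ≤ + d
  n₁ = up {u - + d} {0} n
  b₂ : cub (u - + d - + d) ≼ 0
  b₂ = ℕ.≤-reflexive (cong ∣_∣ (cub-nonPos _ n))
  b₁ : cub (u - + d) ≼ d ℕ.* d ℕ.* U
  b₁ = cub-≼₂ (u - + d) d n₁ (≤-trans (down u) u≤U)
  b₀ : cub u ≼ 4 ℕ.* (d ℕ.* d ℕ.* U)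
  b₀ = ℕ.≤-trans (cub-≼₂ u (d ℕ.+ d) (up {u} {d} n₁) u≤U) (ℕ.≤-reflexive (lemma₀ d U))
    where
    lemma₀ : ∀ d u → (d ℕ.+ d) ℕ.* (d ℕ.+ d) ℕ.* u ≡ 4 ℕ.* (d ℕ.* d ℕ.* u)
    lemma₀ = ℕSolver.solve-∀
  lemma : ∀ x → 0 ℕ.+ x ℕ.+ (x ℕ.+ 4 ℕ.* x) ≡ 6 ℕ.* x
  lemma = ℕSolver.solve-∀

module DivisorSum (N : ℕ) {{_ : NonZero N}} (χ : ℕ → ℤ) (χ-periodic : Periodic N χ)
  (Σχ≡0 : Σ< N χ ≡ 0ℤ) (χ0≡0 : χ 0 ≡ 0ℤ) (∣χ∣≤1 : ∀ d → χ d ≼ 1) where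

  F : ℕ → ℕ → ℕ → ℤ
  F T k d = weight T (+ (d ℕ.* k))

  -- Fixes the codivisor k of n = d k and sums over the divisor d. For k ≥ 1 the range d ≤ T is
  -- ample, because the weight vanishes as soon as d k ≥ T.
  Ψ : ℕ → ℕ → ℤ
  Ψ T k = Σ< (suc T) λ d → χ d * F T k d

  q₁ q₂ q₃ : ℕ → ℤ
  q₁ = next N χ
  q₂ = next N q₁
  q₃ = next N q₂

  σ₁ σ₂ : ℤ
  σ₁ = Σ< N q₁
  σ₂ = Σ< N q₂

  β K₃ : ℕ
  β = bnd 0 0 1
  K₃ = maxUpTo N q₃

  private
    q₃≼ : ∀ d → q₃ d ≼ K₃
    q₃≼ = periodic-≼ N q₃ (next-periodic N q₂ (next-periodic N q₁ (next-periodic N χ χ-periodic)))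

    bnd-cubic : ∀ T k → bnd T 0 k ≡ β ℕ.* (k ℕ.* k ℕ.* k)
    bnd-cubic = lemma
      where
      lemma : ∀ T k → (18 ℕ.* (T ℕ.* 0)
        ℕ.+ (27 ℕ.* ((k ℕ.+ k) ℕ.* (k ℕ.+ k) ℕ.* (k ℕ.+ k))
        ℕ.+ 3 ℕ.* ((k ℕ.+ k ℕ.+ k) ℕ.* (k ℕ.+ k ℕ.+ k) ℕ.* (k ℕ.+ k ℕ.+ k))
        ℕ.+ 3 ℕ.* (k ℕ.* k ℕ.* k)))
        ℕ.+ 8 ℕ.* ((6 ℕ.* k) ℕ.* (6 ℕ.* k) ℕ.* (6 ℕ.* k)) ≡ 2028 ℕ.* (k ℕ.* k ℕ.* k)
      lemma = ℕSolver.solve-∀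

  F-far : ∀ T k d → T ℕ.≤ d ℕ.* k → F T k d ≡ 0ℤ
  F-far T k d T≤ = weight-far T _ (+≤+ T≤)

  F-zero : ∀ T k → F T k 0 ≡ + T * + T * + T
  F-zero T k = trans (cong cub (+-identityʳ (+ T))) refl

  third≼ : ∀ T k d → Δ (Δ (Δ (F T k))) d ≼ β ℕ.* (k ℕ.* k ℕ.* k)
  third≼ T k d = subst₂ _≼_
    (cong₂ _-_
      (cong₂ _-_ (cong₂ (λ p q → cub p - cub q) (e₃ (+ T) (+ (d ℕ.* k)) (+ k)) (e₂ (+ T) (+ (d ℕ.* k)) (+ k)))
        (cong₂ (λ p q → cub p - cub q) (e₂ (+ T) (+ (d ℕ.* k)) (+ k)) (e₁ (+ T) (+ (d ℕ.* k)) (+ k))))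
      (cong₂ _-_ (cong₂ (λ p q → cub p - cub q) (e₂ (+ T) (+ (d ℕ.* k)) (+ k)) (e₁ (+ T) (+ (d ℕ.* k)) (+ k)))
        (cong₂ (λ p q → cub p - cub q) (e₁ (+ T) (+ (d ℕ.* k)) (+ k)) (e₀ (+ T) (+ (d ℕ.* k)) (+ k)))))
    (bnd-cubic T k)
    (ThirdDifference.bound (+ T - + (d ℕ.* k)) (- + k) 0ℤ T 0 k
      (i-j≤i (+ T) (+ (d ℕ.* k))) (≼-neg {+ k} ℕ.≤-refl) z≤n z≤n)
    where
    e₀ : ∀ T x k → T - x + + 0 * - k + + 0 * + 0 ≡ T - x
    e₀ = solve-∀
    e₁ : ∀ T x k → T - x + + 1 * - k + + 0 * + 0 ≡ T - (k + x)
    e₁ = solve-∀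
    e₂ : ∀ T x k → T - x + + 2 * - k + + 1 * + 0 ≡ T - (k + (k + x))
    e₂ = solve-∀
    e₃ : ∀ T x k → T - x + + 3 * - k + + 3 * + 0 ≡ T - (k + (k + (k + x)))
    e₃ = solve-∀

  drop : ℕ → ℕ → ℤ
  drop T k = weight T (+ k) - + T * + T * + T

  -- The boundary terms at d = 0 of the second and third summation by parts, with the factors N that
  -- remain; `drop T k` is the first difference of the weight there. The first summation leaves no
  -- boundary term because χ has mean 0.
  main : ℕ → ℕ → ℤ
  main T k = + N * σ₁ * (+ T * + T * + T) - σ₂ * drop T k

  N³ : ℤ
  N³ = + N * + N * + N

  Ψ-range : ∀ T k Q → Q ℕ.≤ suc T → T ℕ.≤ Q ℕ.* k → Ψ T k ≡ Σ< Q λ d → χ d * F T k d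
  Ψ-range T k Q Q≤ T≤ = Σ-extend Q≤ λ d Q≤d →
    trans (cong (χ d *_) (F-far T k d (ℕ.≤-trans T≤ (ℕ.*-monoˡ-≤ k Q≤d)))) (*-zeroʳ (χ d))

  -- Euler–Maclaurin to third order for the sum of (T − dk)₊³ against χ.

  Ψ-expand : ∀ T k → 1 ℕ.≤ k →
             N³ * Ψ T k - main T k ≼ (T ℕ.+ k) ℕ.* (K₃ ℕ.* β ℕ.* (k ℕ.* k))
  Ψ-expand T k 1≤k = ℕ.≤-trans (ℕ.≤-reflexive (trans (cong ∣_∣ expansion) (∣-i∣≡∣i∣ S₃)))
    (ℕ.≤-trans (∣Σ∣≤ M (K₃ ℕ.* (β ℕ.* (k ℕ.* k ℕ.* k))) λ d _ →
        ≼-* {q₃ d} {Δ (Δ (Δ f)) d} (q₃≼ d) (third≼ T k d))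
      (ℕ.≤-trans (ℕ.≤-reflexive (lemma M K₃ β k)) (ℕ.*-monoˡ-≤ (K₃ ℕ.* β ℕ.* (k ℕ.* k)) M*k≤)))
    where
    instance
      k≢0 : NonZero k
      k≢0 = ℕ.>-nonZero 1≤k
    -- The weight vanishes from M on, since T ≤ M k; and M k ≤ T + k turns M error terms of size k³
    -- into (T + k) k².
    M = suc (T ℕ./ k)
    f = F T k
    lemma : ∀ m K b k → m ℕ.* (K ℕ.* (b ℕ.* (k ℕ.* k ℕ.* k))) ≡ m ℕ.* k ℕ.* (K ℕ.* b ℕ.* (k ℕ.* k))
    lemma = ℕSolver.solve-∀
    M*k≤ : M ℕ.* k ℕ.≤ T ℕ.+ k
    M*k≤ = ℕ.≤-trans (ℕ.+-monoʳ-≤ k (ℕ.m/n*n≤m T k)) (ℕ.≤-reflexive (ℕ.+-comm k T))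
    T≤M*k : T ℕ.≤ M ℕ.* k
    T≤M*k = ℕ.≤-trans (ℕ.≤-reflexive (ℕ.m≡m%n+[m/n]*n T k))
      (ℕ.+-monoˡ-≤ _ (ℕ.<⇒≤ (ℕ.m%n<n T k)))
    f₀ : f M ≡ 0ℤ
    f₀ = F-far T k M T≤M*k
    f₁ : f (1 ℕ.+ M) ≡ 0ℤ
    f₁ = F-far T k (1 ℕ.+ M) (ℕ.≤-trans T≤M*k (ℕ.*-monoˡ-≤ k (ℕ.n≤1+n M)))
    f₂ : f (2 ℕ.+ M) ≡ 0ℤ
    f₂ = F-far T k (2 ℕ.+ M) (ℕ.≤-trans T≤M*k (ℕ.*-monoˡ-≤ k (ℕ.m≤n+m M 2)))
    S₀ = Σ< M λ d → χ d * f d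
    S₁ = Σ< M λ d → q₁ d * Δ f d
    S₂ = Σ< M λ d → q₂ d * Δ (Δ f) d
    S₃ = Σ< M λ d → q₃ d * Δ (Δ (Δ f)) d
    step₀ : + N * S₀ ≡ - S₁
    step₀ = trans (by-parts N χ M f f₀) (trans (cong (λ s → s * Σ< M f - S₁) Σχ≡0) (l (Σ< M f) S₁))
      where
      l : ∀ a b → + 0 * a - b ≡ - b
      l = solve-∀
    step₁ : + N * S₁ ≡ - (σ₁ * f 0) - S₂
    step₁ = trans (by-parts N q₁ M (Δ f) (cong₂ _-_ f₁ f₀))
      (trans (cong (λ s → σ₁ * s - S₂) (trans (Σ-telescope M f) (cong (_- f 0) f₀))) (l σ₁ (f 0) S₂))
      where
      l : ∀ s a b → s * (+ 0 - a) - b ≡ - (s * a) - b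
      l = solve-∀
    step₂ : + N * S₂ ≡ - (σ₂ * Δ f 0) - S₃
    step₂ = trans (by-parts N q₂ M (Δ (Δ f)) (cong₂ _-_ (cong₂ _-_ f₂ f₁) (cong₂ _-_ f₁ f₀)))
      (trans (cong (λ s → σ₂ * s - S₃) (trans (Σ-telescope M (Δ f)) (cong (_- Δ f 0) (cong₂ _-_ f₁ f₀))))
        (l σ₂ (Δ f 0) S₃))
      where
      l : ∀ s a b → s * (+ 0 - a) - b ≡ - (s * a) - b
      l = solve-∀
    Δf0 : Δ f 0 ≡ drop T k
    Δf0 = cong₂ _-_ (cong (λ x → weight T (+ x)) (ℕ.+-identityʳ k)) (F-zero T k)
    expansion : N³ * Ψ T k - main T k ≡ - S₃
    expansion = begin
      N³ * Ψ T k - main T k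
        ≡⟨ cong (λ s → N³ * s - main T k) (Ψ-range T k M (s≤s (ℕ.m/n≤m T k)) T≤M*k) ⟩
      N³ * S₀ - main T k
        ≡⟨ cong (_- main T k) (trans (*-assoc (+ N * + N) (+ N) S₀) (cong (_*_ (+ N * + N)) step₀)) ⟩
      + N * + N * - S₁ - main T k
        ≡⟨ cong (_- main T k) (trans (l₁ (+ N) S₁) (cong (λ s → - (+ N * s)) step₁)) ⟩
      - (+ N * (- (σ₁ * f 0) - S₂)) - main T k
        ≡⟨ cong (_- main T k) (trans (l₂ (+ N) σ₁ (f 0) S₂) (cong (_+_ (+ N * σ₁ * f 0)) step₂)) ⟩
      + N * σ₁ * f 0 + (- (σ₂ * Δ f 0) - S₃) - main T k
        ≡⟨ cong₂ (λ a b → + N * σ₁ * a + (- (σ₂ * b) - S₃) - main T k) (F-zero T k) Δf0 ⟩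
      + N * σ₁ * (+ T * + T * + T) + (- (σ₂ * drop T k) - S₃) - main T k
        ≡⟨ l₃ (+ N * σ₁ * (+ T * + T * + T)) (σ₂ * drop T k) S₃ ⟩
      - S₃ ∎
      where
      open ≡-Reasoning
      l₁ : ∀ n s → n * n * - s ≡ - (n * (n * s))
      l₁ = solve-∀
      l₂ : ∀ n s a b → - (n * (- (s * a) - b)) ≡ n * s * a + n * b
      l₂ = solve-∀
      l₃ : ∀ a b s → a + (- b - s) - (a - b) ≡ - s
      l₃ = solve-∀

  Ψ′ : ℕ → ℕ → ℤ
  Ψ′ T k = Ψ T (suc k)

  Δ² : (ℕ → ℤ) → ℕ → ℤ
  Δ² f = Δ (Δ f)

  -- 144 = 4 · 4 · 9: a second difference involves four errors of `Ψ-expand`, each taken at some k ≤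
  -- 3K and so at most (T + 3K) K₃ β (3K)² ≤ 4T · 9K² · K₃ β. The summand with σ₂ comes from
  -- `second-difference` with step 1.
  D₁ : ℕ
  D₁ = 144 ℕ.* (K₃ ℕ.* β) ℕ.+ 6 ℕ.* ∣ σ₂ ∣

  -- For few codivisors the expansion is precise. In the second difference the part N σ₁ T³ of
  -- `main` cancels, as it does not depend on k; there remain four error terms and σ₂ times a second
  -- difference of (T - k)₊³.
  Δ²Ψ-small : ∀ T K k → k ℕ.< K → K ℕ.≤ T →
              N³ * Δ² (Ψ′ T) k ≼ D₁ ℕ.* (T ℕ.* (K ℕ.* K))
  Δ²Ψ-small T K k k<K K≤T = ℕ.≤-trans
    (ℕ.≤-reflexive (cong ∣_∣ (decompose N³ (Ψ′ T k) (Ψ′ T (1 ℕ.+ k)) (Ψ′ T (2 ℕ.+ k))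
      (+ N * σ₁) (+ T * + T * + T) σ₂ (w 0) (w 1) (w 2))))
    (ℕ.≤-trans (≼-- {(e 2 - e 1) - (e 1 - e 0)} {σ₂ * ((w 2 - w 1) - (w 1 - w 0))}
      (≼-- {e 2 - e 1} {e 1 - e 0} (≼-- {e 2} {e 1} (e≼ 2 ℕ.≤-refl) (e≼ 1 (s≤s z≤n)))
        (≼-- {e 1} {e 0} (e≼ 1 (s≤s z≤n)) (e≼ 0 z≤n)))
      (≼-* {σ₂} {(w 2 - w 1) - (w 1 - w 0)} ℕ.≤-refl w≼))
      (ℕ.≤-trans (ℕ.≤-reflexive (lemma (K₃ ℕ.* β) ∣ σ₂ ∣ T (K ℕ.* K)))
        (ℕ.≤-trans (ℕ.+-monoʳ-≤ (144 ℕ.* (K₃ ℕ.* β) ℕ.* (T ℕ.* (K ℕ.* K)))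
          (ℕ.*-monoʳ-≤ (6 ℕ.* ∣ σ₂ ∣) (ℕ.m≤m*n T (K ℕ.* K) {{ℕ.>-nonZero (ℕ.*-mono-≤ 1≤K 1≤K)}})))
          (ℕ.≤-reflexive (sym (ℕ.*-distribʳ-+ (T ℕ.* (K ℕ.* K)) (144 ℕ.* (K₃ ℕ.* β)) (6 ℕ.* ∣ σ₂ ∣)))))))
    where
    1≤K : 1 ℕ.≤ K
    1≤K = ℕ.≤-trans (s≤s z≤n) k<K
    w : ℕ → ℤ
    w i = weight T (+ (i ℕ.+ suc k))
    e : ℕ → ℤ
    e i = N³ * Ψ T (i ℕ.+ suc k) - main T (i ℕ.+ suc k)
    decompose : ∀ n a b c x t s u v z →
      n * ((c - b) - (b - a)) ≡
      ((n * c - (x * t - s * (z - t))) - (n * b - (x * t - s * (v - t)))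
       - ((n * b - (x * t - s * (v - t))) - (n * a - (x * t - s * (u - t)))))
      - s * ((z - v) - (v - u))
    decompose = solve-∀
    lemma : ∀ b s t k → (4 ℕ.* t ℕ.* (b ℕ.* (9 ℕ.* k)) ℕ.+ 4 ℕ.* t ℕ.* (b ℕ.* (9 ℕ.* k))
      ℕ.+ (4 ℕ.* t ℕ.* (b ℕ.* (9 ℕ.* k)) ℕ.+ 4 ℕ.* t ℕ.* (b ℕ.* (9 ℕ.* k)))) ℕ.+ s ℕ.* (6 ℕ.* (1 ℕ.* 1 ℕ.* t))
      ≡ 144 ℕ.* b ℕ.* (t ℕ.* k) ℕ.+ 6 ℕ.* s ℕ.* t
    lemma = ℕSolver.solve-∀
    three : ∀ i → i ℕ.≤ 2 → i ℕ.+ suc k ℕ.≤ 3 ℕ.* K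
    three i i≤2 = ℕ.≤-trans (ℕ.+-mono-≤ (ℕ.≤-trans i≤2 (ℕ.*-monoʳ-≤ 2 1≤K)) k<K) (ℕ.≤-reflexive (l K))
      where
      l : ∀ k → 2 ℕ.* k ℕ.+ k ≡ 3 ℕ.* k
      l = ℕSolver.solve-∀
    e≼ : ∀ i → i ℕ.≤ 2 → e i ≼ 4 ℕ.* T ℕ.* (K₃ ℕ.* β ℕ.* (9 ℕ.* (K ℕ.* K)))
    e≼ i i≤2 = ℕ.≤-trans (Ψ-expand T (i ℕ.+ suc k) (ℕ.≤-trans (s≤s z≤n) (ℕ.m≤n+m (suc k) i)))
      (ℕ.*-mono-≤ (ℕ.+-monoʳ-≤ T (ℕ.≤-trans (three i i≤2) (ℕ.*-monoʳ-≤ 3 K≤T)))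
        (ℕ.*-monoʳ-≤ (K₃ ℕ.* β) (ℕ.≤-trans (ℕ.*-mono-≤ (three i i≤2) (three i i≤2))
          (ℕ.≤-reflexive (l K)))))
      where
      l : ∀ k → 3 ℕ.* k ℕ.* (3 ℕ.* k) ≡ 9 ℕ.* (k ℕ.* k)
      l = ℕSolver.solve-∀
    w≼ : (w 2 - w 1) - (w 1 - w 0) ≼ 6 ℕ.* (1 ℕ.* 1 ℕ.* T)
    w≼ = subst (_≼ 6 ℕ.* (1 ℕ.* 1 ℕ.* T))
      (cong₂ (λ p q → (cub p - cub q) - (cub q - w 0)) (l₂ (+ T) (+ suc k)) (l₁ (+ T) (+ suc k)))
      (second-difference (+ T - + suc k) 1 T (i-j≤i (+ T) (+ suc k)))
      where
      l₁ : ∀ t k → t - k - + 1 ≡ t - (+ 1 + k)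
      l₁ = solve-∀
      l₂ : ∀ t k → t - k - + 1 - + 1 ≡ t - (+ 2 + k)
      l₂ = solve-∀

  -- For large codivisors few divisors are left: from d ≥ Q on the weight is 0, since d k ≥ Q K ≥ T.
  -- Each remaining d contributes a second difference of step d, at most 6 d² T.
  Δ²Ψ-large : ∀ T K Q k → K ℕ.≤ k → Q ℕ.≤ suc T → T ℕ.≤ Q ℕ.* K →
              Δ² (Ψ′ T) k ≼ Q ℕ.* (6 ℕ.* (Q ℕ.* Q ℕ.* T))
  Δ²Ψ-large T K Q k K≤k Q≤ T≤ = ℕ.≤-trans (ℕ.≤-reflexive (cong ∣_∣ collect))
    (∣Σ∣≤ Q (6 ℕ.* (Q ℕ.* Q ℕ.* T)) λ d d<Q → ℕ.≤-trans
      (≼-* {χ d} {H d} (∣χ∣≤1 d) (H≼ d))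
      (ℕ.≤-trans (ℕ.≤-reflexive (ℕ.*-identityˡ _))
        (ℕ.*-monoʳ-≤ 6 (ℕ.*-monoˡ-≤ T (ℕ.*-mono-≤ (ℕ.<⇒≤ d<Q) (ℕ.<⇒≤ d<Q))))))
    where
    H : ℕ → ℤ
    H d = (F T (3 ℕ.+ k) d - F T (2 ℕ.+ k) d) - (F T (2 ℕ.+ k) d - F T (1 ℕ.+ k) d)
    range : ∀ i → Ψ T (i ℕ.+ k) ≡ Σ< Q λ d → χ d * F T (i ℕ.+ k) d
    range i = Ψ-range T (i ℕ.+ k) Q Q≤ (ℕ.≤-trans T≤ (ℕ.*-monoʳ-≤ Q (ℕ.≤-trans K≤k (ℕ.m≤n+m k i))))
    collect : Δ² (Ψ′ T) k ≡ Σ< Q λ d → χ d * H d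
    collect = trans (cong₂ _-_ (diff 2) (diff 1))
      (trans (sym (Σ-- Q (λ d → χ d * F T (3 ℕ.+ k) d - χ d * F T (2 ℕ.+ k) d)
                         (λ d → χ d * F T (2 ℕ.+ k) d - χ d * F T (1 ℕ.+ k) d)))
        (Σ-cong′ Q λ d → l (χ d) (F T (3 ℕ.+ k) d) (F T (2 ℕ.+ k) d) (F T (1 ℕ.+ k) d)))
      where
      diff : ∀ i → Ψ T (suc i ℕ.+ k) - Ψ T (i ℕ.+ k) ≡
             Σ< Q λ d → χ d * F T (suc i ℕ.+ k) d - χ d * F T (i ℕ.+ k) d
      diff i = trans (cong₂ _-_ (range (suc i)) (range i))
        (sym (Σ-- Q (λ d → χ d * F T (suc i ℕ.+ k) d) (λ d → χ d * F T (i ℕ.+ k) d)))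
      l : ∀ x a b c → (x * a - x * b) - (x * b - x * c) ≡ x * ((a - b) - (b - c))
      l = solve-∀
    H≼ : ∀ d → H d ≼ 6 ℕ.* (d ℕ.* d ℕ.* T)
    H≼ d = subst (_≼ 6 ℕ.* (d ℕ.* d ℕ.* T))
      (cong₂ (λ p q → (cub p - cub q) - (cub q - F T (1 ℕ.+ k) d))
        (trans (l₂ (+ T) (+ d) (+ (d ℕ.* suc k)))
          (cong (λ x → + T - + x) (sym (trans (ℕ.*-suc d (2 ℕ.+ k)) (cong (d ℕ.+_) (ℕ.*-suc d (1 ℕ.+ k)))))))
        (trans (l₁ (+ T) (+ d) (+ (d ℕ.* suc k)))
          (cong (λ x → + T - + x) (sym (ℕ.*-suc d (1 ℕ.+ k))))))
      (second-difference (+ T - + (d ℕ.* suc k)) d T (i-j≤i (+ T) (+ (d ℕ.* suc k))))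
      where
      l₁ : ∀ t d x → t - x - d ≡ t - (d + x)
      l₁ = solve-∀
      l₂ : ∀ t d x → t - x - d - d ≡ t - (d + (d + x))
      l₂ = solve-∀

  private
    cc : ℕ → ℤ
    cc = next 4 (next 4 c₄)

    Kc : ℕ
    Kc = maxUpTo 4 cc

    cc≼ : ∀ k → cc k ≼ Kc
    cc≼ = periodic-≼ 4 cc (next-periodic 4 (next 4 c₄) (next-periodic 4 c₄ c₄-periodic))

  Ψ-far : ∀ T k → T ℕ.≤ k → Ψ′ T k ≡ 0ℤ
  Ψ-far T k T≤k = Σ-zero (suc T) λ
    { zero    _ → cong (_* F T (suc k) 0) χ0≡0
    ; (suc d) _ → trans (cong (χ (suc d) *_) (F-far T (suc k) (suc d)
        (ℕ.≤-trans T≤k (ℕ.≤-trans (ℕ.n≤1+n k) (ℕ.m≤m+n (suc k) (d ℕ.* suc k))))))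
        (*-zeroʳ (χ (suc d))) }

  -- The partial sums of 4 c₄ over a period are -4, -8, -12, 0, whence the constant -24. The
  -- boundary term `Ψ′ T 0` = `Ψ T 1` will carry the whole main term.
  c₄-by-parts : ∀ T → + 16 * Σ< (T ℕ.* 4) (λ k → c₄ k * Ψ′ T k) ≡
    - (+ 24 * Ψ′ T 0) + Σ< (T ℕ.* 4) (λ k → cc k * Δ² (Ψ′ T) k)
  c₄-by-parts T = begin
    + 16 * S₀                         ≡⟨ l₀ S₀ ⟩
    + 4 * (+ 4 * S₀)                  ≡⟨ cong (_*_ (+ 4)) (by-parts 4 c₄ M g g₀) ⟩
    + 4 * (+ 0 * Σ< M g - S₁)         ≡⟨ l₁ (Σ< M g) S₁ ⟩
    - (+ 4 * S₁)                      ≡⟨ cong -_ (by-parts 4 (next 4 c₄) M (Δ g) (cong₂ _-_ g₁ g₀)) ⟩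
    - (- + 24 * Σ< M (Δ g) - S₂)      ≡⟨ cong (λ x → - (- + 24 * x - S₂))
                                          (trans (Σ-telescope M g) (cong (_- g 0) g₀)) ⟩
    - (- + 24 * (+ 0 - g 0) - S₂)     ≡⟨ l₂ (g 0) S₂ ⟩
    - (+ 24 * g 0) + S₂               ∎
    where
    open ≡-Reasoning
    M = T ℕ.* 4
    g = Ψ′ T
    S₀ = Σ< M λ k → c₄ k * g k
    S₁ = Σ< M λ k → next 4 c₄ k * Δ g k
    S₂ = Σ< M λ k → cc k * Δ² g k
    T≤M : T ℕ.≤ M
    T≤M = ℕ.m≤m*n T 4
    g₀ : g M ≡ 0ℤ
    g₀ = Ψ-far T M T≤M
    g₁ : g (suc M) ≡ 0ℤ
    g₁ = Ψ-far T (suc M) (ℕ.≤-trans T≤M (ℕ.n≤1+n M))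
    l₀ : ∀ a → + 16 * a ≡ + 4 * (+ 4 * a)
    l₀ = solve-∀
    l₁ : ∀ a b → + 4 * (+ 0 * a - b) ≡ - (+ 4 * b)
    l₁ = solve-∀
    l₂ : ∀ a b → - (- + 24 * (+ 0 - a) - b) ≡ - (+ 24 * a) + b
    l₂ = solve-∀

  E₀ E₁ divisorConst : ℕ
  E₀ = Kc ℕ.* D₁ ℕ.+ Kc ℕ.* (∣ N³ ∣ ℕ.* 6) ℕ.+ 4 ℕ.* (Kc ℕ.* (∣ N³ ∣ ℕ.* 6))
  E₁ = 24 ℕ.* (∣ σ₂ ∣ ℕ.* 7) ℕ.+ 24 ℕ.* (2 ℕ.* (K₃ ℕ.* β))
  divisorConst = E₀ ℕ.+ E₁

  drop≼ : ∀ T → 1 ℕ.≤ T → drop T 1 ≼ 7 ℕ.* (T ℕ.* T)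
  drop≼ T@(suc T-1) 1≤T = ℕ.≤-trans (ℕ.≤-reflexive (cong ∣_∣
      (trans (cong (_- + T * + T * + T) (cub-nonNeg (+ T - + 1) (+≤+ z≤n))) (l (+ T)))))
    (ℕ.≤-trans (≼-+ { - + 3 * (+ T * + T) + + 3 * + T} { - + 1}
        (≼-+ { - + 3 * (+ T * + T)} {+ 3 * + T} (≼-* { - + 3} {+ T * + T} ℕ.≤-refl (≼-* {+ T} {+ T} ℕ.≤-refl ℕ.≤-refl))
          (≼-* {+ 3} {+ T} ℕ.≤-refl ℕ.≤-refl)) (ℕ.≤-refl {1}))
      (ℕ.≤-trans (ℕ.+-mono-≤ (ℕ.+-monoʳ-≤ (3 ℕ.* (T ℕ.* T)) (ℕ.*-monoʳ-≤ 3 (ℕ.m≤m*n T T)))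
          (ℕ.*-mono-≤ 1≤T 1≤T))
        (ℕ.≤-reflexive (l₂ (T ℕ.* T)))))
    where
    l : ∀ t → (t - + 1) * (t - + 1) * (t - + 1) - t * t * t ≡ - + 3 * (t * t) + + 3 * t + - + 1
    l = solve-∀
    l₂ : ∀ x → 3 ℕ.* x ℕ.+ 3 ℕ.* x ℕ.+ x ≡ 7 ℕ.* x
    l₂ = ℕSolver.solve-∀

  -- The codivisors are cut at t⁶ and at t⁶ + t⁷. Below t⁶, `Δ²Ψ-small` gives t⁶ · T · t¹² = t²⁸. In
  -- the next t⁷ terms `Δ²Ψ-large` with Q = t⁴ gives t⁷ · t¹² · T = t²⁹. The remaining terms, at
  -- most 4T in number, with Q = t³ give T · t⁹ · T = t²⁹. The main term has size T³ = t³⁰.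
  divisor-bound : ∀ t → 1 ℕ.≤ t → let T = t ℕ.^ 10 in
    + 16 * (N³ * Σ< (T ℕ.* 4) (λ k → c₄ k * Ψ′ T k)) + + 24 * (+ N * σ₁ * (+ T * + T * + T))
    ≼ divisorConst ℕ.* t ℕ.^ 29
  divisor-bound t 1≤t = ℕ.≤-trans (ℕ.≤-reflexive (cong ∣_∣ decompose))
    (ℕ.≤-trans (≼-+ {N³ * Z} {+ 24 * (σ₂ * drop T 1) - + 24 * e} Z≼ rest≼)
      (ℕ.≤-reflexive (sym (ℕ.*-distribʳ-+ (t ℕ.^ 29) E₀ E₁))))
    where
    T = t ℕ.^ 10
    K Q : ℕ → ℕ
    K i = t ℕ.^ i
    Q i = t ℕ.^ i
    M = T ℕ.* 4
    pw : ∀ a b → t ℕ.^ a ℕ.* t ℕ.^ b ≡ t ℕ.^ (a ℕ.+ b)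
    pw a b = sym (ℕ.^-distribˡ-+-* t a b)
    mono : ∀ {a b} → a ℕ.≤ b → t ℕ.^ a ℕ.≤ t ℕ.^ b
    mono = ℕ.^-monoʳ-≤ t {{ℕ.>-nonZero 1≤t}}
    1≤T : 1 ℕ.≤ T
    1≤T = mono {0} {10} z≤n
    e = N³ * Ψ T 1 - main T 1
    Z = Σ< M λ k → cc k * Δ² (Ψ′ T) k

    decompose : + 16 * (N³ * Σ< M (λ k → c₄ k * Ψ′ T k)) + + 24 * (+ N * σ₁ * (+ T * + T * + T)) ≡
                N³ * Z + (+ 24 * (σ₂ * drop T 1) - + 24 * e)
    decompose = begin
      + 16 * (N³ * S) + + 24 * x                 ≡⟨ cong (_+ + 24 * x) (l₁ N³ S) ⟩
      N³ * (+ 16 * S) + + 24 * x                 ≡⟨ cong (λ y → N³ * y + + 24 * x) (c₄-by-parts T) ⟩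
      N³ * (- (+ 24 * Ψ T 1) + Z) + + 24 * x     ≡⟨ l₂ N³ (Ψ T 1) Z x (σ₂ * drop T 1) ⟩
      N³ * Z + (+ 24 * (σ₂ * drop T 1) - + 24 * (N³ * Ψ T 1 - (x - σ₂ * drop T 1))) ∎
      where
      open ≡-Reasoning
      x = + N * σ₁ * (+ T * + T * + T)
      S = Σ< M λ k → c₄ k * Ψ′ T k
      l₁ : ∀ n s → + 16 * (n * s) ≡ n * (+ 16 * s)
      l₁ = solve-∀
      l₂ : ∀ n p z x d → n * (- (+ 24 * p) + z) + + 24 * x ≡
                         n * z + (+ 24 * d - + 24 * (n * p - (x - d)))
      l₂ = solve-∀

    rest≼ : + 24 * (σ₂ * drop T 1) - + 24 * e ≼ E₁ ℕ.* t ℕ.^ 29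
    rest≼ = ℕ.≤-trans
      (≼-- {+ 24 * (σ₂ * drop T 1)} {+ 24 * e}
        (≼-* {+ 24} {σ₂ * drop T 1} ℕ.≤-refl (≼-* {σ₂} {drop T 1} ℕ.≤-refl
          (ℕ.≤-trans (drop≼ T 1≤T) (ℕ.*-monoʳ-≤ 7 T²≤))))
        (≼-* {+ 24} {e} ℕ.≤-refl (ℕ.≤-trans (Ψ-expand T 1 ℕ.≤-refl)
          (ℕ.*-monoˡ-≤ (K₃ ℕ.* β ℕ.* (1 ℕ.* 1)) (ℕ.≤-trans (ℕ.+-monoʳ-≤ T 1≤T)
            (ℕ.≤-trans (ℕ.≤-reflexive (cong (T ℕ.+_) (sym (ℕ.+-identityʳ T))))
              (ℕ.*-monoʳ-≤ 2 (mono {10} {29} (ℕ.m≤m+n 10 19)))))))))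
      (ℕ.≤-reflexive (lemma ∣ σ₂ ∣ (K₃ ℕ.* β) (t ℕ.^ 29)))
      where
      T²≤ : T ℕ.* T ℕ.≤ t ℕ.^ 29
      T²≤ = ℕ.≤-trans (ℕ.≤-reflexive (pw 10 10)) (mono {20} {29} (ℕ.m≤m+n 20 9))
      lemma : ∀ s k x → 24 ℕ.* (s ℕ.* (7 ℕ.* x)) ℕ.+ 24 ℕ.* (2 ℕ.* x ℕ.* (k ℕ.* 1)) ≡
                        (24 ℕ.* (s ℕ.* 7) ℕ.+ 24 ℕ.* (2 ℕ.* k)) ℕ.* x
      lemma = ℕSolver.solve-∀

    term : ℕ → ℤ
    term k = cc k * (N³ * Δ² (Ψ′ T) k)

    r = M ℕ.∸ (K 6 ℕ.+ K 7)
    M≡ : M ≡ K 6 ℕ.+ (K 7 ℕ.+ r)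
    M≡ = trans (sym (ℕ.m+[n∸m]≡n K₆+K₇≤M)) (ℕ.+-assoc (K 6) (K 7) r)
      where
      K₆+K₇≤M : K 6 ℕ.+ K 7 ℕ.≤ M
      K₆+K₇≤M = ℕ.≤-trans (ℕ.+-mono-≤ (mono {6} {10} (ℕ.m≤m+n 6 4)) (mono {7} {10} (ℕ.m≤m+n 7 3)))
        (ℕ.≤-trans (ℕ.≤-reflexive (l T)) (ℕ.*-monoʳ-≤ T (ℕ.m≤m+n 2 2)))
        where
        l : ∀ t → t ℕ.+ t ≡ t ℕ.* 2
        l = ℕSolver.solve-∀

    large : ∀ i j k → i ℕ.+ j ≡ 10 → j ℕ.≤ 10 → K i ℕ.≤ k → term k ≼ Kc ℕ.* (∣ N³ ∣ ℕ.* (Q j ℕ.* (6 ℕ.* (Q j ℕ.* Q j ℕ.* T))))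
    large i j k eq j≤ K≤k = ≼-* {cc k} {N³ * Δ² (Ψ′ T) k} (cc≼ k)
      (≼-* {N³} {Δ² (Ψ′ T) k} ℕ.≤-refl (Δ²Ψ-large T (K i) (Q j) k K≤k
        (ℕ.≤-trans (mono j≤) (ℕ.n≤1+n T))
        (ℕ.≤-reflexive (sym (trans (pw j i) (cong (t ℕ.^_) (trans (ℕ.+-comm j i) eq)))))))

    Z≼ : N³ * Z ≼ E₀ ℕ.* t ℕ.^ 29
    Z≼ = ℕ.≤-trans (ℕ.≤-reflexive (cong ∣_∣ (begin
        N³ * Z                  ≡⟨ sym (Σ-*ˡ M N³ (λ k → cc k * Δ² (Ψ′ T) k)) ⟩
        Σ< M (λ k → N³ * (cc k * Δ² (Ψ′ T) k))
                                ≡⟨ Σ-cong′ M (λ k → comm₃ N³ (cc k) (Δ² (Ψ′ T) k)) ⟩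
        Σ< M term               ≡⟨ cong (λ m → Σ< m term) M≡ ⟩
        Σ< (K 6 ℕ.+ (K 7 ℕ.+ r)) term
                                ≡⟨ trans (Σ-split (K 6) (K 7 ℕ.+ r) term)
                                     (trans (cong (_+_ (Σ< (K 6) term)) (Σ-split (K 7) r (λ k → term (K 6 ℕ.+ k))))
                                       (sym (+-assoc (Σ< (K 6) term) (Σ< (K 7) term₂) (Σ< r term₃)))) ⟩
        Σ< (K 6) term + Σ< (K 7) term₂ + Σ< r term₃ ∎)))
      (ℕ.≤-trans (≼-+ {Σ< (K 6) term + Σ< (K 7) term₂} {Σ< r term₃}
        (≼-+ {Σ< (K 6) term} {Σ< (K 7) term₂}
          (∣Σ∣≤ (K 6) {term} (Kc ℕ.* (D₁ ℕ.* (T ℕ.* (K 6 ℕ.* K 6)))) λ k k<K →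
            ≼-* {cc k} {N³ * Δ² (Ψ′ T) k} (cc≼ k) (Δ²Ψ-small T (K 6) k k<K (mono {6} {10} (ℕ.m≤m+n 6 4))))
          (∣Σ∣≤ (K 7) {term₂} _ λ k _ → large 6 4 (K 6 ℕ.+ k) refl (ℕ.m≤m+n 4 6) (ℕ.m≤m+n (K 6) k)))
        (∣Σ∣≤ r {term₃} _ λ k _ → large 7 3 (K 6 ℕ.+ (K 7 ℕ.+ k)) refl (ℕ.m≤m+n 3 7)
          (ℕ.≤-trans (ℕ.m≤m+n (K 7) k) (ℕ.m≤n+m (K 7 ℕ.+ k) (K 6)))))
      (ℕ.≤-trans (ℕ.+-mono-≤ (ℕ.+-mono-≤ first (ℕ.≤-reflexive second)) third)
        (ℕ.≤-reflexive (trans (cong (ℕ._+ 4 ℕ.* (Kc ℕ.* (∣ N³ ∣ ℕ.* 6)) ℕ.* t ℕ.^ 29)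
          (sym (ℕ.*-distribʳ-+ (t ℕ.^ 29) (Kc ℕ.* D₁) (Kc ℕ.* (∣ N³ ∣ ℕ.* 6)))))
          (sym (ℕ.*-distribʳ-+ (t ℕ.^ 29) (Kc ℕ.* D₁ ℕ.+ Kc ℕ.* (∣ N³ ∣ ℕ.* 6)) (4 ℕ.* (Kc ℕ.* (∣ N³ ∣ ℕ.* 6)))))))))
      where
      open ≡-Reasoning
      term₂ term₃ : ℕ → ℤ
      term₂ k = term (K 6 ℕ.+ k)
      term₃ k = term (K 6 ℕ.+ (K 7 ℕ.+ k))
      comm₃ : ∀ n c x → n * (c * x) ≡ c * (n * x)
      comm₃ = solve-∀
      first : K 6 ℕ.* (Kc ℕ.* (D₁ ℕ.* (T ℕ.* (K 6 ℕ.* K 6)))) ℕ.≤ Kc ℕ.* D₁ ℕ.* t ℕ.^ 29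
      first = ℕ.≤-trans (ℕ.≤-reflexive (trans (l (K 6) Kc D₁ T)
          (cong (Kc ℕ.* D₁ ℕ.*_) (trans (cong (t ℕ.^ 10 ℕ.*_) (trans (cong (t ℕ.^ 6 ℕ.*_) (pw 6 6)) (pw 6 12))) (pw 10 18)))))
        (ℕ.*-monoʳ-≤ (Kc ℕ.* D₁) (mono {28} {29} (ℕ.n≤1+n 28)))
        where
        l : ∀ k c d t → k ℕ.* (c ℕ.* (d ℕ.* (t ℕ.* (k ℕ.* k)))) ≡ c ℕ.* d ℕ.* (t ℕ.* (k ℕ.* (k ℕ.* k)))
        l = ℕSolver.solve-∀
      second : K 7 ℕ.* (Kc ℕ.* (∣ N³ ∣ ℕ.* (Q 4 ℕ.* (6 ℕ.* (Q 4 ℕ.* Q 4 ℕ.* T)))))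
               ≡ Kc ℕ.* (∣ N³ ∣ ℕ.* 6) ℕ.* t ℕ.^ 29
      second = trans (l (K 7) Kc ∣ N³ ∣ (Q 4) T)
        (cong (Kc ℕ.* (∣ N³ ∣ ℕ.* 6) ℕ.*_) (trans (cong (t ℕ.^ 7 ℕ.*_) (trans (cong (t ℕ.^ 10 ℕ.*_)
          (trans (cong (t ℕ.^ 4 ℕ.*_) (pw 4 4)) (pw 4 8))) (pw 10 12))) (pw 7 22)))
        where
        l : ∀ k c n q t → k ℕ.* (c ℕ.* (n ℕ.* (q ℕ.* (6 ℕ.* (q ℕ.* q ℕ.* t))))) ≡
            c ℕ.* (n ℕ.* 6) ℕ.* (k ℕ.* (t ℕ.* (q ℕ.* (q ℕ.* q))))
        l = ℕSolver.solve-∀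
      third : r ℕ.* (Kc ℕ.* (∣ N³ ∣ ℕ.* (Q 3 ℕ.* (6 ℕ.* (Q 3 ℕ.* Q 3 ℕ.* T)))))
              ℕ.≤ 4 ℕ.* (Kc ℕ.* (∣ N³ ∣ ℕ.* 6)) ℕ.* t ℕ.^ 29
      third = ℕ.≤-trans (ℕ.*-monoˡ-≤ _ (ℕ.m∸n≤m M (K 6 ℕ.+ K 7)))
        (ℕ.≤-reflexive (trans (l T Kc ∣ N³ ∣ (Q 3))
          (cong (4 ℕ.* (Kc ℕ.* (∣ N³ ∣ ℕ.* 6)) ℕ.*_) (trans (cong (t ℕ.^ 10 ℕ.*_) (trans (cong (t ℕ.^ 10 ℕ.*_)
            (trans (cong (t ℕ.^ 3 ℕ.*_) (pw 3 3)) (pw 3 6))) (pw 10 9))) (pw 10 19)))))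
        where
        l : ∀ t c n q → t ℕ.* 4 ℕ.* (c ℕ.* (n ℕ.* (q ℕ.* (6 ℕ.* (q ℕ.* q ℕ.* t))))) ≡
            4 ℕ.* (c ℕ.* (n ℕ.* 6)) ℕ.* (t ℕ.* (t ℕ.* (q ℕ.* (q ℕ.* q))))
        l = ℕSolver.solve-∀

-- Congruences

infix 4 _≅_[_] _≅?_[_]

-- The quotient is a field and the equation is solved for x, so that matching on `refl` substitutes
-- y plus a multiple of n for x and leaves a polynomial identity.
record _≅_[_] (x y : ℤ) (n : ℕ) : Set where
  constructor cg
  field
    quot : ℤ
    eq   : x ≡ y + quot * + n

module _ {n : ℕ} where

  ≅-reflexive : ∀ {x y} → x ≡ y → x ≅ y [ n ]
  ≅-reflexive {x} refl = cg 0ℤ (lemma x (+ n))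
    where
    lemma : ∀ x n → x ≡ x + + 0 * n
    lemma = solve-∀

  ≅-refl : ∀ {x} → x ≅ x [ n ]
  ≅-refl = ≅-reflexive refl

  ≅-sym : ∀ {x y} → x ≅ y [ n ] → y ≅ x [ n ]
  ≅-sym {x} {y} (cg k refl) = cg (- k) (lemma y k (+ n))
    where
    lemma : ∀ y k n → y ≡ y + k * n + - k * n
    lemma = solve-∀

  ≅-trans : ∀ {x y z} → x ≅ y [ n ] → y ≅ z [ n ] → x ≅ z [ n ]
  ≅-trans {z = z} (cg k refl) (cg l refl) = cg (l + k) (lemma z k l (+ n))
    where
    lemma : ∀ z k l n → z + l * n + k * n ≡ z + (l + k) * n
    lemma = solve-∀

  ≅-+ : ∀ {x y u v} → x ≅ y [ n ] → u ≅ v [ n ] → x + u ≅ y + v [ n ]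
  ≅-+ {y = y} {v = v} (cg k refl) (cg l refl) = cg (k + l) (lemma y v k l (+ n))
    where
    lemma : ∀ y v k l n → y + k * n + (v + l * n) ≡ y + v + (k + l) * n
    lemma = solve-∀

  ≅-* : ∀ {x y u v} → x ≅ y [ n ] → u ≅ v [ n ] → x * u ≅ y * v [ n ]
  ≅-* {y = y} {v = v} (cg k refl) (cg l refl) = cg (k * v + y * l + k * l * + n) (lemma y v k l (+ n))
    where
    lemma : ∀ y v k l n → (y + k * n) * (v + l * n) ≡ y * v + (k * v + y * l + k * l * n) * n
    lemma = solve-∀

  ≅-neg : ∀ {x y} → x ≅ y [ n ] → - x ≅ - y [ n ]
  ≅-neg {y = y} (cg k refl) = cg (- k) (lemma y k (+ n))
    where
    lemma : ∀ y k n → - (y + k * n) ≡ - y + - k * n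
    lemma = solve-∀

  ≅-- : ∀ {x y u v} → x ≅ y [ n ] → u ≅ v [ n ] → x - u ≅ y - v [ n ]
  ≅-- p q = ≅-+ p (≅-neg q)

  ≅-^ : ∀ {x y} k → x ≅ y [ n ] → x ^ k ≅ y ^ k [ n ]
  ≅-^ zero    p = ≅-refl
  ≅-^ (suc k) p = ≅-* p (≅-^ k p)

  ≅⇒∣ : ∀ {x y} → x ≅ y [ n ] → + n ∣ᶻ x - y
  ≅⇒∣ {y = y} (cg k refl) = divides k (lemma y k (+ n))
    where
    lemma : ∀ y k n → y + k * n - y ≡ k * n
    lemma = solve-∀

  ∣⇒≅ : ∀ {x y} → + n ∣ᶻ x - y → x ≅ y [ n ]
  ∣⇒≅ {x} {y} (divides k eq) = cg k (trans (lemma x y) (cong (_+_ y) eq))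
    where
    lemma : ∀ x y → x ≡ y + (x - y)
    lemma = solve-∀

  ≅0⇒∣ : ∀ {x} → x ≅ 0ℤ [ n ] → n ∣ ∣ x ∣
  ≅0⇒∣ (cg k eq) = ∣⇒∣ᵤ (divides k (trans eq (+-identityˡ _)))

  ∣⇒≅0 : ∀ {x} → n ∣ ∣ x ∣ → x ≅ 0ℤ [ n ]
  ∣⇒≅0 n∣x with ∣ᵤ⇒∣ {+ n} n∣x
  ... | divides k eq = cg k (trans eq (sym (+-identityˡ _)))

  ∣-⇒≅ : ∀ {x y} → n ∣ ∣ x - y ∣ → x ≅ y [ n ]
  ∣-⇒≅ d = ∣⇒≅ (∣ᵤ⇒∣ d)

  ≅⇒∣- : ∀ {x y} → x ≅ y [ n ] → n ∣ ∣ x - y ∣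
  ≅⇒∣- p = ∣⇒∣ᵤ (≅⇒∣ p)

_≅?_[_] : ∀ x y n → Dec (x ≅ y [ n ])
x ≅? y [ n ] with n ∣? ∣ x - y ∣
... | yes d = yes (∣-⇒≅ d)
... | no ¬d = no (¬d ∘ ≅⇒∣-)

≅-weaken : ∀ {x y n} k → x ≅ y [ k ℕ.* n ] → x ≅ y [ n ]
≅-weaken {y = y} {n} k (cg l refl) = cg (l * + k) (cong (_+_ y)
  (trans (cong (l *_) (pos-* k n)) (sym (*-assoc l (+ k) (+ n)))))

≅-small : ∀ {n i j} → + i ≅ + j [ n ] → i ℕ.< n → j ℕ.< n → i ≡ j
≅-small {n} {i} {j} p i<n j<n = ℕ.∣m-n∣≡0⇒m≡n (small (ℕ∣.∣-trans (≅⇒∣- p) (ℕ∣.∣-reflexive ∣-∣≡)))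
  where
  ∣-∣≡ : ∣ + i - + j ∣ ≡ ℕ.∣ i - j ∣
  ∣-∣≡ = trans (cong ∣_∣ (m-n≡m⊖n i j)) (∣⊖∣≡ i j)
    where
    ∣⊖∣≡ : ∀ i j → ∣ i ⊖ j ∣ ≡ ℕ.∣ i - j ∣
    ∣⊖∣≡ i j with ℕ.≤-total i j
    ... | inj₁ i≤j = trans (∣⊖∣-≤ i≤j) (sym (ℕ.m≤n⇒∣m-n∣≡n∸m i≤j))
    ... | inj₂ j≤i = trans (cong ∣_∣ (⊖-≥ j≤i)) (sym (trans (ℕ.∣-∣-comm i j) (ℕ.m≤n⇒∣m-n∣≡n∸m j≤i)))
  bound : ℕ.∣ i - j ∣ ℕ.< n
  bound = ℕ.≤-<-trans (ℕ.∣m-n∣≤m⊔n i j) (ℕ.⊔-lub i<n j<n)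
  small : n ∣ ℕ.∣ i - j ∣ → ℕ.∣ i - j ∣ ≡ 0
  small d with ℕ.∣ i - j ∣ | bound
  ... | zero  | _ = refl
  ... | suc m | m<n = ⊥-elim (ℕ.<⇒≱ m<n (ℕ∣.∣⇒≤ d))

residue : ∀ x n .{{_ : NonZero n}} → x ≅ + (x %ℕ n) [ n ]
residue x n = cg (x /ℕ n) (a≡a%ℕn+[a/ℕn]*n x n)

residue-cong : ∀ {x y n} .{{_ : NonZero n}} → x ≅ y [ n ] → x %ℕ n ≡ y %ℕ n
residue-cong {x} {y} {n} p = ≅-small (≅-trans (≅-sym (residue x n)) (≅-trans p (residue y n)))
  (n%ℕd<d x n) (n%ℕd<d y n)

residue-small : ∀ {i n} .{{_ : NonZero n}} → i ℕ.< n → + i %ℕ n ≡ i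
residue-small {i} {n} i<n = ≅-small (≅-sym (residue (+ i) n)) (n%ℕd<d (+ i) n) i<n

inverse : ∀ a n → Coprime ∣ a ∣ n → ∃[ b ] a * b ≅ 1ℤ [ n ]
inverse a n cop with natural ∣ a ∣ (coprime-Bézout cop)
  where
  natural : ∀ m → Bézout.Identity 1 m n → ∃[ b ] + m * b ≅ 1ℤ [ n ]
  natural m (Bézout.+- x y eq) = + x , cg (+ y) (trans (trans (*-comm (+ m) (+ x)) (sym (pos-* x m)))
    (trans (cong +_ (sym eq)) (cong (_+_ 1ℤ) (pos-* y n))))
  natural m (Bézout.-+ x y eq) = - + x , cg (- + y) (lemma₁ (+ m) (+ x) (+ y) (+ n)
    (trans (cong (_+_ 1ℤ) (sym (pos-* x m))) (trans (cong +_ eq) (pos-* y n))))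
    where
    lemma₀ : ∀ m x → m * - x ≡ + 1 - (+ 1 + x * m)
    lemma₀ = solve-∀
    lemma₂ : ∀ y n → + 1 - y * n ≡ + 1 + - y * n
    lemma₂ = solve-∀
    lemma₁ : ∀ m x y n → + 1 + x * m ≡ y * n → m * - x ≡ + 1 + - y * n
    lemma₁ m x y n eq = trans (lemma₀ m x) (trans (cong (λ z → + 1 - z) eq) (lemma₂ y n))
inverse (+ _)    n cop | b , p = b , p
inverse -[1+ m ] n cop | b , p = - b , ≅-trans (≅-reflexive (lemma (+ suc m) b)) p
  where
  lemma : ∀ m b → - m * - b ≡ m * b
  lemma = solve-∀

≅-cancelˡ : ∀ a {x y n} → Coprime ∣ a ∣ n → a * x ≅ a * y [ n ] → x ≅ y [ n ]
≅-cancelˡ a {x} {y} {n} cop p with inverse a n cop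
... | b , q = ≅-trans (≅-sym (undo x)) (≅-trans (≅-* (≅-refl {x = b}) p) (undo y))
  where
  undo : ∀ z → b * (a * z) ≅ z [ n ]
  undo z = ≅-trans (≅-reflexive (lemma a b z)) (≅-trans (≅-* q (≅-refl {x = z})) (≅-reflexive (*-identityˡ z)))
    where
    lemma : ∀ a b z → b * (a * z) ≡ a * b * z
    lemma = solve-∀

module _ {p : ℕ} (pr : Prime p) where

  prime>1 : 1 ℕ.< p
  prime>1 = ℕ.nonTrivial⇒n>1 p {{prime⇒nonTrivial pr}}

  ∤⇒coprime : ∀ {m} → ¬ p ∣ m → Coprime m p
  ∤⇒coprime ¬p∣m {d} (d∣m , d∣p) with prime⇒irreducible pr d∣p
  ... | inj₁ d≡1 = d≡1
  ... | inj₂ d≡p = ⊥-elim (¬p∣m (subst (_∣ _) d≡p d∣m))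

  ≅0-* : ∀ {x y} → x * y ≅ 0ℤ [ p ] → x ≅ 0ℤ [ p ] ⊎ y ≅ 0ℤ [ p ]
  ≅0-* {x} {y} q with euclidsLemma ∣ x ∣ ∣ y ∣ pr (subst (p ∣_) (abs-* x y) (≅0⇒∣ q))
  ... | inj₁ d = inj₁ (∣⇒≅0 d)
  ... | inj₂ d = inj₂ (∣⇒≅0 d)

  ≇0⇒coprime : ∀ {x} → ¬ x ≅ 0ℤ [ p ] → Coprime ∣ x ∣ p
  ≇0⇒coprime x≇0 = ∤⇒coprime (x≇0 ∘ ∣⇒≅0)

  prime-cancelˡ : ∀ a {x y} → ¬ a ≅ 0ℤ [ p ] → a * x ≅ a * y [ p ] → x ≅ y [ p ]
  prime-cancelˡ a a≇0 = ≅-cancelˡ a (≇0⇒coprime a≇0)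

  small≇0 : ∀ {k} → suc k ℕ.< p → ¬ + suc k ≅ 0ℤ [ p ]
  small≇0 k<p q with ≅-small q k<p (ℕ.<-trans (s≤s z≤n) k<p)
  ... | ()

Π< : ℕ → (ℕ → ℤ) → ℤ
Π< zero    F = 1ℤ
Π< (suc n) F = Π< n F * F n

Π-cong : ∀ n {F G : ℕ → ℤ} → (∀ i → i ℕ.< n → F i ≡ G i) → Π< n F ≡ Π< n G
Π-cong zero    eq = refl
Π-cong (suc n) eq =
  cong₂ _*_ (Π-cong n λ i i<n → eq i (ℕ.m<n⇒m<1+n i<n)) (eq n (ℕ.n<1+n n))

Π-one : ∀ n {F : ℕ → ℤ} → (∀ i → i ℕ.< n → F i ≡ 1ℤ) → Π< n F ≡ 1ℤ
Π-one zero    eq = refl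
Π-one (suc n) eq = cong₂ _*_ (Π-one n λ i i<n → eq i (ℕ.m<n⇒m<1+n i<n)) (eq n (ℕ.n<1+n n))

Π-* : ∀ n (F G : ℕ → ℤ) → Π< n (λ i → F i * G i) ≡ Π< n F * Π< n G
Π-* zero    F G = refl
Π-* (suc n) F G = trans (cong (_* (F n * G n)) (Π-* n F G)) (lemma (Π< n F) (Π< n G) (F n) (G n))
  where
  lemma : ∀ a b c d → a * b * (c * d) ≡ a * c * (b * d)
  lemma = solve-∀

Π-const : ∀ n c → Π< n (λ _ → c) ≡ c ^ n
Π-const zero    c = refl
Π-const (suc n) c = trans (cong (_* c) (Π-const n c)) (*-comm (c ^ n) c)

Π-swap : ∀ m n (F : ℕ → ℕ → ℤ) →
         Π< m (λ i → Π< n (F i)) ≡ Π< n (λ j → Π< m (λ i → F i j))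
Π-swap zero    n F = sym (Π-one n λ _ _ → refl)
Π-swap (suc m) n F = trans (cong (_* Π< n (F m)) (Π-swap m n F)) (sym (Π-* n _ (F m)))

Π-single : ∀ n {F : ℕ → ℤ} k → k ℕ.< n →
           (∀ i → i ℕ.< n → i ≢ k → F i ≡ 1ℤ) → Π< n F ≡ F k
Π-single (suc n) {F} k k<1+n off with k ℕ.≟ n
... | yes refl = trans (cong (_* F n) (Π-one n λ i i<n →
        off i (ℕ.m<n⇒m<1+n i<n) (ℕ.<⇒≢ i<n))) (*-identityˡ (F n))
... | no k≢n = trans (cong₂ _*_
        (Π-single n k (ℕ.≤∧≢⇒< (ℕ.s≤s⁻¹ k<1+n) k≢n) λ i i<n → off i (ℕ.m<n⇒m<1+n i<n))
        (off n (ℕ.n<1+n n) (λ n≡k → k≢n (sym n≡k)))) (*-identityʳ (F k))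

Π-split : ∀ m n (F : ℕ → ℤ) → Π< (m ℕ.+ n) F ≡ Π< m F * Π< n (λ i → F (m ℕ.+ i))
Π-split m zero    F = trans (cong (λ k → Π< k F) (ℕ.+-identityʳ m)) (sym (*-identityʳ _))
Π-split m (suc n) F = trans (cong (λ k → Π< k F) (ℕ.+-suc m n))
  (trans (cong (_* F (m ℕ.+ n)) (Π-split m n F)) (*-assoc (Π< m F) _ _))

Π-reindex : ∀ n (π : ℕ → ℕ) (F : ℕ → ℤ) →
            (∀ i → i ℕ.< n → π i ℕ.< n) →
            (∀ j → j ℕ.< n → ∃[ i ] i ℕ.< n × π i ≡ j) →
            (∀ i i′ → i ℕ.< n → i′ ℕ.< n → π i ≡ π i′ → i ≡ i′) →
            Π< n (λ i → F (π i)) ≡ Π< n F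
Π-reindex n π F into onto inj = begin
  Π< n (λ i → F (π i))
    ≡⟨ Π-cong n (λ i i<n → sym (trans (Π-single n {δ i} (π i) (into i i<n)
         λ j _ j≢πi → off i j j≢πi) (on i))) ⟩
  Π< n (λ i → Π< n (δ i))
    ≡⟨ Π-swap n n δ ⟩
  Π< n (λ j → Π< n (λ i → δ i j))
    ≡⟨ Π-cong n inner ⟩
  Π< n F ∎
  where
  open ≡-Reasoning
  δ : ℕ → ℕ → ℤ
  δ i j with j ℕ.≟ π i
  ... | yes _ = F j
  ... | no _  = 1ℤ
  off : ∀ i j → j ≢ π i → δ i j ≡ 1ℤ
  off i j j≢πi with j ℕ.≟ π i
  ... | yes p = ⊥-elim (j≢πi p)
  ... | no _  = refl
  on : ∀ i → δ i (π i) ≡ F (π i)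
  on i with π i ℕ.≟ π i
  ... | yes _ = refl
  ... | no ¬p = ⊥-elim (¬p refl)
  inner : ∀ j → j ℕ.< n → Π< n (λ i → δ i j) ≡ F j
  inner j j<n with onto j j<n
  ... | i₀ , i₀<n , refl = trans (Π-single n i₀ i₀<n λ i i<n i≢i₀ →
          off i (π i₀) (λ eq → i≢i₀ (inj i i₀ i<n i₀<n (sym eq)))) (on i₀)

Π-≅ : ∀ {m} n {F G : ℕ → ℤ} → (∀ i → i ℕ.< n → F i ≅ G i [ m ]) → Π< n F ≅ Π< n G [ m ]
Π-≅ zero    eq = ≅-refl
Π-≅ (suc n) eq = ≅-* (Π-≅ n λ i i<n → eq i (ℕ.m<n⇒m<1+n i<n)) (eq n (ℕ.n<1+n n))

Σ-≅ : ∀ {m} n {F G : ℕ → ℤ} → (∀ i → i ℕ.< n → F i ≅ G i [ m ]) → Σ< n F ≅ Σ< n G [ m ]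
Σ-≅ zero    eq = ≅-refl
Σ-≅ (suc n) eq = ≅-+ (Σ-≅ n λ i i<n → eq i (ℕ.m<n⇒m<1+n i<n)) (eq n (ℕ.n<1+n n))

-- Quadratic reciprocity

-- Replaces the search over `Fin p` inside `legendre` by congruences, the form in which the later
-- arguments use it.
data LegendreView (x : ℤ) (p : ℕ) : ℤ → Set where
  zero-residue  : x ≅ 0ℤ [ p ] → LegendreView x p 0ℤ
  residual   : ¬ x ≅ 0ℤ [ p ] → ∀ y → y ℕ.< p → x ≅ + y * + y [ p ] → LegendreView x p 1ℤ
  irresidual : ¬ x ≅ 0ℤ [ p ] → (∀ y → y ℕ.< p → ¬ x ≅ + y * + y [ p ]) → LegendreView x p -1ℤ

legendreView : ∀ x p → LegendreView x p (legendre x p)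
legendreView x p with p ∣? ∣ x ∣
... | yes d = zero-residue (∣⇒≅0 d)
... | no ¬d with Fin.any? {n = p} (λ y → p ∣? ∣ x - + (toℕ y ℕ.* toℕ y) ∣)
... | yes (y , d) = residual (¬d ∘ ≅0⇒∣) (toℕ y) (Fin.toℕ<n y)
        (≅-trans (∣-⇒≅ d) (≅-reflexive (pos-* (toℕ y) (toℕ y))))
... | no ¬∃ = irresidual (¬d ∘ ≅0⇒∣) λ y y<p e → ¬∃ (fromℕ< y<p , subst
        (λ z → p ∣ ∣ x - + (z ℕ.* z) ∣) (sym (Fin.toℕ-fromℕ< y<p))
        (≅⇒∣- (≅-trans e (≅-reflexive (sym (pos-* y y))))))

-- Iterated differences of a polynomial: Degree n c F says that F has degree n
-- and leading coefficient c.

Degree : ℕ → ℤ → (ℕ → ℤ) → Set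
Degree zero    c F = ∀ i → F i ≡ c
Degree (suc n) c F = Degree n (+ suc n * c) (Δ F)

Degree-cong : ∀ n {c d F G} → c ≡ d → (∀ i → F i ≡ G i) → Degree n c F → Degree n d G
Degree-cong zero    eq FG D i = trans (sym (FG i)) (trans (D i) eq)
Degree-cong (suc n) eq FG D =
  Degree-cong n (cong (_*_ (+ suc n)) eq) (λ i → cong₂ _-_ (FG (suc i)) (FG i)) D

Degree-+ : ∀ n {c d F G} → Degree n c F → Degree n d G → Degree n (c + d) (λ i → F i + G i)
Degree-+ zero    D E i = cong₂ _+_ (D i) (E i)
Degree-+ (suc n) {c} {d} {F} {G} D E = Degree-cong n (sym (*-distribˡ-+ (+ suc n) c d))
  (λ i → lemma (F (suc i)) (F i) (G (suc i)) (G i)) (Degree-+ n {F = Δ F} {G = Δ G} D E)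
  where
  lemma : ∀ a b c d → a - b + (c - d) ≡ a + c - (b + d)
  lemma = solve-∀

Degree-lift : ∀ n {c F} → Degree n c F → Degree (suc n) 0ℤ F
Degree-lift zero    {c} D i = trans (cong₂ _-_ (D (suc i)) (D i)) (+-inverseʳ c)
Degree-lift (suc n) {c} {F} D = Degree-cong (suc n) {F = Δ F} (sym (*-zeroʳ (+ suc (suc n)))) (λ _ → refl)
  (Degree-lift n {F = Δ F} D)

-- The product rule Δ(i F) = i ΔF + F + ΔF, whose last summand does not affect the leading
-- coefficient.
Degree-x* : ∀ n {c F} → Degree n c F → Degree (suc n) c (λ i → + i * F i)
Degree-x* zero    {c} {F} D i = trans
  (cong₂ (λ a b → + suc i * a - + i * b) (D (suc i)) (D i)) (lemma (+ i) c)
  where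
  lemma : ∀ i c → (+ 1 + i) * c - i * c ≡ + 1 * c
  lemma = solve-∀
Degree-x* (suc n) {c} {F} D = Degree-cong (suc n) (coef (+ n) c)
  (λ i → lemma (+ i) (F (suc i)) (F i))
  (Degree-+ (suc n) {F = λ i → + i * Δ F i + F i} {G = Δ F}
    (Degree-+ (suc n) {F = λ i → + i * Δ F i} {G = F} (Degree-x* n {F = Δ F} D) D)
    (Degree-lift n {F = Δ F} D))
  where
  coef : ∀ n c → (+ 1 + n) * c + c + + 0 ≡ (+ 2 + n) * c
  coef = solve-∀
  lemma : ∀ i a b → i * (a - b) + b + (a - b) ≡ (+ 1 + i) * a - i * b
  lemma = solve-∀

Degree-^ : ∀ n → Degree n 1ℤ (λ i → (+ i) ^ n)
Degree-^ zero    i = refl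
Degree-^ (suc n) = Degree-x* n (Degree-^ n)

-- Takes the place of the bound for the number of roots modulo p: n differences lead to the constant
-- n! c, which is prime to p for n < p, whereas n + 1 consecutive zeros would make it 0.
Degree-nonvanishing : ∀ {p} → Prime p → ∀ n {c F} a → n ℕ.< p → Degree n c F → ¬ c ≅ 0ℤ [ p ] →
                      ¬ (∀ i → i ℕ.≤ n → F (a ℕ.+ i) ≅ 0ℤ [ p ])
Degree-nonvanishing pr zero a n<p D c≇0 vanish =
  c≇0 (≅-trans (≅-reflexive (sym (D (a ℕ.+ 0)))) (vanish 0 z≤n))
Degree-nonvanishing {p} pr (suc n) {c} {F} a n<p D c≇0 vanish =
  Degree-nonvanishing pr n {F = Δ F} a (ℕ.<-trans (ℕ.n<1+n n) n<p) D
    (λ e → [ small≇0 pr n<p , c≇0 ]′ (≅0-* pr e))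
    λ i i≤n → ≅-- (subst (λ k → F k ≅ 0ℤ [ p ]) (ℕ.+-suc a i) (vanish (suc i) (s≤s i≤n)))
                  (vanish i (ℕ.m≤n⇒m≤1+n i≤n))

Sign : ℤ → Set
Sign ε = ε ≡ 1ℤ ⊎ ε ≡ -1ℤ

Sign-* : ∀ {ε δ} → Sign ε → Sign δ → Sign (ε * δ)
Sign-* (inj₁ refl) (inj₁ refl) = inj₁ refl
Sign-* (inj₁ refl) (inj₂ refl) = inj₂ refl
Sign-* (inj₂ refl) (inj₁ refl) = inj₂ refl
Sign-* (inj₂ refl) (inj₂ refl) = inj₁ refl

Sign-Π : ∀ n {F : ℕ → ℤ} → (∀ i → Sign (F i)) → Sign (Π< n F)
Sign-Π zero    s = inj₁ refl
Sign-Π (suc n) s = Sign-* (Sign-Π n s) (s n)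

Sign-square : ∀ {ε} → Sign ε → ε * ε ≡ 1ℤ
Sign-square (inj₁ refl) = refl
Sign-square (inj₂ refl) = refl

module OddPrime (h : ℕ) (pr : Prime (suc (h ℕ.+ h))) where

  p : ℕ
  p = suc (h ℕ.+ h)

  1≤h : 1 ℕ.≤ h
  1≤h = positive-half h (prime>1 pr)
    where
    positive-half : ∀ k → 1 ℕ.< suc (k ℕ.+ k) → 1 ℕ.≤ k
    positive-half zero    (s≤s ())
    positive-half (suc k) _ = s≤s z≤n

  2≇0 : ¬ + 2 ≅ 0ℤ [ p ]
  2≇0 = small≇0 pr (s≤s (ℕ.+-mono-≤ 1≤h 1≤h))

  1≇-1 : ¬ 1ℤ ≅ -1ℤ [ p ]
  1≇-1 e = 2≇0 (≅-- e (≅-refl {x = -1ℤ}))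

  1≇0 : ¬ 1ℤ ≅ 0ℤ [ p ]
  1≇0 e = 2≇0 (≅-+ e e)

  Sign-≅ : ∀ {ε δ} → Sign ε → Sign δ → ε ≅ δ [ p ] → ε ≡ δ
  Sign-≅ (inj₁ refl) (inj₁ refl) e = refl
  Sign-≅ (inj₁ refl) (inj₂ refl) e = ⊥-elim (1≇-1 e)
  Sign-≅ (inj₂ refl) (inj₁ refl) e = ⊥-elim (1≇-1 (≅-sym e))
  Sign-≅ (inj₂ refl) (inj₂ refl) e = refl

  -- The representative of x in the half-system ±1, …, ±h is
  -- halfSign x · (1 + halfIndex x).

  halfSign : ℤ → ℤ
  halfSign x with x %ℕ p ℕ.≤? h
  ... | yes _ = 1ℤ
  ... | no  _ = -1ℤ

  halfIndex : ℤ → ℕ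
  halfIndex x with x %ℕ p ℕ.≤? h
  ... | yes _ = ℕ.pred (x %ℕ p)
  ... | no  _ = ℕ.pred (p ℕ.∸ x %ℕ p)

  halfSign-Sign : ∀ x → Sign (halfSign x)
  halfSign-Sign x with x %ℕ p ℕ.≤? h
  ... | yes _ = inj₁ refl
  ... | no  _ = inj₂ refl

  half-spec : ∀ x → ¬ x ≅ 0ℤ [ p ] →
              halfIndex x ℕ.< h × x ≅ halfSign x * + suc (halfIndex x) [ p ]
  half-spec x x≇0 with x %ℕ p ℕ.≤? h
  ... | yes r≤h = ℕ.≤-trans (ℕ.≤-reflexive r≡) r≤h ,
          ≅-trans (residue x p) (≅-reflexive (trans (cong +_ (sym r≡)) (sym (*-identityˡ _))))
    where
    r≡ : suc (ℕ.pred (x %ℕ p)) ≡ x %ℕ p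
    r≡ = ℕ.suc-pred (x %ℕ p) {{ℕ.≢-nonZero λ r≡0 →
      x≇0 (≅-trans (residue x p) (≅-reflexive (cong +_ r≡0)))}}
  ... | no r≰h = ℕ.≤-trans (ℕ.≤-reflexive s≡) s≤h ,
          ≅-trans (residue x p) (cg 1ℤ (sym (trans (cong₂ (λ a b → -1ℤ * + a + 1ℤ * + b) s≡ (sym p≡))
            (lemma (+ (p ℕ.∸ x %ℕ p)) (+ (x %ℕ p))))))
    where
    r<p : x %ℕ p ℕ.< p
    r<p = n%ℕd<d x p
    p≡ : p ℕ.∸ x %ℕ p ℕ.+ x %ℕ p ≡ p
    p≡ = ℕ.m∸n+n≡m (ℕ.<⇒≤ r<p)
    s≡ : suc (ℕ.pred (p ℕ.∸ x %ℕ p)) ≡ p ℕ.∸ x %ℕ p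
    s≡ = ℕ.suc-pred (p ℕ.∸ x %ℕ p) {{ℕ.>-nonZero (ℕ.m<n⇒0<n∸m r<p)}}
    s≤h : p ℕ.∸ x %ℕ p ℕ.≤ h
    s≤h = ℕ.m≤n+o⇒m∸n≤o p (x %ℕ p) (ℕ.+-monoˡ-≤ h (ℕ.≰⇒> r≰h))
    lemma : ∀ a r → - + 1 * a + + 1 * (a + r) ≡ r
    lemma = solve-∀

  half-unique : ∀ {ε δ j k} → Sign ε → Sign δ → j ℕ.< h → k ℕ.< h →
                ε * + suc j ≅ δ * + suc k [ p ] → ε ≡ δ × j ≡ k
  half-unique {ε} {δ} {j} {k} sε sδ j<h k<h e = cases sε sδ e
    where
    small : ∀ {i} → i ℕ.< h → suc i ℕ.< p
    small i<h = s≤s (ℕ.≤-trans i<h (ℕ.m≤m+n h h))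
    opposite : ¬ + suc j ≅ - (+ suc k) [ p ]
    opposite e = small≇0 pr (s≤s (ℕ.+-mono-≤ j<h k<h))
      (≅-trans (≅-+ e (≅-refl {x = + suc k})) (≅-reflexive (+-inverseˡ (+ suc k))))
    same : + suc j ≅ + suc k [ p ] → j ≡ k
    same e = ℕ.suc-injective (≅-small e (small j<h) (small k<h))
    neg1 : ∀ x → -1ℤ * x ≡ - x
    neg1 x = -1*i≡-i x
    cases : ∀ {ε δ} → Sign ε → Sign δ → ε * + suc j ≅ δ * + suc k [ p ] → ε ≡ δ × j ≡ k
    cases (inj₁ refl) (inj₁ refl) e = refl , same
      (subst₂ (_≅_[ p ]) (*-identityˡ _) (*-identityˡ _) e)
    cases (inj₁ refl) (inj₂ refl) e = ⊥-elim (opposite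
      (subst₂ (_≅_[ p ]) (*-identityˡ _) (neg1 _) e))
    cases (inj₂ refl) (inj₁ refl) e = ⊥-elim (opposite
      (≅-trans (≅-reflexive (sym (neg-involutive (+ suc j))))
        (≅-neg (subst₂ (_≅_[ p ]) (neg1 _) (*-identityˡ _) e))))
    cases (inj₂ refl) (inj₂ refl) e = refl , same
      (subst₂ (_≅_[ p ]) (neg-involutive _) (neg-involutive _)
        (≅-neg (subst₂ (_≅_[ p ]) (neg1 _) (neg1 _) e)))

  -- The sign of Gauss's lemma. It serves as the quadratic character of nonzero residues until
  -- `legendre≡g` identifies the two, because its multiplicativity follows at once from a^h.
  gauss : ℤ → ℤ
  gauss a = Π< h λ k → halfSign (a * + suc k)

  gauss-Sign : ∀ a → Sign (gauss a)
  gauss-Sign a = Sign-Π h λ k → halfSign-Sign (a * + suc k)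

  module _ (a : ℤ) (a≇0 : ¬ a ≅ 0ℤ [ p ]) where

    multiple≇0 : ∀ k → k ℕ.< h → ¬ a * + suc k ≅ 0ℤ [ p ]
    multiple≇0 k k<h e = [ a≇0 , small≇0 pr (s≤s (ℕ.≤-trans k<h (ℕ.m≤m+n h h))) ]′ (≅0-* pr e)

    private
      π : ℕ → ℕ
      π k = halfIndex (a * + suc k)

      π< : ∀ k → k ℕ.< h → π k ℕ.< h
      π< k k<h = proj₁ (half-spec _ (multiple≇0 k k<h))

    halfIndex-injective : ∀ j k → j ℕ.< h → k ℕ.< h → π j ≡ π k → j ≡ k
    halfIndex-injective j k j<h k<h eq =
      proj₂ (half-unique εj εk j<h k<h
        (prime-cancelˡ pr a a≇0 (≅-trans (≅-reflexive (lemma a s (+ suc j)))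
          (≅-trans (≅-* (≅-refl {x = s}) (proj₂ (half-spec _ (multiple≇0 j j<h))))
          (≅-trans (≅-reflexive (trans (cong (λ m → s * (s * + suc m)) eq) (swap s t (+ suc (π k))
              (trans (Sign-square εj) (sym (Sign-square εk))))))
          (≅-trans (≅-* (≅-refl {x = t}) (≅-sym (proj₂ (half-spec _ (multiple≇0 k k<h)))))
            (≅-reflexive (sym (lemma a t (+ suc k))))))))))
      where
      s = halfSign (a * + suc j)
      t = halfSign (a * + suc k)
      εj = halfSign-Sign (a * + suc j)
      εk = halfSign-Sign (a * + suc k)
      lemma : ∀ a s j → a * (s * j) ≡ s * (a * j)
      lemma = solve-∀
      swap : ∀ s t x → s * s ≡ t * t → s * (s * x) ≡ t * (t * x)
      swap s t x eq = trans (sym (*-assoc s s x)) (trans (cong (_* x) eq) (*-assoc t t x))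

    halfIndex-onto : ∀ j → j ℕ.< h → ∃[ i ] i ℕ.< h × π i ≡ j
    halfIndex-onto = injective⇒onto h π π< halfIndex-injective

    -- The product of a, 2a, ..., ha is a^h h!. Passing to the representatives ±1, ..., ±h permutes
    -- the absolute values and gives `gauss a` times h!, and h! is prime to p.
    gauss-lemma : a ^ h ≅ gauss a [ p ]
    gauss-lemma = prime-cancelˡ pr (Π< h (λ k → + suc k)) (factorial≇0 h ℕ.≤-refl)
      (≅-trans (≅-reflexive (begin
        Π< h (λ k → + suc k) * a ^ h            ≡⟨ *-comm _ (a ^ h) ⟩
        a ^ h * Π< h (λ k → + suc k)            ≡⟨ cong (_* Π< h (λ k → + suc k)) (sym (Π-const h a)) ⟩
        Π< h (λ _ → a) * Π< h (λ k → + suc k)   ≡⟨ sym (Π-* h (λ _ → a) (λ k → + suc k)) ⟩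
        Π< h (λ k → a * + suc k)                ∎))
      (≅-trans (Π-≅ h λ k k<h → proj₂ (half-spec _ (multiple≇0 k k<h)))
      (≅-reflexive (begin
        Π< h (λ k → halfSign (a * + suc k) * + suc (π k))
          ≡⟨ Π-* h (λ k → halfSign (a * + suc k)) (λ k → + suc (π k)) ⟩
        gauss a * Π< h (λ k → + suc (π k))
          ≡⟨ cong (gauss a *_) (Π-reindex h π (λ k → + suc k) π< halfIndex-onto halfIndex-injective) ⟩
        gauss a * Π< h (λ k → + suc k)
          ≡⟨ *-comm (gauss a) _ ⟩
        Π< h (λ k → + suc k) * gauss a          ∎))))
      where
      open ≡-Reasoning
      factorial≇0 : ∀ n → n ℕ.≤ h → ¬ Π< n (λ k → + suc k) ≅ 0ℤ [ p ]
      factorial≇0 zero    _   e = 1≇0 e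
      factorial≇0 (suc n) n<h e =
        [ factorial≇0 n (ℕ.<⇒≤ n<h) , small≇0 pr (s≤s (ℕ.≤-trans n<h (ℕ.m≤m+n h h))) ]′ (≅0-* pr e)

  gauss-cong : ∀ {a b} → ¬ a ≅ 0ℤ [ p ] → a ≅ b [ p ] → gauss a ≡ gauss b
  gauss-cong {a} {b} a≇0 e = Sign-≅ (gauss-Sign a) (gauss-Sign b)
    (≅-trans (≅-sym (gauss-lemma a a≇0)) (≅-trans (≅-^ h e) (gauss-lemma b (a≇0 ∘ ≅-trans e))))

  ^-distrib-* : ∀ a b n → (a * b) ^ n ≡ a ^ n * b ^ n
  ^-distrib-* a b zero    = refl
  ^-distrib-* a b (suc n) = trans (cong (a * b *_) (^-distrib-* a b n)) (lemma a b (a ^ n) (b ^ n))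
    where
    lemma : ∀ a b x y → a * b * (x * y) ≡ a * x * (b * y)
    lemma = solve-∀

  gauss-* : ∀ {a b} → ¬ a ≅ 0ℤ [ p ] → ¬ b ≅ 0ℤ [ p ] → gauss (a * b) ≡ gauss a * gauss b
  gauss-* {a} {b} a≇0 b≇0 = Sign-≅ (gauss-Sign (a * b)) (Sign-* (gauss-Sign a) (gauss-Sign b))
    (≅-trans (≅-sym (gauss-lemma (a * b) λ e → [ a≇0 , b≇0 ]′ (≅0-* pr e)))
      (≅-trans (≅-reflexive (^-distrib-* a b h)) (≅-* (gauss-lemma a a≇0) (gauss-lemma b b≇0))))

  -- Otherwise i^h ≡ 1 for all i from 1 to 2h, and (i + 1)^h - i^h, of degree h - 1 with leading
  -- coefficient h, would vanish at h consecutive points.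
  gauss-nontrivial : ∃[ b ] ¬ b ≅ 0ℤ [ p ] × gauss b ≡ -1ℤ
  gauss-nontrivial with ℕ.anyUpTo? (λ k → gauss (+ suc k) ≟ -1ℤ) (h ℕ.+ h)
  ... | yes (k , k<2h , eq) = + suc k , small≇0 pr (s≤s k<2h) , eq
  ... | no none = ⊥-elim (contradiction h refl 1≤h)
    where
    trivial : ∀ k → k ℕ.< h ℕ.+ h → (+ suc k) ^ h ≅ 1ℤ [ p ]
    trivial k k<2h with gauss-Sign (+ suc k)
    ... | inj₁ eq = ≅-trans (gauss-lemma _ (small≇0 pr (s≤s k<2h))) (≅-reflexive eq)
    ... | inj₂ eq = ⊥-elim (none (k , k<2h , eq))
    contradiction : ∀ n → n ≡ h → 1 ℕ.≤ n → ⊥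
    contradiction (suc n) refl _ = Degree-nonvanishing pr n 1 n<p (Degree-^ (suc n))
      (λ e → small≇0 pr (s≤s (ℕ.m≤m+n (suc n) (suc n))) (≅-trans (≅-reflexive (sym (*-identityʳ _))) e))
      λ i i≤n → ≅-- (trivial (suc i) (s≤s (ℕ.≤-trans (s≤s i≤n) (ℕ.m≤n+m (suc n) n))))
                    (trivial i (s≤s (ℕ.≤-trans i≤n (ℕ.m≤m+n n (suc n)))))
      where
      n<p : n ℕ.< p
      n<p = s≤s (ℕ.≤-trans (ℕ.n≤1+n n) (ℕ.m≤m+n (suc n) (suc n)))

  g : ℤ → ℤ
  g x with x ≅? 0ℤ [ p ]
  ... | yes _ = 0ℤ
  ... | no  _ = gauss x

  g-zero : ∀ {x} → x ≅ 0ℤ [ p ] → g x ≡ 0ℤ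
  g-zero {x} e with x ≅? 0ℤ [ p ]
  ... | yes _ = refl
  ... | no ¬e = ⊥-elim (¬e e)

  g-gauss : ∀ {x} → ¬ x ≅ 0ℤ [ p ] → g x ≡ gauss x
  g-gauss {x} ¬e with x ≅? 0ℤ [ p ]
  ... | yes e = ⊥-elim (¬e e)
  ... | no _  = refl

  g-cong : ∀ {x y} → x ≅ y [ p ] → g x ≡ g y
  g-cong {x} {y} e with x ≅? 0ℤ [ p ]
  ... | yes z = sym (g-zero (≅-trans (≅-sym e) z))
  ... | no ¬z = trans (gauss-cong ¬z e) (sym (g-gauss (¬z ∘ ≅-trans e)))

  g-* : ∀ x y → g (x * y) ≡ g x * g y
  g-* x y with x ≅? 0ℤ [ p ]
  ... | yes zx = trans (g-zero (≅-* zx (≅-refl {x = y}))) (sym (*-zeroˡ (g y)))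
  ... | no ¬zx with y ≅? 0ℤ [ p ]
  ...   | yes zy = trans (g-zero (≅-trans (≅-* (≅-refl {x = x}) zy) (≅-reflexive (*-zeroʳ x))))
                     (sym (*-zeroʳ (gauss x)))
  ...   | no ¬zy = trans (g-gauss λ e → [ ¬zx , ¬zy ]′ (≅0-* pr e)) (gauss-* ¬zx ¬zy)

  -- Multiplication by an element of sign -1 permutes the residues and reverses the sign of the sum.
  Σg≡0 : Σ< p (λ x → g (+ x)) ≡ 0ℤ
  Σg≡0 with gauss-nontrivial
  ... | b , b≇0 , gb≡-1 = self-negative _ (trans
        (sym (Σ-reindex p p π (λ x → g (+ x)) π< (injective⇒onto p π π< inj) inj))
        (trans (Σ-cong′ p λ x → trans (g-cong (≅-sym (residue (b * + x) p))) (trans (g-* b (+ x))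
            (trans (cong (_* g (+ x)) (trans (g-gauss b≇0) gb≡-1)) (-1*i≡-i (g (+ x))))))
          (Σ-neg p (λ x → g (+ x)))))
    where
    π : ℕ → ℕ
    π x = (b * + x) %ℕ p
    π< : ∀ i → i ℕ.< p → π i ℕ.< p
    π< i _ = n%ℕd<d (b * + i) p
    inj : ∀ i i′ → i ℕ.< p → i′ ℕ.< p → π i ≡ π i′ → i ≡ i′
    inj i i′ i<p i′<p eq = ≅-small (prime-cancelˡ pr b b≇0
      (≅-trans (residue (b * + i) p) (≅-trans (≅-reflexive (cong +_ eq)) (≅-sym (residue (b * + i′) p)))))
      i<p i′<p
    self-negative : ∀ x → x ≡ - x → x ≡ 0ℤ
    self-negative (+ zero)  _ = refl
    self-negative (+ suc n) ()
    self-negative -[1+ n ]  ()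

  roots : ℤ → ℤ
  roots x = Σ< p λ y → 𝟙 (x ≅? + y * + y [ p ])

  roots-count : ∀ x → roots x ≡ 1ℤ + legendre x p
  roots-count x with legendre x p | legendreView x p
  ... | .0ℤ | zero-residue x≅0 = trans (Σ-single p 0 (s≤s z≤n) λ y y<p y≢0 →
          𝟙-no (x ≅? + y * + y [ p ]) λ e → y≢0 (≅-small
            ([ id , id ]′ (≅0-* pr (≅-trans (≅-sym e) x≅0))) y<p (s≤s z≤n)))
          (𝟙-yes (x ≅? + 0 * + 0 [ p ]) x≅0)
  ... | .1ℤ | residual x≇0 y₀ y₀<p e₀ = trans
          (Σ-pair p y₀ (p ℕ.∸ y₀) y₀<p y₁<p distinct λ y y<p y≢y₀ y≢y₁ →
            𝟙-no (x ≅? + y * + y [ p ]) λ e → [ (λ z → y≢y₀ (≅-small (diff z) y<p y₀<p)) ,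
              (λ z → y≢y₁ (≅-small (opposite z) y<p y₁<p)) ]′
              (≅0-* pr (≅-trans (≅-reflexive (factor (+ y) (+ y₀))) (≅-trans (≅-- (≅-sym e) (≅-sym e₀)) (≅-reflexive (+-inverseʳ x))))))
          (cong₂ _+_ (𝟙-yes (x ≅? + y₀ * + y₀ [ p ]) e₀)
            (𝟙-yes (x ≅? + (p ℕ.∸ y₀) * + (p ℕ.∸ y₀) [ p ]) (≅-trans e₀ (≅-trans (≅-reflexive (squares (+ y₀)))
              (≅-sym (≅-* complement complement))))))
    where
    y₀≢0 : y₀ ≢ 0
    y₀≢0 refl = x≇0 e₀
    y₁<p : p ℕ.∸ y₀ ℕ.< p
    y₁<p = ℕ.∸-monoʳ-< {p} {y₀} {0} (ℕ.n≢0⇒n>0 y₀≢0) (ℕ.<⇒≤ y₀<p)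
    complement : + (p ℕ.∸ y₀) ≅ - + y₀ [ p ]
    complement = cg 1ℤ (trans (lemma (+ (p ℕ.∸ y₀)) (+ y₀)) (cong (λ z → - + y₀ + 1ℤ * + z) (ℕ.m∸n+n≡m (ℕ.<⇒≤ y₀<p))))
      where
      lemma : ∀ a b → a ≡ - b + + 1 * (a + b)
      lemma = solve-∀
    distinct : y₀ ≢ p ℕ.∸ y₀
    distinct eq = [ 2≇0 , (λ z → y₀≢0 (≅-small z y₀<p (s≤s z≤n))) ]′ (≅0-* pr
      (≅-trans (≅-reflexive (lemma (+ y₀))) (≅-trans (≅-+ (≅-trans (≅-reflexive (cong +_ eq)) complement) (≅-refl {x = + y₀}))
        (≅-reflexive (+-inverseˡ (+ y₀))))))
      where
      lemma : ∀ y → + 2 * y ≡ y + y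
      lemma = solve-∀
    factor : ∀ a b → (a - b) * (a + b) ≡ a * a - b * b
    factor = solve-∀
    squares : ∀ a → a * a ≡ - a * - a
    squares = solve-∀
    diff : ∀ {y} → + y - + y₀ ≅ 0ℤ [ p ] → + y ≅ + y₀ [ p ]
    diff {y} z = ≅-trans (≅-reflexive (lemma (+ y) (+ y₀))) (≅-trans (≅-+ z (≅-refl {x = + y₀})) (≅-reflexive (+-identityˡ _)))
      where
      lemma : ∀ a b → a ≡ a - b + b
      lemma = solve-∀
    opposite : ∀ {y} → + y + + y₀ ≅ 0ℤ [ p ] → + y ≅ + (p ℕ.∸ y₀) [ p ]
    opposite {y} z = ≅-trans (≅-reflexive (lemma (+ y) (+ y₀))) (≅-trans (≅-- z (≅-refl {x = + y₀})) (≅-trans (≅-reflexive (+-identityˡ _)) (≅-sym complement)))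
      where
      lemma : ∀ a b → a ≡ a + b - b
      lemma = solve-∀
  ... | .-1ℤ | irresidual x≇0 nores = Σ-zero p λ y y<p → 𝟙-no (x ≅? + y * + y [ p ]) (nores y y<p)

  legendre-cong : ∀ {x y} → x ≅ y [ p ] → legendre x p ≡ legendre y p
  legendre-cong {x} {y} e = +-cancelˡ 1ℤ (trans (sym (roots-count x)) (trans
    (Σ-cong′ p λ z → 𝟙-cong (x ≅? + z * + z [ p ]) (y ≅? + z * + z [ p ]) (≅-trans (≅-sym e)) (≅-trans e))
    (roots-count y)))

  -- Each y is a square root of exactly one residue, so the numbers 1 + legendre of square roots sum
  -- to p.
  Σlegendre≡0 : Σ< p (λ x → legendre (+ x) p) ≡ 0ℤ
  Σlegendre≡0 = +-cancelˡ (+ p * 1ℤ) (trans (sym (trans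
      (Σ-cong′ p λ x → roots-count (+ x))
      (trans (Σ-+ p (λ _ → 1ℤ) (λ x → legendre (+ x) p)) (cong (_+ Σ< p (λ x → legendre (+ x) p)) (Σ-const p 1ℤ)))))
    (trans (trans (Σ-swap p p λ x y → 𝟙 (+ x ≅? + y * + y [ p ]))
      (trans (Σ-cong′ p one-x) (Σ-const p 1ℤ))) (sym (+-identityʳ _))))
    where
    one-x : ∀ y → Σ< p (λ x → 𝟙 (+ x ≅? + y * + y [ p ])) ≡ 1ℤ
    one-x y = trans (Σ-single p r (n%ℕd<d (+ y * + y) p) λ x x<p x≢r →
        𝟙-no (+ x ≅? + y * + y [ p ]) λ e → x≢r (≅-small (≅-trans e (residue _ p)) x<p (n%ℕd<d (+ y * + y) p)))
      (𝟙-yes (+ r ≅? + y * + y [ p ]) (≅-sym (residue _ p)))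
      where
      r = (+ y * + y) %ℕ p

  -- Euler's criterion: both sides have sum 0, and a residue is certainly a
  -- square root of 1 to the power h.

  legendre≡g : ∀ x → legendre x p ≡ g x
  legendre≡g x = trans (legendre-cong (residue x p)) (trans
    (Σ-≡⇒≡ p {λ x → legendre (+ x) p} {λ x → g (+ x)} (λ y _ → le (+ y)) (trans Σlegendre≡0 (sym Σg≡0))
      (x %ℕ p) (n%ℕd<d x p))
    (g-cong (≅-sym (residue x p))))
    where
    -1≤gauss : ∀ {ε} → Sign ε → -1ℤ ≤ ε
    -1≤gauss (inj₁ refl) = -≤+
    -1≤gauss (inj₂ refl) = ≤-refl
    le : ∀ x → legendre x p ≤ g x
    le x with legendre x p | legendreView x p
    ... | .0ℤ | zero-residue e = ≤-reflexive (sym (g-zero e))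
    ... | .1ℤ | residual x≇0 y _ e = ≤-reflexive (sym (trans (g-cong e) (trans (g-* (+ y) (+ y))
            (trans (cong (λ z → z * z) (g-gauss y≇0)) (Sign-square (gauss-Sign (+ y)))))))
      where
      y≇0 : ¬ + y ≅ 0ℤ [ p ]
      y≇0 z = x≇0 (≅-trans e (≅-trans (≅-* z (≅-refl {x = + y})) (≅-reflexive (*-zeroˡ (+ y)))))
    ... | .-1ℤ | irresidual x≇0 _ = ≤-trans (-1≤gauss (gauss-Sign x)) (≤-reflexive (sym (g-gauss x≇0)))

  legendre-* : ∀ x y → legendre (x * y) p ≡ legendre x p * legendre y p
  legendre-* x y = trans (legendre≡g (x * y)) (trans (g-* x y)
    (sym (cong₂ _*_ (legendre≡g x) (legendre≡g y))))

  legendre≡gauss : ∀ {x} → ¬ x ≅ 0ℤ [ p ] → legendre x p ≡ gauss x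
  legendre≡gauss {x} x≇0 = trans (legendre≡g x) (g-gauss x≇0)

  legendre-Sign : ∀ {x} → ¬ x ≅ 0ℤ [ p ] → Sign (legendre x p)
  legendre-Sign {x} x≇0 = subst Sign (sym (legendre≡gauss x≇0)) (gauss-Sign x)

  legendre-zero : ∀ {x} → x ≅ 0ℤ [ p ] → legendre x p ≡ 0ℤ
  legendre-zero {x} e = trans (legendre≡g x) (g-zero e)

/ℕ-exact : ∀ n .{{_ : NonZero n}} {x} k → x ≡ k * + n → x /ℕ n ≡ k
/ℕ-exact n {x} k eq = *-cancelʳ-≡ (x /ℕ n) k (+ n)  (trans
    (trans (sym (+-identityˡ _)) (cong (λ r → + r + x /ℕ n * + n) (sym r≡0)))
    (trans (sym (a≡a%ℕn+[a/ℕn]*n x n)) eq))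
  where
  r≡0 : x %ℕ n ≡ 0
  r≡0 = ≅-small (≅-trans (≅-sym (residue x n)) (cg k (trans eq (sym (+-identityˡ _)))))
    (n%ℕd<d x n) (ℕ.>-nonZero⁻¹ n)

sgz : ℤ → ℤ
sgz k = -1ℤ ^ ∣ k ∣

sgz-suc : ∀ k → sgz (1ℤ + k) ≡ - sgz k
sgz-suc (+ n)          = -1*i≡-i (-1ℤ ^ n)
sgz-suc -[1+ zero ]    = refl
sgz-suc -[1+ suc n ]   = sym (trans (cong -_ (-1*i≡-i (-1ℤ ^ suc n))) (neg-involutive (-1ℤ ^ suc n)))

sgz-even : ∀ j → sgz (+ 2 * j) ≡ 1ℤ
sgz-even j = trans (cong (_^_ -1ℤ) (abs-* (+ 2) j)) (trans (sym (^-*-assoc -1ℤ 2 ∣ j ∣)) (^-zeroˡ ∣ j ∣))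

data Parity (k : ℤ) : Set where
  even : ∀ j → k ≡ + 2 * j → Parity k
  odd  : ∀ j → k ≡ 1ℤ + + 2 * j → Parity k

parity : ∀ k → Parity k
parity k with k %ℕ 2 | a≡a%ℕn+[a/ℕn]*n k 2 | n%ℕd<d k 2
... | 0 | eq | _ = even (k /ℕ 2) (trans eq (trans (+-identityˡ _) (*-comm (k /ℕ 2) (+ 2))))
... | 1 | eq | _ = odd (k /ℕ 2) (trans eq (cong (_+_ 1ℤ) (*-comm (k /ℕ 2) (+ 2))))
... | suc (suc _) | _ | s≤s (s≤s ())

sgz-odd : ∀ j → sgz (1ℤ + + 2 * j) ≡ -1ℤ
sgz-odd j = trans (sgz-suc (+ 2 * j)) (cong -_ (sgz-even j))

sgz-+ : ∀ k l → sgz (k + l) ≡ sgz k * sgz l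
sgz-+ k l with parity k | parity l
... | even i refl | even j refl = trans (cong sgz (lemma i j)) (trans (sgz-even (i + j))
        (sym (cong₂ _*_ (sgz-even i) (sgz-even j))))
  where
  lemma : ∀ i j → + 2 * i + + 2 * j ≡ + 2 * (i + j)
  lemma = solve-∀
... | even i refl | odd j refl = trans (cong sgz (lemma i j)) (trans (sgz-odd (i + j))
        (sym (cong₂ _*_ (sgz-even i) (sgz-odd j))))
  where
  lemma : ∀ i j → + 2 * i + (+ 1 + + 2 * j) ≡ + 1 + + 2 * (i + j)
  lemma = solve-∀
... | odd i refl | even j refl = trans (cong sgz (lemma i j)) (trans (sgz-odd (i + j))
        (sym (cong₂ _*_ (sgz-odd i) (sgz-even j))))
  where
  lemma : ∀ i j → + 1 + + 2 * i + + 2 * j ≡ + 1 + + 2 * (i + j)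
  lemma = solve-∀
... | odd i refl | odd j refl = trans (cong sgz (lemma i j)) (trans (sgz-even (1ℤ + i + j))
        (sym (cong₂ _*_ (sgz-odd i) (sgz-odd j))))
  where
  lemma : ∀ i j → + 1 + + 2 * i + (+ 1 + + 2 * j) ≡ + 2 * (+ 1 + i + j)
  lemma = solve-∀

sgz-cong : ∀ {k l} → k ≅ l [ 2 ] → sgz k ≡ sgz l
sgz-cong {k} {l} (cg j refl) = trans (sgz-+ l (j * + 2)) (trans
  (cong (sgz l *_) (trans (cong sgz (*-comm j (+ 2))) (sgz-even j))) (*-identityʳ (sgz l)))

sgz-Σ : ∀ n (F : ℕ → ℤ) → Π< n (λ i → sgz (F i)) ≡ sgz (Σ< n F)
sgz-Σ zero    F = refl
sgz-Σ (suc n) F = trans (cong (_* sgz (F n)) (sgz-Σ n F)) (sym (sgz-+ (Σ< n F) (F n)))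

sgz-Sign : ∀ k → Sign (sgz k)
sgz-Sign k with parity k
... | even j refl = inj₁ (sgz-even j)
... | odd j refl  = inj₂ (sgz-odd j)

χ₄-odd : ∀ k → χ₄ (1ℤ + + 2 * k) ≡ sgz k
χ₄-odd k = cong sgz (/ℕ-exact 2 k (lemma k))
  where
  lemma : ∀ k → + 1 + + 2 * k - + 1 ≡ k * + 2
  lemma = solve-∀

χ₈-odd : ∀ {x} u → x * x ≡ 1ℤ + + 8 * u → χ₈ x ≡ sgz u
χ₈-odd {x} u eq = cong sgz (/ℕ-exact 8 u (trans (cong (_- 1ℤ) eq) (lemma u)))
  where
  lemma : ∀ u → + 1 + + 8 * u - + 1 ≡ u * + 8
  lemma = solve-∀

+suc-double : ∀ h → + suc (h ℕ.+ h) ≡ 1ℤ + + 2 * + h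
+suc-double h = cong (_+_ 1ℤ) (trans (pos-+ h h) (lemma (+ h)))
  where
  lemma : ∀ h → h + h ≡ + 2 * h
  lemma = solve-∀

cancel-mod-2 : ∀ s b f → s ≅ s + b + f [ 2 ] → b ≅ f [ 2 ]
cancel-mod-2 s b f (cg k eq) = cg (- k - f)
  (+-cancelˡ (s + f + k * + 2) (trans (l₁ s b f k) (trans (sym eq) (l₂ s f k))))
  where
  l₁ : ∀ s b f k → s + f + k * + 2 + b ≡ s + b + f + k * + 2
  l₁ = solve-∀
  l₂ : ∀ s f k → s ≡ s + f + k * + 2 + (f + (- k - f) * + 2)
  l₂ = solve-∀

module Supplements (h : ℕ) (pr : Prime (suc (h ℕ.+ h))) where
  open OddPrime h pr

  legendre-neg1 : legendre -1ℤ p ≡ χ₄ (+ p)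
  legendre-neg1 = trans (legendre≡gauss -1≇0) (trans
    (Sign-≅ (gauss-Sign -1ℤ) (sgz-Sign (+ h)) (≅-sym (gauss-lemma -1ℤ -1≇0)))
    (sym (trans (cong χ₄ (+suc-double h)) (χ₄-odd (+ h)))))
    where
    -1≇0 : ¬ -1ℤ ≅ 0ℤ [ p ]
    -1≇0 e = 1≇0 (≅-neg e)

  private
    halfSign-small : ∀ r → r ℕ.≤ h → halfSign (+ r) ≡ 1ℤ
    halfSign-small r r≤h with + r %ℕ p ℕ.≤? h
    ... | yes _  = refl
    ... | no r≰h = ⊥-elim (r≰h (subst (ℕ._≤ h) (sym (residue-small (s≤s (ℕ.≤-trans r≤h (ℕ.m≤m+n h h))))) r≤h))

    halfSign-large : ∀ r → h ℕ.< r → r ℕ.< p → halfSign (+ r) ≡ -1ℤ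
    halfSign-large r h<r r<p with + r %ℕ p ℕ.≤? h
    ... | yes r≤h = ⊥-elim (ℕ.<⇒≱ h<r (subst (ℕ._≤ h) (residue-small r<p) r≤h))
    ... | no _    = refl

    -- The multiples 2, 4, ..., 2i do not exceed h and count with sign +; the other j multiples lie
    -- in the upper half and count with sign -.
    gauss-2 : ∀ i j → i ℕ.+ j ≡ h → i ℕ.+ i ℕ.≤ h → h ℕ.≤ suc (i ℕ.+ i) → gauss (+ 2) ≡ sgz (+ j)
    gauss-2 i j eq 2i≤h h≤ = trans (cong (λ n → Π< n (λ k → halfSign (+ 2 * + suc k))) (sym eq))
      (trans (Π-split i j (λ k → halfSign (+ 2 * + suc k)))
      (trans (cong₂ _*_ (Π-one i low) (Π-cong j high)) (trans (*-identityˡ _) (Π-const j -1ℤ))))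
      where
      two* : ∀ k → + 2 * + suc k ≡ + (suc k ℕ.+ suc k)
      two* k = trans (lemma (+ suc k)) (sym (pos-+ (suc k) (suc k)))
        where
        lemma : ∀ x → + 2 * x ≡ x + x
        lemma = solve-∀
      low : ∀ k → k ℕ.< i → halfSign (+ 2 * + suc k) ≡ 1ℤ
      low k k<i = trans (cong halfSign (two* k)) (halfSign-small _ (ℕ.≤-trans (ℕ.+-mono-≤ k<i k<i) 2i≤h))
      high : ∀ k → k ℕ.< j → halfSign (+ 2 * + suc (i ℕ.+ k)) ≡ -1ℤ
      high k k<j = trans (cong halfSign (two* (i ℕ.+ k))) (halfSign-large _
        (ℕ.≤-trans (s≤s h≤) (s≤s (ℕ.≤-trans (s≤s (ℕ.+-mono-≤ (ℕ.m≤m+n i k) (ℕ.m≤m+n i k)))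
          (ℕ.≤-reflexive (sym (ℕ.+-suc (i ℕ.+ k) (i ℕ.+ k)))))))
        (s≤s (ℕ.+-mono-≤ i+k<h i+k<h)))
        where
        i+k<h : suc (i ℕ.+ k) ℕ.≤ h
        i+k<h = ℕ.≤-trans (ℕ.≤-reflexive (sym (ℕ.+-suc i k))) (ℕ.≤-trans (ℕ.+-monoʳ-≤ i k<j) (ℕ.≤-reflexive eq))

  legendre-2 : legendre (+ 2) p ≡ χ₈ (+ p)
  legendre-2 = trans (legendre≡gauss 2≇0) (by-parity (h ℕ.% 2) (ℕ.m≡m%n+[m/n]*n h 2) (ℕ.m%n<n h 2))
    where
    i = h ℕ./ 2
    double : ∀ i → i ℕ.* 2 ≡ i ℕ.+ i
    double = ℕSolver.solve-∀
    by-parity : ∀ r → h ≡ r ℕ.+ i ℕ.* 2 → r ℕ.< 2 → gauss (+ 2) ≡ χ₈ (+ p)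
    by-parity 0 eq _ = trans (gauss-2 i i (trans (sym (double i)) (sym eq))
        (ℕ.≤-reflexive (trans (sym (double i)) (sym eq))) (ℕ.≤-trans (ℕ.≤-reflexive (trans eq (double i))) (ℕ.n≤1+n _)))
      (trans (sgz-cong {+ i} {+ i * (+ 2 * + i + 1ℤ)} (cg (- (+ i * + i)) (l₁ (+ i))))
        (sym (χ₈-odd {+ p} (+ i * (+ 2 * + i + 1ℤ)) (trans (cong (λ x → x * x) p≡) (l₂ (+ i))))))
      where
      p≡ : + p ≡ 1ℤ + + 4 * + i
      p≡ = trans (+suc-double h) (trans (cong (λ z → 1ℤ + + 2 * + z) eq) (trans (cong (λ z → 1ℤ + + 2 * z) (pos-* i 2)) (l₃ (+ i))))
        where
        l₃ : ∀ i → + 1 + + 2 * (i * + 2) ≡ + 1 + + 4 * i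
        l₃ = solve-∀
      l₁ : ∀ i → i ≡ i * (+ 2 * i + + 1) + - (i * i) * + 2
      l₁ = solve-∀
      l₂ : ∀ i → (+ 1 + + 4 * i) * (+ 1 + + 4 * i) ≡ + 1 + + 8 * (i * (+ 2 * i + + 1))
      l₂ = solve-∀
    by-parity 1 eq _ = trans (gauss-2 i (suc i) (trans (ℕ.+-suc i i) (trans (cong suc (sym (double i))) (sym eq)))
        (ℕ.≤-trans (ℕ.n≤1+n _) (ℕ.≤-reflexive (trans (cong suc (sym (double i))) (sym eq))))
        (ℕ.≤-reflexive (trans eq (cong suc (double i)))))
      (trans (sgz-cong {+ suc i} {(1ℤ + + i) * (+ 2 * + i + 1ℤ)} (cg (- ((1ℤ + + i) * + i)) (l₁ (+ i))))
        (sym (χ₈-odd {+ p} ((1ℤ + + i) * (+ 2 * + i + 1ℤ)) (trans (cong (λ x → x * x) p≡) (l₂ (+ i))))))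
      where
      p≡ : + p ≡ + 3 + + 4 * + i
      p≡ = trans (+suc-double h) (trans (cong (λ z → 1ℤ + + 2 * + z) eq) (trans (cong (λ z → 1ℤ + + 2 * (1ℤ + z)) (pos-* i 2)) (l₃ (+ i))))
        where
        l₃ : ∀ i → + 1 + + 2 * (+ 1 + i * + 2) ≡ + 3 + + 4 * i
        l₃ = solve-∀
      l₁ : ∀ i → + 1 + i ≡ (+ 1 + i) * (+ 2 * i + + 1) + - ((+ 1 + i) * i) * + 2
      l₁ = solve-∀
      l₂ : ∀ i → (+ 3 + + 4 * i) * (+ 3 + + 4 * i) ≡ + 1 + + 8 * ((+ 1 + i) * (+ 2 * i + + 1))
      l₂ = solve-∀
    by-parity (suc (suc _)) _ (s≤s (s≤s ()))

  halfBit : ℤ → ℤ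
  halfBit x with x %ℕ p ℕ.≤? h
  ... | yes _ = 0ℤ
  ... | no  _ = 1ℤ

  halfSign≡sgz : ∀ x → halfSign x ≡ sgz (halfBit x)
  halfSign≡sgz x with x %ℕ p ℕ.≤? h
  ... | yes _ = refl
  ... | no  _ = refl

  p≅1 : + p ≅ 1ℤ [ 2 ]
  p≅1 = cg (+ h) (trans (+suc-double h) (cong (_+_ 1ℤ) (*-comm (+ 2) (+ h))))

  residue-parity : ∀ x → ¬ x ≅ 0ℤ [ p ] → + (x %ℕ p) ≅ + suc (halfIndex x) + halfBit x [ 2 ]
  residue-parity x x≇0 with x %ℕ p ℕ.≤? h
  ... | yes r≤h = ≅-reflexive (sym (trans (+-identityʳ _) (cong +_ (ℕ.suc-pred (x %ℕ p)
          {{ℕ.≢-nonZero λ r≡0 → x≇0 (≅-trans (residue x p) (≅-reflexive (cong +_ r≡0)))}}))))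
  ... | no r≰h = ≅-trans (≅-reflexive (trans (lemma (+ s) (+ r)) (cong (λ z → + z - + s) (ℕ.m∸n+n≡m (ℕ.<⇒≤ r<p)))))
      (≅-trans (≅-- p≅1 (≅-refl {x = + s})) (≅-trans (cg (- + s) (lemma₂ (+ s)))
        (≅-reflexive (cong (λ z → + z + 1ℤ) (sym (ℕ.suc-pred s {{ℕ.>-nonZero (ℕ.m<n⇒0<n∸m r<p)}}))))))
    where
    r = x %ℕ p
    s = p ℕ.∸ r
    r<p : r ℕ.< p
    r<p = n%ℕd<d x p
    lemma : ∀ s r → r ≡ s + r - s
    lemma = solve-∀
    lemma₂ : ∀ s → + 1 - s ≡ s + + 1 + - s * + 2
    lemma₂ = solve-∀

  floorSum : ℕ → ℤ
  floorSum a = Σ< h λ k → (+ a * + suc k) /ℕ p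

  -- Eisenstein's argument: for odd a and p, division of a k by p reads k ≡ r + floor modulo 2, and
  -- the residue r is the index up to the bit that marks the upper half. Summed over k, the indices
  -- are a permutation of 1, ..., h and cancel against the k.
  gauss-eisenstein : ∀ a → ¬ + a ≅ 0ℤ [ p ] → + a ≅ 1ℤ [ 2 ] → gauss (+ a) ≡ sgz (floorSum a)
  gauss-eisenstein a a≇0 a≅1 = trans (Π-cong h λ k _ → halfSign≡sgz (+ a * + suc k))
    (trans (sgz-Σ h bit) (sgz-cong {Σ< h bit} {Σ< h floor} bits≅floors))
    where
    bit index floor : ℕ → ℤ
    bit k   = halfBit (+ a * + suc k)
    index k = + suc (halfIndex (+ a * + suc k))
    floor k = (+ a * + suc k) /ℕ p
    pointwise : ∀ k → k ℕ.< h → + suc k ≅ index k + bit k + floor k [ 2 ]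
    pointwise k k<h = ≅-trans (≅-sym (≅-trans (≅-* a≅1 (≅-refl {x = + suc k})) (≅-reflexive (*-identityˡ _))))
      (≅-trans (≅-reflexive (a≡a%ℕn+[a/ℕn]*n (+ a * + suc k) p))
        (≅-+ (residue-parity (+ a * + suc k) (multiple≇0 (+ a) a≇0 k k<h))
          (≅-trans (≅-* (≅-refl {x = floor k}) p≅1) (≅-reflexive (*-identityʳ (floor k))))))
    indices : Σ< h index ≡ Σ< h (λ k → + suc k)
    indices = Σ-reindex h h (λ k → halfIndex (+ a * + suc k)) (λ k → + suc k)
      (λ k k<h → proj₁ (half-spec (+ a * + suc k) (multiple≇0 (+ a) a≇0 k k<h)))
      (halfIndex-onto (+ a) a≇0) (halfIndex-injective (+ a) a≇0)
    total : Σ< h (λ k → + suc k) ≅ Σ< h (λ k → + suc k) + Σ< h bit + Σ< h floor [ 2 ]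
    total = ≅-trans (Σ-≅ h pointwise) (≅-reflexive (trans (Σ-+ h (λ k → index k + bit k) floor)
      (cong (_+ Σ< h floor) (trans (Σ-+ h index bit) (cong (_+ Σ< h bit) indices)))))
    bits≅floors : Σ< h bit ≅ Σ< h floor [ 2 ]
    bits≅floors = cancel-mod-2 (Σ< h (λ k → + suc k)) (Σ< h bit) (Σ< h floor) total

Σ-below : ∀ m c → c ℕ.≤ m → Σ< m (λ l → 𝟙 (l ℕ.<? c)) ≡ + c
Σ-below m c c≤m = trans (cong (λ k → Σ< k (λ l → 𝟙 (l ℕ.<? c))) (sym (ℕ.m+[n∸m]≡n c≤m)))
  (trans (Σ-split c (m ℕ.∸ c) (λ l → 𝟙 (l ℕ.<? c)))
  (trans (cong₂ _+_ (trans (Σ-cong c λ l l<c → 𝟙-yes (l ℕ.<? c) l<c) (Σ-const c 1ℤ))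
                    (Σ-zero (m ℕ.∸ c) λ l _ → 𝟙-no (c ℕ.+ l ℕ.<? c) (ℕ.≤⇒≯ (ℕ.m≤m+n c l))))
    (trans (+-identityʳ _) (*-identityʳ (+ c)))))

floor-count : ∀ p .{{_ : NonZero p}} m n → n ℕ.< suc m ℕ.* p →
              Σ< m (λ l → 𝟙 (p ℕ.* suc l ℕ.≤? n)) ≡ + (n ℕ./ p)
floor-count p m n n< = trans (Σ-cong′ m λ l → 𝟙-cong (p ℕ.* suc l ℕ.≤? n) (l ℕ.<? n ℕ./ p) (to l) (from l))
  (Σ-below m (n ℕ./ p) (ℕ.s≤s⁻¹ (ℕ.m<n*o⇒m/o<n n<)))
  where
  to : ∀ l → p ℕ.* suc l ℕ.≤ n → l ℕ.< n ℕ./ p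
  to l le = ℕ.≤-trans (ℕ.≤-reflexive (sym (trans (cong (ℕ._/ p) (ℕ.*-comm p (suc l))) (ℕ.m*n/n≡m (suc l) p)))) (ℕ./-monoˡ-≤ p le)
  from : ∀ l → l ℕ.< n ℕ./ p → p ℕ.* suc l ℕ.≤ n
  from l lt = ℕ.≤-trans (ℕ.*-monoʳ-≤ p lt) (ℕ.≤-trans (ℕ.≤-reflexive (ℕ.*-comm p _)) (ℕ.m/n*n≤m n p))

module Reciprocity (h k : ℕ) (pr : Prime (suc (h ℕ.+ h))) (qr : Prime (suc (k ℕ.+ k)))
  (h≢k : h ≢ k) where

  private
    p = suc (h ℕ.+ h)
    q = suc (k ℕ.+ k)

    p≢q : p ≢ q
    p≢q eq = h≢k (half-injective h k (ℕ.suc-injective eq))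
      where
      half-injective : ∀ m n → m ℕ.+ m ≡ n ℕ.+ n → m ≡ n
      half-injective m n eq = ℕ.*-cancelʳ-≡ m n 2 (trans (l m) (trans eq (sym (l n))))
        where
        l : ∀ m → m ℕ.* 2 ≡ m ℕ.+ m
        l = ℕSolver.solve-∀

    ∤ : ∀ {a b} → Prime a → Prime b → a ≢ b → ¬ + b ≅ 0ℤ [ a ]
    ∤ {a} {b} pa pb a≢b e with prime⇒irreducible pb (≅0⇒∣ e)
    ... | inj₁ refl = ¬prime[1] pa
    ... | inj₂ eq = a≢b eq

    module P = OddPrime h pr
    module Q = OddPrime k qr
    module SP = Supplements h pr
    module SQ = Supplements k qr

  private
    -- Keeps the floor of q (i + 1) / p at most k, so that a count over j < k captures it.
    bound : ∀ h k i → i ℕ.< h → suc (k ℕ.+ k) ℕ.* suc i ℕ.< suc k ℕ.* suc (h ℕ.+ h)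
    bound h k i i<h = s≤s (ℕ.≤-trans (ℕ.≤-trans (ℕ.*-monoʳ-≤ (suc (k ℕ.+ k)) i<h)
        (ℕ.m≤m+n _ (h ℕ.+ k))) (ℕ.≤-reflexive (l h k)))
      where
      l : ∀ h k → suc (k ℕ.+ k) ℕ.* h ℕ.+ (h ℕ.+ k) ≡ h ℕ.+ h ℕ.+ k ℕ.* suc (h ℕ.+ h)
      l = ℕSolver.solve-∀

    floors : ∀ h k → let p = suc (h ℕ.+ h) ; q = suc (k ℕ.+ k) in
      Σ< h (λ i → (+ q * + suc i) /ℕ p) ≡ Σ< h (λ i → Σ< k (λ j → 𝟙 (p ℕ.* suc j ℕ.≤? q ℕ.* suc i)))
    floors h k = Σ-cong h λ i i<h → trans (cong (_/ℕ suc (h ℕ.+ h)) (sym (pos-* (suc (k ℕ.+ k)) (suc i))))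
      (sym (floor-count (suc (h ℕ.+ h)) k (suc (k ℕ.+ k) ℕ.* suc i) (bound h k i i<h)))

    -- Each lattice point of the rectangle lies on exactly one side of the diagonal.

    rectangle : SP.floorSum q + SQ.floorSum p ≡ + h * + k
    rectangle = begin
      SP.floorSum q + SQ.floorSum p
        ≡⟨ cong₂ _+_ (floors h k) (trans (floors k h) (Σ-swap k h _)) ⟩
      Σ< h (λ i → Σ< k (A i)) + Σ< h (λ i → Σ< k (B i))
        ≡⟨ sym (trans (Σ-cong′ h (λ i → Σ-+ k (A i) (B i))) (Σ-+ h (λ i → Σ< k (A i)) (λ i → Σ< k (B i)))) ⟩
      Σ< h (λ i → Σ< k (λ j → A i j + B i j))
        ≡⟨ Σ-cong h (λ i i<h → trans (Σ-cong k λ j _ → exactly i j i<h) (Σ-const k 1ℤ)) ⟩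
      Σ< h (λ _ → + k * 1ℤ)
        ≡⟨ trans (Σ-const h (+ k * 1ℤ)) (cong (_*_ (+ h)) (*-identityʳ (+ k))) ⟩
      + h * + k ∎
      where
      open ≡-Reasoning
      A B : ℕ → ℕ → ℤ
      A i j = 𝟙 (p ℕ.* suc j ℕ.≤? q ℕ.* suc i)
      B i j = 𝟙 (q ℕ.* suc i ℕ.≤? p ℕ.* suc j)
      exactly : ∀ i j → i ℕ.< h → A i j + B i j ≡ 1ℤ
      exactly i j i<h with ℕ.<-cmp (p ℕ.* suc j) (q ℕ.* suc i)
      ... | tri< lt _ _ = cong₂ _+_ (𝟙-yes (p ℕ.* suc j ℕ.≤? q ℕ.* suc i) (ℕ.<⇒≤ lt))
              (𝟙-no (q ℕ.* suc i ℕ.≤? p ℕ.* suc j) (ℕ.<⇒≱ lt))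
      ... | tri> _ _ gt = cong₂ _+_ (𝟙-no (p ℕ.* suc j ℕ.≤? q ℕ.* suc i) (ℕ.<⇒≱ gt))
              (𝟙-yes (q ℕ.* suc i ℕ.≤? p ℕ.* suc j) (ℕ.<⇒≤ gt))
      ... | tri≈ _ eq _ = ⊥-elim (P.multiple≇0 (+ q) (∤ pr qr p≢q) i i<h
              (∣⇒≅0 (subst (p ∣_) (sym (trans (cong ∣_∣ (sym (pos-* q (suc i)))) (sym eq))) (ℕ∣.m∣m*n (suc j)))))

  reciprocity : legendre (+ q) p * legendre (+ p) q ≡ sgz (+ h * + k)
  reciprocity = trans (cong₂ _*_
      (trans (P.legendre≡gauss (∤ pr qr p≢q)) (SP.gauss-eisenstein q (∤ pr qr p≢q) SQ.p≅1))
      (trans (Q.legendre≡gauss (∤ qr pr (p≢q ∘ sym))) (SQ.gauss-eisenstein p (∤ qr pr (p≢q ∘ sym)) SP.p≅1)))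
    (trans (sym (sgz-+ (SP.floorSum q) (SQ.floorSum p))) (cong sgz rectangle))

-- Jacobi symbols and the characters modulo 4 and 8

OddNat : ℕ → Set
OddNat q = ∃[ h ] q ≡ suc (h ℕ.+ h)

odd⇒OddNat : ∀ q → + q ≅ 1ℤ [ 2 ] → OddNat q
odd⇒OddNat zero    e with ≅-small {i = 0} {j = 1} e (s≤s z≤n) (s≤s (s≤s z≤n))
... | ()
odd⇒OddNat (suc zero) e = 0 , refl
odd⇒OddNat (suc (suc q)) e with odd⇒OddNat q (≅-trans (cg -1ℤ (lemma (+ q))) e)
  where
  lemma : ∀ q → q ≡ + 2 + q + - + 1 * + 2
  lemma = solve-∀
... | h , refl = suc h , cong suc (sym (cong suc (ℕ.+-suc h h)))

J : ℤ → List ℕ → ℤ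
J x qs = foldr _*_ 1ℤ (map (legendre x) qs)

jacobi≡J : ∀ x n .{{_ : NonZero n}} → jacobi x n ≡ J x (factors (factorise n))
jacobi≡J x (suc n) = refl

-- Carries the half h along, so that matching on it brings q into the shape 2h + 1 on which
-- `OddPrime` is built.
OddPrime′ : ℕ → Set
OddPrime′ q = Prime q × OddNat q

J-* : ∀ x y {qs} → All OddPrime′ qs → J (x * y) qs ≡ J x qs * J y qs
J-* x y [] = refl
J-* x y {q ∷ qs} ((pr , h , refl) ∷ rest) =
  trans (cong₂ _*_ (OddPrime.legendre-* h pr x y) (J-* x y rest))
    (lemma (legendre x q) (legendre y q) (J x qs) (J y qs))
  where
  lemma : ∀ a b c d → a * b * (c * d) ≡ a * c * (b * d)
  lemma = solve-∀

J-cong : ∀ {x y qs} → All OddPrime′ qs → All (λ q → x ≅ y [ q ]) qs → J x qs ≡ J y qs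
J-cong [] [] = refl
J-cong ((pr , h , refl) ∷ rest) (e ∷ es) = cong₂ _*_ (OddPrime.legendre-cong h pr e) (J-cong rest es)

J-Sign : ∀ {x qs} → All OddPrime′ qs → All (λ q → ¬ x ≅ 0ℤ [ q ]) qs → Sign (J x qs)
J-Sign [] [] = inj₁ refl
J-Sign ((pr , h , refl) ∷ rest) (e ∷ es) = Sign-* (OddPrime.legendre-Sign h pr e) (J-Sign rest es)

χ₄-* : ∀ j k → χ₄ ((1ℤ + + 2 * j) * (1ℤ + + 2 * k)) ≡ χ₄ (1ℤ + + 2 * j) * χ₄ (1ℤ + + 2 * k)
χ₄-* j k = begin
  χ₄ ((1ℤ + + 2 * j) * (1ℤ + + 2 * k))      ≡⟨ cong χ₄ (lemma j k) ⟩
  χ₄ (1ℤ + + 2 * (j + k + + 2 * (j * k)))   ≡⟨ χ₄-odd (j + k + + 2 * (j * k)) ⟩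
  sgz (j + k + + 2 * (j * k))               ≡⟨ sgz-cong {j + k + + 2 * (j * k)} {j + k} (cg (j * k) (lemma₂ j k)) ⟩
  sgz (j + k)                               ≡⟨ sgz-+ j k ⟩
  sgz j * sgz k                             ≡⟨ sym (cong₂ _*_ (χ₄-odd j) (χ₄-odd k)) ⟩
  χ₄ (1ℤ + + 2 * j) * χ₄ (1ℤ + + 2 * k)     ∎
  where
  open ≡-Reasoning
  lemma : ∀ j k → (+ 1 + + 2 * j) * (+ 1 + + 2 * k) ≡ + 1 + + 2 * (j + k + + 2 * (j * k))
  lemma = solve-∀
  lemma₂ : ∀ j k → j + k + + 2 * (j * k) ≡ j + k + j * k * + 2
  lemma₂ = solve-∀

triangular : ∀ j → ∃[ u ] j * (j + 1ℤ) ≡ + 2 * u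
triangular j with parity j
... | even i refl = i * (+ 2 * i + 1ℤ) , *-assoc (+ 2) i _
... | odd i refl  = (1ℤ + + 2 * i) * (i + 1ℤ) , lemma i
  where
  lemma : ∀ i → (+ 1 + + 2 * i) * (+ 1 + + 2 * i + + 1) ≡ + 2 * ((+ 1 + + 2 * i) * (i + + 1))
  lemma = solve-∀

odd-square : ∀ j → ∃[ u ] (1ℤ + + 2 * j) * (1ℤ + + 2 * j) ≡ 1ℤ + + 8 * u
odd-square j = proj₁ (triangular j) , trans (lemma j) (trans
  (cong (λ z → 1ℤ + + 4 * z) (proj₂ (triangular j))) (lemma₂ (proj₁ (triangular j))))
  where
  lemma : ∀ j → (+ 1 + + 2 * j) * (+ 1 + + 2 * j) ≡ + 1 + + 4 * (j * (j + + 1))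
  lemma = solve-∀
  lemma₂ : ∀ u → + 1 + + 4 * (+ 2 * u) ≡ + 1 + + 8 * u
  lemma₂ = solve-∀

χ₈-* : ∀ j k → χ₈ ((1ℤ + + 2 * j) * (1ℤ + + 2 * k)) ≡ χ₈ (1ℤ + + 2 * j) * χ₈ (1ℤ + + 2 * k)
χ₈-* j k = begin
  χ₈ (x * y)      ≡⟨ χ₈-odd {x * y} (u + v + + 8 * (u * v)) square ⟩
  sgz (u + v + + 8 * (u * v))
                  ≡⟨ sgz-cong {u + v + + 8 * (u * v)} {u + v} (cg (+ 4 * (u * v)) (lemma₂ u v)) ⟩
  sgz (u + v)     ≡⟨ sgz-+ u v ⟩
  sgz u * sgz v   ≡⟨ sym (cong₂ _*_ (χ₈-odd {x} u (proj₂ (odd-square j))) (χ₈-odd {y} v (proj₂ (odd-square k)))) ⟩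
  χ₈ x * χ₈ y     ∎
  where
  open ≡-Reasoning
  x = 1ℤ + + 2 * j
  y = 1ℤ + + 2 * k
  u = proj₁ (odd-square j)
  v = proj₁ (odd-square k)
  lemma₀ : ∀ x y → x * y * (x * y) ≡ x * x * (y * y)
  lemma₀ = solve-∀
  lemma₁ : ∀ u v → (+ 1 + + 8 * u) * (+ 1 + + 8 * v) ≡ + 1 + + 8 * (u + v + + 8 * (u * v))
  lemma₁ = solve-∀
  lemma₂ : ∀ u v → u + v + + 8 * (u * v) ≡ u + v + + 4 * (u * v) * + 2
  lemma₂ = solve-∀
  square : x * y * (x * y) ≡ 1ℤ + + 8 * (u + v + + 8 * (u * v))
  square = trans (lemma₀ x y) (trans (cong₂ _*_ (proj₂ (odd-square j)) (proj₂ (odd-square k))) (lemma₁ u v))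

χ₄-cong : ∀ j {y} → 1ℤ + + 2 * j ≅ y [ 4 ] → χ₄ (1ℤ + + 2 * j) ≡ χ₄ y
χ₄-cong j {y} e with ≅-sym e
... | cg l refl = trans (χ₄-odd j) (sym (trans (cong χ₄ (lemma j l)) (trans (χ₄-odd (j + + 2 * l))
        (sgz-cong {j + + 2 * l} {j} (cg l (cong (_+_ j) (*-comm (+ 2) l)))))))
  where
  lemma : ∀ j l → + 1 + + 2 * j + l * + 4 ≡ + 1 + + 2 * (j + + 2 * l)
  lemma = solve-∀

χ₈-cong : ∀ j {y} → 1ℤ + + 2 * j ≅ y [ 8 ] → χ₈ (1ℤ + + 2 * j) ≡ χ₈ y
χ₈-cong j {y} e with ≅-sym e
... | cg l refl = trans (χ₈-odd {x} u (proj₂ (odd-square j)))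
        (sym (trans (χ₈-odd {x + l * + 8} (u + + 2 * (x * l + + 4 * (l * l)))
          (trans (lemma x l) (trans (cong (λ z → z + + 8 * (+ 2 * (x * l + + 4 * (l * l)))) (proj₂ (odd-square j)))
            (lemma₂ u (+ 2 * (x * l + + 4 * (l * l)))))))
        (sgz-cong {u + + 2 * (x * l + + 4 * (l * l))} {u} (cg (x * l + + 4 * (l * l)) (cong (_+_ u) (*-comm (+ 2) (x * l + + 4 * (l * l))))))))
  where
  x = 1ℤ + + 2 * j
  u = proj₁ (odd-square j)
  lemma : ∀ x l → (x + l * + 8) * (x + l * + 8) ≡ x * x + + 8 * (+ 2 * (x * l + + 4 * (l * l)))
  lemma = solve-∀
  lemma₂ : ∀ u w → + 1 + + 8 * u + + 8 * w ≡ + 1 + + 8 * (u + w)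
  lemma₂ = solve-∀

χ₄-Sign : ∀ j → Sign (χ₄ (1ℤ + + 2 * j))
χ₄-Sign j = subst Sign (sym (χ₄-odd j)) (sgz-Sign j)

χ₈-Sign : ∀ j → Sign (χ₈ (1ℤ + + 2 * j))
χ₈-Sign j = subst Sign (sym (χ₈-odd {1ℤ + + 2 * j} (proj₁ (odd-square j)) (proj₂ (odd-square j)))) (sgz-Sign (proj₁ (odd-square j)))

product-odd : ∀ {qs} → All OddPrime′ qs → ∃[ k ] + product qs ≡ 1ℤ + + 2 * k
product-odd [] = 0ℤ , refl
product-odd {q ∷ qs} ((pr , h , refl) ∷ rest) with product-odd rest
... | k , eq = + h + k + + 2 * (+ h * k) ,
      trans (pos-* q (product qs)) (trans (cong₂ _*_ (+suc-double h) eq) (lemma (+ h) k))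
  where
  lemma : ∀ j k → (+ 1 + + 2 * j) * (+ 1 + + 2 * k) ≡ + 1 + + 2 * (j + k + + 2 * (j * k))
  lemma = solve-∀

χ₄-product : ∀ q {qs} → OddPrime′ q → All OddPrime′ qs → χ₄ (+ (q ℕ.* product qs)) ≡ χ₄ (+ q) * χ₄ (+ product qs)
χ₄-product q {qs} (pr , h , refl) rest = trans (cong χ₄ (pos-* q (product qs)))
  (subst₂ (λ a b → χ₄ (a * b) ≡ χ₄ a * χ₄ b) (sym (+suc-double h)) (sym (proj₂ (product-odd rest)))
    (χ₄-* (+ h) (proj₁ (product-odd rest))))

χ₈-product : ∀ q {qs} → OddPrime′ q → All OddPrime′ qs → χ₈ (+ (q ℕ.* product qs)) ≡ χ₈ (+ q) * χ₈ (+ product qs)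
χ₈-product q {qs} (pr , h , refl) rest = trans (cong χ₈ (pos-* q (product qs)))
  (subst₂ (λ a b → χ₈ (a * b) ≡ χ₈ a * χ₈ b) (sym (+suc-double h)) (sym (proj₂ (product-odd rest)))
    (χ₈-* (+ h) (proj₁ (product-odd rest))))

J-neg1 : ∀ {qs} → All OddPrime′ qs → J -1ℤ qs ≡ χ₄ (+ product qs)
J-neg1 [] = refl
J-neg1 {q ∷ qs} (oq@(pr , h , refl) ∷ rest) =
  trans (cong₂ _*_ (Supplements.legendre-neg1 h pr) (J-neg1 rest)) (sym (χ₄-product q oq rest))

J-2 : ∀ {qs} → All OddPrime′ qs → J (+ 2) qs ≡ χ₈ (+ product qs)
J-2 [] = refl
J-2 {q ∷ qs} (oq@(pr , h , refl) ∷ rest) =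
  trans (cong₂ _*_ (Supplements.legendre-2 h pr) (J-2 rest)) (sym (χ₈-product q oq rest))

module _ (h : ℕ) (pr : Prime (suc (h ℕ.+ h))) where
  open OddPrime h pr

  legendre-one : legendre 1ℤ p ≡ 1ℤ
  legendre-one = trans (legendre≡gauss 1≇0) (Sign-≅ (gauss-Sign 1ℤ) (inj₁ refl)
    (≅-trans (≅-sym (gauss-lemma 1ℤ 1≇0)) (≅-reflexive (^-zeroˡ h))))

  -- Reciprocity in the form (p / q) = (q* / p) with q* = χ₄(q) q. As q* is multiplicative in q,
  -- this passes to products of primes in `J-flip`.
  legendre-flip : ∀ k (qr : Prime (suc (k ℕ.+ k))) → h ≢ k → ¬ + suc (k ℕ.+ k) ≅ 0ℤ [ p ] →
    legendre (+ p) (suc (k ℕ.+ k)) ≡ legendre (χ₄ (+ suc (k ℕ.+ k)) * + suc (k ℕ.+ k)) p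
  legendre-flip k qr h≢k q≇0 = sym (begin
    legendre (χ₄ (+ q) * + q) p           ≡⟨ legendre-* (χ₄ (+ q)) (+ q) ⟩
    legendre (χ₄ (+ q)) p * legendre (+ q) p
      ≡⟨ cong (_* legendre (+ q) p) (trans (cong (λ z → legendre z p) χ₄q) (leg-sgz (+ k))) ⟩
    sgz (+ h * + k) * legendre (+ q) p
      ≡⟨ cong (_* legendre (+ q) p) (sym (Reciprocity.reciprocity h k pr qr h≢k)) ⟩
    legendre (+ q) p * legendre (+ p) q * legendre (+ q) p
      ≡⟨ lemma (legendre (+ q) p) (legendre (+ p) q) ⟩
    legendre (+ q) p * legendre (+ q) p * legendre (+ p) q
      ≡⟨ cong (_* legendre (+ p) q) (Sign-square (legendre-Sign q≇0)) ⟩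
    1ℤ * legendre (+ p) q                 ≡⟨ *-identityˡ _ ⟩
    legendre (+ p) q                      ∎)
    where
    open ≡-Reasoning
    q = suc (k ℕ.+ k)
    lemma : ∀ a b → a * b * a ≡ a * a * b
    lemma = solve-∀
    χ₄q : χ₄ (+ q) ≡ sgz (+ k)
    χ₄q = trans (cong χ₄ (+suc-double k)) (χ₄-odd (+ k))
    leg-sgz : ∀ k → legendre (sgz k) p ≡ sgz (+ h * k)
    leg-sgz k with parity k
    ... | even j refl = trans (cong (λ z → legendre z p) (sgz-even j)) (trans legendre-one
            (sym (trans (cong sgz (l (+ h) j)) (sgz-even (+ h * j)))))
      where
      l : ∀ h j → h * (+ 2 * j) ≡ + 2 * (h * j)
      l = solve-∀
    ... | odd j refl = trans (cong (λ z → legendre z p) (sgz-odd j)) (trans (Supplements.legendre-neg1 h pr)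
            (trans (trans (cong χ₄ (+suc-double h)) (χ₄-odd (+ h)))
              (sgz-cong {+ h} {+ h * (1ℤ + + 2 * j)} (cg (- (+ h * j)) (l (+ h) j)))))
      where
      l : ∀ h j → h ≡ h * (+ 1 + + 2 * j) + - (h * j) * + 2
      l = solve-∀

  J-flip : ∀ {qs} → All OddPrime′ qs → All (λ q → ¬ + q ≅ 0ℤ [ p ]) qs →
           J (+ p) qs ≡ legendre (χ₄ (+ product qs) * + product qs) p
  J-flip [] [] = sym legendre-one
  J-flip {q ∷ qs} (oq@(qr , k , refl) ∷ rest) (q≇0 ∷ ≇0s) = begin
    legendre (+ p) q * J (+ p) qs
      ≡⟨ cong₂ _*_ (legendre-flip k qr (λ { refl → q≇0 (cg 1ℤ (sym (trans (+-identityˡ _) (*-identityˡ (+ p))))) }) q≇0)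
           (J-flip rest ≇0s) ⟩
    legendre (χ₄ (+ q) * + q) p * legendre (χ₄ (+ product qs) * + product qs) p
      ≡⟨ sym (legendre-* (χ₄ (+ q) * + q) (χ₄ (+ product qs) * + product qs)) ⟩
    legendre (χ₄ (+ q) * + q * (χ₄ (+ product qs) * + product qs)) p
      ≡⟨ cong (λ z → legendre z p) (trans (lemma (χ₄ (+ q)) (+ q) (χ₄ (+ product qs)) (+ product qs))
           (cong₂ _*_ (sym (χ₄-product q oq rest)) (sym (pos-* q (product qs))))) ⟩
    legendre (χ₄ (+ (q ℕ.* product qs)) * + (q ℕ.* product qs)) p ∎
    where
    open ≡-Reasoning
    lemma : ∀ a b c d → a * b * (c * d) ≡ a * c * (b * d)
    lemma = solve-∀

-- The Kronecker character

-- The interface between the explicit formulas for `χ` and the rest of the proof. The last three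
-- fields tie the values at primes to the roots of the minimal polynomial of ω; at 2 these depend on
-- D modulo 8.
record Kronecker (D : ℤ) (X : ℤ → ℤ) : Set where
  field
    χ-*     : ∀ x y → X (x * y) ≡ X x * X y
    χ-cong  : ∀ {x y} → x ≅ y [ ∣ D ∣ ] → X x ≡ X y
    χ-Sign  : ∀ {x} → Coprime ∣ x ∣ ∣ D ∣ → Sign (X x)
    χ-zero  : ∀ {x} → ¬ Coprime ∣ x ∣ ∣ D ∣ → X x ≡ 0ℤ
    χ-neg1  : X -1ℤ ≡ -1ℤ
    χ-prime : ∀ h → Prime (suc (h ℕ.+ h)) → X (+ suc (h ℕ.+ h)) ≡ legendre D (suc (h ℕ.+ h))
    χ-two₁  : D ≅ + 1 [ 8 ] → X (+ 2) ≡ 1ℤ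
    χ-two₅  : D ≅ + 5 [ 8 ] → X (+ 2) ≡ -1ℤ

coprime-*ˡ : ∀ {x y n} → Coprime ∣ x * y ∣ n → Coprime ∣ x ∣ n
coprime-*ˡ {x} {y} c {d} (d∣x , d∣n) = c (subst (d ∣_) (sym (abs-* x y)) (ℕ∣.∣m⇒∣m*n ∣ y ∣ d∣x) , d∣n)

coprime-*ʳ : ∀ {x y n} → Coprime ∣ x * y ∣ n → Coprime ∣ y ∣ n
coprime-*ʳ {x} {y} c {d} (d∣y , d∣n) = c (subst (d ∣_) (sym (abs-* x y)) (ℕ∣.∣n⇒∣m*n ∣ x ∣ d∣y) , d∣n)

coprime-* : ∀ {x y n} → Coprime ∣ x ∣ n → Coprime ∣ y ∣ n → Coprime ∣ x * y ∣ n
coprime-* {x} {y} cx cy {d} (d∣xy , d∣n) =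
  cy (Coprime.coprime-divisor (λ (e∣d , e∣x) → cx (e∣x , ℕ∣.∣-trans e∣d d∣n)) (subst (d ∣_) (abs-* x y) d∣xy) , d∣n)

coprime-cong : ∀ {x y n} → x ≅ y [ n ] → Coprime ∣ x ∣ n → Coprime ∣ y ∣ n
coprime-cong {x} {y} {n} (cg k eq) c {d} (d∣y , d∣n) =
  c (≅0⇒∣ (≅-trans (≅-reflexive eq) (≅-trans (≅-+ (∣⇒≅0 {x = y} d∣y)
      (≅-* (≅-refl {x = k}) (∣⇒≅0 {x = + n} d∣n))) (≅-reflexive (trans (+-identityˡ _) (*-zeroʳ k))))) , d∣n)

≅-divisor : ∀ {x y q n} → q ∣ n → x ≅ y [ n ] → x ≅ y [ q ]
≅-divisor (ℕ∣.divides k refl) e = ≅-weaken k e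

¬1∣0⇒ : ∀ {q} → Prime q → q ≢ 1
¬1∣0⇒ pr refl with prime>1 pr
... | s≤s ()

-- The common shape of the four formulas for `χ`: a character ψ at 2 times the Jacobi symbol of an
-- odd Q, where D = c² ε Q* with Q* = χ₄(Q) Q and ψ(p) = (ε / p). The cases are ε = 1, -1, 2, -2
-- with ψ = 1, χ₄, χ₈, χ₄ χ₈. Reciprocity then gives X(p) = (ε / p) (Q* / p) = (D / p) uniformly.
record Datum (D : ℤ) (X : ℤ → ℤ) : Set where
  field
    qs       : List ℕ
    qs-prime : All OddPrime′ qs
    qs-∣     : All (_∣ ∣ D ∣) qs
    ψ        : ℤ → ℤ
    ε c      : ℤ
    ψ-*      : ∀ x y → Coprime ∣ x ∣ ∣ D ∣ → Coprime ∣ y ∣ ∣ D ∣ → ψ (x * y) ≡ ψ x * ψ y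
    ψ-cong   : ∀ {x y} → Coprime ∣ x ∣ ∣ D ∣ → x ≅ y [ ∣ D ∣ ] → ψ x ≡ ψ y
    ψ-Sign   : ∀ {x} → Coprime ∣ x ∣ ∣ D ∣ → Sign (ψ x)
    X-value  : ∀ {x} → Coprime ∣ x ∣ ∣ D ∣ → X x ≡ ψ x * J x qs
    X-zero   : ∀ {x} → ¬ Coprime ∣ x ∣ ∣ D ∣ → X x ≡ 0ℤ
    D-eq     : D ≡ c * c * (ε * (χ₄ (+ product qs) * + product qs))
    ε-value  : ∀ h → Prime (suc (h ℕ.+ h)) → legendre ε (suc (h ℕ.+ h)) ≡ ψ (+ suc (h ℕ.+ h))
    ψ-neg1   : ψ -1ℤ * χ₄ (+ product qs) ≡ -1ℤ
    X-two₁   : D ≅ + 1 [ 8 ] → X (+ 2) ≡ 1ℤ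
    X-two₅   : D ≅ + 5 [ 8 ] → X (+ 2) ≡ -1ℤ

module _ {D : ℤ} {X : ℤ → ℤ} (datum : Datum D X) where
  open Datum datum

  private
    N = ∣ D ∣

    units : ∀ {x} → Coprime ∣ x ∣ N → ∀ {qs} → All OddPrime′ qs → All (_∣ N) qs → All (λ q → ¬ x ≅ 0ℤ [ q ]) qs
    units c [] [] = []
    units c ((pr , _) ∷ rest) (q∣N ∷ ds) = (λ e → ¬1∣0⇒ pr (c (≅0⇒∣ e , q∣N))) ∷ units c rest ds

  datum⇒kronecker : Kronecker D X
  datum⇒kronecker = record
    { χ-* = mult ; χ-cong = λ {x} {y} → congr {x} {y} ; χ-Sign = λ {x} → sign {x}
    ; χ-zero = X-zero ; χ-neg1 = neg1 ; χ-prime = prime ; χ-two₁ = X-two₁ ; χ-two₅ = X-two₅ }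
    where
    mult : ∀ x y → X (x * y) ≡ X x * X y
    mult x y with coprime? ∣ x ∣ N | coprime? ∣ y ∣ N
    ... | no ¬cx | _ = trans (X-zero (λ (c : Coprime ∣ x * y ∣ N) → ¬cx (coprime-*ˡ {x} {y} c)))
            (sym (trans (cong (_* X y) (X-zero ¬cx)) (*-zeroˡ (X y))))
    ... | yes _ | no ¬cy = trans (X-zero (λ (c : Coprime ∣ x * y ∣ N) → ¬cy (coprime-*ʳ {x} {y} c)))
            (sym (trans (cong (X x *_) (X-zero ¬cy)) (*-zeroʳ (X x))))
    ... | yes cx | yes cy = trans (X-value (coprime-* {x} {y} cx cy))
            (trans (cong₂ _*_ (ψ-* x y cx cy) (J-* x y qs-prime))
              (trans (lemma (ψ x) (ψ y) (J x qs) (J y qs)) (sym (cong₂ _*_ (X-value cx) (X-value cy)))))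
      where
      lemma : ∀ a b c d → a * b * (c * d) ≡ a * c * (b * d)
      lemma = solve-∀
    congr : ∀ {x y} → x ≅ y [ N ] → X x ≡ X y
    congr {x} {y} e with coprime? ∣ x ∣ N
    ... | no ¬cx = trans (X-zero ¬cx) (sym (X-zero (λ (c : Coprime ∣ y ∣ N) → ¬cx (coprime-cong (≅-sym e) c))))
    ... | yes cx = trans (X-value cx) (trans (cong₂ _*_ (ψ-cong cx e)
            (J-cong qs-prime (All.map (λ q∣N → ≅-divisor q∣N e) qs-∣)))
            (sym (X-value (coprime-cong e cx))))
    sign : ∀ {x} → Coprime ∣ x ∣ N → Sign (X x)
    sign cx = subst Sign (sym (X-value cx)) (Sign-* (ψ-Sign cx) (J-Sign qs-prime (units cx qs-prime qs-∣)))
    neg1 : X -1ℤ ≡ -1ℤ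
    neg1 = trans (X-value (Coprime.1-coprimeTo N)) (trans (cong (ψ -1ℤ *_) (J-neg1 qs-prime)) ψ-neg1)
    prime : ∀ h → Prime (suc (h ℕ.+ h)) → X (+ suc (h ℕ.+ h)) ≡ legendre D (suc (h ℕ.+ h))
    prime h pr with coprime? (suc (h ℕ.+ h)) N
    ... | no ¬c = trans (X-zero ¬c) (sym (OddPrime.legendre-zero h pr {D} (∣⇒≅0 p∣N)))
      where
      p∣N : suc (h ℕ.+ h) ∣ N
      p∣N with suc (h ℕ.+ h) ℕ∣.∣? N
      ... | yes d = d
      ... | no ¬d = ⊥-elim (¬c (Coprime.sym (∤⇒coprime pr ¬d)))
    ... | yes c′ = begin
      X (+ p)                            ≡⟨ X-value c′ ⟩
      ψ (+ p) * J (+ p) qs               ≡⟨ cong₂ _*_ (sym (ε-value h pr)) (J-flip h pr qs-prime q≇0s) ⟩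
      legendre ε p * legendre Q* p       ≡⟨ sym (legendre-* ε Q*) ⟩
      legendre (ε * Q*) p                ≡⟨ sym (*-identityˡ _) ⟩
      1ℤ * legendre (ε * Q*) p           ≡⟨ cong (_* legendre (ε * Q*) p) (sym c²) ⟩
      legendre (c * c) p * legendre (ε * Q*) p ≡⟨ sym (legendre-* (c * c) (ε * Q*)) ⟩
      legendre (c * c * (ε * Q*)) p      ≡⟨ cong (λ z → legendre z p) (sym D-eq) ⟩
      legendre D p                       ∎
      where
      open ≡-Reasoning
      open OddPrime h pr
      Q* = χ₄ (+ product qs) * + product qs
      c≇0 : ¬ c ≅ 0ℤ [ p ]
      c≇0 e = ¬1∣0⇒ pr (c′ (ℕ∣.∣-refl , ≅0⇒∣ (≅-trans (≅-reflexive D-eq)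
        (≅-* (≅-* e (≅-refl {x = c})) (≅-refl {x = ε * Q*})))))
      c² : legendre (c * c) p ≡ 1ℤ
      c² = trans (legendre-* c c) (Sign-square (legendre-Sign c≇0))
      q≇0s : All (λ q → ¬ + q ≅ 0ℤ [ p ]) qs
      q≇0s = All.map (λ q∣N e → ¬1∣0⇒ pr (c′ (ℕ∣.∣-refl , ℕ∣.∣-trans (≅0⇒∣ e) q∣N))) qs-∣

-- The laws concern odd arguments only, since `χ₄` and `χ₈` take junk values at even ones.
record EvenPsi (M : ℕ) (ψ : ℤ → ℤ) : Set where
  field
    mult  : ∀ j k → ψ ((1ℤ + + 2 * j) * (1ℤ + + 2 * k)) ≡ ψ (1ℤ + + 2 * j) * ψ (1ℤ + + 2 * k)
    congr : ∀ j {y} → 1ℤ + + 2 * j ≅ y [ M ] → ψ (1ℤ + + 2 * j) ≡ ψ y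
    sign  : ∀ j → Sign (ψ (1ℤ + + 2 * j))

χ₄-even : EvenPsi 4 χ₄
χ₄-even = record { mult = χ₄-* ; congr = χ₄-cong ; sign = χ₄-Sign }

χ₈-even : EvenPsi 8 χ₈
χ₈-even = record { mult = χ₈-* ; congr = χ₈-cong ; sign = χ₈-Sign }

χ₄χ₈-even : EvenPsi 8 (λ x → χ₄ x * χ₈ x)
χ₄χ₈-even = record
  { mult = λ j k → trans (cong₂ _*_ (χ₄-* j k) (χ₈-* j k)) (lemma (χ₄ (1ℤ + + 2 * j)) _ (χ₈ (1ℤ + + 2 * j)) _)
  ; congr = λ j e → cong₂ _*_ (χ₄-cong j (≅-weaken 2 e)) (χ₈-cong j e)
  ; sign = λ j → Sign-* (χ₄-Sign j) (χ₈-Sign j) }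
  where
  lemma : ∀ a b c d → a * b * (c * d) ≡ a * c * (b * d)
  lemma = solve-∀

coprime-odd : ∀ x {n} → 2 ∣ n → Coprime ∣ x ∣ n → ∃[ j ] x ≡ 1ℤ + + 2 * j
coprime-odd x 2∣n c with parity x
... | odd j eq = j , eq
... | even j refl with c (subst (2 ∣_) (sym (abs-* (+ 2) j)) (ℕ∣.m∣m*n ∣ j ∣) , 2∣n)
...   | ()

OddPrime-factors : ∀ Q .{{_ : NonZero Q}} → ¬ 2 ∣ Q →
                   All OddPrime′ (factors (factorise Q)) × product (factors (factorise Q)) ≡ Q
OddPrime-factors Q 2∤Q = All.tabulate odd-prime , sym isFactorisation
  where
  open PrimeFactorisation (factorise Q) using (isFactorisation; factorsPrime)
  odd-prime : ∀ {q} → q Membership.∈ factors (factorise Q) → OddPrime′ q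
  odd-prime {q} q∈ = All.lookup factorsPrime q∈ , odd⇒OddNat q (is-odd (parity (+ q)))
    where
    q∣Q : q ∣ Q
    q∣Q = subst (q ∣_) (sym isFactorisation) (∈⇒∣product q∈)
    is-odd : Parity (+ q) → + q ≅ 1ℤ [ 2 ]
    is-odd (odd j eq) = cg j (trans eq (cong (_+_ 1ℤ) (*-comm (+ 2) j)))
    is-odd (even j eq) = ⊥-elim (2∤Q (ℕ∣.∣-trans (subst (2 ∣_) (sym (trans (cong ∣_∣ eq) (abs-* (+ 2) j))) (ℕ∣.m∣m*n ∣ j ∣)) q∣Q))

factors-∣ : ∀ Q .{{_ : NonZero Q}} {N} → Q ∣ N → All (_∣ N) (factors (factorise Q))
factors-∣ Q Q∣N = All.tabulate λ q∈ →
  ℕ∣.∣-trans (subst (_ ∣_) (sym isFactorisation) (∈⇒∣product q∈)) Q∣N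
  where
  open PrimeFactorisation (factorise Q) using (isFactorisation)

disc-1 : ∀ m → m %ℕ 4 ≡ 1 → disc m ≡ m
disc-1 m e rewrite e = refl

disc-4 : ∀ m → m %ℕ 4 ≢ 1 → disc m ≡ + 4 * m
disc-4 m e with m %ℕ 4
... | 0           = refl
... | 1           = ⊥-elim (e refl)
... | suc (suc _) = refl

module _ (m : ℤ) where

  χ-gcd≢1 : ∀ {x} → ¬ Coprime ∣ x ∣ ∣ disc m ∣ → χ m x ≡ 0ℤ
  χ-gcd≢1 {x} ¬c with gcd ∣ x ∣ ∣ disc m ∣ ℕ.≟ 1
  ... | no  _ = refl
  ... | yes e = ⊥-elim (¬c (gcd≡1⇒coprime e))

  χ-case₁ : ∀ {x} → m %ℕ 4 ≡ 1 → Coprime ∣ x ∣ ∣ disc m ∣ → χ m x ≡ jacobi x ∣ m ∣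
  χ-case₁ {x} e c with gcd ∣ x ∣ ∣ disc m ∣ ℕ.≟ 1
  ... | no g = ⊥-elim (g (coprime⇒gcd≡1 c))
  ... | yes _ with m %ℕ 4 | e
  ... | .1 | refl = refl

  χ-case₃ : ∀ {x} → m %ℕ 4 ≡ 3 → Coprime ∣ x ∣ ∣ disc m ∣ → χ m x ≡ χ₄ x * jacobi x ∣ m ∣
  χ-case₃ {x} e c with gcd ∣ x ∣ ∣ disc m ∣ ℕ.≟ 1
  ... | no g = ⊥-elim (g (coprime⇒gcd≡1 c))
  ... | yes _ with m %ℕ 4 | e
  ... | .3 | refl = refl

  χ-case₂₁ : ∀ {x} → m %ℕ 4 ≡ 2 → (m /ℕ 2) %ℕ 4 ≡ 1 → Coprime ∣ x ∣ ∣ disc m ∣ →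
             χ m x ≡ χ₈ x * jacobi x ∣ m /ℕ 2 ∣
  χ-case₂₁ {x} e e′ c with gcd ∣ x ∣ ∣ disc m ∣ ℕ.≟ 1
  ... | no g = ⊥-elim (g (coprime⇒gcd≡1 c))
  ... | yes _ with m %ℕ 4 | e
  ... | .2 | refl with (m /ℕ 2) %ℕ 4 | e′
  ... | .1 | refl = refl

  χ-case₂₃ : ∀ {x} → m %ℕ 4 ≡ 2 → (m /ℕ 2) %ℕ 4 ≡ 3 → Coprime ∣ x ∣ ∣ disc m ∣ →
             χ m x ≡ χ₄ x * χ₈ x * jacobi x ∣ m /ℕ 2 ∣
  χ-case₂₃ {x} e e′ c with gcd ∣ x ∣ ∣ disc m ∣ ℕ.≟ 1
  ... | no g = ⊥-elim (g (coprime⇒gcd≡1 c))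
  ... | yes _ with m %ℕ 4 | e
  ... | .2 | refl with (m /ℕ 2) %ℕ 4 | e′
  ... | .3 | refl = refl

module _ (m : ℤ) (m<0 : m < 0ℤ) (squareFree : SquareFree m) where

  private
    N = ∣ disc m ∣

    instance
      m≢0 : NonZero ∣ m ∣
      m≢0 = ℕ.≢-nonZero λ ∣m∣≡0 → <-irrefl refl (subst (_< 0ℤ) (∣i∣≡0⇒i≡0 ∣m∣≡0) m<0)

    4∤m : ¬ 4 ∣ ∣ m ∣
    4∤m d with squareFree 2 d
    ... | ()

    minus-abs : ∀ {k} → k < 0ℤ → k ≡ - + ∣ k ∣
    minus-abs { -[1+ _ ]} _ = refl
    minus-abs {+ _} (+<+ ())

    m≅ : ∀ r → m %ℕ 4 ≡ r → m ≅ + r [ 4 ]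
    m≅ r e = ≅-trans (residue m 4) (≅-reflexive (cong +_ e))

    legendre-neg1×2 : ∀ h (pr : Prime (suc (h ℕ.+ h))) →
      legendre (- + 2) (suc (h ℕ.+ h)) ≡ χ₄ (+ suc (h ℕ.+ h)) * χ₈ (+ suc (h ℕ.+ h))
    legendre-neg1×2 h pr = trans (OddPrime.legendre-* h pr -1ℤ (+ 2))
      (cong₂ _*_ (Supplements.legendre-neg1 h pr) (Supplements.legendre-2 h pr))

    -- Q is the odd part of |m|.
    module Common (Q : ℕ) {{Q≢0 : NonZero Q}} (Q∣N : Q ∣ N) (2∤Q : ¬ 2 ∣ Q) where
      qs = factors (factorise Q)
      qs-prime : All OddPrime′ qs
      qs-prime = proj₁ (OddPrime-factors Q 2∤Q)
      product-qs : product qs ≡ Q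
      product-qs = proj₂ (OddPrime-factors Q 2∤Q)
      qs-∣ : All (_∣ N) qs
      qs-∣ = factors-∣ Q Q∣N

    module Even (M : ℕ) (M∣N : M ∣ N) (2∣M : 2 ∣ M) (ψ : ℤ → ℤ) (ev : EvenPsi M ψ) where
      open EvenPsi ev
      2∣N : 2 ∣ N
      2∣N = ℕ∣.∣-trans 2∣M M∣N
      ψ-* : ∀ x y → Coprime ∣ x ∣ N → Coprime ∣ y ∣ N → ψ (x * y) ≡ ψ x * ψ y
      ψ-* x y cx cy with coprime-odd x 2∣N cx | coprime-odd y 2∣N cy
      ... | j , refl | k , refl = mult j k
      ψ-cong : ∀ {x y} → Coprime ∣ x ∣ N → x ≅ y [ N ] → ψ x ≡ ψ y
      ψ-cong {x} cx e with coprime-odd x 2∣N cx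
      ... | j , refl = congr j (≅-divisor M∣N e)
      ψ-Sign : ∀ {x} → Coprime ∣ x ∣ N → Sign (ψ x)
      ψ-Sign {x} cx with coprime-odd x 2∣N cx
      ... | j , refl = sign j

    0≇1 : ¬ 0ℤ ≅ 1ℤ [ 2 ]
    0≇1 e with ≅-small {2} {0} {1} e (s≤s z≤n) (s≤s (s≤s z≤n))
    ... | ()

    not-odd : ∀ r → 2 ∣ N → disc m ≅ 1ℤ + + 2 * r [ 8 ] → ⊥
    not-odd r 2∣N e = 0≇1 (≅-trans (≅-sym (∣⇒≅0 {x = disc m} 2∣N)) (≅-trans (≅-weaken 4 e)
      (cg r (cong (_+_ 1ℤ) (*-comm (+ 2) r)))))

    module Case₁ (e : m %ℕ 4 ≡ 1) where
      Q = ∣ m ∣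
      D≡ : disc m ≡ m
      D≡ = disc-1 m e
      Q∣N : Q ∣ N
      Q∣N = ℕ∣.∣-reflexive (cong ∣_∣ (sym D≡))
      2∤Q : ¬ 2 ∣ Q
      2∤Q d = 0≇1 (≅-trans (≅-sym (∣⇒≅0 {x = m} d)) (≅-weaken 2 (m≅ 1 e)))
      Q≡ : + Q ≡ - m
      Q≡ = sym (trans (cong -_ (minus-abs m<0)) (neg-involutive (+ Q)))
      open Common Q Q∣N 2∤Q
      χ₄Q : χ₄ (+ Q) ≡ -1ℤ
      -- The argument 1ℤ stands for the odd number 1 + 2 · 1 = 3, and Q = -m ≡ 3 modulo 4. Hence
      -- χ₄(Q) Q = m.
      χ₄Q = sym (χ₄-cong 1ℤ (≅-trans (cg 1ℤ refl) (≅-trans (≅-neg (≅-sym (m≅ 1 e))) (≅-reflexive (sym Q≡)))))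
      χ₈Q : ∀ j {r} → - r ≅ 1ℤ + + 2 * j [ 8 ] → disc m ≅ r [ 8 ] → χ₈ (+ Q) ≡ χ₈ (1ℤ + + 2 * j)
      χ₈Q j {r} e₁ e₂ = sym (χ₈-cong j (≅-trans (≅-sym e₁) (≅-trans (≅-neg (≅-sym e₂))
        (≅-reflexive (trans (cong -_ D≡) (sym Q≡))))))
      value : ∀ {x} → Coprime ∣ x ∣ N → χ m x ≡ J x qs
      value {x} c = trans (χ-case₁ m {x} e c) (jacobi≡J x Q)
      coprime-2 : Coprime 2 N
      coprime-2 = Coprime.sym (∤⇒coprime prime[2] (2∤Q ∘ subst (2 ∣_) (cong ∣_∣ D≡)))
      two : ∀ j {r} → - r ≅ 1ℤ + + 2 * j [ 8 ] → disc m ≅ r [ 8 ] → χ m (+ 2) ≡ χ₈ (1ℤ + + 2 * j)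
      two j e₁ e₂ = trans (value {+ 2} coprime-2) (trans (J-2 qs-prime)
        (trans (cong (λ k → χ₈ (+ k)) product-qs) (χ₈Q j e₁ e₂)))
      datum : Datum (disc m) (χ m)
      datum = record
        { qs = qs ; qs-prime = qs-prime ; qs-∣ = qs-∣ ; ψ = λ _ → 1ℤ ; ε = 1ℤ ; c = 1ℤ
        ; ψ-* = λ _ _ _ _ → refl ; ψ-cong = λ _ _ → refl ; ψ-Sign = λ _ → inj₁ refl
        ; X-value = λ {x} c → trans (value {x} c) (sym (*-identityˡ (J x qs)))
        ; X-zero = λ {x} → χ-gcd≢1 m {x}
        ; D-eq = trans D≡ (trans (minus-abs m<0) (trans (lemma (+ Q))
            (cong₂ (λ a b → 1ℤ * 1ℤ * (1ℤ * (a * b))) (sym (trans (cong (λ k → χ₄ (+ k)) product-qs) χ₄Q))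
              (cong +_ (sym product-qs)))))
        ; ε-value = λ h pr → legendre-one h pr
        ; ψ-neg1 = cong (1ℤ *_) (trans (cong (λ k → χ₄ (+ k)) product-qs) χ₄Q)
        -- For D ≡ 1 modulo 8, Q = -D ≡ 7 = 1 + 2 · 3 and χ₈(7) = 1. For D ≡ 5, Q ≡ 3 = 1 + 2 · 1
        -- and χ₈(3) = -1.
        ; X-two₁ = two (+ 3) (cg -1ℤ refl)
        ; X-two₅ = two 1ℤ (cg -1ℤ refl) }
        where
        lemma : ∀ q → - q ≡ + 1 * + 1 * (+ 1 * (- + 1 * q))
        lemma = solve-∀

    module Case₃ (e : m %ℕ 4 ≡ 3) where
      Q = ∣ m ∣
      D≡ : disc m ≡ + 4 * m
      D≡ = disc-4 m λ e′ → 3≢1 (trans (sym e) e′)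
        where
        3≢1 : 3 ≢ 1
        3≢1 ()
      N≡ : N ≡ 4 ℕ.* Q
      N≡ = trans (cong ∣_∣ D≡) (abs-* (+ 4) m)
      Q∣N : Q ∣ N
      Q∣N = subst (Q ∣_) (sym N≡) (ℕ∣.∣n⇒∣m*n 4 ℕ∣.∣-refl)
      2∤Q : ¬ 2 ∣ Q
      2∤Q d = 0≇1 (≅-trans (≅-sym (∣⇒≅0 {x = m} d)) (≅-trans (≅-weaken 2 (m≅ 3 e)) (cg 1ℤ refl)))
      Q≡ : + Q ≡ - m
      Q≡ = sym (trans (cong -_ (minus-abs m<0)) (neg-involutive (+ Q)))
      open Common Q Q∣N 2∤Q
      open Even 4 (subst (4 ∣_) (sym N≡) (ℕ∣.m∣m*n Q)) (ℕ∣.divides 2 refl) χ₄ χ₄-even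
      χ₄Q : χ₄ (+ Q) ≡ 1ℤ
      χ₄Q = sym (χ₄-cong 0ℤ (≅-trans (cg 1ℤ refl) (≅-trans (≅-neg (≅-sym (m≅ 3 e))) (≅-reflexive (sym Q≡)))))
      datum : Datum (disc m) (χ m)
      datum = record
        { qs = qs ; qs-prime = qs-prime ; qs-∣ = qs-∣ ; ψ = χ₄ ; ε = -1ℤ ; c = + 2
        ; ψ-* = ψ-* ; ψ-cong = λ {x} {y} → ψ-cong {x} {y} ; ψ-Sign = λ {x} → ψ-Sign {x}
        ; X-value = λ {x} c → trans (χ-case₃ m {x} e c) (cong (χ₄ x *_) (jacobi≡J x Q))
        ; X-zero = λ {x} → χ-gcd≢1 m {x}
        ; D-eq = trans D≡ (trans (cong (_*_ (+ 4)) (minus-abs m<0)) (trans (lemma (+ Q))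
            (cong₂ (λ a b → + 2 * + 2 * (-1ℤ * (a * b))) (sym (trans (cong (λ k → χ₄ (+ k)) product-qs) χ₄Q))
              (cong +_ (sym product-qs)))))
        ; ε-value = λ h pr → Supplements.legendre-neg1 h pr
        ; ψ-neg1 = cong (-1ℤ *_) (trans (cong (λ k → χ₄ (+ k)) product-qs) χ₄Q)
        ; X-two₁ = λ e′ → ⊥-elim (not-odd 0ℤ 2∣N e′)
        ; X-two₅ = λ e′ → ⊥-elim (not-odd (+ 2) 2∣N e′) }
        where
        lemma : ∀ q → + 4 * - q ≡ + 2 * + 2 * (- + 1 * (+ 1 * q))
        lemma = solve-∀

    module Case₂ (e : m %ℕ 4 ≡ 2) where
      n = m /ℕ 2
      m≡ : m ≡ n * + 2
      m≡ = trans (a≡a%ℕn+[a/ℕn]*n m 2) (trans (cong (λ r → + r + n * + 2) r≡0) (+-identityˡ _))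
        where
        r≡0 : m %ℕ 2 ≡ 0
        r≡0 = ≅-small (≅-trans (≅-sym (residue m 2)) (≅-trans (≅-weaken 2 (m≅ 2 e)) (cg 1ℤ refl)))
          (n%ℕd<d m 2) (s≤s z≤n)
      Q = ∣ n ∣
      ∣m∣≡ : ∣ m ∣ ≡ Q ℕ.* 2
      ∣m∣≡ = trans (cong ∣_∣ m≡) (abs-* n (+ 2))
      instance
        Q≢0 : NonZero Q
        Q≢0 = ℕ.≢-nonZero λ Q≡0 → ℕ.≢-nonZero⁻¹ ∣ m ∣ (trans ∣m∣≡ (cong (ℕ._* 2) Q≡0))
      n<0 : n < 0ℤ
      n<0 = *-cancelʳ-<-nonNeg {n} {0ℤ} (+ 2) (subst (_< 0ℤ) m≡ m<0)
      D≡ : disc m ≡ + 4 * m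
      D≡ = disc-4 m λ e′ → 2≢1 (trans (sym e) e′)
        where
        2≢1 : 2 ≢ 1
        2≢1 ()
      N≡ : N ≡ 8 ℕ.* Q
      N≡ = trans (cong ∣_∣ (trans D≡ (trans (cong (_*_ (+ 4)) m≡) (lemma n)))) (abs-* (+ 8) n)
        where
        lemma : ∀ n → + 4 * (n * + 2) ≡ + 8 * n
        lemma = solve-∀
      Q∣N : Q ∣ N
      Q∣N = subst (Q ∣_) (sym N≡) (ℕ∣.∣n⇒∣m*n 8 ℕ∣.∣-refl)
      2∤Q : ¬ 2 ∣ Q
      2∤Q d = 4∤m (subst (4 ∣_) (sym ∣m∣≡) (ℕ∣.*-monoˡ-∣ 2 d))
      n≅ : ∀ r → n %ℕ 4 ≡ r → n ≅ + r [ 4 ]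
      n≅ r e = ≅-trans (residue n 4) (≅-reflexive (cong +_ e))
      Q≡ : + Q ≡ - n
      Q≡ = sym (trans (cong -_ (minus-abs n<0)) (neg-involutive (+ Q)))
      D≡Q : disc m ≡ + 4 * (- + Q * + 2)
      D≡Q = trans D≡ (cong (_*_ (+ 4)) (trans m≡ (cong (_* + 2) (minus-abs n<0))))
      open Common Q Q∣N 2∤Q
      module Ev = Even 8 (subst (8 ∣_) (sym N≡) (ℕ∣.m∣m*n Q)) (ℕ∣.divides 4 refl)

      datum₁ : n %ℕ 4 ≡ 1 → Datum (disc m) (χ m)
      datum₁ e′ = record
        { qs = qs ; qs-prime = qs-prime ; qs-∣ = qs-∣ ; ψ = χ₈ ; ε = + 2 ; c = + 2
        ; ψ-* = E.ψ-* ; ψ-cong = λ {x} {y} → E.ψ-cong {x} {y} ; ψ-Sign = λ {x} → E.ψ-Sign {x}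
        ; X-value = λ {x} c → trans (χ-case₂₁ m {x} e e′ c) (cong (χ₈ x *_) (jacobi≡J x Q))
        ; X-zero = λ {x} → χ-gcd≢1 m {x}
        ; D-eq = trans D≡Q (trans (lemma (+ Q))
            (cong₂ (λ a b → + 2 * + 2 * (+ 2 * (a * b))) (sym (trans (cong (λ k → χ₄ (+ k)) product-qs) χ₄Q))
              (cong +_ (sym product-qs))))
        ; ε-value = λ h pr → Supplements.legendre-2 h pr
        ; ψ-neg1 = cong (1ℤ *_) (trans (cong (λ k → χ₄ (+ k)) product-qs) χ₄Q)
        ; X-two₁ = λ e″ → ⊥-elim (not-odd 0ℤ E.2∣N e″)
        ; X-two₅ = λ e″ → ⊥-elim (not-odd (+ 2) E.2∣N e″) }
        where
        module E = Ev χ₈ χ₈-even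
        χ₄Q : χ₄ (+ Q) ≡ -1ℤ
        χ₄Q = sym (χ₄-cong 1ℤ (≅-trans (cg 1ℤ refl) (≅-trans (≅-neg (≅-sym (n≅ 1 e′))) (≅-reflexive (sym Q≡)))))
        lemma : ∀ q → + 4 * (- q * + 2) ≡ + 2 * + 2 * (+ 2 * (- + 1 * q))
        lemma = solve-∀

      datum₃ : n %ℕ 4 ≡ 3 → Datum (disc m) (χ m)
      datum₃ e′ = record
        { qs = qs ; qs-prime = qs-prime ; qs-∣ = qs-∣ ; ψ = λ x → χ₄ x * χ₈ x ; ε = - + 2 ; c = + 2
        ; ψ-* = E.ψ-* ; ψ-cong = λ {x} {y} → E.ψ-cong {x} {y} ; ψ-Sign = λ {x} → E.ψ-Sign {x}
        ; X-value = λ {x} c → trans (χ-case₂₃ m {x} e e′ c) (cong (χ₄ x * χ₈ x *_) (jacobi≡J x Q))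
        ; X-zero = λ {x} → χ-gcd≢1 m {x}
        ; D-eq = trans D≡Q (trans (lemma (+ Q))
            (cong₂ (λ a b → + 2 * + 2 * (- + 2 * (a * b))) (sym (trans (cong (λ k → χ₄ (+ k)) product-qs) χ₄Q))
              (cong +_ (sym product-qs))))
        ; ε-value = legendre-neg1×2
        ; ψ-neg1 = cong (-1ℤ *_) (trans (cong (λ k → χ₄ (+ k)) product-qs) χ₄Q)
        ; X-two₁ = λ e″ → ⊥-elim (not-odd 0ℤ E.2∣N e″)
        ; X-two₅ = λ e″ → ⊥-elim (not-odd (+ 2) E.2∣N e″) }
        where
        module E = Ev (λ x → χ₄ x * χ₈ x) χ₄χ₈-even
        χ₄Q : χ₄ (+ Q) ≡ 1ℤ
        χ₄Q = sym (χ₄-cong 0ℤ (≅-trans (cg 1ℤ refl) (≅-trans (≅-neg (≅-sym (n≅ 3 e′))) (≅-reflexive (sym Q≡)))))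
        lemma : ∀ q → + 4 * (- q * + 2) ≡ + 2 * + 2 * (- + 2 * (+ 1 * q))
        lemma = solve-∀

      datum : Datum (disc m) (χ m)
      datum = by-residue (n %ℕ 4) refl (n%ℕd<d n 4)
        where
        even-n : ∀ r → n %ℕ 4 ≡ r → + r ≅ 0ℤ [ 2 ] → ⊥
        even-n r e′ z = 2∤Q (≅0⇒∣ (≅-trans (≅-weaken 2 (n≅ r e′)) z))
        by-residue : ∀ r → n %ℕ 4 ≡ r → r ℕ.< 4 → Datum (disc m) (χ m)
        by-residue 0 e′ _ = ⊥-elim (even-n 0 e′ ≅-refl)
        by-residue 1 e′ _ = datum₁ e′
        by-residue 2 e′ _ = ⊥-elim (even-n 2 e′ (cg 1ℤ refl))
        by-residue 3 e′ _ = datum₃ e′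
        by-residue (suc (suc (suc (suc _)))) _ (s≤s (s≤s (s≤s (s≤s ()))))

  kronecker : Kronecker (disc m) (χ m)
  kronecker = datum⇒kronecker (by-residue (m %ℕ 4) refl (n%ℕd<d m 4))
    where
    by-residue : ∀ r → m %ℕ 4 ≡ r → r ℕ.< 4 → Datum (disc m) (χ m)
    by-residue 0 e _ = ⊥-elim (4∤m (≅0⇒∣ (m≅ 0 e)))
    by-residue 1 e _ = Case₁.datum e
    by-residue 2 e _ = Case₂.datum e
    by-residue 3 e _ = Case₃.datum e
    by-residue (suc (suc (suc (suc _)))) _ (s≤s (s≤s (s≤s (s≤s ()))))

-- Roots of the minimal polynomial and sums of χ over divisors

Σ-blocks : ∀ p n (F : ℕ → ℤ) → Σ< (p ℕ.* n) F ≡ Σ< p (λ t → Σ< n (λ r → F (t ℕ.* n ℕ.+ r)))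
Σ-blocks zero    n F = refl
Σ-blocks (suc p) n F = trans (cong (λ k → Σ< k F) (ℕ.+-comm n (p ℕ.* n)))
  (trans (Σ-split (p ℕ.* n) n F) (cong (_+ Σ< n (λ r → F (p ℕ.* n ℕ.+ r))) (Σ-blocks p n F)))

Σ-multiples : ∀ q .{{_ : NonZero q}} M (F : ℕ → ℤ) →
              Σ< (M ℕ.* q) (λ d → 𝟙 (q ∣? d) * F d) ≡ Σ< M (λ e → F (e ℕ.* q))
Σ-multiples q@(suc _) M F = trans (Σ-blocks M q _) (Σ-cong′ M λ e →
  trans (Σ-single q 0 (s≤s z≤n) λ r r<q r≢0 →
      trans (cong (_* F (e ℕ.* q ℕ.+ r)) (𝟙-no (q ∣? (e ℕ.* q ℕ.+ r)) λ d →
        ℕ∣.>⇒∤ {{ℕ.≢-nonZero r≢0}} r<q (ℕ∣.∣m+n∣m⇒∣n d (ℕ∣.n∣m*n e)))) (*-zeroˡ (F (e ℕ.* q ℕ.+ r))))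
    (trans (cong₂ _*_ (𝟙-yes (q ∣? (e ℕ.* q ℕ.+ 0)) (subst (q ∣_) (sym (ℕ.+-identityʳ (e ℕ.* q))) (ℕ∣.n∣m*n e)))
        (cong F (ℕ.+-identityʳ (e ℕ.* q)))) (*-identityˡ _)))

𝟙-¬ : ∀ {a} {P : Set a} (d : Dec P) → 𝟙 d + 𝟙 (¬? d) ≡ 1ℤ
𝟙-¬ (yes _) = refl
𝟙-¬ (no _)  = refl

Σ-by-divisibility : ∀ q n (F : ℕ → ℤ) →
  Σ< n F ≡ Σ< n (λ d → 𝟙 (q ∣? d) * F d) + Σ< n (λ d → 𝟙 (¬? (q ∣? d)) * F d)
Σ-by-divisibility q n F = sym (trans (sym (Σ-+ n _ _)) (Σ-cong′ n λ d →
  trans (sym (*-distribʳ-+ (F d) (𝟙 (q ∣? d)) (𝟙 (¬? (q ∣? d)))))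
    (trans (cong (_* F d) (𝟙-¬ (q ∣? d))) (*-identityˡ (F d)))))

coprime-≅ : ∀ {x q b} → Coprime q b → x ≅ 0ℤ [ q ] → x ≅ 0ℤ [ b ] → x ≅ 0ℤ [ q ℕ.* b ]
coprime-≅ {x} {q} {b} cop e₁ e₂ with ≅0⇒∣ e₁ | ≅0⇒∣ e₂
... | ℕ∣.divides k eq | b∣x = ∣⇒≅0 (subst (q ℕ.* b ∣_) (trans (ℕ.*-comm q k) (sym eq))
        (ℕ∣.*-monoʳ-∣ q (Coprime.coprime-divisor (Coprime.sym cop) (subst (b ∣_) (trans eq (ℕ.*-comm k q)) b∣x))))

module Roots (s t : ℤ) where

  P : ℤ → ℤ
  P r = r * r - s * r + t

  D : ℤ
  D = s * s - + 4 * t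

  ρ : ℕ → ℤ
  ρ a = Σ< a λ r → 𝟙 (P (+ r) ≅? 0ℤ [ a ])

  P-cong : ∀ {n x y} → x ≅ y [ n ] → P x ≅ P y [ n ]
  P-cong e = ≅-+ (≅-- (≅-* e e) (≅-* (≅-refl {x = s}) e)) (≅-refl {x = t})

  -- The Chinese remainder theorem: `term i j r` couples the roots i and j with the r that reduces
  -- to both. For fixed i, j there is exactly one such r; for fixed r the pair (i, j) is given by
  -- reduction, and r is a root modulo q b exactly if both reductions are roots.
  ρ-* : ∀ q b .{{_ : NonZero q}} .{{_ : NonZero b}} → Coprime q b → ρ (q ℕ.* b) ≡ ρ q * ρ b
  ρ-* q b cop = sym (begin
    ρ q * ρ b
      ≡⟨ sym (Σ-*ʳ q (ρ b) (λ i → 𝟙 (root? i q))) ⟩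
    Σ< q (λ i → 𝟙 (root? i q) * ρ b)
      ≡⟨ Σ-cong′ q (λ i → sym (Σ-*ˡ b (𝟙 (root? i q)) (λ j → 𝟙 (root? j b)))) ⟩
    Σ< q (λ i → Σ< b (λ j → 𝟙 (root? i q) * 𝟙 (root? j b)))
      ≡⟨ Σ-cong q (λ i i<q → Σ-cong b λ j j<b → insert i j i<q j<b) ⟩
    Σ< q (λ i → Σ< b (λ j → Σ< (q ℕ.* b) (term i j)))
      ≡⟨ Σ-cong′ q (λ i → Σ-swap b (q ℕ.* b) (term i)) ⟩
    Σ< q (λ i → Σ< (q ℕ.* b) (λ r → Σ< b (λ j → term i j r)))
      ≡⟨ Σ-swap q (q ℕ.* b) _ ⟩
    Σ< (q ℕ.* b) (λ r → Σ< q (λ i → Σ< b (λ j → term i j r)))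
      ≡⟨ Σ-cong′ (q ℕ.* b) collapse ⟩
    ρ (q ℕ.* b) ∎)
    where
    open ≡-Reasoning
    root? : ∀ i n → Dec (P (+ i) ≅ 0ℤ [ n ])
    root? i n = P (+ i) ≅? 0ℤ [ n ]
    instance
      qb≢0 : NonZero (q ℕ.* b)
      qb≢0 = ℕ.m*n≢0 q b
    term : ℕ → ℕ → ℕ → ℤ
    term i j r = 𝟙 (root? i q) * 𝟙 (root? j b) * (𝟙 (i ℕ.≟ r ℕ.% q) * 𝟙 (j ℕ.≟ r ℕ.% b))
    off : ∀ i j r → i ≢ r ℕ.% q ⊎ j ≢ r ℕ.% b → term i j r ≡ 0ℤ
    off i j r (inj₁ i≢) = trans (cong (λ z → 𝟙 (root? i q) * 𝟙 (root? j b) * (z * 𝟙 (j ℕ.≟ r ℕ.% b))) (𝟙-no (i ℕ.≟ r ℕ.% q) i≢))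
      (trans (cong (𝟙 (root? i q) * 𝟙 (root? j b) *_) (*-zeroˡ (𝟙 (j ℕ.≟ r ℕ.% b)))) (*-zeroʳ (𝟙 (root? i q) * 𝟙 (root? j b))))
    off i j r (inj₂ j≢) = trans (cong (λ z → 𝟙 (root? i q) * 𝟙 (root? j b) * (𝟙 (i ℕ.≟ r ℕ.% q) * z)) (𝟙-no (j ℕ.≟ r ℕ.% b) j≢))
      (trans (cong (𝟙 (root? i q) * 𝟙 (root? j b) *_) (*-zeroʳ (𝟙 (i ℕ.≟ r ℕ.% q)))) (*-zeroʳ (𝟙 (root? i q) * 𝟙 (root? j b))))
    on : ∀ i j r → i ≡ r ℕ.% q → j ≡ r ℕ.% b → term i j r ≡ 𝟙 (root? i q) * 𝟙 (root? j b)
    on i j r eq₁ eq₂ = trans (cong₂ (λ y z → 𝟙 (root? i q) * 𝟙 (root? j b) * (y * z))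
        (𝟙-yes (i ℕ.≟ r ℕ.% q) eq₁) (𝟙-yes (j ℕ.≟ r ℕ.% b) eq₂)) (*-identityʳ _)
    crt : ∀ i j → i ℕ.< q → j ℕ.< b → ∃[ r ] r ℕ.< q ℕ.* b × i ≡ r ℕ.% q × j ≡ r ℕ.% b
    crt i j i<q j<b with inverse (+ q) b cop
    ... | v , qv≅1 = r , n%ℕd<d x (q ℕ.* b) ,
        ≅-small (≅-trans (≅-trans (≅-sym x≅i) (≅-weaken b (subst (x ≅ + r [_]) (ℕ.*-comm q b) (residue x (q ℕ.* b))))) (residue (+ r) q)) i<q (ℕ.m%n<n r q) ,
        ≅-small (≅-trans (≅-trans (≅-sym x≅j) (≅-weaken q (residue x (q ℕ.* b)))) (residue (+ r) b)) j<b (ℕ.m%n<n r b)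
      where
      x = + i + + q * v * (+ j - + i)
      r = x %ℕ (q ℕ.* b)
      x≅i : x ≅ + i [ q ]
      x≅i = cg (v * (+ j - + i)) (lemma (+ i) (+ j) (+ q) v)
        where
        lemma : ∀ i j q v → i + q * v * (j - i) ≡ i + v * (j - i) * q
        lemma = solve-∀
      x≅j : x ≅ + j [ b ]
      x≅j = ≅-trans (≅-+ (≅-refl {x = + i}) (≅-* qv≅1 (≅-refl {x = + j - + i}))) (≅-reflexive (lemma (+ i) (+ j)))
        where
        lemma : ∀ i j → i + + 1 * (j - i) ≡ j
        lemma = solve-∀
    insert : ∀ i j → i ℕ.< q → j ℕ.< b → 𝟙 (root? i q) * 𝟙 (root? j b) ≡ Σ< (q ℕ.* b) (term i j)
    insert i j i<q j<b = insert-at (crt i j i<q j<b)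
     where
     insert-at : ∃[ r ] r ℕ.< q ℕ.* b × i ≡ r ℕ.% q × j ≡ r ℕ.% b →
                 𝟙 (root? i q) * 𝟙 (root? j b) ≡ Σ< (q ℕ.* b) (term i j)
     insert-at (r₀ , r₀< , eq₁ , eq₂) = sym (trans (Σ-single (q ℕ.* b) r₀ r₀< others) (on i j r₀ eq₁ eq₂))
      where
      others : ∀ r → r ℕ.< q ℕ.* b → r ≢ r₀ → term i j r ≡ 0ℤ
      others r r< r≢r₀ = decide (i ℕ.≟ r ℕ.% q) (j ℕ.≟ r ℕ.% b)
        where
        decide : Dec (i ≡ r ℕ.% q) → Dec (j ≡ r ℕ.% b) → term i j r ≡ 0ℤ
        decide (no i≢) _       = off i j r (inj₁ i≢)
        decide (yes _) (no j≢) = off i j r (inj₂ j≢)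
        decide (yes eq₁′) (yes eq₂′) = ⊥-elim (r≢r₀ (≅-small (diff (coprime-≅ cop (same q (trans (sym eq₁′) eq₁)) (same b (trans (sym eq₂′) eq₂)))) r< r₀<))
            where
            same : ∀ n .{{_ : NonZero n}} → r ℕ.% n ≡ r₀ ℕ.% n → + r - + r₀ ≅ 0ℤ [ n ]
            same n e = ≅-trans (≅-- (≅-trans (residue (+ r) n) (≅-trans (≅-reflexive (cong +_ e)) (≅-sym (residue (+ r₀) n)))) (≅-refl {x = + r₀})) (≅-reflexive (+-inverseʳ (+ r₀)))
            diff : ∀ {n} → + r - + r₀ ≅ 0ℤ [ n ] → + r ≅ + r₀ [ n ]
            diff e = ≅-trans (≅-reflexive (lemma (+ r) (+ r₀))) (≅-trans (≅-+ e (≅-refl {x = + r₀})) (≅-reflexive (+-identityˡ (+ r₀))))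
              where
              lemma : ∀ a b → a ≡ a - b + b
              lemma = solve-∀
    collapse : ∀ r → Σ< q (λ i → Σ< b (λ j → term i j r)) ≡ 𝟙 (root? r (q ℕ.* b))
    collapse r = trans (Σ-single q (r ℕ.% q) (ℕ.m%n<n r q) λ i _ i≢ → Σ-zero b λ j _ → off i j r (inj₁ i≢))
      (trans (Σ-single b (r ℕ.% b) (ℕ.m%n<n r b) λ j _ j≢ → off (r ℕ.% q) j r (inj₂ j≢))
      (trans (on (r ℕ.% q) (r ℕ.% b) r refl refl) (both (root? (r ℕ.% q) q) (root? (r ℕ.% b) b))))
      where
      both : (d₁ : Dec (P (+ (r ℕ.% q)) ≅ 0ℤ [ q ])) (d₂ : Dec (P (+ (r ℕ.% b)) ≅ 0ℤ [ b ])) →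
             𝟙 d₁ * 𝟙 d₂ ≡ 𝟙 (root? r (q ℕ.* b))
      both (yes e₁) (yes e₂) = sym (𝟙-yes (root? r (q ℕ.* b)) (coprime-≅ cop
        (≅-trans (P-cong (residue (+ r) q)) e₁) (≅-trans (P-cong (residue (+ r) b)) e₂)))
      both (no ¬e) d₂ = trans (*-zeroˡ (𝟙 d₂)) (sym (𝟙-no (root? r (q ℕ.* b)) λ e → ¬e
        (≅-trans (P-cong (≅-sym (residue (+ r) q))) (≅-weaken b (subst (P (+ r) ≅ 0ℤ [_]) (ℕ.*-comm q b) e)))))
      both (yes _) (no ¬e) = sym (𝟙-no (root? r (q ℕ.* b)) λ e → ¬e
        (≅-trans (P-cong (≅-sym (residue (+ r) b))) (≅-weaken q e)))

  ρ-1 : ρ 1 ≡ 1ℤ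
  ρ-1 = trans (+-identityˡ _) (𝟙-yes (P (+ 0) ≅? 0ℤ [ 1 ]) (∣⇒≅0 (ℕ∣.1∣ _)))

  -- Dedekind's criterion for ℤ[ω] to be the maximal order: no r is both a zero of the derivative
  -- modulo a prime p and a root of P modulo p².
  Fundamental : Set
  Fundamental = ∀ p → Prime p → ∀ r → + 2 * r - s ≅ 0ℤ [ p ] → P r ≅ 0ℤ [ p ℕ.* p ] → ⊥

  derivative² : ∀ r → (+ 2 * r - s) * (+ 2 * r - s) ≡ D + + 4 * P r
  derivative² r = lemma r s t
    where
    lemma : ∀ r s t → (+ 2 * r - s) * (+ 2 * r - s) ≡ s * s - + 4 * t + + 4 * (r * r - s * r + t)
    lemma = solve-∀

  module PrimePower (fund : Fundamental) (p : ℕ) (pr : Prime p) where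

    private
      instance
        p≢0 : NonZero p
        p≢0 = prime⇒nonZero pr

    linear-solutions : ℤ → ℤ → ℤ
    linear-solutions w v = Σ< p λ u → 𝟙 (w + + u * v ≅? 0ℤ [ p ])

    one-solution : ∀ w v → ¬ v ≅ 0ℤ [ p ] → linear-solutions w v ≡ 1ℤ
    one-solution w v v≇0 with inverse v p (≇0⇒coprime pr v≇0)
    ... | v⁻¹ , vv⁻¹≅1 = trans (Σ-single p u₀ (n%ℕd<d x p) λ u u<p u≢u₀ →
          𝟙-no (w + + u * v ≅? 0ℤ [ p ]) λ e → u≢u₀ (≅-small (unique u e) u<p (n%ℕd<d x p)))
        (𝟙-yes (w + + u₀ * v ≅? 0ℤ [ p ]) solution)
      where
      x = - w * v⁻¹
      u₀ = x %ℕ p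
      solution : w + + u₀ * v ≅ 0ℤ [ p ]
      solution = ≅-trans (≅-+ (≅-refl {x = w}) (≅-trans (≅-* (≅-sym (residue x p)) (≅-refl {x = v}))
        (≅-trans (≅-reflexive (l w v v⁻¹)) (≅-* (≅-refl {x = - w}) vv⁻¹≅1)))) (≅-reflexive (l₂ w))
        where
        l : ∀ w v i → - w * i * v ≡ - w * (v * i)
        l = solve-∀
        l₂ : ∀ w → w + - w * + 1 ≡ + 0
        l₂ = solve-∀
      unique : ∀ u → w + + u * v ≅ 0ℤ [ p ] → + u ≅ + u₀ [ p ]
      unique u e = prime-cancelˡ pr v v≇0 (≅-trans (≅-reflexive (l w (+ u) v)) (≅-trans (≅-- e (≅-refl {x = w}))
        (≅-trans (≅-sym (≅-- solution (≅-refl {x = w}))) (≅-reflexive (sym (l w (+ u₀) v))))))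
        where
        l : ∀ w u v → v * u ≡ w + u * v - w
        l = solve-∀

    no-solution : ∀ w v → v ≅ 0ℤ [ p ] → ¬ w ≅ 0ℤ [ p ] → linear-solutions w v ≡ 0ℤ
    no-solution w v v≅0 w≇0 = Σ-zero p λ u _ → 𝟙-no (w + + u * v ≅? 0ℤ [ p ]) λ e → w≇0
      (≅-trans (≅-sym (≅-trans (≅-+ (≅-refl {x = w}) (≅-* (≅-refl {x = + u}) v≅0))
        (≅-reflexive (trans (cong (_+_ w) (*-zeroʳ (+ u))) (+-identityʳ w))))) e)

    -- Hensel lifting: the lifts r + u n of a root r modulo n are the solutions
    -- u of a linear congruence with slope P′(r).

    lifts′ : ∀ n .{{_ : NonZero n}} → p ∣ n → ∀ r (d : Dec (P (+ r) ≅ 0ℤ [ n ])) →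
      Σ< p (λ u → 𝟙 (P (+ (u ℕ.* n ℕ.+ r)) ≅? 0ℤ [ p ℕ.* n ])) ≡
      𝟙 d * 𝟙 (¬? (D ≅? 0ℤ [ p ]))
    lifts′ n p∣n r (no ¬e) = trans (Σ-zero p λ u _ → 𝟙-no (P (+ (u ℕ.* n ℕ.+ r)) ≅? 0ℤ [ p ℕ.* n ]) λ e →
            ¬e (≅-trans (P-cong (≅-sym (shift u))) (≅-weaken p e))) (sym (*-zeroˡ (𝟙 (¬? (D ≅? 0ℤ [ p ])))))
      where
      shift : ∀ u → + (u ℕ.* n ℕ.+ r) ≅ + r [ n ]
      shift u = cg (+ u) (trans (pos-+ (u ℕ.* n) r) (trans (+-comm (+ (u ℕ.* n)) (+ r)) (cong (_+_ (+ r)) (pos-* u n))))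
    lifts′ n p∣n r (yes (cg w P≡)) = trans (Σ-cong′ p λ u →
            𝟙-cong (P (+ (u ℕ.* n ℕ.+ r)) ≅? 0ℤ [ p ℕ.* n ]) (w + + u * v ≅? 0ℤ [ p ]) (to u) (from u))
            (trans (count (D ≅? 0ℤ [ p ])) (sym (*-identityˡ (𝟙 (¬? (D ≅? 0ℤ [ p ]))))))
      where
      v = + 2 * + r - s
      expand : ∀ u → P (+ (u ℕ.* n ℕ.+ r)) ≡ (w + + u * v + + u * + u * + n) * + n
      expand u = trans (cong P (trans (pos-+ (u ℕ.* n) r) (cong (_+ + r) (pos-* u n))))
        (trans (l (+ u) (+ n) (+ r) s t) (trans (cong (λ z → z + (+ u * v + + u * + u * + n) * + n) P≡) (l₂ w (+ n) (+ u * v) (+ u * + u * + n))))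
        where
        l : ∀ u n r s t → (u * n + r) * (u * n + r) - s * (u * n + r) + t ≡
                          r * r - s * r + t + (u * (+ 2 * r - s) + u * u * n) * n
        l = solve-∀
        l₂ : ∀ w n a b → + 0 + w * n + (a + b) * n ≡ (w + a + b) * n
        l₂ = solve-∀
      n≅0 : + n ≅ 0ℤ [ p ]
      n≅0 = ∣⇒≅0 p∣n
      square≅0 : ∀ u → + u * + u * + n ≅ 0ℤ [ p ]
      square≅0 u = ≅-trans (≅-* (≅-refl {x = + u * + u}) n≅0) (≅-reflexive (*-zeroʳ (+ u * + u)))
      to : ∀ u → P (+ (u ℕ.* n ℕ.+ r)) ≅ 0ℤ [ p ℕ.* n ] → w + + u * v ≅ 0ℤ [ p ]
      to u (cg k eq) = ≅-trans (≅-trans (≅-reflexive (sym (+-identityʳ _))) (≅-+ (≅-refl {x = w + + u * v}) (≅-sym (square≅0 u))))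
        (cg k (*-cancelʳ-≡ _ _ (+ n) (trans (sym (expand u)) (trans eq (trans (cong (λ z → 0ℤ + k * z) (pos-* p n)) (l k (+ p) (+ n)))))))
        where
        l : ∀ k p n → + 0 + k * (p * n) ≡ (+ 0 + k * p) * n
        l = solve-∀
      from : ∀ u → w + + u * v ≅ 0ℤ [ p ] → P (+ (u ℕ.* n ℕ.+ r)) ≅ 0ℤ [ p ℕ.* n ]
      from u e with ≅-+ e (square≅0 u)
      ... | cg k eq = cg k (trans (expand u) (trans (cong (_* + n) eq) (trans (l k (+ p) (+ n)) (cong (λ z → 0ℤ + k * z) (sym (pos-* p n))))))
        where
        l : ∀ k p n → (+ 0 + + 0 + k * p) * n ≡ + 0 + k * (p * n)
        l = solve-∀
      P≅0 : P (+ r) ≅ 0ℤ [ p ]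
      P≅0 = ≅-trans (≅-reflexive P≡) (≅-trans (≅-+ (≅-refl {x = 0ℤ}) (≅-* (≅-refl {x = w}) n≅0)) (≅-reflexive (l w)))
        where
        l : ∀ w → + 0 + w * + 0 ≡ + 0
        l = solve-∀
      v²≅D : v * v ≅ D [ p ]
      v²≅D = ≅-trans (≅-reflexive (derivative² (+ r))) (≅-trans (≅-+ (≅-refl {x = D}) (≅-* (≅-refl {x = + 4}) P≅0)) (≅-reflexive (+-identityʳ D)))
      count : (d : Dec (D ≅ 0ℤ [ p ])) → linear-solutions w v ≡ 𝟙 (¬? d)
      count (no D≇0) = one-solution w v λ v≅0 → D≇0 (≅-trans (≅-sym v²≅D) (≅-* v≅0 v≅0))
      count (yes D≅0) = no-solution w v v≅0 λ (cg k w≡) → fund p pr (+ r) v≅0 (p²∣P k w≡ p∣n)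
        where
        v≅0 : v ≅ 0ℤ [ p ]
        v≅0 = [ id , id ]′ (≅0-* pr (≅-trans v²≅D D≅0))
        p²∣P : ∀ k → w ≡ 0ℤ + k * + p → p ∣ n → P (+ r) ≅ 0ℤ [ p ℕ.* p ]
        p²∣P k w≡ (ℕ∣.divides j n≡) = cg (k * + j) (trans P≡ (trans (cong₂ (λ a b → 0ℤ + a * b) w≡
                (trans (cong +_ n≡) (pos-* j p))) (trans (l k (+ p) (+ j)) (cong (λ z → 0ℤ + k * + j * z) (sym (pos-* p p))))))
          where
          l : ∀ k p j → + 0 + (+ 0 + k * p) * (j * p) ≡ + 0 + k * j * (p * p)
          l = solve-∀

    lifts : ∀ n .{{_ : NonZero n}} → p ∣ n → ∀ r →
      Σ< p (λ u → 𝟙 (P (+ (u ℕ.* n ℕ.+ r)) ≅? 0ℤ [ p ℕ.* n ])) ≡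
      𝟙 (P (+ r) ≅? 0ℤ [ n ]) * 𝟙 (¬? (D ≅? 0ℤ [ p ]))
    lifts n p∣n r = lifts′ n p∣n r (P (+ r) ≅? 0ℤ [ n ])

    -- For p prime to D each root lifts in exactly one way. If p divides D the slope P′(r) is 0
    -- modulo p, and `Fundamental` excludes every lift.
    ρ-lift : ∀ n .{{_ : NonZero n}} → p ∣ n → ρ (p ℕ.* n) ≡ ρ n * 𝟙 (¬? (D ≅? 0ℤ [ p ]))
    ρ-lift n p∣n = trans (Σ-blocks p n _) (trans (Σ-swap p n _)
      (trans (Σ-cong′ n (lifts n p∣n)) (Σ-*ʳ n (𝟙 (¬? (D ≅? 0ℤ [ p ]))) _)))

prime-divisor : ∀ n → 1 ℕ.< n → ∃[ p ] Prime p × p ∣ n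
prime-divisor n@(suc _) 1<n = find (factors (factorise n)) factorsPrime isFactorisation
  where
  open PrimeFactorisation (factorise n) using (isFactorisation; factorsPrime)
  find : ∀ qs → All Prime qs → n ≡ product qs → ∃[ p ] Prime p × p ∣ n
  find []       _          eq = ⊥-elim (ℕ.<⇒≢ 1<n (sym eq))
  find (q ∷ qs) (pr ∷ _) eq = q , pr , subst (q ∣_) (sym eq) (ℕ∣.m∣m*n (product qs))

factor-out : ∀ p → Prime p → ∀ n → 1 ℕ.≤ n →
             ∃[ k ] ∃[ u ] n ≡ p ℕ.^ k ℕ.* u × ¬ p ∣ u × 1 ℕ.≤ u
factor-out p pr = <-rec (λ n → 1 ℕ.≤ n → ∃[ k ] ∃[ u ] n ≡ p ℕ.^ k ℕ.* u × ¬ p ∣ u × 1 ℕ.≤ u) step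
  where
  step : ∀ n → (∀ {j} → j ℕ.< n → 1 ℕ.≤ j → ∃[ k ] ∃[ u ] j ≡ p ℕ.^ k ℕ.* u × ¬ p ∣ u × 1 ℕ.≤ u) →
         1 ℕ.≤ n → ∃[ k ] ∃[ u ] n ≡ p ℕ.^ k ℕ.* u × ¬ p ∣ u × 1 ℕ.≤ u
  step n rec 1≤n with p ∣? n
  ... | no p∤n = 0 , n , sym (ℕ.+-identityʳ n) , p∤n , 1≤n
  ... | yes (ℕ∣.divides j refl) with rec (ℕ.m<m*n j p {{ℕ.>-nonZero 1≤j}} (prime>1 pr)) 1≤j
    where
    1≤j : 1 ℕ.≤ j
    1≤j = ℕ.n≢0⇒n>0 λ { refl → ℕ.<⇒≢ 1≤n refl }
  ... | k , u , eq , p∤u , 1≤u = suc k , u , trans (cong (ℕ._* p) eq) (lemma (p ℕ.^ k) u p) , p∤u , 1≤u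
    where
    lemma : ∀ q u p → q ℕ.* u ℕ.* p ≡ p ℕ.* q ℕ.* u
    lemma = ℕSolver.solve-∀

coprime-^ : ∀ {p d} k → Coprime d p → Coprime d (p ℕ.^ k)
coprime-^ zero    c (_ , e∣1) = ℕ∣.∣1⇒≡1 e∣1
coprime-^ {p} {d} (suc k) c {e} (e∣d , e∣pq) = coprime-^ k c (e∣d ,
  coprime-divisor (λ (f∣e , f∣p) → c (ℕ∣.∣-trans f∣e e∣d , f∣p)) e∣pq)

Trit : ℤ → Set
Trit c = c ≡ 0ℤ ⊎ Sign c

Trit-square² : ∀ {c} → Trit c → c * c * (c * c) ≡ c * c
Trit-square² (inj₁ refl)        = refl
Trit-square² (inj₂ (inj₁ refl)) = refl
Trit-square² (inj₂ (inj₂ refl)) = refl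

module IdealCount (s t : ℤ) (X : ℤ → ℤ) (kron : Kronecker (Roots.D s t) X)
  (fund : Roots.Fundamental s t) where

  open Roots s t
  open Kronecker kron

  χ⁺ : ℕ → ℤ
  χ⁺ d = X (+ d)

  χ-Trit : ∀ d → Trit (χ⁺ d)
  χ-Trit d with coprime? d ∣ D ∣
  ... | yes c = inj₂ (χ-Sign {+ d} c)
  ... | no ¬c = inj₁ (χ-zero {+ d} ¬c)

  prime∣D⇒χ≡0 : ∀ {p} → Prime p → D ≅ 0ℤ [ p ] → χ⁺ p ≡ 0ℤ
  prime∣D⇒χ≡0 {p} pr e = χ-zero {+ p} λ c → ℕ.<⇒≢ (prime>1 pr) (sym (c (ℕ∣.∣-refl , ≅0⇒∣ e)))

  prime∤D⇒Sign : ∀ {p} → Prime p → ¬ D ≅ 0ℤ [ p ] → Sign (χ⁺ p)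
  prime∤D⇒Sign {p} pr e = χ-Sign {+ p} (Coprime.sym (≇0⇒coprime pr e))

  -- Completing the square: r ↦ 2r - s permutes the residues modulo an odd p and carries the roots
  -- of P to the square roots of D.
  ρ-odd-prime : ∀ h → (pr : Prime (suc (h ℕ.+ h))) → ρ (suc (h ℕ.+ h)) ≡ 1ℤ + χ⁺ (suc (h ℕ.+ h))
  ρ-odd-prime h pr = trans (Σ-cong′ p λ r → 𝟙-cong (P (+ r) ≅? 0ℤ [ p ]) (D ≅? + π r * + π r [ p ]) (to r) (from r))
    (trans (Σ-reindex p p π (λ y → 𝟙 (D ≅? + y * + y [ p ])) π< (injective⇒onto p π π< π-injective) π-injective)
      (trans (roots-count D) (cong (_+_ 1ℤ) (sym (χ-prime h pr)))))
    where
    open OddPrime h pr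
    v : ℕ → ℤ
    v r = + 2 * + r - s
    π : ℕ → ℕ
    π r = v r %ℕ p
    π< : ∀ r → r ℕ.< p → π r ℕ.< p
    π< r _ = n%ℕd<d (v r) p
    π-injective : ∀ i j → i ℕ.< p → j ℕ.< p → π i ≡ π j → i ≡ j
    π-injective i j i<p j<p eq = ≅-small (prime-cancelˡ pr (+ 2) 2≇0
      (≅-trans (≅-reflexive (l (+ i) s)) (≅-trans (≅-+ (≅-trans (residue (v i) p)
        (≅-trans (≅-reflexive (cong +_ eq)) (≅-sym (residue (v j) p)))) (≅-refl {x = s})) (≅-reflexive (sym (l (+ j) s)))))) i<p j<p
      where
      l : ∀ i s → + 2 * i ≡ + 2 * i - s + s
      l = solve-∀
    square : ∀ r → + π r * + π r ≅ D + + 4 * P (+ r) [ p ]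
    square r = ≅-trans (≅-* (≅-sym (residue (v r) p)) (≅-sym (residue (v r) p))) (≅-reflexive (derivative² (+ r)))
    to : ∀ r → P (+ r) ≅ 0ℤ [ p ] → D ≅ + π r * + π r [ p ]
    to r e = ≅-trans (≅-reflexive (sym (+-identityʳ D))) (≅-trans (≅-+ (≅-refl {x = D}) (≅-* (≅-refl {x = + 4}) (≅-sym e))) (≅-sym (square r)))
    from : ∀ r → D ≅ + π r * + π r [ p ] → P (+ r) ≅ 0ℤ [ p ]
    from r e = [ ⊥-elim ∘ 2≇0 , [ ⊥-elim ∘ 2≇0 , id ]′ ∘ ≅0-* pr ]′ (≅0-* pr
      (≅-trans (≅-reflexive (l D (P (+ r)))) (≅-trans (≅-- (≅-sym (square r)) e) (≅-reflexive (+-inverseʳ (+ π r * + π r))))))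
      where
      l : ∀ d x → + 2 * (+ 2 * x) ≡ d + + 4 * x - d
      l = solve-∀

  -- For odd s, D = s² - 4t is 1 or 5 modulo 8 according to the parity of t, and P has two roots or
  -- none. For even s, 2 divides D and there is one root.
  ρ-2 : ρ 2 ≡ 1ℤ + χ⁺ 2
  ρ-2 = trans (cong (_+ 𝟙 (P (+ 1) ≅? 0ℤ [ 2 ])) (+-identityˡ (𝟙 (P (+ 0) ≅? 0ℤ [ 2 ])))) (cases (parity s) (parity t))
    where
    1≇0 : ¬ 1ℤ ≅ 0ℤ [ 2 ]
    1≇0 e with ≅-small {2} {1} {0} e (s≤s (s≤s z≤n)) (s≤s z≤n)
    ... | ()
    yes! : ∀ {x} → x ≅ 0ℤ [ 2 ] → 𝟙 (x ≅? 0ℤ [ 2 ]) ≡ 1ℤ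
    yes! {x} e = 𝟙-yes (x ≅? 0ℤ [ 2 ]) e
    no! : ∀ {x} → x ≅ 1ℤ [ 2 ] → 𝟙 (x ≅? 0ℤ [ 2 ]) ≡ 0ℤ
    no! {x} e = 𝟙-no (x ≅? 0ℤ [ 2 ]) λ z → 1≇0 (≅-trans (≅-sym e) z)
    cases : Parity s → Parity t → 𝟙 (P (+ 0) ≅? 0ℤ [ 2 ]) + 𝟙 (P (+ 1) ≅? 0ℤ [ 2 ]) ≡ 1ℤ + χ⁺ 2
    cases (even j refl) (even k refl) = trans (cong₂ _+_ (yes! {P (+ 0)} (cg k (l₀ j k))) (no! {P (+ 1)} (cg (k - j) (l₁ j k))))
      (cong (_+_ 1ℤ) (sym (prime∣D⇒χ≡0 prime[2] (cg (+ 2 * (j * j) - + 4 * k) (l₂ j k)))))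
      where
      l₀ : ∀ j k → + 0 * + 0 - + 2 * j * + 0 + + 2 * k ≡ + 0 + k * + 2
      l₀ = solve-∀
      l₁ : ∀ j k → + 1 * + 1 - + 2 * j * + 1 + + 2 * k ≡ + 1 + (k - j) * + 2
      l₁ = solve-∀
      l₂ : ∀ j k → + 2 * j * (+ 2 * j) - + 4 * (+ 2 * k) ≡ + 0 + (+ 2 * (j * j) - + 4 * k) * + 2
      l₂ = solve-∀
    cases (even j refl) (odd k refl) = trans (cong₂ _+_ (no! {P (+ 0)} (cg k (l₀ j k))) (yes! {P (+ 1)} (cg (1ℤ + k - j) (l₁ j k))))
      (cong (_+_ 1ℤ) (sym (prime∣D⇒χ≡0 prime[2] (cg (+ 2 * (j * j) - + 2 - + 4 * k) (l₂ j k)))))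
      where
      l₀ : ∀ j k → + 0 * + 0 - + 2 * j * + 0 + (+ 1 + + 2 * k) ≡ + 1 + k * + 2
      l₀ = solve-∀
      l₁ : ∀ j k → + 1 * + 1 - + 2 * j * + 1 + (+ 1 + + 2 * k) ≡ + 0 + (+ 1 + k - j) * + 2
      l₁ = solve-∀
      l₂ : ∀ j k → + 2 * j * (+ 2 * j) - + 4 * (+ 1 + + 2 * k) ≡ + 0 + (+ 2 * (j * j) - + 2 - + 4 * k) * + 2
      l₂ = solve-∀
    cases (odd j refl) (even k refl) = trans (cong₂ _+_ (yes! {P (+ 0)} (cg k (l₀ j k))) (yes! {P (+ 1)} (cg (k - j) (l₁ j k))))
      (cong (_+_ 1ℤ) (sym (χ-two₁ (cg (proj₁ (odd-square j) - k)
        (trans (cong (_- + 4 * (+ 2 * k)) (proj₂ (odd-square j))) (l₂ (proj₁ (odd-square j)) k))))))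
      where
      l₀ : ∀ j k → + 0 * + 0 - (+ 1 + + 2 * j) * + 0 + + 2 * k ≡ + 0 + k * + 2
      l₀ = solve-∀
      l₁ : ∀ j k → + 1 * + 1 - (+ 1 + + 2 * j) * + 1 + + 2 * k ≡ + 0 + (k - j) * + 2
      l₁ = solve-∀
      l₂ : ∀ u k → + 1 + + 8 * u - + 4 * (+ 2 * k) ≡ + 1 + (u - k) * + 8
      l₂ = solve-∀
    cases (odd j refl) (odd k refl) = trans (cong₂ _+_ (no! {P (+ 0)} (cg k (l₀ j k))) (no! {P (+ 1)} (cg (k - j) (l₁ j k))))
      (cong (_+_ 1ℤ) (sym (χ-two₅ (cg (proj₁ (odd-square j) - k - 1ℤ)
        (trans (cong (_- + 4 * (1ℤ + + 2 * k)) (proj₂ (odd-square j))) (l₂ (proj₁ (odd-square j)) k))))))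
      where
      l₀ : ∀ j k → + 0 * + 0 - (+ 1 + + 2 * j) * + 0 + (+ 1 + + 2 * k) ≡ + 1 + k * + 2
      l₀ = solve-∀
      l₁ : ∀ j k → + 1 * + 1 - (+ 1 + + 2 * j) * + 1 + (+ 1 + + 2 * k) ≡ + 1 + (k - j) * + 2
      l₁ = solve-∀
      l₂ : ∀ u k → + 1 + + 8 * u - + 4 * (+ 1 + + 2 * k) ≡ + 5 + (u - k - + 1) * + 8
      l₂ = solve-∀

  ρ-prime : ∀ p → Prime p → ρ p ≡ 1ℤ + χ⁺ p
  ρ-prime p pr = cases (parity (+ p))
    where
    cases : Parity (+ p) → ρ p ≡ 1ℤ + χ⁺ p
    cases (odd j eq) with odd⇒OddNat p (cg j (trans eq (cong (_+_ 1ℤ) (*-comm (+ 2) j))))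
    ... | h , refl = ρ-odd-prime h pr
    cases (even j eq) with prime⇒irreducible pr (subst (2 ∣_) (sym (trans (cong ∣_∣ eq) (abs-* (+ 2) j))) (ℕ∣.m∣m*n ∣ j ∣))
    ... | inj₁ ()
    ... | inj₂ refl = ρ-2

  module AtPrime (p : ℕ) (pr : Prime p) where

    c : ℤ
    c = χ⁺ p

    private
      instance
        p≢0 : NonZero p
        p≢0 = prime⇒nonZero pr

    pw≢0 : ∀ k → NonZero (p ℕ.^ k)
    pw≢0 k = ℕ.m^n≢0 p k

    𝟙-unramified : 𝟙 (¬? (D ≅? 0ℤ [ p ])) ≡ c * c
    𝟙-unramified = cases (D ≅? 0ℤ [ p ])
      where
      cases : (d : Dec (D ≅ 0ℤ [ p ])) → 𝟙 (¬? d) ≡ c * c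
      cases (yes e) = sym (cong (λ z → z * z) (prime∣D⇒χ≡0 pr e))
      cases (no ¬e) = sym (Sign-square (prime∤D⇒Sign pr ¬e))

    ρ-pp : ∀ k → ρ (p ℕ.^ suc (suc k)) ≡ (1ℤ + c) * (c * c)
    ρ-pp k = trans (PrimePower.ρ-lift fund p pr (p ℕ.^ suc k) {{pw≢0 (suc k)}} (ℕ∣.m∣m*n (p ℕ.^ k)))
      (trans (cong (ρ (p ℕ.^ suc k) *_) 𝟙-unramified) (rest k))
      where
      rest : ∀ k → ρ (p ℕ.^ suc k) * (c * c) ≡ (1ℤ + c) * (c * c)
      rest zero    = cong (_* (c * c)) (trans (cong ρ (ℕ.*-identityʳ p)) (ρ-prime p pr))
      rest (suc k) = trans (cong (_* (c * c)) (ρ-pp k))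
        (trans (*-assoc (1ℤ + c) (c * c) (c * c)) (cong ((1ℤ + c) *_) (Trit-square² (χ-Trit p))))

  R : ℕ → ℤ
  R n = Σ< (suc n) λ d → 𝟙 (d ∣? n) * χ⁺ d

  R-range : ∀ n M → 1 ℕ.≤ n → n ℕ.< M → Σ< M (λ d → 𝟙 (d ∣? n) * χ⁺ d) ≡ R n
  R-range n M 1≤n n<M = Σ-extend n<M λ d n<d → trans
    (cong (_* χ⁺ d) (𝟙-no (d ∣? n) (ℕ∣.>⇒∤ {{ℕ.>-nonZero 1≤n}} n<d))) (*-zeroˡ (χ⁺ d))

  -- The number of ideals of norm n: such an ideal is g times a primitive one of norm a, with n = g²
  -- a, and the primitive ideals of norm a are ℤ a + ℤ (ω - r) for the roots r of P modulo a.
  A : ℕ → ℤ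
  A n = Σ< (suc n) λ g → Σ< (suc n) λ a → 𝟙 (g ℕ.* g ℕ.* a ℕ.≟ n) * ρ a

  A-off : ∀ n g a → 1 ℕ.≤ n → n ℕ.< g ⊎ n ℕ.< a → 𝟙 (g ℕ.* g ℕ.* a ℕ.≟ n) * ρ a ≡ 0ℤ
  A-off n g a 1≤n lt = trans (cong (_* ρ a) (𝟙-no (g ℕ.* g ℕ.* a ℕ.≟ n) λ eq → contradiction eq lt)) (*-zeroˡ (ρ a))
    where
    contradiction : g ℕ.* g ℕ.* a ≡ n → ¬ (n ℕ.< g ⊎ n ℕ.< a)
    contradiction refl = λ { (inj₁ lt) → ℕ.<⇒≱ lt (ℕ.≤-trans (ℕ.m≤m*n g (g ℕ.* a) {{ga≢0}}) (ℕ.≤-reflexive (sym (ℕ.*-assoc g g a))))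
                           ; (inj₂ lt) → ℕ.<⇒≱ lt (ℕ.m≤n*m a (g ℕ.* g) {{gg≢0}}) }
      where
      gga≢0 : NonZero (g ℕ.* g ℕ.* a)
      gga≢0 = ℕ.>-nonZero 1≤n
      gg≢0 : NonZero (g ℕ.* g)
      gg≢0 = ℕ.m*n≢0⇒m≢0 (g ℕ.* g) {{gga≢0}}
      ga≢0 : NonZero (g ℕ.* a)
      ga≢0 = ℕ.m*n≢0⇒n≢0 g {{subst NonZero (ℕ.*-assoc g g a) gga≢0}}

  A-range : ∀ n M₁ M₂ → 1 ℕ.≤ n → n ℕ.< M₁ → n ℕ.< M₂ →
            Σ< M₁ (λ g → Σ< M₂ λ a → 𝟙 (g ℕ.* g ℕ.* a ℕ.≟ n) * ρ a) ≡ A n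
  A-range n M₁ M₂ 1≤n n<M₁ n<M₂ = trans
    (Σ-extend n<M₁ λ g n<g → Σ-zero M₂ λ a _ → A-off n g a 1≤n (inj₁ n<g))
    (Σ-cong′ (suc n) λ g → Σ-extend n<M₂ λ a n<a → A-off n g a 1≤n (inj₂ n<a))

  module Factor (p : ℕ) (pr : Prime p) (u : ℕ) (p∤u : ¬ p ∣ u) (1≤u : 1 ℕ.≤ u) where

    open AtPrime p pr

    private
      instance
        p≢0 : NonZero p
        p≢0 = prime⇒nonZero pr

      1≤p^ : ∀ k → 1 ℕ.≤ p ℕ.^ k
      1≤p^ k = ℕ.>-nonZero⁻¹ (p ℕ.^ k) {{pw≢0 k}}

      1≤n : ∀ k → 1 ℕ.≤ p ℕ.^ k ℕ.* u
      1≤n k = ℕ.*-mono-≤ (1≤p^ k) 1≤u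

      u≤n : ∀ k → u ℕ.≤ p ℕ.^ k ℕ.* u
      u≤n k = ℕ.m≤n*m u (p ℕ.^ k) {{pw≢0 k}}

      ∤⇒coprime-^ : ∀ k {d} → ¬ p ∣ d → Coprime d (p ℕ.^ k)
      ∤⇒coprime-^ k p∤d = coprime-^ k (∤⇒coprime pr p∤d)

    -- The divisors divisible by p are p times the divisors of p^k u; the others are the divisors of
    -- u.
    R-step : ∀ k → R (p ℕ.^ suc k ℕ.* u) ≡ R u + c * R (p ℕ.^ k ℕ.* u)
    R-step k = trans (sym (R-range N (suc n ℕ.* p) (1≤n (suc k)) N<))
      (trans (Σ-by-divisibility p (suc n ℕ.* p) F)
      (trans (cong₂ _+_ (trans (Σ-multiples p (suc n) F) divisible) prime-to)
        (+-comm (c * R n) (R u))))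
      where
      n = p ℕ.^ k ℕ.* u
      N = p ℕ.^ suc k ℕ.* u
      N≡ : N ≡ n ℕ.* p
      N≡ = lemma p (p ℕ.^ k) u
        where
        lemma : ∀ p q u → p ℕ.* q ℕ.* u ≡ q ℕ.* u ℕ.* p
        lemma = ℕSolver.solve-∀
      N< : N ℕ.< suc n ℕ.* p
      N< = ℕ.≤-trans (ℕ.≤-reflexive (cong suc N≡)) (ℕ.+-monoˡ-≤ (n ℕ.* p) (ℕ.<⇒≤ (prime>1 pr)))
      F : ℕ → ℤ
      F d = 𝟙 (d ∣? N) * χ⁺ d
      divisible : Σ< (suc n) (λ e → F (e ℕ.* p)) ≡ c * R n
      divisible = trans (Σ-cong′ (suc n) λ e → trans (cong₂ _*_
          (𝟙-cong (e ℕ.* p ∣? N) (e ∣? n)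
            (λ d → ℕ∣.*-cancelʳ-∣ p (subst (e ℕ.* p ∣_) N≡ d))
            (λ d → subst (e ℕ.* p ∣_) (sym N≡) (ℕ∣.*-monoˡ-∣ p d)))
          (trans (cong X (pos-* e p)) (χ-* (+ e) (+ p))))
          (lemma (𝟙 (e ∣? n)) (χ⁺ e) c))
        (Σ-*ˡ (suc n) c (λ e → 𝟙 (e ∣? n) * χ⁺ e))
        where
        lemma : ∀ a b c → a * (b * c) ≡ c * (a * b)
        lemma = solve-∀
      prime-to : Σ< (suc n ℕ.* p) (λ d → 𝟙 (¬? (p ∣? d)) * F d) ≡ R u
      prime-to = trans (Σ-cong′ (suc n ℕ.* p) λ d → cases d (p ∣? d))
        (R-range u (suc n ℕ.* p) 1≤u (ℕ.≤-<-trans (u≤n (suc k)) N<))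
        where
        cases : ∀ d (dec : Dec (p ∣ d)) → 𝟙 (¬? dec) * F d ≡ 𝟙 (d ∣? u) * χ⁺ d
        cases d (yes p∣d) = trans (*-zeroˡ (F d)) (sym (trans
          (cong (_* χ⁺ d) (𝟙-no (d ∣? u) λ d∣u → p∤u (ℕ∣.∣-trans p∣d d∣u))) (*-zeroˡ (χ⁺ d))))
        cases d (no p∤d) = trans (*-identityˡ (F d)) (cong (_* χ⁺ d) (𝟙-cong (d ∣? N) (d ∣? u)
          (coprime-divisor (∤⇒coprime-^ (suc k) p∤d)) (ℕ∣.∣n⇒∣m*n (p ℕ.^ suc k))))

    A-term : ℕ → ℕ → ℕ → ℤ
    A-term n g a = 𝟙 (g ℕ.* g ℕ.* a ℕ.≟ n) * ρ a

    -- If p does not divide g, the full power q divides a, and the cofactor a / q is prime to p, so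
    -- ρ(a) = ρ(q) ρ(a / q).
    prime-to-part : ∀ k M → let q = p ℕ.^ k in u ℕ.< M →
      Σ< (M ℕ.* p) (λ g → 𝟙 (¬? (p ∣? g)) * Σ< (M ℕ.* q) (A-term (q ℕ.* u) g)) ≡ ρ q * A u
    prime-to-part k M u<M = trans (Σ-cong′ (M ℕ.* p) λ g → cases g (p ∣? g))
      (trans (Σ-*ˡ (M ℕ.* p) (ρ q) (λ g → Σ< M (A-term u g)))
        (cong (ρ q *_) (A-range u (M ℕ.* p) M 1≤u (ℕ.<-≤-trans u<M (ℕ.m≤m*n M p)) u<M)))
      where
      q = p ℕ.^ k
      instance
        q≢0 : NonZero q
        q≢0 = pw≢0 k
      cases : ∀ g (d : Dec (p ∣ g)) → 𝟙 (¬? d) * Σ< (M ℕ.* q) (A-term (q ℕ.* u) g) ≡ ρ q * Σ< M (A-term u g)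
      cases g (yes p∣g) = trans (*-zeroˡ (Σ< (M ℕ.* q) (A-term (q ℕ.* u) g)))
        (sym (trans (cong (ρ q *_) (Σ-zero M λ a _ → trans (cong (_* ρ a)
            (𝟙-no (g ℕ.* g ℕ.* a ℕ.≟ u) λ eq → p∤u (subst (p ∣_) eq (ℕ∣.∣m⇒∣m*n a (ℕ∣.∣m⇒∣m*n g p∣g)))))
            (*-zeroˡ (ρ a)))) (*-zeroʳ (ρ q))))
      cases g (no p∤g) = trans (*-identityˡ _)
        (trans (Σ-cong′ (M ℕ.* q) λ a → multiples-only a (q ∣? a))
        (trans (Σ-multiples q M (A-term (q ℕ.* u) g))
        (trans (Σ-cong′ M λ b → scaled b) (Σ-*ˡ M (ρ q) (A-term u g)))))
        where
        p∤gg : ¬ p ∣ g ℕ.* g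
        p∤gg d = [ p∤g , p∤g ]′ (euclidsLemma g g pr d)
        multiples-only : ∀ a (d : Dec (q ∣ a)) → A-term (q ℕ.* u) g a ≡ 𝟙 d * A-term (q ℕ.* u) g a
        multiples-only a (yes _) = sym (*-identityˡ (A-term (q ℕ.* u) g a))
        multiples-only a (no q∤a) = trans (trans (cong (_* ρ a) (𝟙-no (g ℕ.* g ℕ.* a ℕ.≟ q ℕ.* u) λ eq →
            q∤a (coprime-divisor (Coprime.sym (∤⇒coprime-^ k p∤gg)) (subst (q ∣_) (sym eq) (ℕ∣.m∣m*n u)))))
            (*-zeroˡ (ρ a))) (sym (*-zeroˡ (A-term (q ℕ.* u) g a)))
        swap : ∀ b → g ℕ.* g ℕ.* (b ℕ.* q) ≡ q ℕ.* (g ℕ.* g ℕ.* b)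
        swap b = lemma g b q
          where
          lemma : ∀ g b q → g ℕ.* g ℕ.* (b ℕ.* q) ≡ q ℕ.* (g ℕ.* g ℕ.* b)
          lemma = ℕSolver.solve-∀
        scaled : ∀ b → A-term (q ℕ.* u) g (b ℕ.* q) ≡ ρ q * A-term u g b
        scaled b = trans (cong (_* ρ (b ℕ.* q)) (𝟙-cong (g ℕ.* g ℕ.* (b ℕ.* q) ℕ.≟ q ℕ.* u) (g ℕ.* g ℕ.* b ℕ.≟ u)
            (λ eq → ℕ.*-cancelˡ-≡ (g ℕ.* g ℕ.* b) u q (trans (sym (swap b)) eq))
            (λ eq → trans (swap b) (cong (q ℕ.*_) eq))))
          (trans (𝟙* (g ℕ.* g ℕ.* b ℕ.≟ u) λ eq → trans (cong ρ (ℕ.*-comm b q))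
              (ρ-* q b {{q≢0}} {{b≢0 eq}} (Coprime.sym (∤⇒coprime-^ k (p∤b eq)))))
            (lemma (𝟙 (g ℕ.* g ℕ.* b ℕ.≟ u)) (ρ q) (ρ b)))
          where
          lemma : ∀ x y z → x * (y * z) ≡ y * (x * z)
          lemma = solve-∀
          b≢0 : g ℕ.* g ℕ.* b ≡ u → NonZero b
          b≢0 eq = ℕ.m*n≢0⇒n≢0 (g ℕ.* g) {{subst NonZero (sym eq) (ℕ.>-nonZero 1≤u)}}
          p∤b : g ℕ.* g ℕ.* b ≡ u → ¬ p ∣ b
          p∤b eq p∣b = p∤u (subst (p ∣_) eq (ℕ∣.∣n⇒∣m*n (g ℕ.* g) p∣b))

    A-split : ∀ k M → u ℕ.< M → p ℕ.^ k ℕ.* u ℕ.< M → let q = p ℕ.^ k in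
      A (q ℕ.* u) ≡ Σ< M (λ g → Σ< (M ℕ.* q) (A-term (q ℕ.* u) (g ℕ.* p))) + ρ q * A u
    A-split k M u<M n<M = trans (sym (A-range (q ℕ.* u) (M ℕ.* p) (M ℕ.* q) (1≤n k)
        (ℕ.<-≤-trans n<M (ℕ.m≤m*n M p)) (ℕ.<-≤-trans n<M (ℕ.m≤m*n M q {{pw≢0 k}}))))
      (trans (Σ-by-divisibility p (M ℕ.* p) (λ g → Σ< (M ℕ.* q) (A-term (q ℕ.* u) g)))
        (cong₂ _+_ (Σ-multiples p M (λ g → Σ< (M ℕ.* q) (A-term (q ℕ.* u) g))) (prime-to-part k M u<M)))
      where
      q = p ℕ.^ k

    A-one : A (p ℕ.^ 1 ℕ.* u) ≡ (1ℤ + c) * A u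
    A-one = trans (A-split 1 M (s≤s (u≤n 1)) (ℕ.n<1+n _))
      (trans (cong₂ _+_ (Σ-zero M λ g _ → Σ-zero (M ℕ.* p ℕ.^ 1) λ a _ → none g a)
          (cong (_* A u) (trans (cong ρ (ℕ.*-identityʳ p)) (ρ-prime p pr))))
        (+-identityˡ _))
      where
      M = suc (p ℕ.^ 1 ℕ.* u)
      none : ∀ g a → A-term (p ℕ.^ 1 ℕ.* u) (g ℕ.* p) a ≡ 0ℤ
      none g a = trans (cong (_* ρ a) (𝟙-no (g ℕ.* p ℕ.* (g ℕ.* p) ℕ.* a ℕ.≟ p ℕ.^ 1 ℕ.* u) λ eq →
        p∤u (ℕ∣.divides (g ℕ.* g ℕ.* a) (sym (ℕ.*-cancelˡ-≡ (g ℕ.* g ℕ.* a ℕ.* p) u p (trans (lemma g p a) (trans eq (cong (ℕ._* u) (ℕ.*-identityʳ p)))))))))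
        (*-zeroˡ (ρ a))
        where
        lemma : ∀ g p a → p ℕ.* (g ℕ.* g ℕ.* a ℕ.* p) ≡ g ℕ.* p ℕ.* (g ℕ.* p) ℕ.* a
        lemma = ℕSolver.solve-∀

    -- For p ∣ g replace g by g / p, which divides n by p². The terms with g prime to p contribute
    -- the factor ρ(p^{k+2}), constant from the second power on.
    A-step : ∀ k → A (p ℕ.^ suc (suc k) ℕ.* u) ≡ A (p ℕ.^ k ℕ.* u) + (1ℤ + c) * (c * c) * A u
    A-step k = trans (A-split (suc (suc k)) M (s≤s (u≤n (suc (suc k)))) (ℕ.n<1+n _))
      (cong₂ _+_ (trans (Σ-cong′ M λ g → Σ-cong′ (M ℕ.* p ℕ.^ suc (suc k)) λ a → descend g a)
          (A-range n M (M ℕ.* p ℕ.^ suc (suc k)) (1≤n k) n<M (ℕ.<-≤-trans n<M (ℕ.m≤m*n M (p ℕ.^ suc (suc k)) {{pw≢0 (suc (suc k))}}))))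
        (cong (_* A u) (ρ-pp k)))
      where
      n = p ℕ.^ k ℕ.* u
      N = p ℕ.^ suc (suc k) ℕ.* u
      M = suc N
      N≡ : N ≡ p ℕ.* p ℕ.* n
      N≡ = lemma p (p ℕ.^ k) u
        where
        lemma : ∀ p q u → p ℕ.* (p ℕ.* q) ℕ.* u ≡ p ℕ.* p ℕ.* (q ℕ.* u)
        lemma = ℕSolver.solve-∀
      instance
        pp≢0 : NonZero (p ℕ.* p)
        pp≢0 = ℕ.m*n≢0 p p
      n<M : n ℕ.< M
      n<M = s≤s (ℕ.≤-trans (ℕ.m≤n*m n (p ℕ.* p)) (ℕ.≤-reflexive (sym N≡)))
      descend : ∀ g a → A-term N (g ℕ.* p) a ≡ A-term n g a
      descend g a = cong (_* ρ a) (𝟙-cong (g ℕ.* p ℕ.* (g ℕ.* p) ℕ.* a ℕ.≟ N) (g ℕ.* g ℕ.* a ℕ.≟ n)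
        (λ eq → ℕ.*-cancelˡ-≡ (g ℕ.* g ℕ.* a) n (p ℕ.* p) (trans (lemma g p a) (trans eq N≡)))
        (λ eq → trans (sym (lemma g p a)) (trans (cong (p ℕ.* p ℕ.*_) eq) (sym N≡))))
        where
        lemma : ∀ g p a → p ℕ.* p ℕ.* (g ℕ.* g ℕ.* a) ≡ g ℕ.* p ℕ.* (g ℕ.* p) ℕ.* a
        lemma = ℕSolver.solve-∀

    -- Both sides satisfy a two-step recursion in k; for ramified p (c = 0) the
    -- recursion for R gives R u in every degree, as does the one for A.

    A≡R-powers : A u ≡ R u → ∀ k → A (p ℕ.^ k ℕ.* u) ≡ R (p ℕ.^ k ℕ.* u) × (c ≡ 0ℤ → R (p ℕ.^ k ℕ.* u) ≡ R u)
    A≡R-powers eq k = proj₁ (both k)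
      where
      Claim : ℕ → Set
      Claim k = A (p ℕ.^ k ℕ.* u) ≡ R (p ℕ.^ k ℕ.* u) × (c ≡ 0ℤ → R (p ℕ.^ k ℕ.* u) ≡ R u)
      1*u : p ℕ.^ 0 ℕ.* u ≡ u
      1*u = ℕ.*-identityˡ u
      both : ∀ k → Claim k × Claim (suc k)
      both zero = (trans (cong A 1*u) (trans eq (cong R (sym 1*u))) , λ _ → cong R 1*u) ,
        (trans A-one (trans (cong ((1ℤ + c) *_) eq) (trans (lemma c (R u)) (sym (trans (R-step 0) (cong (λ z → R u + c * R z) 1*u))))) ,
         λ c≡0 → trans (R-step 0) (trans (cong (λ z → R u + z * R (p ℕ.^ 0 ℕ.* u)) c≡0) (trans (cong (_+_ (R u)) (*-zeroˡ (R (p ℕ.^ 0 ℕ.* u)))) (+-identityʳ (R u)))))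
        where
        lemma : ∀ c r → (+ 1 + c) * r ≡ r + c * r
        lemma = solve-∀
      both (suc k) = proj₂ (both k) ,
        (trans (A-step k) (trans (cong₂ (λ x y → x + (1ℤ + c) * (c * c) * y) (proj₁ (proj₁ (both k))) eq) (cases (χ-Trit p))) ,
         λ c≡0 → trans (R-step (suc k)) (trans (cong (λ z → R u + z * R (p ℕ.^ suc k ℕ.* u)) c≡0) (trans (cong (_+_ (R u)) (*-zeroˡ (R (p ℕ.^ suc k ℕ.* u)))) (+-identityʳ (R u)))))
        where
        Rk = R (p ℕ.^ k ℕ.* u)
        step² : R (p ℕ.^ suc (suc k) ℕ.* u) ≡ R u + c * (R u + c * Rk)
        step² = trans (R-step (suc k)) (cong (λ z → R u + c * z) (R-step k))
        cases : Trit c → Rk + (1ℤ + c) * (c * c) * R u ≡ R (p ℕ.^ suc (suc k) ℕ.* u)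
        cases (inj₁ c≡0) = trans (cong₂ (λ x z → x + (1ℤ + z) * (z * z) * R u) (proj₂ (proj₁ (both k)) c≡0) c≡0)
          (trans (lemma (R u) Rk) (sym (trans step² (cong (λ z → R u + z * (R u + z * Rk)) c≡0))))
          where
          lemma : ∀ r x → r + (+ 1 + + 0) * (+ 0 * + 0) * r ≡ r + + 0 * (r + + 0 * x)
          lemma = solve-∀
        cases (inj₂ σ) = trans (cong (λ z → Rk + (1ℤ + c) * z * R u) (Sign-square σ))
          (trans (lemma Rk c (R u)) (trans (cong (λ z → R u + c * R u + z * Rk) (sym (Sign-square σ)))
            (trans (lemma₂ Rk c (R u)) (sym step²))))
          where
          lemma : ∀ x c r → x + (+ 1 + c) * + 1 * r ≡ r + c * r + + 1 * x
          lemma = solve-∀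
          lemma₂ : ∀ x c r → r + c * r + c * c * x ≡ r + c * (r + c * x)
          lemma₂ = solve-∀

  A≡R : ∀ n → 1 ℕ.≤ n → A n ≡ R n
  A≡R = <-rec (λ n → 1 ℕ.≤ n → A n ≡ R n) step
    where
    base : A 1 ≡ R 1
    base = trans (trans (lemma (ρ 0) (ρ 1)) ρ-1) (sym (trans (cong₂ _+_ (trans (+-identityˡ _) (*-zeroˡ (χ⁺ 0))) (*-identityˡ (χ⁺ 1))) (trans (+-identityˡ (χ⁺ 1)) χ-1)))
      where
      lemma : ∀ x y → + 0 + (+ 0 + + 0 * x + + 0 * y) + (+ 0 + + 0 * x + + 1 * y) ≡ y
      lemma = solve-∀
      χ-1 : χ⁺ 1 ≡ 1ℤ
      χ-1 with χ-Sign {1ℤ} (Coprime.1-coprimeTo ∣ D ∣)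
      ... | inj₁ eq = eq
      ... | inj₂ eq = trans (χ-* 1ℤ 1ℤ) (cong (λ z → z * z) eq)
    step : ∀ n → (∀ {j} → j ℕ.< n → 1 ℕ.≤ j → A j ≡ R j) → 1 ℕ.≤ n → A n ≡ R n
    step (suc zero) rec _ = base
    step n@(suc (suc _)) rec _ with prime-divisor n (s≤s (s≤s z≤n))
    ... | p , pr , p∣n = from-factor (factor-out p pr n (s≤s z≤n))
      where
      from-factor : ∃[ k ] ∃[ u ] n ≡ p ℕ.^ k ℕ.* u × ¬ p ∣ u × 1 ℕ.≤ u → A n ≡ R n
      from-factor (zero , u , eq , p∤u , _) = ⊥-elim (p∤u (subst (p ∣_) (trans eq (ℕ.*-identityˡ u)) p∣n))
      from-factor (suc k , u , eq , p∤u , 1≤u) = trans (cong A eq)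
        (trans (proj₁ (Factor.A≡R-powers p pr u p∤u 1≤u (rec u<n 1≤u) (suc k))) (cong R (sym eq)))
        where
        u<n : u ℕ.< n
        u<n = subst (u ℕ.<_) (sym (trans eq (ℕ.*-comm (p ℕ.^ suc k) u)))
          (ℕ.m<m*n u (p ℕ.^ suc k) {{ℕ.>-nonZero 1≤u}}
            (ℕ.<-≤-trans (prime>1 pr) (ℕ.m≤m*n p (p ℕ.^ k) {{ℕ.m^n≢0 p k {{prime⇒nonZero pr}}}})))

-- Orders in quadratic fields and their ideals

signed : ∀ a → ∃[ σ ] σ * σ ≡ 1ℤ × a ≡ σ * + ∣ a ∣
signed (+ n)    = 1ℤ , refl , sym (*-identityˡ (+ n))
signed -[1+ n ] = -1ℤ , refl , sym (-1*i≡-i (+ suc n))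

bezout : ∀ a b → a ≢ 0ℤ → ∃[ e ] ∃[ a′ ] ∃[ b′ ] ∃[ x ] ∃[ y ]
         e ≢ 0ℤ × a ≡ e * a′ × b ≡ e * b′ × x * a′ + y * b′ ≡ 1ℤ
bezout a b a≢0 with signed a | signed b | Bézout.lemma ∣ a ∣ ∣ b ∣
... | σ , σ²≡1 , a≡ | τ , τ²≡1 , b≡ | Bézout.result d gcd-d identity =
  + d , σ * + m′ , τ * + n′ , proj₁ cofactors , proj₁ (proj₂ cofactors) , d≢0 ,
  trans a≡ (trans (cong (σ *_) (trans (cong +_ m≡) (pos-* m′ d))) (swap σ (+ m′) (+ d))) ,
  trans b≡ (trans (cong (τ *_) (trans (cong +_ n≡) (pos-* n′ d))) (swap τ (+ n′) (+ d))) ,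
  proj₂ (proj₂ cofactors)
  where
  module G = GCD.GCD gcd-d
  m′ = ℕ∣.quotient (proj₁ G.commonDivisor)
  n′ = ℕ∣.quotient (proj₂ G.commonDivisor)
  m≡ : ∣ a ∣ ≡ m′ ℕ.* d
  m≡ = ℕ∣._∣_.equality (proj₁ G.commonDivisor)
  n≡ : ∣ b ∣ ≡ n′ ℕ.* d
  n≡ = ℕ∣._∣_.equality (proj₂ G.commonDivisor)
  swap : ∀ s m d → s * (m * d) ≡ d * (s * m)
  swap = solve-∀
  d≢0 : + d ≢ 0ℤ
  d≢0 eq = a≢0 (∣i∣≡0⇒i≡0 (trans m≡ (trans (cong (m′ ℕ.*_) (+-injective eq)) (ℕ.*-zeroʳ m′))))
  cancel-d : ∀ {i j} → i * + d ≡ j * + d → i ≡ j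
  cancel-d {i} {j} = *-cancelʳ-≡ i j (+ d) {{ℕ.≢-nonZero (λ d≡0 → d≢0 (cong +_ d≡0))}}
  plus : ∀ x y → d ℕ.+ y ℕ.* ∣ b ∣ ≡ x ℕ.* ∣ a ∣ → + x * + m′ - + y * + n′ ≡ 1ℤ
  plus x y eq = cancel-d (trans (l₁ (+ x) (+ m′) (+ y) (+ n′) (+ d)) (trans
    (cong₂ (λ p q → + x * p - + y * q) (sym (trans (cong +_ m≡) (pos-* m′ d))) (sym (trans (cong +_ n≡) (pos-* n′ d))))
    (trans (cong₂ _-_ (trans (sym (pos-* x ∣ a ∣)) (trans (cong +_ (sym eq)) (pos-+ d (y ℕ.* ∣ b ∣)))) (sym (pos-* y ∣ b ∣)))
      (l₂ (+ d) (+ (y ℕ.* ∣ b ∣))))))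
    where
    l₁ : ∀ x m y n d → (x * m - y * n) * d ≡ x * (m * d) - y * (n * d)
    l₁ = solve-∀
    l₂ : ∀ d z → d + z - z ≡ + 1 * d
    l₂ = solve-∀
  minus : ∀ x y → d ℕ.+ x ℕ.* ∣ a ∣ ≡ y ℕ.* ∣ b ∣ → + y * + n′ - + x * + m′ ≡ 1ℤ
  minus x y eq = cancel-d (trans (l₁ (+ y) (+ n′) (+ x) (+ m′) (+ d)) (trans
    (cong₂ (λ p q → + y * p - + x * q) (sym (trans (cong +_ n≡) (pos-* n′ d))) (sym (trans (cong +_ m≡) (pos-* m′ d))))
    (trans (cong₂ _-_ (trans (sym (pos-* y ∣ b ∣)) (trans (cong +_ (sym eq)) (pos-+ d (x ℕ.* ∣ a ∣)))) (sym (pos-* x ∣ a ∣)))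
      (l₂ (+ d) (+ (x ℕ.* ∣ a ∣))))))
    where
    l₁ : ∀ x m y n d → (x * m - y * n) * d ≡ x * (m * d) - y * (n * d)
    l₁ = solve-∀
    l₂ : ∀ d z → d + z - z ≡ + 1 * d
    l₂ = solve-∀
  absorb : ∀ x y m n → σ * x * (σ * m) + τ * y * (τ * n) ≡ x * m + y * n
  absorb x y m n = trans (l σ τ x y m n) (cong₂ (λ p q → p * (x * m) + q * (y * n)) σ²≡1 τ²≡1 ⟨trans⟩ l₂ (x * m) (y * n))
    where
    infixl 1 _⟨trans⟩_
    _⟨trans⟩_ : ∀ {i j k : ℤ} → i ≡ j → j ≡ k → i ≡ k
    _⟨trans⟩_ = trans
    l : ∀ σ τ x y m n → σ * x * (σ * m) + τ * y * (τ * n) ≡ σ * σ * (x * m) + τ * τ * (y * n)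
    l = solve-∀
    l₂ : ∀ a b → + 1 * a + + 1 * b ≡ a + b
    l₂ = solve-∀
  cofactors : ∃[ x ] ∃[ y ] x * (σ * + m′) + y * (τ * + n′) ≡ 1ℤ
  cofactors = from-identity identity
    where
    from-identity : Bézout.Identity d ∣ a ∣ ∣ b ∣ → ∃[ x ] ∃[ y ] x * (σ * + m′) + y * (τ * + n′) ≡ 1ℤ
    from-identity (Bézout.+- x y eq) = σ * + x , τ * - + y ,
      trans (absorb (+ x) (- + y) (+ m′) (+ n′)) (trans (l (+ x) (+ m′) (+ y) (+ n′)) (plus x y eq))
      where
      l : ∀ x m y n → x * m + - y * n ≡ x * m - y * n
      l = solve-∀
    from-identity (Bézout.-+ x y eq) = σ * - + x , τ * + y ,
      trans (absorb (- + x) (+ y) (+ m′) (+ n′)) (trans (l (+ x) (+ m′) (+ y) (+ n′)) (minus x y eq))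
      where
      l : ∀ x m y n → - x * m + y * n ≡ y * n - x * m
      l = solve-∀

-- A form (A, B, c) of fundamental discriminant is primitive.

primitive-cancel : ∀ s t → Roots.Fundamental s t → ∀ A r c → Roots.P s t r ≡ A * c → ∀ a y → 1 ℕ.≤ a →
  y * A ≅ 0ℤ [ a ] → y * (s - + 2 * r) ≅ 0ℤ [ a ] → y * c ≅ 0ℤ [ a ] → y ≅ 0ℤ [ a ]
primitive-cancel s t fund A r c P≡ a y 1≤a yA≅0 yb≅0 yc≅0 = conclude (d ℕ.≟ 1)
  where
  instance
    a≢0 : NonZero a
    a≢0 = ℕ.>-nonZero 1≤a
  g = gcd a ∣ y ∣
  g∣a : g ∣ a
  g∣a = gcd[m,n]∣m a ∣ y ∣
  -- d = a / gcd(a, y) divides all three coefficients. A prime divisor p of d would give p ∣ 2r - s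
  -- and p² ∣ A c = P(r), against `Fundamental`.
  d = ℕ∣.quotient g∣a
  a≡ : a ≡ d ℕ.* g
  a≡ = ℕ∣._∣_.equality g∣a
  y′ = ℕ∣.quotient (gcd[m,n]∣n a ∣ y ∣)
  y≡ : ∣ y ∣ ≡ y′ ℕ.* g
  y≡ = ℕ∣._∣_.equality (gcd[m,n]∣n a ∣ y ∣)
  instance
    g≢0 : NonZero g
    g≢0 = ℕ.≢-nonZero λ g≡0 → ℕ.≢-nonZero⁻¹ a (trans a≡ (trans (cong (d ℕ.*_) g≡0) (ℕ.*-zeroʳ d)))
  coprime-d : Coprime d y′
  coprime-d {f} (f∣d , f∣y′) = ℕ∣.∣1⇒≡1 (ℕ∣.*-cancelʳ-∣ g (subst (f ℕ.* g ∣_) (sym (ℕ.*-identityˡ g))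
    (gcd-greatest (subst (f ℕ.* g ∣_) (sym a≡) (ℕ∣.*-monoˡ-∣ g f∣d)) (subst (f ℕ.* g ∣_) (sym y≡) (ℕ∣.*-monoˡ-∣ g f∣y′)))))
  reduce : ∀ z → y * z ≅ 0ℤ [ a ] → d ∣ ∣ z ∣
  reduce z e = coprime-divisor coprime-d (ℕ∣.*-cancelˡ-∣ g (subst₂ _∣_ (trans a≡ (ℕ.*-comm d g))
    (trans (abs-* y z) (trans (cong (ℕ._* ∣ z ∣) (trans y≡ (ℕ.*-comm y′ g))) (ℕ.*-assoc g y′ ∣ z ∣))) (≅0⇒∣ e)))
  conclude : Dec (d ≡ 1) → y ≅ 0ℤ [ a ]
  conclude (yes d≡1) = ∣⇒≅0 (subst (_∣ ∣ y ∣) (sym (trans a≡ (trans (cong (ℕ._* g) d≡1) (ℕ.*-identityˡ g)))) (gcd[m,n]∣n a ∣ y ∣))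
  conclude (no d≢1) with prime-divisor d (ℕ.≤∧≢⇒< (ℕ.n≢0⇒n>0 λ d≡0 → ℕ.≢-nonZero⁻¹ a (trans a≡ (cong (ℕ._* g) d≡0))) (d≢1 ∘ sym))
  ... | p , pr , p∣d = ⊥-elim (fund p pr r (∣⇒≅0 (subst (p ∣_) flip (ℕ∣.∣-trans p∣d (reduce (s - + 2 * r) yb≅0))))
          (∣⇒≅0 (subst (p ℕ.* p ∣_) (sym (trans (cong ∣_∣ P≡) (abs-* A c)))
            (ℕ∣.*-pres-∣ (ℕ∣.∣-trans p∣d (reduce A yA≅0)) (ℕ∣.∣-trans p∣d (reduce c yc≅0))))))
    where
    flip : ∣ s - + 2 * r ∣ ≡ ∣ + 2 * r - s ∣
    flip = ∣i-j∣≡∣j-i∣ s (+ 2 * r)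

-- Isolates what is used of ℚ(√m), so that the arithmetic of pairs of rationals stays out of the
-- theory of lattices and a ring solver with integer coefficients applies. By `denominator`, K
-- consists of the fractions of ℤ[ω].
record OrderField (s t : ℤ) : Set₁ where
  infixl 6 _⊕_
  infixl 7 _⊗_
  infix  8 ⊝_
  field
    K    : Set
    _⊕_  : K → K → K
    _⊗_  : K → K → K
    ⊝_   : K → K
    𝟎 𝟏  : K
    isCommutativeRing : IsCommutativeRing _≡_ _⊕_ _⊗_ ⊝_ 𝟎 𝟏
    _≟𝟎  : ∀ x → Dec (x ≡ 𝟎)
    ι    : ℤ → K
    ι-+  : ∀ u v → ι (u + v) ≡ ι u ⊕ ι v
    ι-*  : ∀ u v → ι (u * v) ≡ ι u ⊗ ι v
    ι-neg : ∀ u → ι (- u) ≡ ⊝ ι u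
    ι-0  : ι 0ℤ ≡ 𝟎
    ι-1  : ι 1ℤ ≡ 𝟏
    ι-inverse : ∀ n → n ≢ 0ℤ → ∃[ x ] ι n ⊗ x ≡ 𝟏
    ω    : K
    ω²   : ω ⊗ ω ≡ ι s ⊗ ω ⊕ ⊝ ι t
    independent : ∀ u v → ι u ⊕ ι v ⊗ ω ≡ 𝟎 → u ≡ 0ℤ × v ≡ 0ℤ
    denominator : ∀ x → ∃[ w ] ∃[ u ] ∃[ v ] w ≢ 0ℤ × ι w ⊗ x ≡ ι u ⊕ ι v ⊗ ω

  commutativeRing : CommutativeRing 0ℓ 0ℓ
  commutativeRing = record { isCommutativeRing = isCommutativeRing }

  private
    R : AlmostCommutativeRing 0ℓ 0ℓ
    R = fromCommutativeRing commutativeRing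

    Coeff = AlmostCommutativeRing.rawRing (fromCommutativeRing +-*-commutativeRing)

    morphism : Coeff -Raw-AlmostCommutative⟶ R
    morphism = record { ⟦_⟧ = ι ; +-homo = ι-+ ; *-homo = ι-* ; -‿homo = ι-neg ; 0-homo = ι-0 ; 1-homo = ι-1 }

    _coeff≟_ : ∀ x y → Maybe (ι x ≡ ι y)
    x coeff≟ y with x ≟ y
    ... | yes eq = just (cong ι eq)
    ... | no _   = nothing

  module Solver = Algebra.Solver.Ring Coeff R morphism _coeff≟_

  open CommutativeRing commutativeRing public using ()
    renaming ( *-assoc to ⊗-assoc; *-comm to ⊗-comm; *-identityˡ to ⊗-identityˡ; *-identityʳ to ⊗-identityʳ
             ; +-identityˡ to ⊕-identityˡ; +-identityʳ to ⊕-identityʳ; zeroˡ to ⊗-zeroˡ; zeroʳ to ⊗-zeroʳ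
             ; -‿inverseʳ to ⊝-inverseʳ; distribˡ to ⊗-distribˡ; distribʳ to ⊗-distribʳ )

sum-cong : ∀ {n} {F G : Fin n → ℤ} → (∀ i → F i ≡ G i) → sum F ≡ sum G
sum-cong {zero}  eq = refl
sum-cong {suc n} eq = cong₂ _+_ (eq Fin.zero) (sum-cong λ i → eq (Fin.suc i))

sum-0 : ∀ n → sum {n} (λ _ → 0ℤ) ≡ 0ℤ
sum-0 zero    = refl
sum-0 (suc n) = trans (+-identityˡ _) (sum-0 n)

sum-+ : ∀ {n} (F G : Fin n → ℤ) → sum (λ i → F i + G i) ≡ sum F + sum G
sum-+ {zero}  F G = refl
sum-+ {suc n} F G = trans (cong (_+_ (F Fin.zero + G Fin.zero)) (sum-+ (λ i → F (Fin.suc i)) (λ i → G (Fin.suc i))))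
  (lemma (F Fin.zero) (G Fin.zero) (sum (λ i → F (Fin.suc i))) (sum (λ i → G (Fin.suc i))))
  where
  lemma : ∀ a b c d → a + b + (c + d) ≡ a + c + (b + d)
  lemma = solve-∀

sum-*ˡ : ∀ {n} c (F : Fin n → ℤ) → sum (λ i → c * F i) ≡ c * sum F
sum-*ˡ {zero}  c F = sym (*-zeroʳ c)
sum-*ˡ {suc n} c F = trans (cong (_+_ (c * F Fin.zero)) (sum-*ˡ c (λ i → F (Fin.suc i))))
  (sym (*-distribˡ-+ c (F Fin.zero) _))

sum-Σ-swap : ∀ {h} n (F : Fin h → ℕ → ℤ) → sum (λ j → Σ< n (F j)) ≡ Σ< n (λ i → sum (λ j → F j i))
sum-Σ-swap {h} zero    F = sum-0 h
sum-Σ-swap (suc n) F = trans (sum-+ (λ j → Σ< n (F j)) (λ j → F j n)) (cong (_+ sum (λ j → F j n)) (sum-Σ-swap n F))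

sum-single : ∀ {n} {F : Fin n → ℤ} k → (∀ i → i ≢ k → F i ≡ 0ℤ) → sum F ≡ F k
sum-single {suc n} {F} Fin.zero off = trans (cong (_+_ (F Fin.zero))
  (trans (sum-cong λ i → off (Fin.suc i) λ ()) (sum-0 n))) (+-identityʳ _)
sum-single {suc n} {F} (Fin.suc k) off = trans (cong₂ _+_ (off Fin.zero λ ())
  (sum-single k λ i i≢k → off (Fin.suc i) (i≢k ∘ Fin.suc-injective))) (+-identityˡ _)

ΣZ-pair : ∀ X {F : ℤ → ℤ} z w → ∣ z ∣ ℕ.≤ X → ∣ w ∣ ℕ.≤ X → z ≢ w →
          (∀ v → ∣ v ∣ ℕ.≤ X → v ≢ z → v ≢ w → F v ≡ 0ℤ) → ΣZ X F ≡ F z + F w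
ΣZ-pair X {F} z w z≤X w≤X z≢w off = at (ΣZ-index X z z≤X) (ΣZ-index X w w≤X)
  where
  at : ∃[ i ] i ℕ.< suc (X ℕ.+ X) × + i - + X ≡ z → ∃[ i ] i ℕ.< suc (X ℕ.+ X) × + i - + X ≡ w → ΣZ X F ≡ F z + F w
  at (k , k< , refl) (l , l< , refl) = Σ-pair _ k l k< l< (λ { refl → z≢w refl })
    λ i i< i≢k i≢l → off _ (ΣZ-range X i i<) (λ eq → i≢k (ΣZ-index-injective X eq)) (λ eq → i≢l (ΣZ-index-injective X eq))

box-pair : ∀ X (G : ℤ → ℤ → ℤ) x y x′ y′ → ∣ x ∣ ℕ.≤ X → ∣ y ∣ ℕ.≤ X → ∣ x′ ∣ ℕ.≤ X → ∣ y′ ∣ ℕ.≤ X →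
  ¬ (x ≡ x′ × y ≡ y′) → G x y ≡ 1ℤ → G x′ y′ ≡ 1ℤ →
  (∀ u v → ¬ (u ≡ x × v ≡ y) → ¬ (u ≡ x′ × v ≡ y′) → G u v ≡ 0ℤ) →
  ΣZ X (λ u → ΣZ X (G u)) ≡ + 2
box-pair X G x y x′ y′ x≤ y≤ x′≤ y′≤ distinct one one′ off = cases (x ≟ x′)
  where
  cases : Dec (x ≡ x′) → ΣZ X (λ u → ΣZ X (G u)) ≡ + 2
  cases (yes refl) = trans (ΣZ-single X x x≤ λ u _ u≢x → ΣZ-zero X λ v _ → off u v (u≢x ∘ proj₁) (u≢x ∘ proj₁))
    (trans (ΣZ-pair X y y′ y≤ y′≤ (λ eq → distinct (refl , eq)) λ v _ v≢y v≢y′ → off x v (v≢y ∘ proj₂) (v≢y′ ∘ proj₂))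
      (cong₂ _+_ one one′))
  cases (no x≢x′) = trans (ΣZ-pair X x x′ x≤ x′≤ x≢x′ λ u _ u≢x u≢x′ → ΣZ-zero X λ v _ → off u v (u≢x ∘ proj₁) (u≢x′ ∘ proj₁))
    (cong₂ _+_ (trans (ΣZ-single X y y≤ λ v _ v≢y → off x v (v≢y ∘ proj₂) (x≢x′ ∘ proj₁)) one)
               (trans (ΣZ-single X y′ y′≤ λ v _ v≢y′ → off x′ v (x≢x′ ∘ sym ∘ proj₁) (v≢y′ ∘ proj₂)) one′))

ΣZ-*ˡ : ∀ X c (F : ℤ → ℤ) → ΣZ X (λ z → c * F z) ≡ c * ΣZ X F
ΣZ-*ˡ X c F = Σ-*ˡ (suc (X ℕ.+ X)) c (λ i → F (+ i - + X))

ΣZ-Σ-swap : ∀ X n (F : ℕ → ℤ → ℤ) → ΣZ X (λ z → Σ< n λ i → F i z) ≡ Σ< n (λ i → ΣZ X (F i))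
ΣZ-Σ-swap X n F = Σ-swap (suc (X ℕ.+ X)) n (λ k i → F i (+ k - + X))

module Boxes {h : ℕ} (X : Fin h → ℕ) where

  box : (Fin h → ℤ → ℤ → ℤ) → ℤ
  box F = sum λ j → ΣZ (X j) λ u → ΣZ (X j) (F j u)

  box-cong : ∀ {F G} → (∀ j u v → F j u v ≡ G j u v) → box F ≡ box G
  box-cong eq = sum-cong λ j → ΣZ-cong (X j) λ u _ → ΣZ-cong (X j) λ v _ → eq j u v

  box-*ˡ : ∀ c F → box (λ j u v → c * F j u v) ≡ c * box F
  box-*ˡ c F = trans (sum-cong λ j → trans (ΣZ-cong (X j) λ u _ → ΣZ-*ˡ (X j) c (F j u)) (ΣZ-*ˡ (X j) c λ u → ΣZ (X j) (F j u)))
    (sum-*ˡ c λ j → ΣZ (X j) λ u → ΣZ (X j) (F j u))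

  box-Σ : ∀ n (F : ℕ → Fin h → ℤ → ℤ → ℤ) →
          box (λ j u v → Σ< n (λ i → F i j u v)) ≡ Σ< n (λ i → box (F i))
  box-Σ n F = trans (sum-cong λ j → trans (ΣZ-cong (X j) λ u _ → ΣZ-Σ-swap (X j) n λ i → F i j u)
      (ΣZ-Σ-swap (X j) n λ i u → ΣZ (X j) (F i j u)))
    (sum-Σ-swap n λ j i → ΣZ (X j) λ u → ΣZ (X j) (F i j u))

Σ-𝟙-single₃ : ∀ M M′ (L : ℕ → ℕ) (F : ℕ → ℕ → ℕ → ℤ) g a r → g ℕ.< M → a ℕ.< M′ → r ℕ.< L a → F g a r ≡ 1ℤ →
  (∀ g′ a′ r′ → r′ ℕ.< L a′ → ¬ (g ≡ g′ × a ≡ a′ × r ≡ r′) → F g′ a′ r′ ≡ 0ℤ) →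
  Σ< M (λ g → Σ< M′ λ a → Σ< (L a) (F g a)) ≡ 1ℤ
Σ-𝟙-single₃ M M′ L F g a r g< a< r< one off = trans
  (Σ-single M g g< λ g′ _ g′≢g → Σ-zero M′ λ a′ _ → Σ-zero (L a′) λ r′ r′< → off g′ a′ r′ r′< (g′≢g ∘ sym ∘ proj₁))
  (trans (Σ-single M′ a a< λ a′ _ a′≢a → Σ-zero (L a′) λ r′ r′< → off g a′ r′ r′< (a′≢a ∘ sym ∘ proj₁ ∘ proj₂))
  (trans (Σ-single (L a) r r< λ r′ r′< r′≢r → off g a r′ r′< (r′≢r ∘ sym ∘ proj₂ ∘ proj₂)) one))

𝟙-product : ∀ {p q r} {P : Set p} {Q : Set q} {R : Set r} (d : Dec P) (e : Dec Q) (f : Dec R) →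
            ¬ (P × Q × R) → 𝟙 d * (𝟙 e * 𝟙 f) ≡ 0ℤ
𝟙-product (no _)  e f _ = *-zeroˡ (𝟙 e * 𝟙 f)
𝟙-product (yes _) (no _) f _ = trans (*-identityˡ (0ℤ * 𝟙 f)) (*-zeroˡ (𝟙 f))
𝟙-product (yes _) (yes _) (no _) _ = refl
𝟙-product (yes p) (yes q) (yes r) ¬all = ⊥-elim (¬all (p , q , r))

neg-fixed : ∀ {x} → x ≡ - x → x ≡ 0ℤ
neg-fixed { +0} _ = refl

module Order {s t : ℤ} (F : OrderField s t) (fund : Roots.Fundamental s t) (D<-4 : Roots.D s t < - + 4) where

  open OrderField F
  open Solver using (solve; _:+_; _:*_; _:=_; :-_; con)
  open Roots s t using (P; D; ρ)

  D<0 : D < 0ℤ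
  D<0 = <-trans D<-4 -<+

  E : ℤ → ℤ → K
  E u v = ι u ⊕ ι v ⊗ ω

  E-+ : ∀ u v u′ v′ → E u v ⊕ E u′ v′ ≡ E (u + u′) (v + v′)
  E-+ u v u′ v′ = trans
    (solve 5 (λ u v u′ v′ w → (u :+ v :* w) :+ (u′ :+ v′ :* w) := (u :+ u′) :+ (v :+ v′) :* w) refl (ι u) (ι v) (ι u′) (ι v′) ω)
    (cong₂ (λ x y → x ⊕ y ⊗ ω) (sym (ι-+ u u′)) (sym (ι-+ v v′)))

  E-⊗ : ∀ u v u′ v′ → E u v ⊗ E u′ v′ ≡ E (u * u′ - t * (v * v′)) (u * v′ + v * u′ + s * (v * v′))
  E-⊗ u v u′ v′ = begin
    E u v ⊗ E u′ v′
      ≡⟨ solve 5 (λ u v u′ v′ w → (u :+ v :* w) :* (u′ :+ v′ :* w) :=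
           u :* u′ :+ (u :* v′ :+ v :* u′) :* w :+ (v :* v′) :* (w :* w)) refl (ι u) (ι v) (ι u′) (ι v′) ω ⟩
    ι u ⊗ ι u′ ⊕ (ι u ⊗ ι v′ ⊕ ι v ⊗ ι u′) ⊗ ω ⊕ (ι v ⊗ ι v′) ⊗ (ω ⊗ ω)
      ≡⟨ cong (λ z → ι u ⊗ ι u′ ⊕ (ι u ⊗ ι v′ ⊕ ι v ⊗ ι u′) ⊗ ω ⊕ (ι v ⊗ ι v′) ⊗ z) ω² ⟩
    ι u ⊗ ι u′ ⊕ (ι u ⊗ ι v′ ⊕ ι v ⊗ ι u′) ⊗ ω ⊕ (ι v ⊗ ι v′) ⊗ (ι s ⊗ ω ⊕ ⊝ ι t)
      ≡⟨ solve 7 (λ u v u′ v′ w s t → u :* u′ :+ (u :* v′ :+ v :* u′) :* w :+ (v :* v′) :* (s :* w :+ :- t) :=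
           (u :* u′ :+ :- (t :* (v :* v′))) :+ (u :* v′ :+ v :* u′ :+ s :* (v :* v′)) :* w) refl
           (ι u) (ι v) (ι u′) (ι v′) ω (ι s) (ι t) ⟩
    (ι u ⊗ ι u′ ⊕ ⊝ (ι t ⊗ (ι v ⊗ ι v′))) ⊕ (ι u ⊗ ι v′ ⊕ ι v ⊗ ι u′ ⊕ ι s ⊗ (ι v ⊗ ι v′)) ⊗ ω
      ≡⟨ cong₂ (λ x y → x ⊕ y ⊗ ω) (sym real) (sym imag) ⟩
    E (u * u′ - t * (v * v′)) (u * v′ + v * u′ + s * (v * v′)) ∎
    where
    open ≡-Reasoning
    ι-** : ∀ a b c → ι (a * (b * c)) ≡ ι a ⊗ (ι b ⊗ ι c)
    ι-** a b c = trans (ι-* a (b * c)) (cong (ι a ⊗_) (ι-* b c))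
    real : ι (u * u′ - t * (v * v′)) ≡ ι u ⊗ ι u′ ⊕ ⊝ (ι t ⊗ (ι v ⊗ ι v′))
    real = trans (ι-+ (u * u′) (- (t * (v * v′)))) (cong₂ _⊕_ (ι-* u u′)
      (trans (ι-neg (t * (v * v′))) (cong ⊝_ (ι-** t v v′))))
    imag : ι (u * v′ + v * u′ + s * (v * v′)) ≡ ι u ⊗ ι v′ ⊕ ι v ⊗ ι u′ ⊕ ι s ⊗ (ι v ⊗ ι v′)
    imag = trans (ι-+ (u * v′ + v * u′) (s * (v * v′))) (cong₂ _⊕_
      (trans (ι-+ (u * v′) (v * u′)) (cong₂ _⊕_ (ι-* u v′) (ι-* v u′))) (ι-** s v v′))

  E-ι : ∀ u → E u 0ℤ ≡ ι u
  E-ι u = trans (cong (λ z → ι u ⊕ z ⊗ ω) ι-0) (trans (cong (ι u ⊕_) (⊗-zeroˡ ω)) (⊕-identityʳ (ι u)))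

  E-ω : E 0ℤ 1ℤ ≡ ω
  E-ω = trans (cong₂ (λ x y → x ⊕ y ⊗ ω) ι-0 ι-1) (trans (⊕-identityˡ (𝟏 ⊗ ω)) (⊗-identityˡ ω))

  E-0 : E 0ℤ 0ℤ ≡ 𝟎
  E-0 = trans (E-ι 0ℤ) ι-0

  E-1 : E 1ℤ 0ℤ ≡ 𝟏
  E-1 = trans (E-ι 1ℤ) ι-1

  E-injective : ∀ {u v u′ v′} → E u v ≡ E u′ v′ → u ≡ u′ × v ≡ v′
  E-injective {u} {v} {u′} {v′} eq = i-j≡0⇒i≡j u u′ (proj₁ zeros) , i-j≡0⇒i≡j v v′ (proj₂ zeros)
    where
    zeros : u + - u′ ≡ 0ℤ × v + - v′ ≡ 0ℤ
    zeros = independent (u + - u′) (v + - v′)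
      (trans (sym (E-+ u v (- u′) (- v′))) (trans (cong (_⊕ E (- u′) (- v′)) eq)
        (trans (E-+ u′ v′ (- u′) (- v′)) (trans (cong₂ E (+-inverseʳ u′) (+-inverseʳ v′)) E-0))))

  ι-injective : ∀ {u v} → ι u ≡ ι v → u ≡ v
  ι-injective {u} {v} eq = proj₁ (E-injective {u} {0ℤ} {v} {0ℤ} (trans (E-ι u) (trans eq (sym (E-ι v)))))

  𝟏≢𝟎 : 𝟏 ≢ 𝟎
  𝟏≢𝟎 eq = 1≢0 (ι-injective {1ℤ} {0ℤ} (trans ι-1 (trans eq (sym ι-0))))
    where
    1≢0 : 1ℤ ≢ 0ℤ
    1≢0 ()

  inverse-cancel : ∀ {x y z x⁻¹} → x ⊗ x⁻¹ ≡ 𝟏 → x ⊗ y ≡ x ⊗ z → y ≡ z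
  inverse-cancel {x} {y} {z} {x⁻¹} inv eq = trans (sym (undo y)) (trans (cong (x⁻¹ ⊗_) eq) (undo z))
    where
    undo : ∀ y → x⁻¹ ⊗ (x ⊗ y) ≡ y
    undo y = trans (solve 3 (λ a x y → a :* (x :* y) := (x :* a) :* y) refl x⁻¹ x y)
      (trans (cong (_⊗ y) inv) (⊗-identityˡ y))

  ι-cancel : ∀ n {y z} → n ≢ 0ℤ → ι n ⊗ y ≡ ι n ⊗ z → y ≡ z
  ι-cancel n n≢0 = inverse-cancel (proj₂ (ι-inverse n n≢0))

  norm : ℤ → ℤ → ℤ
  norm u v = u * (u + s * v) + t * (v * v)

  conjugate : ∀ u v → E u v ⊗ E (u + s * v) (- v) ≡ ι (norm u v)
  conjugate u v = trans (E-⊗ u v (u + s * v) (- v)) (trans (cong₂ E (l₁ s t u v) (l₂ s u v)) (E-ι (norm u v)))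
    where
    l₁ : ∀ s t u v → u * (u + s * v) - t * (v * - v) ≡ u * (u + s * v) + t * (v * v)
    l₁ = solve-∀
    l₂ : ∀ s u v → u * - v + v * (u + s * v) + s * (v * - v) ≡ + 0
    l₂ = solve-∀

  square-nonNeg : ∀ x → 0ℤ ≤ x * x
  square-nonNeg (+ n)    = ≤-trans (+≤+ z≤n) (≤-reflexive (pos-* n n))
  square-nonNeg -[1+ n ] = +≤+ z≤n

  square≡0 : ∀ x → x * x ≡ 0ℤ → x ≡ 0ℤ
  square≡0 x eq = [ id , id ]′ (i*j≡0⇒i≡0∨j≡0 x eq)

  norm≢0 : ∀ u v → ¬ (u ≡ 0ℤ × v ≡ 0ℤ) → norm u v ≢ 0ℤ
  norm≢0 u v nonzero norm≡0 = nonzero (u≡0 , v≡0)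
    where
    0<-D : 0ℤ < - D
    0<-D = neg-mono-< D<0
    identity : + 4 * norm u v ≡ (+ 2 * u + s * v) * (+ 2 * u + s * v) + - D * (v * v)
    identity = l s t u v
      where
      l : ∀ s t u v → + 4 * (u * (u + s * v) + t * (v * v)) ≡
          (+ 2 * u + s * v) * (+ 2 * u + s * v) + - (s * s - + 4 * t) * (v * v)
      l = solve-∀
    Dv²≤0 : - D * (v * v) ≤ - D * 0ℤ
    Dv²≤0 = ≤-trans (≤-trans (≤-reflexive (sym (+-identityˡ _)))
        (+-monoˡ-≤ (- D * (v * v)) (square-nonNeg (+ 2 * u + s * v))))
      (≤-reflexive (trans (sym identity) (trans (cong (_*_ (+ 4)) norm≡0) (sym (*-zeroʳ (- D))))))
    v≡0 : v ≡ 0ℤ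
    v≡0 = square≡0 v (≤-antisym (*-cancelˡ-≤-pos (v * v) 0ℤ (- D) {{positive 0<-D}} Dv²≤0) (square-nonNeg v))
    u≡0 : u ≡ 0ℤ
    u≡0 = square≡0 u (trans (trans (l u s) (sym (cong (λ z → u * (u + s * z) + t * (z * z)) v≡0 ⟨trans⟩ l₂ u s t))) norm≡0)
      where
      infixl 1 _⟨trans⟩_
      _⟨trans⟩_ : ∀ {i j k : ℤ} → i ≡ j → j ≡ k → i ≡ k
      _⟨trans⟩_ = trans
      l : ∀ u s → u * u ≡ u * (u + s * + 0)
      l = solve-∀
      l₂ : ∀ u s t → u * (u + s * + 0) + t * (+ 0 * + 0) ≡ u * (u + s * + 0)
      l₂ = solve-∀

  invert : ∀ x → x ≢ 𝟎 → ∃[ y ] x ⊗ y ≡ 𝟏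
  invert x x≢𝟎 = from-denominator (denominator x)
    where
    open ≡-Reasoning
    from-denominator : ∃[ w ] ∃[ u ] ∃[ v ] w ≢ 0ℤ × ι w ⊗ x ≡ E u v → ∃[ y ] x ⊗ y ≡ 𝟏
    from-denominator (w , u , v , w≢0 , wx≡) = from-norm (ι-inverse (norm u v) (norm≢0 u v nonzero))
      where
      nonzero : ¬ (u ≡ 0ℤ × v ≡ 0ℤ)
      nonzero (u≡0 , v≡0) = x≢𝟎 (ι-cancel w w≢0 (trans wx≡ (trans (cong₂ E u≡0 v≡0) (trans E-0 (sym (⊗-zeroʳ (ι w)))))))
      from-norm : ∃[ n⁻¹ ] ι (norm u v) ⊗ n⁻¹ ≡ 𝟏 → ∃[ y ] x ⊗ y ≡ 𝟏
      from-norm (n⁻¹ , nn⁻¹≡1) = ι w ⊗ E (u + s * v) (- v) ⊗ n⁻¹ , (begin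
        x ⊗ (ι w ⊗ E (u + s * v) (- v) ⊗ n⁻¹)
          ≡⟨ solve 4 (λ x w c n → x :* (w :* c :* n) := ((w :* x) :* c) :* n) refl x (ι w) (E (u + s * v) (- v)) n⁻¹ ⟩
        ((ι w ⊗ x) ⊗ E (u + s * v) (- v)) ⊗ n⁻¹
          ≡⟨ cong (λ z → (z ⊗ E (u + s * v) (- v)) ⊗ n⁻¹) wx≡ ⟩
        (E u v ⊗ E (u + s * v) (- v)) ⊗ n⁻¹
          ≡⟨ trans (cong (_⊗ n⁻¹) (conjugate u v)) nn⁻¹≡1 ⟩
        𝟏 ∎)

  -- Lattices and finitely generated modules over ℤ[ω]

  OSpan : List K → K → Set
  OSpan []       x = x ≡ 𝟎
  OSpan (g ∷ gs) x = ∃[ p ] ∃[ q ] ∃[ y ] OSpan gs y × x ≡ E p q ⊗ g ⊕ y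

  ZSpan : K → K → K → Set
  ZSpan b₁ b₂ x = ∃[ p ] ∃[ q ] x ≡ ι p ⊗ b₁ ⊕ ι q ⊗ b₂

  -- Says that b₁ and b₂ span K over ℚ. In dimension 2 this takes the place of linear independence,
  -- and it supplies the relation w z = u b₁ + v b₂ with which `adjoin` begins.
  Full : K → K → Set
  Full b₁ b₂ = ∀ z → ∃[ w ] w ≢ 0ℤ × ZSpan b₁ b₂ (ι w ⊗ z)

  record Basis (M : K → Set) : Set where
    constructor basis
    field
      b₁ b₂   : K
      nonzero : b₁ ≢ 𝟎
      full    : Full b₁ b₂
      to      : ∀ {x} → M x → ZSpan b₁ b₂ x
      from    : ∀ {x} → ZSpan b₁ b₂ x → M x

  Plus : (K → Set) → K → K → Set
  Plus M z x = ∃[ p ] ∃[ y ] M y × x ≡ ι p ⊗ z ⊕ y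

  ι-combine : ∀ p q r u → ι (p * q + r * u) ≡ ι p ⊗ ι q ⊕ ι r ⊗ ι u
  ι-combine p q r u = trans (ι-+ (p * q) (r * u)) (cong₂ _⊕_ (ι-* p q) (ι-* r u))

  -- Adding a generator z to a lattice: unimodular column operations replace
  -- (b₂, z) by (b₂′, κ) with κ a rational multiple of b₁.

  adjoin : ∀ {M} → Basis M → ∀ z → Basis (Plus M z)
  adjoin {M} (basis b₁ b₂ b₁≢𝟎 full to from) z with full z
  ... | w , w≢0 , u , v , wz≡ with bezout w v w≢0
  ...   | e , w′ , v′ , x , y , e≢0 , w≡ , v≡ , unit with bezout e u e≢0
  ...     | e₀ , e₁ , u₁ , x′ , y′ , e₀≢0 , e≡ , u≡ , unit′ = record
    { b₁ = c₁ ; b₂ = c₂ ; nonzero = c₁≢𝟎 ; full = full′ ; to = to′ ; from = from′ }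
    where
    open ≡-Reasoning
    κ c₁ c₂ : K
    -- Dividing w z = u b₁ + v b₂ by the common divisor e of w and v gives e κ = u b₁. The second
    -- Bézout step, for e and u, then finds the generator c₁ of ℤ b₁ + ℤ κ.
    κ  = ι w′ ⊗ z ⊕ ⊝ (ι v′ ⊗ b₂)
    c₁ = ι x′ ⊗ b₁ ⊕ ι y′ ⊗ κ
    c₂ = ι x ⊗ b₂ ⊕ ι y ⊗ z
    one : ι x ⊗ ι w′ ⊕ ι y ⊗ ι v′ ≡ 𝟏
    one = trans (sym (ι-combine x w′ y v′)) (trans (cong ι unit) ι-1)
    one′ : ι x′ ⊗ ι e₁ ⊕ ι y′ ⊗ ι u₁ ≡ 𝟏
    one′ = trans (sym (ι-combine x′ e₁ y′ u₁)) (trans (cong ι unit′) ι-1)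
    eκ≡ : ι e ⊗ κ ≡ ι u ⊗ b₁
    eκ≡ = begin
      ι e ⊗ κ ≡⟨ solve 5 (λ e w z v b → e :* (w :* z :+ :- (v :* b)) := (e :* w) :* z :+ :- ((e :* v) :* b)) refl (ι e) (ι w′) z (ι v′) b₂ ⟩
      (ι e ⊗ ι w′) ⊗ z ⊕ ⊝ ((ι e ⊗ ι v′) ⊗ b₂)
        ≡⟨ cong₂ (λ a c → a ⊗ z ⊕ ⊝ (c ⊗ b₂)) (trans (sym (ι-* e w′)) (cong ι (sym w≡))) (trans (sym (ι-* e v′)) (cong ι (sym v≡))) ⟩
      ι w ⊗ z ⊕ ⊝ (ι v ⊗ b₂) ≡⟨ cong (_⊕ ⊝ (ι v ⊗ b₂)) wz≡ ⟩
      (ι u ⊗ b₁ ⊕ ι v ⊗ b₂) ⊕ ⊝ (ι v ⊗ b₂) ≡⟨ solve 2 (λ a c → (a :+ c) :+ :- c := a) refl (ι u ⊗ b₁) (ι v ⊗ b₂) ⟩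
      ι u ⊗ b₁ ∎
    e₁κ≡ : ι e₁ ⊗ κ ≡ ι u₁ ⊗ b₁
    e₁κ≡ = ι-cancel e₀ e₀≢0 (begin
      ι e₀ ⊗ (ι e₁ ⊗ κ)  ≡⟨ trans (sym (⊗-assoc (ι e₀) (ι e₁) κ)) (cong (_⊗ κ) (trans (sym (ι-* e₀ e₁)) (cong ι (sym e≡)))) ⟩
      ι e ⊗ κ            ≡⟨ eκ≡ ⟩
      ι u ⊗ b₁           ≡⟨ sym (trans (sym (⊗-assoc (ι e₀) (ι u₁) b₁)) (cong (_⊗ b₁) (trans (sym (ι-* e₀ u₁)) (cong ι (sym u≡))))) ⟩
      ι e₀ ⊗ (ι u₁ ⊗ b₁) ∎)
    b₁≡ : b₁ ≡ ι e₁ ⊗ c₁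
    b₁≡ = sym (begin
      ι e₁ ⊗ c₁ ≡⟨ solve 5 (λ e x b y k → e :* (x :* b :+ y :* k) := (x :* e) :* b :+ y :* (e :* k)) refl (ι e₁) (ι x′) b₁ (ι y′) κ ⟩
      (ι x′ ⊗ ι e₁) ⊗ b₁ ⊕ ι y′ ⊗ (ι e₁ ⊗ κ) ≡⟨ cong (λ a → (ι x′ ⊗ ι e₁) ⊗ b₁ ⊕ ι y′ ⊗ a) e₁κ≡ ⟩
      (ι x′ ⊗ ι e₁) ⊗ b₁ ⊕ ι y′ ⊗ (ι u₁ ⊗ b₁) ≡⟨ solve 5 (λ x e b y u → (x :* e) :* b :+ y :* (u :* b) := (x :* e :+ y :* u) :* b) refl (ι x′) (ι e₁) b₁ (ι y′) (ι u₁) ⟩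
      (ι x′ ⊗ ι e₁ ⊕ ι y′ ⊗ ι u₁) ⊗ b₁ ≡⟨ trans (cong (_⊗ b₁) one′) (⊗-identityˡ b₁) ⟩
      b₁ ∎)
    κ≡ : κ ≡ ι u₁ ⊗ c₁
    κ≡ = sym (begin
      ι u₁ ⊗ c₁ ≡⟨ solve 5 (λ u x b y k → u :* (x :* b :+ y :* k) := x :* (u :* b) :+ (y :* u) :* k) refl (ι u₁) (ι x′) b₁ (ι y′) κ ⟩
      ι x′ ⊗ (ι u₁ ⊗ b₁) ⊕ (ι y′ ⊗ ι u₁) ⊗ κ ≡⟨ cong (λ a → ι x′ ⊗ a ⊕ (ι y′ ⊗ ι u₁) ⊗ κ) (sym e₁κ≡) ⟩
      ι x′ ⊗ (ι e₁ ⊗ κ) ⊕ (ι y′ ⊗ ι u₁) ⊗ κ ≡⟨ solve 5 (λ x e k y u → x :* (e :* k) :+ (y :* u) :* k := (x :* e :+ y :* u) :* k) refl (ι x′) (ι e₁) κ (ι y′) (ι u₁) ⟩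
      (ι x′ ⊗ ι e₁ ⊕ ι y′ ⊗ ι u₁) ⊗ κ ≡⟨ trans (cong (_⊗ κ) one′) (⊗-identityˡ κ) ⟩
      κ ∎)
    z≡ : z ≡ ι v′ ⊗ c₂ ⊕ ι x ⊗ κ
    z≡ = sym (begin
      ι v′ ⊗ c₂ ⊕ ι x ⊗ κ ≡⟨ solve 6 (λ v x b y z w → v :* (x :* b :+ y :* z) :+ x :* (w :* z :+ :- (v :* b)) := (x :* w :+ y :* v) :* z) refl (ι v′) (ι x) b₂ (ι y) z (ι w′) ⟩
      (ι x ⊗ ι w′ ⊕ ι y ⊗ ι v′) ⊗ z ≡⟨ trans (cong (_⊗ z) one) (⊗-identityˡ z) ⟩
      z ∎)
    b₂≡ : b₂ ≡ ι w′ ⊗ c₂ ⊕ ⊝ (ι y ⊗ κ)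
    b₂≡ = sym (begin
      ι w′ ⊗ c₂ ⊕ ⊝ (ι y ⊗ κ) ≡⟨ solve 6 (λ v x b y z w → w :* (x :* b :+ y :* z) :+ :- (y :* (w :* z :+ :- (v :* b))) := (x :* w :+ y :* v) :* b) refl (ι v′) (ι x) b₂ (ι y) z (ι w′) ⟩
      (ι x ⊗ ι w′ ⊕ ι y ⊗ ι v′) ⊗ b₂ ≡⟨ trans (cong (_⊗ b₂) one) (⊗-identityˡ b₂) ⟩
      b₂ ∎)
    c₁≢𝟎 : c₁ ≢ 𝟎
    c₁≢𝟎 eq = b₁≢𝟎 (trans b₁≡ (trans (cong (ι e₁ ⊗_) eq) (⊗-zeroʳ (ι e₁))))
    combine : ∀ p r q → ZSpan c₁ c₂ (ι p ⊗ z ⊕ (ι r ⊗ b₁ ⊕ ι q ⊗ b₂))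
    combine p r q = p * (x * u₁) + (r * e₁ + q * (- (y * u₁))) , p * v′ + q * w′ , (begin
      ι p ⊗ z ⊕ (ι r ⊗ b₁ ⊕ ι q ⊗ b₂)
        ≡⟨ cong₂ (λ a c → ι p ⊗ a ⊕ c) z≡ (cong₂ (λ a c → ι r ⊗ a ⊕ ι q ⊗ c) b₁≡ b₂≡) ⟩
      ι p ⊗ (ι v′ ⊗ c₂ ⊕ ι x ⊗ κ) ⊕ (ι r ⊗ (ι e₁ ⊗ c₁) ⊕ ι q ⊗ (ι w′ ⊗ c₂ ⊕ ⊝ (ι y ⊗ κ)))
        ≡⟨ cong (λ k → ι p ⊗ (ι v′ ⊗ c₂ ⊕ ι x ⊗ k) ⊕ (ι r ⊗ (ι e₁ ⊗ c₁) ⊕ ι q ⊗ (ι w′ ⊗ c₂ ⊕ ⊝ (ι y ⊗ k)))) κ≡ ⟩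
      ι p ⊗ (ι v′ ⊗ c₂ ⊕ ι x ⊗ (ι u₁ ⊗ c₁)) ⊕ (ι r ⊗ (ι e₁ ⊗ c₁) ⊕ ι q ⊗ (ι w′ ⊗ c₂ ⊕ ⊝ (ι y ⊗ (ι u₁ ⊗ c₁))))
        ≡⟨ solve 11 (λ p v c₂ x u c₁ r e q w y →
             p :* (v :* c₂ :+ x :* (u :* c₁)) :+ (r :* (e :* c₁) :+ q :* (w :* c₂ :+ :- (y :* (u :* c₁)))) :=
             (p :* (x :* u) :+ (r :* e :+ q :* (:- (y :* u)))) :* c₁ :+ (p :* v :+ q :* w) :* c₂) refl
             (ι p) (ι v′) c₂ (ι x) (ι u₁) c₁ (ι r) (ι e₁) (ι q) (ι w′) (ι y) ⟩
      (ι p ⊗ (ι x ⊗ ι u₁) ⊕ (ι r ⊗ ι e₁ ⊕ ι q ⊗ (⊝ (ι y ⊗ ι u₁)))) ⊗ c₁ ⊕ (ι p ⊗ ι v′ ⊕ ι q ⊗ ι w′) ⊗ c₂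
        ≡⟨ cong₂ (λ a c → a ⊗ c₁ ⊕ c ⊗ c₂) (sym coef₁) (sym (ι-combine p v′ q w′)) ⟩
      ι (p * (x * u₁) + (r * e₁ + q * (- (y * u₁)))) ⊗ c₁ ⊕ ι (p * v′ + q * w′) ⊗ c₂ ∎)
      where
      coef₁ : ι (p * (x * u₁) + (r * e₁ + q * (- (y * u₁)))) ≡ ι p ⊗ (ι x ⊗ ι u₁) ⊕ (ι r ⊗ ι e₁ ⊕ ι q ⊗ (⊝ (ι y ⊗ ι u₁)))
      coef₁ = trans (ι-+ (p * (x * u₁)) (r * e₁ + q * (- (y * u₁)))) (cong₂ _⊕_
        (trans (ι-* p (x * u₁)) (cong (ι p ⊗_) (ι-* x u₁)))
        (trans (ι-combine r e₁ q (- (y * u₁))) (cong (λ a → ι r ⊗ ι e₁ ⊕ ι q ⊗ a) (trans (ι-neg (y * u₁)) (cong ⊝_ (ι-* y u₁))))))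
    to′ : ∀ {a} → Plus M z a → ZSpan c₁ c₂ a
    to′ {a} (p , m , Mm , a≡) with to Mm
    ... | r , q , m≡ = subst (ZSpan c₁ c₂) (sym (trans a≡ (cong (ι p ⊗ z ⊕_) m≡))) (combine p r q)
    from′ : ∀ {a} → ZSpan c₁ c₂ a → Plus M z a
    from′ {a} (p , q , a≡) = p * (y′ * w′) + q * y , ι r ⊗ b₁ ⊕ ι k ⊗ b₂ , from (r , k , refl) , (begin
      a ≡⟨ a≡ ⟩
      ι p ⊗ c₁ ⊕ ι q ⊗ c₂
        ≡⟨ expand ⟩
      (ι p ⊗ (ι y′ ⊗ ι w′) ⊕ ι q ⊗ ι y) ⊗ z ⊕ (ι p ⊗ ι x′ ⊗ b₁ ⊕ (ι q ⊗ ι x ⊕ ι p ⊗ (⊝ (ι y′ ⊗ ι v′))) ⊗ b₂)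
        ≡⟨ cong₂ _⊕_ (cong (_⊗ z) (sym coefz)) (cong₂ (λ a c → a ⊗ b₁ ⊕ c ⊗ b₂) (sym (ι-* p x′)) (sym coef₂)) ⟩
      ι (p * (y′ * w′) + q * y) ⊗ z ⊕ (ι r ⊗ b₁ ⊕ ι k ⊗ b₂) ∎)
      where
      r k : ℤ
      r = p * x′
      k = q * x + p * (- (y′ * v′))
      expand : ι p ⊗ c₁ ⊕ ι q ⊗ c₂ ≡ (ι p ⊗ (ι y′ ⊗ ι w′) ⊕ ι q ⊗ ι y) ⊗ z ⊕ (ι p ⊗ ι x′ ⊗ b₁ ⊕ (ι q ⊗ ι x ⊕ ι p ⊗ (⊝ (ι y′ ⊗ ι v′))) ⊗ b₂)
      expand = solve 11 (λ p x′ b₁ y′ w′ z v′ b₂ q x y →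
        p :* (x′ :* b₁ :+ y′ :* (w′ :* z :+ :- (v′ :* b₂))) :+ q :* (x :* b₂ :+ y :* z) :=
        (p :* (y′ :* w′) :+ q :* y) :* z :+ (p :* x′ :* b₁ :+ (q :* x :+ p :* (:- (y′ :* v′))) :* b₂)) refl
        (ι p) (ι x′) b₁ (ι y′) (ι w′) z (ι v′) b₂ (ι q) (ι x) (ι y)
      coefz : ι (p * (y′ * w′) + q * y) ≡ ι p ⊗ (ι y′ ⊗ ι w′) ⊕ ι q ⊗ ι y
      coefz = trans (ι-combine p (y′ * w′) q y) (cong (λ a → ι p ⊗ a ⊕ ι q ⊗ ι y) (ι-* y′ w′))
      coef₂ : ι (q * x + p * (- (y′ * v′))) ≡ ι q ⊗ ι x ⊕ ι p ⊗ (⊝ (ι y′ ⊗ ι v′))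
      coef₂ = trans (ι-combine q x p (- (y′ * v′))) (cong (λ a → ι q ⊗ ι x ⊕ ι p ⊗ a) (trans (ι-neg (y′ * v′)) (cong ⊝_ (ι-* y′ v′))))
    full′ : Full c₁ c₂
    full′ a with full a
    ... | w″ , w″≢0 , r , q , eq = w″ , w″≢0 , subst (ZSpan c₁ c₂)
          (trans (cong (_⊕ (ι r ⊗ b₁ ⊕ ι q ⊗ b₂)) (trans (cong (_⊗ z) ι-0) (⊗-zeroˡ z))) (trans (⊕-identityˡ _) (sym eq)))
          (combine 0ℤ r q)

  E0⊗ : ∀ x → E 0ℤ 0ℤ ⊗ x ≡ 𝟎
  E0⊗ x = trans (cong (_⊗ x) E-0) (⊗-zeroˡ x)

  OSpan-𝟎 : ∀ gs → OSpan gs 𝟎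
  OSpan-𝟎 []       = refl
  OSpan-𝟎 (g ∷ gs) = 0ℤ , 0ℤ , 𝟎 , OSpan-𝟎 gs , sym (trans (cong (_⊕ 𝟎) (E0⊗ g)) (⊕-identityʳ 𝟎))

  OSpan-⊕ : ∀ gs {x y} → OSpan gs x → OSpan gs y → OSpan gs (x ⊕ y)
  OSpan-⊕ [] refl refl = ⊕-identityʳ 𝟎
  OSpan-⊕ (g ∷ gs) (p , q , x′ , x′∈ , refl) (p′ , q′ , y′ , y′∈ , refl) =
    p + p′ , q + q′ , x′ ⊕ y′ , OSpan-⊕ gs x′∈ y′∈ , trans
      (solve 5 (λ e e′ g x y → (e :* g :+ x) :+ (e′ :* g :+ y) := (e :+ e′) :* g :+ (x :+ y)) refl (E p q) (E p′ q′) g x′ y′)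
      (cong (λ e → e ⊗ g ⊕ (x′ ⊕ y′)) (E-+ p q p′ q′))

  OSpan-E : ∀ gs u v {x} → OSpan gs x → OSpan gs (E u v ⊗ x)
  OSpan-E [] u v refl = ⊗-zeroʳ (E u v)
  OSpan-E (g ∷ gs) u v (p , q , x′ , x′∈ , refl) =
    u * p - t * (v * q) , u * q + v * p + s * (v * q) , E u v ⊗ x′ , OSpan-E gs u v x′∈ , trans
      (solve 4 (λ e f g x → e :* (f :* g :+ x) := (e :* f) :* g :+ e :* x) refl (E u v) (E p q) g x′)
      (cong (λ e → e ⊗ g ⊕ E u v ⊗ x′) (E-⊗ u v p q))

  OSpan-ω : ∀ gs {x} → OSpan gs x → OSpan gs (ω ⊗ x)
  OSpan-ω gs {x} x∈ = subst (λ e → OSpan gs (e ⊗ x)) E-ω (OSpan-E gs 0ℤ 1ℤ x∈)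

  OSpan-⊝ : ∀ gs {x} → OSpan gs x → OSpan gs (⊝ x)
  OSpan-⊝ gs {x} x∈ = subst (OSpan gs) (trans (cong (_⊗ x) (E-ι -1ℤ))
    (solve 1 (λ x → con -1ℤ :* x := :- x) refl x)) (OSpan-E gs -1ℤ 0ℤ x∈)

  OSpan-skip : ∀ g gs {x} → OSpan gs x → OSpan (g ∷ gs) x
  OSpan-skip g gs {x} x∈ = 0ℤ , 0ℤ , x , x∈ , sym (trans (cong (_⊕ x) (E0⊗ g)) (⊕-identityˡ x))

  OSpan-here : ∀ g gs → OSpan (g ∷ gs) g
  OSpan-here g gs = 1ℤ , 0ℤ , 𝟎 , OSpan-𝟎 gs , sym (trans (⊕-identityʳ _) (trans (cong (_⊗ g) E-1) (⊗-identityˡ g)))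

  Basis-resp : ∀ {M M′ : K → Set} → (∀ {x} → M x → M′ x) → (∀ {x} → M′ x → M x) → Basis M → Basis M′
  Basis-resp f g (basis b₁ b₂ nz full to from) = basis b₁ b₂ nz full (to ∘ g) (f ∘ from)

  E⊗ : ∀ p q g → E p q ⊗ g ≡ ι p ⊗ g ⊕ ι q ⊗ (ω ⊗ g)
  E⊗ p q g = solve 4 (λ p q w g → (p :+ q :* w) :* g := p :* g :+ q :* (w :* g)) refl (ι p) (ι q) ω g

  -- A generator g over ℤ[ω] amounts to the two generators g and ω g over ℤ. The first nonzero one
  -- starts a basis, which is full because z / g has a denominator; all further ones are adjoined.
  basis-or-zero : ∀ gs → (∀ {x} → OSpan gs x → x ≡ 𝟎) ⊎ Basis (OSpan gs)
  basis-or-zero [] = inj₁ id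
  basis-or-zero (g ∷ gs) = cons (g ≟𝟎) (basis-or-zero gs)
    where
    cons : Dec (g ≡ 𝟎) → (∀ {x} → OSpan gs x → x ≡ 𝟎) ⊎ Basis (OSpan gs) →
           (∀ {x} → OSpan (g ∷ gs) x → x ≡ 𝟎) ⊎ Basis (OSpan (g ∷ gs))
    cons (yes g≡𝟎) (inj₁ null) = inj₁ λ (p , q , y , y∈ , x≡) →
      trans x≡ (trans (cong₂ _⊕_ (trans (cong (E p q ⊗_) g≡𝟎) (⊗-zeroʳ (E p q))) (null y∈)) (⊕-identityʳ 𝟎))
    cons (no g≢𝟎) (inj₁ null) = inj₂ (basis g (ω ⊗ g) g≢𝟎 full
      (λ (p , q , y , y∈ , x≡) → p , q , trans x≡ (trans (cong (E p q ⊗ g ⊕_) (null y∈)) (trans (⊕-identityʳ _) (E⊗ p q g))))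
      (λ (p , q , x≡) → p , q , 𝟎 , OSpan-𝟎 gs , trans x≡ (trans (sym (E⊗ p q g)) (sym (⊕-identityʳ _)))))
      where
      full : Full g (ω ⊗ g)
      full z = from-inverse (invert g g≢𝟎)
        where
        from-inverse : ∃[ g⁻¹ ] g ⊗ g⁻¹ ≡ 𝟏 → ∃[ w ] w ≢ 0ℤ × ZSpan g (ω ⊗ g) (ι w ⊗ z)
        from-inverse (g⁻¹ , gg⁻¹≡1) = from-denominator (denominator (z ⊗ g⁻¹))
          where
          from-denominator : ∃[ w ] ∃[ u ] ∃[ v ] w ≢ 0ℤ × ι w ⊗ (z ⊗ g⁻¹) ≡ E u v →
                             ∃[ w ] w ≢ 0ℤ × ZSpan g (ω ⊗ g) (ι w ⊗ z)
          from-denominator (w , u , v , w≢0 , eq) = w , w≢0 , u , v , (begin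
            ι w ⊗ z                   ≡⟨ sym (trans (cong (ι w ⊗ z ⊗_) gg⁻¹≡1) (⊗-identityʳ _)) ⟩
            ι w ⊗ z ⊗ (g ⊗ g⁻¹)       ≡⟨ solve 4 (λ w z g i → w :* z :* (g :* i) := (w :* (z :* i)) :* g) refl (ι w) z g g⁻¹ ⟩
            (ι w ⊗ (z ⊗ g⁻¹)) ⊗ g     ≡⟨ cong (_⊗ g) eq ⟩
            E u v ⊗ g                 ≡⟨ E⊗ u v g ⟩
            ι u ⊗ g ⊕ ι v ⊗ (ω ⊗ g)   ∎)
            where open ≡-Reasoning
    cons _ (inj₂ B) = inj₂ (Basis-resp
      (λ (q , m , (p , y , y∈ , m≡) , x≡) → p , q , y , y∈ , trans x≡ (trans (cong (ι q ⊗ (ω ⊗ g) ⊕_) m≡)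
        (solve 5 (λ p q w g y → q :* (w :* g) :+ (p :* g :+ y) := (p :+ q :* w) :* g :+ y) refl (ι p) (ι q) ω g y)))
      (λ (p , q , y , y∈ , x≡) → q , ι p ⊗ g ⊕ y , (p , y , y∈ , refl) , trans x≡
        (solve 5 (λ p q w g y → (p :+ q :* w) :* g :+ y := q :* (w :* g) :+ (p :* g :+ y)) refl (ι p) (ι q) ω g y))
      (adjoin (adjoin B g) (ω ⊗ g)))

  Λ : K → K → Set
  Λ θ y = ∃[ p ] ∃[ q ] y ≡ ι p ⊕ ι q ⊗ θ

  -- The lattice ℤ + ℤ θ with θ = (ω - r) / a. The condition a ∣ P(r) is equivalent to its stability
  -- under ω, by `ωθ-Λ` and `index-of-stable`.
  record Quadratic : Set where
    field
      a   : ℕ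
      1≤a : 1 ℕ.≤ a
      r c : ℤ
      P≡  : P r ≡ + a * c
      θ   : K
      aθ  : ι (+ a) ⊗ θ ≡ ω ⊕ ⊝ ι r

    +a≢0 : + a ≢ 0ℤ
    +a≢0 eq = ℕ.<⇒≢ 1≤a (sym (+-injective eq))

  record Structure (M : K → Set) : Set where
    field
      quadratic : Quadratic
      b b⁻¹     : K
      b-inverse : b ⊗ b⁻¹ ≡ 𝟏
    open Quadratic quadratic public
    field
      to   : ∀ {y} → M (b ⊗ y) → Λ θ y
      from : ∀ {y} → Λ θ y → M (b ⊗ y)

  module _ (a : ℕ) (1≤a : 1 ℕ.≤ a) (r : ℤ) (θ : K) (aθ : ι (+ a) ⊗ θ ≡ ω ⊕ ⊝ ι r) where

    private
      a≢0 : + a ≢ 0ℤ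
      a≢0 eq = ℕ.<⇒≢ 1≤a (sym (+-injective eq))

    aΛ : ∀ p q → ι (+ a) ⊗ (ι p ⊕ ι q ⊗ θ) ≡ E (+ a * p - q * r) q
    aΛ p q = begin
      ι (+ a) ⊗ (ι p ⊕ ι q ⊗ θ)
        ≡⟨ solve 4 (λ a p q θ → a :* (p :+ q :* θ) := a :* p :+ q :* (a :* θ)) refl (ι (+ a)) (ι p) (ι q) θ ⟩
      ι (+ a) ⊗ ι p ⊕ ι q ⊗ (ι (+ a) ⊗ θ)
        ≡⟨ cong (λ z → ι (+ a) ⊗ ι p ⊕ ι q ⊗ z) aθ ⟩
      ι (+ a) ⊗ ι p ⊕ ι q ⊗ (ω ⊕ ⊝ ι r)
        ≡⟨ solve 5 (λ a p q w r → a :* p :+ q :* (w :+ :- r) := (a :* p :+ :- (q :* r)) :+ q :* w) refl (ι (+ a)) (ι p) (ι q) ω (ι r) ⟩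
      (ι (+ a) ⊗ ι p ⊕ ⊝ (ι q ⊗ ι r)) ⊕ ι q ⊗ ω
        ≡⟨ cong (_⊕ ι q ⊗ ω) (sym (trans (ι-+ (+ a * p) (- (q * r))) (cong₂ _⊕_ (ι-* (+ a) p) (trans (ι-neg (q * r)) (cong ⊝_ (ι-* q r)))))) ⟩
      E (+ a * p - q * r) q ∎
      where open ≡-Reasoning

    Λ-injective : ∀ {p q p′ q′} → ι p ⊕ ι q ⊗ θ ≡ ι p′ ⊕ ι q′ ⊗ θ → p ≡ p′ × q ≡ q′
    Λ-injective {p} {q} {p′} {q′} eq = *-cancelˡ-≡ (+ a) p p′ {{ℕ.>-nonZero 1≤a}}
        (+-cancelʳ (- (q * r)) (trans (proj₁ parts) (cong (λ z → + a * p′ - z * r) (sym (proj₂ parts))))) , proj₂ parts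
      where
      parts : + a * p - q * r ≡ + a * p′ - q′ * r × q ≡ q′
      parts = E-injective (trans (sym (aΛ p q)) (trans (cong (ι (+ a) ⊗_) eq) (aΛ p′ q′)))

    ω-Λ : ω ≡ ι r ⊕ ι (+ a) ⊗ θ
    ω-Λ = trans (solve 2 (λ w r → w := r :+ (w :+ :- r)) refl ω (ι r)) (cong (ι r ⊕_) (sym aθ))

    aωθ : ι (+ a) ⊗ (ω ⊗ θ) ≡ E (0ℤ * - r - t * (1ℤ * 1ℤ)) (0ℤ * 1ℤ + 1ℤ * - r + s * (1ℤ * 1ℤ))
    aωθ = begin
      ι (+ a) ⊗ (ω ⊗ θ)    ≡⟨ solve 3 (λ a w θ → a :* (w :* θ) := w :* (a :* θ)) refl (ι (+ a)) ω θ ⟩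
      ω ⊗ (ι (+ a) ⊗ θ)    ≡⟨ cong (ω ⊗_) (trans aθ (trans (solve 2 (λ w r → w :+ :- r := :- r :+ con 1ℤ :* w) refl ω (ι r)) (cong (_⊕ ι 1ℤ ⊗ ω) (sym (ι-neg r))))) ⟩
      ω ⊗ E (- r) 1ℤ       ≡⟨ cong (_⊗ E (- r) 1ℤ) (sym E-ω) ⟩
      E 0ℤ 1ℤ ⊗ E (- r) 1ℤ ≡⟨ E-⊗ 0ℤ 1ℤ (- r) 1ℤ ⟩
      E (0ℤ * - r - t * (1ℤ * 1ℤ)) (0ℤ * 1ℤ + 1ℤ * - r + s * (1ℤ * 1ℤ)) ∎
      where open ≡-Reasoning

    ωθ-Λ : ∀ c → P r ≡ + a * c → ω ⊗ θ ≡ ι (- c) ⊕ ι (s - r) ⊗ θ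
    ωθ-Λ c P≡ = ι-cancel (+ a) a≢0 (trans aωθ (trans
      (cong₂ E (trans (l₁ s t r) (trans (cong (λ z → - z - (s - r) * r) P≡) (l₃ (+ a) c ((s - r) * r)))) (l₂ s r))
      (sym (aΛ (- c) (s - r)))))
      where
      l₁ : ∀ s t r → + 0 * - r - t * (+ 1 * + 1) ≡ - (r * r - s * r + t) - (s - r) * r
      l₁ = solve-∀
      l₂ : ∀ s r → + 0 * + 1 + + 1 * - r + s * (+ 1 * + 1) ≡ s - r
      l₂ = solve-∀
      l₃ : ∀ a c x → - (a * c) - x ≡ a * - c - x
      l₃ = solve-∀

    -- The converse of `ωθ-Λ`: comparing coordinates of a ω θ shows that the constant coefficient of
    -- ω θ is -P(r) / a.
    index-of-stable : Λ θ (ω ⊗ θ) → ∃[ c ] P r ≡ + a * c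
    index-of-stable (u , v , ωθ≡) = - u , trans (l₁ s t r)
      (trans (cong₂ (λ x y → - x - y * r) (proj₁ parts) (proj₂ parts)) (l₂ (+ a) u (v * r)))
      where
      parts : 0ℤ * - r - t * (1ℤ * 1ℤ) ≡ + a * u - v * r × 0ℤ * 1ℤ + 1ℤ * - r + s * (1ℤ * 1ℤ) ≡ v
      parts = E-injective (trans (sym aωθ) (trans (cong (ι (+ a) ⊗_) ωθ≡) (aΛ u v)))
      l₁ : ∀ s t r → r * r - s * r + t ≡ - (+ 0 * - r - t * (+ 1 * + 1)) - (+ 0 * + 1 + + 1 * - r + s * (+ 1 * + 1)) * r
      l₁ = solve-∀
      l₂ : ∀ a u x → - (a * u - x) - x ≡ a * - u
      l₂ = solve-∀

    ideal-to : ∀ c → P r ≡ + a * c → ∀ {x} → OSpan (𝟏 ∷ θ ∷ []) x → Λ θ x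
    ideal-to c P≡ (p , q , _ , (p′ , q′ , _ , refl , refl) , refl) =
      p + q * r + q′ * - c , q * + a + p′ + q′ * (s - r) , (begin
      E p q ⊗ 𝟏 ⊕ (E p′ q′ ⊗ θ ⊕ 𝟎)
        ≡⟨ cong₂ _⊕_ (trans (⊗-identityʳ (E p q)) (cong (λ z → ι p ⊕ ι q ⊗ z) ω-Λ)) (trans (⊕-identityʳ _) (trans (E⊗ p′ q′ θ) (cong (λ z → ι p′ ⊗ θ ⊕ ι q′ ⊗ z) (ωθ-Λ c P≡)))) ⟩
      (ι p ⊕ ι q ⊗ (ι r ⊕ ι (+ a) ⊗ θ)) ⊕ (ι p′ ⊗ θ ⊕ ι q′ ⊗ (ι (- c) ⊕ ι (s - r) ⊗ θ))
        ≡⟨ solve 9 (λ p q r a p′ q′ c d θ → (p :+ q :* (r :+ a :* θ)) :+ (p′ :* θ :+ q′ :* (c :+ d :* θ)) :=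
             ((p :+ q :* r) :+ q′ :* c) :+ ((q :* a :+ p′) :+ q′ :* d) :* θ) refl
             (ι p) (ι q) (ι r) (ι (+ a)) (ι p′) (ι q′) (ι (- c)) (ι (s - r)) θ ⟩
      ((ι p ⊕ ι q ⊗ ι r) ⊕ ι q′ ⊗ ι (- c)) ⊕ ((ι q ⊗ ι (+ a) ⊕ ι p′) ⊕ ι q′ ⊗ ι (s - r)) ⊗ θ
        ≡⟨ cong₂ (λ x y → x ⊕ y ⊗ θ)
             (sym (trans (ι-+ (p + q * r) (q′ * - c)) (cong₂ _⊕_ (trans (ι-+ p (q * r)) (cong (ι p ⊕_) (ι-* q r))) (ι-* q′ (- c)))))
             (sym (trans (ι-+ (q * + a + p′) (q′ * (s - r))) (cong₂ _⊕_ (trans (ι-+ (q * + a) p′) (cong (_⊕ ι p′) (ι-* q (+ a)))) (ι-* q′ (s - r))))) ⟩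
      ι (p + q * r + q′ * - c) ⊕ ι (q * + a + p′ + q′ * (s - r)) ⊗ θ ∎)
      where open ≡-Reasoning

    ideal-from : ∀ {x} → Λ θ x → OSpan (𝟏 ∷ θ ∷ []) x
    ideal-from (p , q , refl) = p , 0ℤ , E q 0ℤ ⊗ θ ⊕ 𝟎 , (q , 0ℤ , 𝟎 , refl , refl) ,
      cong₂ _⊕_ (sym (trans (⊗-identityʳ _) (E-ι p))) (sym (trans (⊕-identityʳ _) (cong (_⊗ θ) (E-ι q))))

    -- The ring of multipliers of Λ is ℤ[ω]. For α = x + y θ, the condition that α θ lies in Λ makes
    -- a divide y (s - 2r) and y c, and trivially y a; the form (a, s - 2r, c) is primitive, so a ∣
    -- y and α lies in ℤ[ω].
    multiplier-integral : ∀ c → P r ≡ + a * c → ∀ α → (∀ {y} → Λ θ y → Λ θ (α ⊗ y)) → ∃[ u ] ∃[ v ] α ≡ E u v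
    multiplier-integral c P≡ α stable = conclude (stable Λ-𝟏) (stable Λ-θ)
      where
      Λ-𝟏 : Λ θ 𝟏
      Λ-𝟏 = 1ℤ , 0ℤ , sym (trans (cong₂ (λ x y → x ⊕ y ⊗ θ) ι-1 ι-0) (trans (cong (𝟏 ⊕_) (⊗-zeroˡ θ)) (⊕-identityʳ 𝟏)))
      Λ-θ : Λ θ θ
      Λ-θ = 0ℤ , 1ℤ , sym (trans (cong₂ (λ x y → x ⊕ y ⊗ θ) ι-0 ι-1) (trans (⊕-identityˡ _) (⊗-identityˡ θ)))
      conclude : Λ θ (α ⊗ 𝟏) → Λ θ (α ⊗ θ) → ∃[ u ] ∃[ v ] α ≡ E u v
      conclude (x , y , α1≡) (m , n , αθ≡) = from-multiple
          (primitive-cancel s t fund (+ a) r c P≡ a y 1≤a (cg y (sym (+-identityˡ _))) (cg (n - x) yb≡) (cg (- m) yc≡))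
        where
        open ≡-Reasoning
        α≡ : α ≡ ι x ⊕ ι y ⊗ θ
        α≡ = trans (sym (⊗-identityʳ α)) α1≡
        parts : (+ a * x - y * r) * - r - t * (y * 1ℤ) ≡ + a * (+ a * m - n * r) - t * (0ℤ * n) ×
                (+ a * x - y * r) * 1ℤ + y * - r + s * (y * 1ℤ) ≡ + a * n + 0ℤ * (+ a * m - n * r) + s * (0ℤ * n)
        parts = E-injective (begin
          E ((+ a * x - y * r) * - r - t * (y * 1ℤ)) ((+ a * x - y * r) * 1ℤ + y * - r + s * (y * 1ℤ))
            ≡⟨ sym (E-⊗ (+ a * x - y * r) y (- r) 1ℤ) ⟩
          E (+ a * x - y * r) y ⊗ E (- r) 1ℤ
            ≡⟨ cong₂ _⊗_ (sym (trans (cong (ι (+ a) ⊗_) α≡) (aΛ x y))) (sym (trans aθ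
                 (trans (solve 2 (λ w r → w :+ :- r := :- r :+ con 1ℤ :* w) refl ω (ι r)) (cong (_⊕ ι 1ℤ ⊗ ω) (sym (ι-neg r)))))) ⟩
          (ι (+ a) ⊗ α) ⊗ (ι (+ a) ⊗ θ)
            ≡⟨ solve 3 (λ a α θ → (a :* α) :* (a :* θ) := a :* (a :* (α :* θ))) refl (ι (+ a)) α θ ⟩
          ι (+ a) ⊗ (ι (+ a) ⊗ (α ⊗ θ))
            ≡⟨ cong (λ z → ι (+ a) ⊗ (ι (+ a) ⊗ z)) αθ≡ ⟩
          ι (+ a) ⊗ (ι (+ a) ⊗ (ι m ⊕ ι n ⊗ θ))
            ≡⟨ cong₂ _⊗_ (sym (E-ι (+ a))) (aΛ m n) ⟩
          E (+ a) 0ℤ ⊗ E (+ a * m - n * r) n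
            ≡⟨ E-⊗ (+ a) 0ℤ (+ a * m - n * r) n ⟩
          E (+ a * (+ a * m - n * r) - t * (0ℤ * n)) (+ a * n + 0ℤ * (+ a * m - n * r) + s * (0ℤ * n)) ∎)
        yb≡ : y * (s - + 2 * r) ≡ 0ℤ + (n - x) * + a
        yb≡ = trans (l₁ s (+ a) x y r) (trans (cong (_- + a * x) (proj₂ parts)) (l₂ (+ a) n x m r s))
          where
          l₁ : ∀ s a x y r → y * (s - + 2 * r) ≡ (a * x - y * r) * + 1 + y * - r + s * (y * + 1) - a * x
          l₁ = solve-∀
          l₂ : ∀ a n x m r s → a * n + + 0 * (a * m - n * r) + s * (+ 0 * n) - a * x ≡ + 0 + (n - x) * a
          l₂ = solve-∀
        yc≡ : y * c ≡ 0ℤ + - m * + a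
        yc≡ = *-cancelˡ-≡ (+ a) (y * c) (0ℤ + - m * + a) {{ℕ.>-nonZero 1≤a}} (begin
          + a * (y * c)   ≡⟨ trans (l₀ (+ a) y c) (cong (y *_) (sym P≡)) ⟩
          y * P r         ≡⟨ l₁ s t (+ a) x y r ⟩
          - ((+ a * x - y * r) * - r - t * (y * 1ℤ)) - r * ((+ a * x - y * r) * 1ℤ + y * - r + s * (y * 1ℤ)) ≡⟨ cong₂ (λ u v → - u - r * v) (proj₁ parts) (proj₂ parts) ⟩
          - (+ a * (+ a * m - n * r) - t * (0ℤ * n)) - r * (+ a * n + 0ℤ * (+ a * m - n * r) + s * (0ℤ * n))
                          ≡⟨ l₂ s t (+ a) m n r y ⟩
          + a * (0ℤ + - m * + a) ∎)
          where
          l₀ : ∀ a y c → a * (y * c) ≡ y * (a * c)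
          l₀ = solve-∀
          l₁ : ∀ s t a x y r → y * (r * r - s * r + t) ≡
            - ((a * x - y * r) * - r - t * (y * + 1)) - r * ((a * x - y * r) * + 1 + y * - r + s * (y * + 1))
          l₁ = solve-∀
          l₂ : ∀ s t a m n r y → - (a * (a * m - n * r) - t * (+ 0 * n)) - r * (a * n + + 0 * (a * m - n * r) + s * (+ 0 * n))
               ≡ a * (+ 0 + - m * a)
          l₂ = solve-∀
        from-multiple : y ≅ 0ℤ [ a ] → ∃[ u ] ∃[ v ] α ≡ E u v
        from-multiple (cg k y≡) = x - k * r , k , (begin
          α                                 ≡⟨ α≡ ⟩
          ι x ⊕ ι y ⊗ θ                     ≡⟨ cong (λ z → ι x ⊕ z ⊗ θ) (trans (cong ι (trans y≡ (+-identityˡ _))) (ι-* k (+ a))) ⟩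
          ι x ⊕ ι k ⊗ ι (+ a) ⊗ θ           ≡⟨ cong (ι x ⊕_) (trans (⊗-assoc (ι k) (ι (+ a)) θ) (cong (ι k ⊗_) aθ)) ⟩
          ι x ⊕ ι k ⊗ (ω ⊕ ⊝ ι r)           ≡⟨ solve 4 (λ x k w r → x :+ k :* (w :+ :- r) := (x :+ :- (k :* r)) :+ k :* w) refl (ι x) (ι k) ω (ι r) ⟩
          (ι x ⊕ ⊝ (ι k ⊗ ι r)) ⊕ ι k ⊗ ω   ≡⟨ cong (_⊕ ι k ⊗ ω) (sym (trans (ι-+ x (- (k * r))) (cong (ι x ⊕_) (trans (ι-neg (k * r)) (cong ⊝_ (ι-* k r)))))) ⟩
          E (x - k * r) k                   ∎)

  -- From ω b₁ = p b₁ + q b₂ follows q b₂ / b₁ = ω - p, where q ≠ 0 because ω is irrational. Up to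
  -- the sign σ of q, b₂ / b₁ is the required θ, with r = p and a = ∣ q ∣; stability under ω yields
  -- a ∣ P(p).
  structure : ∀ {M} → Basis M → (∀ {x} → M x → M (ω ⊗ x)) → Structure M
  structure {M} (basis b₁ b₂ b₁≢𝟎 _ to from) stable = from-ω (to (stable (from (1ℤ , 0ℤ , b₁-span))))
    where
    open ≡-Reasoning
    b₁-span : b₁ ≡ ι 1ℤ ⊗ b₁ ⊕ ι 0ℤ ⊗ b₂
    b₁-span = sym (trans (cong₂ (λ x y → x ⊗ b₁ ⊕ y ⊗ b₂) ι-1 ι-0) (trans (cong₂ _⊕_ (⊗-identityˡ b₁) (⊗-zeroˡ b₂)) (⊕-identityʳ b₁)))
    b₁⁻¹ = proj₁ (invert b₁ b₁≢𝟎)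
    b₁b₁⁻¹ : b₁ ⊗ b₁⁻¹ ≡ 𝟏
    b₁b₁⁻¹ = proj₂ (invert b₁ b₁≢𝟎)
    from-ω : ZSpan b₁ b₂ (ω ⊗ b₁) → Structure M
    from-ω (p , q , ωb₁≡) = from-sign (signed q)
      where
      qb₂ : ι q ⊗ b₂ ≡ b₁ ⊗ (ω ⊕ ⊝ ι p)
      qb₂ = begin
        ι q ⊗ b₂                            ≡⟨ solve 2 (λ x y → y := (x :+ y) :+ :- x) refl (ι p ⊗ b₁) (ι q ⊗ b₂) ⟩
        (ι p ⊗ b₁ ⊕ ι q ⊗ b₂) ⊕ ⊝ (ι p ⊗ b₁) ≡⟨ cong (_⊕ ⊝ (ι p ⊗ b₁)) (sym ωb₁≡) ⟩
        ω ⊗ b₁ ⊕ ⊝ (ι p ⊗ b₁)               ≡⟨ solve 3 (λ w p b → w :* b :+ :- (p :* b) := b :* (w :+ :- p)) refl ω (ι p) b₁ ⟩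
        b₁ ⊗ (ω ⊕ ⊝ ι p)                    ∎
      q≢0 : q ≢ 0ℤ
      q≢0 q≡0 = 1≢0 (proj₂ (independent (- p) 1ℤ (trans rearrange (inverse-cancel b₁b₁⁻¹ (trans (sym qb₂)
          (trans (cong (λ z → ι z ⊗ b₂) q≡0) (trans (cong (_⊗ b₂) ι-0) (trans (⊗-zeroˡ b₂) (sym (⊗-zeroʳ b₁))))))))))
        where
        1≢0 : 1ℤ ≢ 0ℤ
        1≢0 ()
        rearrange : ι (- p) ⊕ ι 1ℤ ⊗ ω ≡ ω ⊕ ⊝ ι p
        rearrange = trans (cong (_⊕ ι 1ℤ ⊗ ω) (ι-neg p)) (solve 2 (λ w p → :- p :+ con 1ℤ :* w := w :+ :- p) refl ω (ι p))
      from-sign : ∃[ σ ] σ * σ ≡ 1ℤ × q ≡ σ * + ∣ q ∣ → Structure M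
      from-sign (σ , σ²≡1 , q≡) = record
        { quadratic = record { a = a ; 1≤a = 1≤a ; r = p ; c = proj₁ dividing ; P≡ = proj₂ dividing ; θ = θ ; aθ = aθ }
        ; b = b₁ ; b⁻¹ = b₁⁻¹ ; b-inverse = b₁b₁⁻¹ ; to = to′ ; from = from′ }
        where
        a = ∣ q ∣
        1≤a : 1 ℕ.≤ a
        1≤a = ℕ.n≢0⇒n>0 λ a≡0 → q≢0 (∣i∣≡0⇒i≡0 a≡0)
        θ = ι σ ⊗ b₂ ⊗ b₁⁻¹
        σι : ι (+ a) ⊗ ι σ ≡ ι q
        σι = trans (sym (ι-* (+ a) σ)) (cong ι (trans (*-comm (+ a) σ) (sym q≡)))
        aθ : ι (+ a) ⊗ θ ≡ ω ⊕ ⊝ ι p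
        aθ = begin
          ι (+ a) ⊗ (ι σ ⊗ b₂ ⊗ b₁⁻¹)     ≡⟨ solve 4 (λ a s b i → a :* (s :* b :* i) := (a :* s) :* b :* i) refl (ι (+ a)) (ι σ) b₂ b₁⁻¹ ⟩
          (ι (+ a) ⊗ ι σ) ⊗ b₂ ⊗ b₁⁻¹     ≡⟨ cong (λ z → z ⊗ b₂ ⊗ b₁⁻¹) σι ⟩
          ι q ⊗ b₂ ⊗ b₁⁻¹                 ≡⟨ cong (_⊗ b₁⁻¹) qb₂ ⟩
          b₁ ⊗ (ω ⊕ ⊝ ι p) ⊗ b₁⁻¹         ≡⟨ solve 3 (λ b x i → b :* x :* i := (b :* i) :* x) refl b₁ (ω ⊕ ⊝ ι p) b₁⁻¹ ⟩
          (b₁ ⊗ b₁⁻¹) ⊗ (ω ⊕ ⊝ ι p)       ≡⟨ trans (cong (_⊗ (ω ⊕ ⊝ ι p)) b₁b₁⁻¹) (⊗-identityˡ _) ⟩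
          ω ⊕ ⊝ ι p                       ∎
        b₁θ : b₁ ⊗ θ ≡ ι σ ⊗ b₂
        b₁θ = trans (solve 4 (λ b s c i → b :* (s :* c :* i) := (b :* i) :* (s :* c)) refl b₁ (ι σ) b₂ b₁⁻¹)
          (trans (cong (_⊗ (ι σ ⊗ b₂)) b₁b₁⁻¹) (⊗-identityˡ _))
        σb₁θ : ι σ ⊗ (b₁ ⊗ θ) ≡ b₂
        σb₁θ = trans (cong (ι σ ⊗_) b₁θ) (trans (sym (⊗-assoc (ι σ) (ι σ) b₂))
          (trans (cong (_⊗ b₂) (trans (sym (ι-* σ σ)) (trans (cong ι σ²≡1) ι-1))) (⊗-identityˡ b₂)))
        to′ : ∀ {y} → M (b₁ ⊗ y) → Λ θ y
        to′ {y} M∋ = convert (to M∋)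
          where
          convert : ZSpan b₁ b₂ (b₁ ⊗ y) → Λ θ y
          convert (m , n , eq) = m , n * σ , inverse-cancel b₁b₁⁻¹ (begin
            b₁ ⊗ y                      ≡⟨ eq ⟩
            ι m ⊗ b₁ ⊕ ι n ⊗ b₂         ≡⟨ cong (λ z → ι m ⊗ b₁ ⊕ ι n ⊗ z) (sym σb₁θ) ⟩
            ι m ⊗ b₁ ⊕ ι n ⊗ (ι σ ⊗ (b₁ ⊗ θ)) ≡⟨ solve 5 (λ m b n s θ → m :* b :+ n :* (s :* (b :* θ)) := b :* (m :+ (n :* s) :* θ)) refl (ι m) b₁ (ι n) (ι σ) θ ⟩
            b₁ ⊗ (ι m ⊕ (ι n ⊗ ι σ) ⊗ θ) ≡⟨ cong (λ z → b₁ ⊗ (ι m ⊕ z ⊗ θ)) (sym (ι-* n σ)) ⟩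
            b₁ ⊗ (ι m ⊕ ι (n * σ) ⊗ θ)  ∎)
        from′ : ∀ {y} → Λ θ y → M (b₁ ⊗ y)
        from′ {y} (m , n , eq) = from (m , n * σ , (begin
          b₁ ⊗ y                        ≡⟨ cong (b₁ ⊗_) eq ⟩
          b₁ ⊗ (ι m ⊕ ι n ⊗ θ)          ≡⟨ solve 4 (λ b m n θ → b :* (m :+ n :* θ) := m :* b :+ n :* (b :* θ)) refl b₁ (ι m) (ι n) θ ⟩
          ι m ⊗ b₁ ⊕ ι n ⊗ (b₁ ⊗ θ)     ≡⟨ cong (λ z → ι m ⊗ b₁ ⊕ ι n ⊗ z) b₁θ ⟩
          ι m ⊗ b₁ ⊕ ι n ⊗ (ι σ ⊗ b₂)   ≡⟨ cong (ι m ⊗ b₁ ⊕_) (trans (sym (⊗-assoc (ι n) (ι σ) b₂)) (cong (_⊗ b₂) (sym (ι-* n σ)))) ⟩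
          ι m ⊗ b₁ ⊕ ι (n * σ) ⊗ b₂     ∎))
        Λ-θ : Λ θ θ
        Λ-θ = 0ℤ , 1ℤ , sym (trans (cong₂ (λ x y → x ⊕ y ⊗ θ) ι-0 ι-1) (trans (⊕-identityˡ _) (⊗-identityˡ θ)))
        dividing : ∃[ c ] P p ≡ + a * c
        dividing = index-of-stable a 1≤a p θ aθ
          (to′ (subst M (solve 3 (λ w b θ → w :* (b :* θ) := b :* (w :* θ)) refl ω b₁ θ) (stable (from′ Λ-θ))))

  -- Integral elements

  evalM : List ℤ → K → K
  evalM []       α = 𝟏
  evalM (c ∷ cs) α = ι c ⊕ α ⊗ evalM cs α

  powers : K → K → ℕ → List K
  powers α β zero    = []
  powers α β (suc n) = β ∷ powers α (α ⊗ β) n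

  top : K → K → ℕ → K
  top α β zero    = β
  top α β (suc n) = top α (α ⊗ β) n

  module _ (α : K) where

    -- Separates the top power αⁿ β from the lower ones. With β = 1, an integral equation for α then
    -- puts αⁿ into the span of 1, α, ..., αⁿ⁻¹.
    evalM-top : ∀ cs β → ∃[ z ] OSpan (powers α β (length cs)) z × β ⊗ evalM cs α ≡ z ⊕ top α β (length cs)
    evalM-top []       β = 𝟎 , refl , trans (⊗-identityʳ β) (sym (⊕-identityˡ β))
    evalM-top (c ∷ cs) β = extend (evalM-top cs (α ⊗ β))
      where
      extend : ∃[ z ] OSpan (powers α (α ⊗ β) (length cs)) z × (α ⊗ β) ⊗ evalM cs α ≡ z ⊕ top α (α ⊗ β) (length cs) →
               ∃[ z ] OSpan (β ∷ powers α (α ⊗ β) (length cs)) z × β ⊗ (ι c ⊕ α ⊗ evalM cs α) ≡ z ⊕ top α (α ⊗ β) (length cs)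
      extend (z , z∈ , eq) = E c 0ℤ ⊗ β ⊕ z , (c , 0ℤ , z , z∈ , refl) , (begin
        β ⊗ (ι c ⊕ α ⊗ evalM cs α)     ≡⟨ solve 4 (λ b c a e → b :* (c :+ a :* e) := c :* b :+ (a :* b) :* e) refl β (ι c) α (evalM cs α) ⟩
        ι c ⊗ β ⊕ (α ⊗ β) ⊗ evalM cs α ≡⟨ cong₂ (λ x y → x ⊗ β ⊕ y) (sym (E-ι c)) eq ⟩
        E c 0ℤ ⊗ β ⊕ (z ⊕ top α (α ⊗ β) (length cs))
          ≡⟨ solve 3 (λ x y z → x :+ (y :+ z) := (x :+ y) :+ z) refl (E c 0ℤ ⊗ β) z (top α (α ⊗ β) (length cs)) ⟩
        (E c 0ℤ ⊗ β ⊕ z) ⊕ top α (α ⊗ β) (length cs) ∎)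
        where open ≡-Reasoning

    powers-shift : ∀ n β {x} → OSpan (powers α β n) x → OSpan (powers α (α ⊗ β) n) (α ⊗ x)
    powers-shift zero    β refl = ⊗-zeroʳ α
    powers-shift (suc n) β (p , q , y , y∈ , refl) = p , q , α ⊗ y , powers-shift n (α ⊗ β) y∈ ,
      solve 4 (λ a e b y → a :* (e :* b :+ y) := e :* (a :* b) :+ a :* y) refl α (E p q) β y

    powers-top : ∀ n β {x} → OSpan (powers α β (suc n)) x →
                 ∃[ y ] ∃[ p ] ∃[ q ] OSpan (powers α β n) y × x ≡ y ⊕ E p q ⊗ top α β n
    powers-top zero β (p , q , _ , refl , refl) = 𝟎 , p , q , refl ,
      trans (⊕-identityʳ (E p q ⊗ β)) (sym (⊕-identityˡ (E p q ⊗ β)))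
    powers-top (suc n) β (p , q , x , x∈ , refl) = extend (powers-top n (α ⊗ β) x∈)
      where
      extend : ∃[ y ] ∃[ p′ ] ∃[ q′ ] OSpan (powers α (α ⊗ β) n) y × x ≡ y ⊕ E p′ q′ ⊗ top α (α ⊗ β) n →
               ∃[ y ] ∃[ p′ ] ∃[ q′ ] OSpan (β ∷ powers α (α ⊗ β) n) y × E p q ⊗ β ⊕ x ≡ y ⊕ E p′ q′ ⊗ top α (α ⊗ β) n
      extend (y , p′ , q′ , y∈ , refl) = E p q ⊗ β ⊕ y , p′ , q′ , (p , q , y , y∈ , refl) ,
        solve 3 (λ x y z → x :+ (y :+ z) := (x :+ y) :+ z) refl (E p q ⊗ β) y (E p′ q′ ⊗ top α (α ⊗ β) n)

    -- α multiplies the O-span of 1, α, …, αⁿ⁻¹ into itself.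

    integrally-closed : ∀ cs → evalM cs α ≡ 𝟎 → ∃[ u ] ∃[ v ] α ≡ E u v
    integrally-closed [] eq = ⊥-elim (𝟏≢𝟎 eq)
    integrally-closed cs@(c ∷ cs′) eq = from-basis (basis-or-zero gs)
      where
      n = length cs
      gs = powers α 𝟏 n
      top∈ : OSpan gs (top α 𝟏 n)
      top∈ = convert (evalM-top cs 𝟏)
        where
        convert : ∃[ z ] OSpan gs z × 𝟏 ⊗ evalM cs α ≡ z ⊕ top α 𝟏 n → OSpan gs (top α 𝟏 n)
        convert (z , z∈ , eq′) = subst (OSpan gs) (begin
          ⊝ z                          ≡⟨ sym (⊕-identityʳ (⊝ z)) ⟩
          ⊝ z ⊕ 𝟎                      ≡⟨ cong (⊝ z ⊕_) (trans (sym eq) (trans (sym (⊗-identityˡ _)) eq′)) ⟩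
          ⊝ z ⊕ (z ⊕ top α 𝟏 n)        ≡⟨ solve 2 (λ z x → :- z :+ (z :+ x) := x) refl z (top α 𝟏 n) ⟩
          top α 𝟏 n                    ∎) (OSpan-⊝ gs z∈)
          where open ≡-Reasoning
      α-stable : ∀ {x} → OSpan gs x → OSpan gs (α ⊗ x)
      α-stable {x} x∈ = convert (powers-top n 𝟏 (OSpan-skip 𝟏 (powers α (α ⊗ 𝟏) n) (powers-shift n 𝟏 x∈)))
        where
        convert : ∃[ y ] ∃[ p ] ∃[ q ] OSpan gs y × α ⊗ x ≡ y ⊕ E p q ⊗ top α 𝟏 n → OSpan gs (α ⊗ x)
        convert (y , p , q , y∈ , αx≡) = subst (OSpan gs) (sym αx≡) (OSpan-⊕ gs y∈ (OSpan-E gs p q top∈))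
      from-basis : (∀ {x} → OSpan gs x → x ≡ 𝟎) ⊎ Basis (OSpan gs) → ∃[ u ] ∃[ v ] α ≡ E u v
      from-basis (inj₁ null) = ⊥-elim (𝟏≢𝟎 (null (OSpan-here 𝟏 (powers α (α ⊗ 𝟏) (length cs′)))))
      from-basis (inj₂ B) = multiplier-integral a 1≤a r θ aθ c₁ P≡ α λ {y} y∈ →
          to (subst (OSpan gs) (solve 3 (λ a b y → a :* (b :* y) := b :* (a :* y)) refl α b y) (α-stable (from y∈)))
        where
        open Structure (structure B (OSpan-ω gs)) renaming (c to c₁)

  -- The two coefficients are the norm and the negative trace of p + q ω.
  evalM-quadratic : ∀ p q → evalM (p * (p + s * q) + t * (q * q) ∷ - (+ 2 * p + s * q) ∷ []) (E p q) ≡ 𝟎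
  evalM-quadratic p q = begin
    ι N ⊕ E p q ⊗ (ι (- T) ⊕ E p q ⊗ 𝟏)
      ≡⟨ cong₂ (λ x y → x ⊕ E p q ⊗ y) (sym (E-ι N)) (cong₂ _⊕_ (sym (E-ι (- T))) (⊗-identityʳ (E p q))) ⟩
    E N 0ℤ ⊕ E p q ⊗ (E (- T) 0ℤ ⊕ E p q)
      ≡⟨ cong (λ z → E N 0ℤ ⊕ E p q ⊗ z) (E-+ (- T) 0ℤ p q) ⟩
    E N 0ℤ ⊕ E p q ⊗ E (- T + p) (0ℤ + q)
      ≡⟨ trans (cong (E N 0ℤ ⊕_) (E-⊗ p q (- T + p) (0ℤ + q))) (E-+ N 0ℤ _ _) ⟩
    E (N + (p * (- T + p) - t * (q * (0ℤ + q)))) (0ℤ + (p * (0ℤ + q) + q * (- T + p) + s * (q * (0ℤ + q))))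
      ≡⟨ cong₂ E (l₁ s t p q) (l₂ s p q) ⟩
    E 0ℤ 0ℤ ≡⟨ E-0 ⟩
    𝟎 ∎
    where
    open ≡-Reasoning
    N = p * (p + s * q) + t * (q * q)
    T = + 2 * p + s * q
    l₁ : ∀ s t p q → p * (p + s * q) + t * (q * q) + (p * (- (+ 2 * p + s * q) + p) - t * (q * (+ 0 + q))) ≡ + 0
    l₁ = solve-∀
    l₂ : ∀ s p q → + 0 + (p * (+ 0 + q) + q * (- (+ 2 * p + s * q) + p) + s * (q * (+ 0 + q))) ≡ + 0
    l₂ = solve-∀

  -- Norm forms and similarity of lattices

  module _ (Q : Quadratic) where
    open Quadratic Q renaming (a to A; 1≤a to 1≤A; r to R; c to C; P≡ to PR≡; θ to Θ; aθ to AΘ)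

    -- A times the norm of x + y Θ; its discriminant is D.
    quadForm : ℤ → ℤ → ℤ
    quadForm = form (+ A) (s - + 2 * R) C

    0<A : 0ℤ < + A
    0<A = +<+ 1≤A

    0<-disc : 0ℤ < + 4 * + A * C - (s - + 2 * R) * (s - + 2 * R)
    0<-disc = subst (0ℤ <_) (trans (l₁ s t R) (trans (cong (λ z → + 4 * z - (s - + 2 * R) * (s - + 2 * R)) PR≡) (l₂ (+ A) C _)))
      (neg-mono-< D<0)
      where
      l₁ : ∀ s t R → - (s * s - + 4 * t) ≡ + 4 * (R * R - s * R + t) - (s - + 2 * R) * (s - + 2 * R)
      l₁ = solve-∀
      l₂ : ∀ a c x → + 4 * (a * c) - x ≡ + 4 * a * c - x
      l₂ = solve-∀

    -- The lattice γ⁻¹Λ(Θ), γ = x + yΘ, has the basis 1, (ω − r)/a.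

    record Rel (a : ℕ) (r x y : ℤ) : Set where
      field
        form≡a : quadForm x y ≡ + a
        row₁   : (R - r) * x - C * y ≅ 0ℤ [ a ]
        row₂   : + A * x + (s - R - r) * y ≅ 0ℤ [ a ]

    -- The form is the determinant of γ = x + y Θ and (ω - r) γ in the basis 1, Θ. The coordinates
    -- of the latter, computed in `shift-Λ`, are the two rows of `Rel`.
    form-det : ∀ r x y → quadForm x y ≡ x * (+ A * x + (s - R - r) * y) - y * ((R - r) * x - C * y)
    form-det r x y = l (+ A) C R r s x y
      where
      l : ∀ A C R r s x y → A * (x * x) + (s - + 2 * R) * (x * y) + C * (y * y) ≡
          x * (A * x + (s - R - r) * y) - y * ((R - r) * x - C * y)
      l = solve-∀

    shift-Λ : ∀ r x y → (ω ⊕ ⊝ ι r) ⊗ (ι x ⊕ ι y ⊗ Θ) ≡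
              ι ((R - r) * x - C * y) ⊕ ι (+ A * x + (s - R - r) * y) ⊗ Θ
    shift-Λ r x y = begin
      (ω ⊕ ⊝ ι r) ⊗ (ι x ⊕ ι y ⊗ Θ)
        ≡⟨ solve 5 (λ w r x y θ → (w :+ :- r) :* (x :+ y :* θ) := x :* w :+ y :* (w :* θ) :+ :- (r :* (x :+ y :* θ))) refl ω (ι r) (ι x) (ι y) Θ ⟩
      ι x ⊗ ω ⊕ ι y ⊗ (ω ⊗ Θ) ⊕ ⊝ (ι r ⊗ (ι x ⊕ ι y ⊗ Θ))
        ≡⟨ cong₂ (λ p q → ι x ⊗ p ⊕ ι y ⊗ q ⊕ ⊝ (ι r ⊗ (ι x ⊕ ι y ⊗ Θ))) (ω-Λ A 1≤A R Θ AΘ) (ωθ-Λ A 1≤A R Θ AΘ C PR≡) ⟩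
      ι x ⊗ (ι R ⊕ ι (+ A) ⊗ Θ) ⊕ ι y ⊗ (ι (- C) ⊕ ι (s - R) ⊗ Θ) ⊕ ⊝ (ι r ⊗ (ι x ⊕ ι y ⊗ Θ))
        ≡⟨ cong₂ (λ p q → ι x ⊗ (ι R ⊕ ι (+ A) ⊗ Θ) ⊕ ι y ⊗ (p ⊕ q ⊗ Θ) ⊕ ⊝ (ι r ⊗ (ι x ⊕ ι y ⊗ Θ))) (ι-neg C)
             (trans (ι-+ s (- R)) (cong (ι s ⊕_) (ι-neg R))) ⟩
      ι x ⊗ (ι R ⊕ ι (+ A) ⊗ Θ) ⊕ ι y ⊗ (⊝ ι C ⊕ (ι s ⊕ ⊝ ι R) ⊗ Θ) ⊕ ⊝ (ι r ⊗ (ι x ⊕ ι y ⊗ Θ))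
        ≡⟨ solve 8 (λ x R A θ y C s r → x :* (R :+ A :* θ) :+ y :* (:- C :+ (s :+ :- R) :* θ) :+ :- (r :* (x :+ y :* θ)) :=
             ((R :+ :- r) :* x :+ :- (C :* y)) :+ (A :* x :+ (s :+ :- R :+ :- r) :* y) :* θ) refl
             (ι x) (ι R) (ι (+ A)) Θ (ι y) (ι C) (ι s) (ι r) ⟩
      ((ι R ⊕ ⊝ ι r) ⊗ ι x ⊕ ⊝ (ι C ⊗ ι y)) ⊕ (ι (+ A) ⊗ ι x ⊕ (ι s ⊕ ⊝ ι R ⊕ ⊝ ι r) ⊗ ι y) ⊗ Θ
        ≡⟨ cong₂ (λ p q → p ⊕ q ⊗ Θ) (sym real) (sym imag) ⟩
      ι ((R - r) * x - C * y) ⊕ ι (+ A * x + (s - R - r) * y) ⊗ Θ ∎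
      where
      open ≡-Reasoning
      ι-- : ∀ u v → ι (u - v) ≡ ι u ⊕ ⊝ ι v
      ι-- u v = trans (ι-+ u (- v)) (cong (ι u ⊕_) (ι-neg v))
      real : ι ((R - r) * x - C * y) ≡ (ι R ⊕ ⊝ ι r) ⊗ ι x ⊕ ⊝ (ι C ⊗ ι y)
      real = trans (ι-- ((R - r) * x) (C * y)) (cong₂ (λ p q → p ⊕ ⊝ q) (trans (ι-* (R - r) x) (cong (_⊗ ι x) (ι-- R r))) (ι-* C y))
      imag : ι (+ A * x + (s - R - r) * y) ≡ ι (+ A) ⊗ ι x ⊕ (ι s ⊕ ⊝ ι R ⊕ ⊝ ι r) ⊗ ι y
      imag = trans (ι-+ (+ A * x) ((s - R - r) * y)) (cong₂ _⊕_ (ι-* (+ A) x)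
        (trans (ι-* (s - R - r) y) (cong (_⊗ ι y) (trans (ι-- (s - R) r) (cong (_⊕ ⊝ ι r) (ι-- s R))))))

    module Definite = PositiveDefinite (+ A) (s - + 2 * R) C 0<A 0<-disc

  module _ (Q Q′ : Quadratic) where
    open Quadratic Q′
    open Quadratic Q using () renaming (a to A; 1≤a to 1≤A; r to R; c to C; P≡ to PR≡; θ to Θ; aθ to AΘ)

    record Similar : Set where
      field
        γ γ⁻¹ : K
        γ-inverse : γ ⊗ γ⁻¹ ≡ 𝟏
        to   : ∀ {y} → Λ θ y → Λ Θ (γ ⊗ y)
        from : ∀ {y} → Λ Θ (γ ⊗ y) → Λ θ y

    private
      det-form : ∀ x y x₂ y₂ → (R - r) * x - C * y ≡ + a * x₂ → + A * x + (s - R - r) * y ≡ + a * y₂ →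
                 quadForm Q x y ≡ + a * (x * y₂ - x₂ * y)
      det-form x y x₂ y₂ e₁ e₂ = trans (form-det Q r x y) (trans (cong₂ (λ p q → x * q - y * p) e₁ e₂) (l (+ a) x y x₂ y₂))
        where
        l : ∀ a x y x₂ y₂ → x * (a * y₂) - y * (a * x₂) ≡ a * (x * y₂ - x₂ * y)
        l = solve-∀

      combination : ∀ x y x₂ y₂ p q → (ι x ⊕ ι y ⊗ Θ) ⊗ ι p ⊕ (ι x₂ ⊕ ι y₂ ⊗ Θ) ⊗ ι q ≡
                    ι (x * p + x₂ * q) ⊕ ι (y * p + y₂ * q) ⊗ Θ
      combination x y x₂ y₂ p q = trans
        (solve 7 (λ x y x₂ y₂ p q θ → (x :+ y :* θ) :* p :+ (x₂ :+ y₂ :* θ) :* q :=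
          (x :* p :+ x₂ :* q) :+ (y :* p :+ y₂ :* q) :* θ) refl (ι x) (ι y) (ι x₂) (ι y₂) (ι p) (ι q) Θ)
        (cong₂ (λ u v → u ⊕ v ⊗ Θ) (sym (ι-combine x p x₂ q)) (sym (ι-combine y p y₂ q)))

      scale : ∀ u v → ι (+ a) ⊗ (ι u ⊕ ι v ⊗ Θ) ≡ ι (+ a * u) ⊕ ι (+ a * v) ⊗ Θ
      scale u v = trans (solve 4 (λ a u v θ → a :* (u :+ v :* θ) := a :* u :+ (a :* v) :* θ) refl (ι (+ a)) (ι u) (ι v) Θ)
        (cong₂ (λ p q → p ⊕ q ⊗ Θ) (sym (ι-* (+ a) u)) (sym (ι-* (+ a) v)))

    -- γ carries the basis 1, θ to a basis of Λ Θ, so the determinant δ is a unit. As a δ is a value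
    -- of a nonnegative form, δ = 1, and this value is a.
    similar⇒rel : Similar → ∃[ x ] ∃[ y ] Rel Q a r x y
    similar⇒rel sim = build (to Λ-𝟏) (to Λ-θ) (from (subst (Λ Θ) (sym γ-inverse) Λ-𝟏Θ))
        (from (subst (Λ Θ) (sym γγ⁻¹Θ) Λ-Θ))
      where
      open Similar sim
      one : ∀ θ → 𝟏 ≡ ι 1ℤ ⊕ ι 0ℤ ⊗ θ
      one θ = sym (trans (cong₂ (λ x y → x ⊕ y ⊗ θ) ι-1 ι-0) (trans (cong (𝟏 ⊕_) (⊗-zeroˡ θ)) (⊕-identityʳ 𝟏)))
      gen : ∀ θ → θ ≡ ι 0ℤ ⊕ ι 1ℤ ⊗ θ
      gen θ = sym (trans (cong₂ (λ x y → x ⊕ y ⊗ θ) ι-0 ι-1) (trans (⊕-identityˡ _) (⊗-identityˡ θ)))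
      Λ-𝟏 : Λ θ 𝟏
      Λ-𝟏 = 1ℤ , 0ℤ , one θ
      Λ-θ : Λ θ θ
      Λ-θ = 0ℤ , 1ℤ , gen θ
      Λ-𝟏Θ : Λ Θ 𝟏
      Λ-𝟏Θ = 1ℤ , 0ℤ , one Θ
      Λ-Θ : Λ Θ Θ
      Λ-Θ = 0ℤ , 1ℤ , gen Θ
      γγ⁻¹Θ : γ ⊗ (γ⁻¹ ⊗ Θ) ≡ Θ
      γγ⁻¹Θ = trans (sym (⊗-assoc γ γ⁻¹ Θ)) (trans (cong (_⊗ Θ) γ-inverse) (⊗-identityˡ Θ))
      build : Λ Θ (γ ⊗ 𝟏) → Λ Θ (γ ⊗ θ) → Λ θ γ⁻¹ → Λ θ (γ⁻¹ ⊗ Θ) → ∃[ x ] ∃[ y ] Rel Q a r x y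
      build (x , y , γ1≡) (x₂ , y₂ , γθ≡) (p , q , γ⁻¹≡) (p′ , q′ , γ⁻¹Θ≡) =
        x , y , record { form≡a = trans form≡ (trans (cong (+ a *_) δ≡1) (*-identityʳ (+ a)))
                       ; row₁ = cg x₂ (trans (proj₁ rows) (trans (*-comm (+ a) x₂) (sym (+-identityˡ _))))
                       ; row₂ = cg y₂ (trans (proj₂ rows) (trans (*-comm (+ a) y₂) (sym (+-identityˡ _)))) }
        where
        open ≡-Reasoning
        δ = x * y₂ - x₂ * y
        γ≡ : γ ≡ ι x ⊕ ι y ⊗ Θ
        γ≡ = trans (sym (⊗-identityʳ γ)) γ1≡
        rows : (R - r) * x - C * y ≡ + a * x₂ × + A * x + (s - R - r) * y ≡ + a * y₂
        rows = Λ-injective A 1≤A R Θ AΘ (begin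
          ι ((R - r) * x - C * y) ⊕ ι (+ A * x + (s - R - r) * y) ⊗ Θ ≡⟨ sym (shift-Λ Q r x y) ⟩
          (ω ⊕ ⊝ ι r) ⊗ (ι x ⊕ ι y ⊗ Θ)   ≡⟨ cong₂ _⊗_ (sym aθ) (sym γ≡) ⟩
          (ι (+ a) ⊗ θ) ⊗ γ               ≡⟨ solve 3 (λ a θ g → (a :* θ) :* g := a :* (g :* θ)) refl (ι (+ a)) θ γ ⟩
          ι (+ a) ⊗ (γ ⊗ θ)               ≡⟨ cong (ι (+ a) ⊗_) γθ≡ ⟩
          ι (+ a) ⊗ (ι x₂ ⊕ ι y₂ ⊗ Θ)     ≡⟨ scale x₂ y₂ ⟩
          ι (+ a * x₂) ⊕ ι (+ a * y₂) ⊗ Θ ∎)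
        form≡ : quadForm Q x y ≡ + a * δ
        form≡ = det-form x y x₂ y₂ (proj₁ rows) (proj₂ rows)
        γΛ : ∀ p q → γ ⊗ (ι p ⊕ ι q ⊗ θ) ≡ ι (x * p + x₂ * q) ⊕ ι (y * p + y₂ * q) ⊗ Θ
        γΛ p q = trans (solve 4 (λ g p q θ → g :* (p :+ q :* θ) := g :* p :+ (g :* θ) :* q) refl γ (ι p) (ι q) θ)
          (trans (cong₂ (λ u v → u ⊗ ι p ⊕ v ⊗ ι q) γ≡ γθ≡) (combination x y x₂ y₂ p q))
        unit : 1ℤ ≡ x * p + x₂ * q × 0ℤ ≡ y * p + y₂ * q
        unit = Λ-injective A 1≤A R Θ AΘ (trans (sym (one Θ)) (trans (sym γ-inverse) (trans (cong (γ ⊗_) γ⁻¹≡) (γΛ p q))))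
        unit′ : 0ℤ ≡ x * p′ + x₂ * q′ × 1ℤ ≡ y * p′ + y₂ * q′
        unit′ = Λ-injective A 1≤A R Θ AΘ (trans (sym (gen Θ)) (trans (sym γγ⁻¹Θ) (trans (cong (γ ⊗_) γ⁻¹Θ≡) (γΛ p′ q′))))
        δ*≡1 : δ * (p * q′ - p′ * q) ≡ 1ℤ
        δ*≡1 = trans (l x y x₂ y₂ p q p′ q′) (trans
          (cong₂ _-_ (cong₂ _*_ (sym (proj₁ unit)) (sym (proj₂ unit′))) (cong₂ _*_ (sym (proj₁ unit′)) (sym (proj₂ unit)))) refl)
          where
          l : ∀ x y x₂ y₂ p q p′ q′ → (x * y₂ - x₂ * y) * (p * q′ - p′ * q) ≡
              (x * p + x₂ * q) * (y * p′ + y₂ * q′) - (x * p′ + x₂ * q′) * (y * p + y₂ * q)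
          l = solve-∀
        0≤δ : 0ℤ ≤ δ
        0≤δ = *-cancelˡ-≤-pos 0ℤ δ (+ a) {{positive (+<+ 1≤a)}} (≤-trans (≤-reflexive (*-zeroʳ (+ a)))
          (≤-trans (Definite.form-nonNeg Q x y) (≤-reflexive form≡)))
        δ≡1 : δ ≡ 1ℤ
        δ≡1 = trans (sym (0≤i⇒+∣i∣≡i 0≤δ)) (cong +_ (ℕ.m*n≡1⇒m≡1 ∣ δ ∣ ∣ p * q′ - p′ * q ∣
          (trans (sym (abs-* δ (p * q′ - p′ * q))) (cong ∣_∣ δ*≡1))))

    -- By `det-form` the matrix of γ and γ θ has determinant 1; its adjugate provides γ⁻¹ = y₂ - y θ
    -- and all preimages.
    rel⇒similar : ∀ x y → Rel Q a r x y → Similar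
    rel⇒similar x y rel = build (Rel.row₁ rel) (Rel.row₂ rel)
      where
      build : (R - r) * x - C * y ≅ 0ℤ [ a ] → + A * x + (s - R - r) * y ≅ 0ℤ [ a ] → Similar
      build (cg x₂ e₁) (cg y₂ e₂) = record
        { γ = γ ; γ⁻¹ = γ⁻¹ ; γ-inverse = inverse-law
        ; to = λ (m , n , z≡) → x * m + x₂ * n , y * m + y₂ * n , trans (cong (γ ⊗_) z≡) (γΛ m n)
        ; from = λ {z} (m , n , γz≡) → y₂ * m + - x₂ * n , - y * m + x * n , inverse-cancel inverse-law
            (trans γz≡ (sym (trans (γΛ (y₂ * m + - x₂ * n) (- y * m + x * n))
              (cong₂ (λ u v → ι u ⊕ ι v ⊗ Θ) (trans (l₁ x y x₂ y₂ m n) (trans (cong (_* m) δ≡1) (*-identityˡ m)))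
                (trans (l₂ x y x₂ y₂ m n) (trans (cong (_* n) δ≡1) (*-identityˡ n))))))) }
        where
        open ≡-Reasoning
        rows₁ : (R - r) * x - C * y ≡ + a * x₂
        rows₁ = trans e₁ (trans (+-identityˡ _) (*-comm x₂ (+ a)))
        rows₂ : + A * x + (s - R - r) * y ≡ + a * y₂
        rows₂ = trans e₂ (trans (+-identityˡ _) (*-comm y₂ (+ a)))
        δ≡1 : x * y₂ - x₂ * y ≡ 1ℤ
        δ≡1 = *-cancelˡ-≡ (+ a) (x * y₂ - x₂ * y) 1ℤ {{ℕ.>-nonZero 1≤a}}
          (trans (sym (det-form x y x₂ y₂ rows₁ rows₂)) (trans (Rel.form≡a rel) (sym (*-identityʳ (+ a)))))
        γ γ⁻¹ : K
        γ   = ι x ⊕ ι y ⊗ Θ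
        γ⁻¹ = ι y₂ ⊕ ι (- y) ⊗ θ
        γθ≡ : γ ⊗ θ ≡ ι x₂ ⊕ ι y₂ ⊗ Θ
        γθ≡ = ι-cancel (+ a) +a≢0 (begin
          ι (+ a) ⊗ (γ ⊗ θ)               ≡⟨ solve 3 (λ a θ g → a :* (g :* θ) := (a :* θ) :* g) refl (ι (+ a)) θ γ ⟩
          (ι (+ a) ⊗ θ) ⊗ γ               ≡⟨ cong (_⊗ γ) aθ ⟩
          (ω ⊕ ⊝ ι r) ⊗ γ                 ≡⟨ shift-Λ Q r x y ⟩
          ι ((R - r) * x - C * y) ⊕ ι (+ A * x + (s - R - r) * y) ⊗ Θ ≡⟨ cong₂ (λ u v → ι u ⊕ ι v ⊗ Θ) rows₁ rows₂ ⟩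
          ι (+ a * x₂) ⊕ ι (+ a * y₂) ⊗ Θ ≡⟨ sym (scale x₂ y₂) ⟩
          ι (+ a) ⊗ (ι x₂ ⊕ ι y₂ ⊗ Θ)     ∎)
        γΛ : ∀ p q → γ ⊗ (ι p ⊕ ι q ⊗ θ) ≡ ι (x * p + x₂ * q) ⊕ ι (y * p + y₂ * q) ⊗ Θ
        γΛ p q = trans (solve 4 (λ g p q θ → g :* (p :+ q :* θ) := g :* p :+ (g :* θ) :* q) refl γ (ι p) (ι q) θ)
          (trans (cong (λ v → γ ⊗ ι p ⊕ v ⊗ ι q) γθ≡) (combination x y x₂ y₂ p q))
        inverse-law : γ ⊗ γ⁻¹ ≡ 𝟏
        inverse-law = trans (γΛ y₂ (- y)) (trans (cong₂ (λ u v → ι u ⊕ ι v ⊗ Θ)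
          (trans (l₃ x y x₂ y₂) δ≡1) (l₄ y y₂)) (trans (cong₂ (λ u v → u ⊕ v ⊗ Θ) ι-1 ι-0)
            (trans (cong (𝟏 ⊕_) (⊗-zeroˡ Θ)) (⊕-identityʳ 𝟏))))
          where
          l₃ : ∀ x y x₂ y₂ → x * y₂ + x₂ * - y ≡ x * y₂ - x₂ * y
          l₃ = solve-∀
          l₄ : ∀ y y₂ → y * y₂ + y₂ * - y ≡ + 0
          l₄ = solve-∀
        l₁ : ∀ x y x₂ y₂ m n → x * (y₂ * m + - x₂ * n) + x₂ * (- y * m + x * n) ≡ (x * y₂ - x₂ * y) * m
        l₁ = solve-∀
        l₂ : ∀ x y x₂ y₂ m n → y * (y₂ * m + - x₂ * n) + y₂ * (- y * m + x * n) ≡ (x * y₂ - x₂ * y) * n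
        l₂ = solve-∀

  infix 4 _≈_

  -- The relation `∼` for arbitrary subsets of K, independent of generating lists.
  record _≈_ (M N : K → Set) : Set where
    field
      α β  : K
      unit : α ⊗ β ≡ 𝟏
      to   : ∀ x → M x → N (α ⊗ x)
      from : ∀ x → N (α ⊗ x) → M x

  E-root : ∀ p q → ∃[ cs ] evalM cs (E p q) ≡ 𝟎
  E-root p q = (p * (p + s * q) + t * (q * q) ∷ - (+ 2 * p + s * q) ∷ []) , evalM-quadratic p q

  cancel : ∀ {x x⁻¹} → x ⊗ x⁻¹ ≡ 𝟏 → ∀ y → x ⊗ (x⁻¹ ⊗ y) ≡ y
  cancel {x} {x⁻¹} eq y = trans (sym (⊗-assoc x x⁻¹ y)) (trans (cong (_⊗ y) eq) (⊗-identityˡ y))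

  unit-product : ∀ {x x⁻¹ y y⁻¹} → x ⊗ x⁻¹ ≡ 𝟏 → y ⊗ y⁻¹ ≡ 𝟏 → (x ⊗ y) ⊗ (y⁻¹ ⊗ x⁻¹) ≡ 𝟏
  unit-product {x} {x⁻¹} {y} {y⁻¹} ex ey = trans (⊗-assoc x y (y⁻¹ ⊗ x⁻¹)) (trans (cong (x ⊗_) (cancel ey x⁻¹)) ex)

  flip-inverse : ∀ {x y} → x ⊗ y ≡ 𝟏 → y ⊗ x ≡ 𝟏
  flip-inverse {x} {y} eq = trans (⊗-comm y x) eq

  ≈⇒similar : ∀ {M} (S : Structure M) Q → M ≈ OSpan (𝟏 ∷ Quadratic.θ Q ∷ []) → Similar (Structure.quadratic S) Q
  ≈⇒similar {M} S Q eq = record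
      { γ = S.b⁻¹ ⊗ β ; γ⁻¹ = α ⊗ S.b
      ; γ-inverse = unit-product (flip-inverse S.b-inverse) (flip-inverse unit)
      ; to = λ {y} y∈ → subst (Λ S.θ) (sym (⊗-assoc S.b⁻¹ β y)) (S.to (subst M (sym (cancel S.b-inverse (β ⊗ y)))
          (from (β ⊗ y) (subst 𝔍 (sym (cancel unit y)) (ideal-from a 1≤a r θ aθ y∈)))))
      ; from = λ {y} γy∈ → ideal-to a 1≤a r θ aθ c P≡ (subst 𝔍 (cancel unit y)
          (to (β ⊗ y) (subst M (cancel S.b-inverse (β ⊗ y)) (S.from (subst (Λ S.θ) (⊗-assoc S.b⁻¹ β y) γy∈))))) }
    where
    open Quadratic Q
    module S = Structure S
    open _≈_ eq
    𝔍 = OSpan (𝟏 ∷ θ ∷ [])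

  similar⇒≈ : ∀ {M N} (S : Structure M) (T : Structure N) Q → Similar (Structure.quadratic S) Q → Similar (Structure.quadratic T) Q → M ≈ N
  similar⇒≈ {M} {N} S T Q simS simT = record { α = α ; β = β ; unit = αβ≡1 ; to = to ; from = from }
    where
    module S = Structure S
    module T = Structure T
    module A = Similar simS
    module B = Similar simT
    α β : K
    α = (T.b ⊗ B.γ) ⊗ (A.γ⁻¹ ⊗ S.b⁻¹)
    β = (S.b ⊗ A.γ) ⊗ (B.γ⁻¹ ⊗ T.b⁻¹)
    αβ≡1 : α ⊗ β ≡ 𝟏
    αβ≡1 = trans (solve 8 (λ bk gb ga bj bj′ ga′ gb′ bk′ → ((bk :* gb) :* (ga :* bj)) :* ((bj′ :* ga′) :* (gb′ :* bk′)) :=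
          ((bj′ :* ga′) :* (ga :* bj)) :* ((bk :* gb) :* (gb′ :* bk′))) refl
          T.b B.γ A.γ⁻¹ S.b⁻¹ S.b A.γ B.γ⁻¹ T.b⁻¹)
      (trans (cong₂ _⊗_ (unit-product S.b-inverse A.γ-inverse) (unit-product T.b-inverse B.γ-inverse)) (⊗-identityˡ 𝟏))
    w : K → K
    w z = A.γ⁻¹ ⊗ (S.b⁻¹ ⊗ z)
    bγw : ∀ z → S.b ⊗ (A.γ ⊗ w z) ≡ z
    bγw z = trans (cong (S.b ⊗_) (cancel A.γ-inverse (S.b⁻¹ ⊗ z))) (cancel S.b-inverse z)
    α⊗ : ∀ z → α ⊗ z ≡ T.b ⊗ (B.γ ⊗ w z)
    α⊗ z = solve 5 (λ bk gb ga bj z → ((bk :* gb) :* (ga :* bj)) :* z := bk :* (gb :* (ga :* (bj :* z)))) refl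
      T.b B.γ A.γ⁻¹ S.b⁻¹ z
    to : ∀ z → M z → N (α ⊗ z)
    to z z∈ = subst N (sym (α⊗ z)) (T.from (B.to (A.from (S.to (subst M (sym (bγw z)) z∈)))))
    from : ∀ z → N (α ⊗ z) → M z
    from z αz∈ = subst M (bγw z) (S.from (A.to (B.from (T.to (subst N (α⊗ z) αz∈)))))

  -- Vectors representing a given number

  module OneForm (Q : Quadratic) where
    open Quadratic Q using () renaming (a to A; 1≤a to 1≤A; r to R; c to C; P≡ to PR≡)
    open Definite Q

    f = quadForm Q

    rowA rowB : ℤ → ℤ → ℤ → ℤ
    rowA r x y = (R - r) * x - C * y
    rowB r x y = + A * x + (s - R - r) * y

    form-scale : ∀ g x y → f (x * g) (y * g) ≡ g * g * f x y
    form-scale g x y = l (+ A) (s - + 2 * R) C g x y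
      where
      l : ∀ A B C g x y → A * (x * g * (x * g)) + B * (x * g * (y * g)) + C * (y * g * (y * g)) ≡
          g * g * (A * (x * x) + B * (x * y) + C * (y * y))
      l = solve-∀

    form-neg : ∀ x y → f (- x) (- y) ≡ f x y
    form-neg x y = l (+ A) (s - + 2 * R) C x y
      where
      l : ∀ A B C x y → A * (- x * - x) + B * (- x * - y) + C * (- y * - y) ≡ A * (x * x) + B * (x * y) + C * (y * y)
      l = solve-∀

    Rel-neg : ∀ {a r x y} → Rel Q a r x y → Rel Q a r (- x) (- y)
    Rel-neg {a} {r} {x} {y} rel = record
      { form≡a = trans (form-neg x y) (Rel.form≡a rel)
      ; row₁ = ≅-trans (≅-reflexive (l₁ (R - r) C x y)) (≅-neg (Rel.row₁ rel))
      ; row₂ = ≅-trans (≅-reflexive (l₂ (+ A) (s - R - r) x y)) (≅-neg (Rel.row₂ rel)) }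
      where
      l₁ : ∀ u c x y → u * - x - c * - y ≡ - (u * x - c * y)
      l₁ = solve-∀
      l₂ : ∀ a v x y → a * - x + v * - y ≡ - (a * x + v * y)
      l₂ = solve-∀

    Rel? : ∀ a r x y → Dec (Rel Q a r x y)
    Rel? a r x y = decide (f x y ≟ + a) (rowA r x y ≅? 0ℤ [ a ]) (rowB r x y ≅? 0ℤ [ a ])
      where
      decide : Dec (f x y ≡ + a) → Dec (rowA r x y ≅ 0ℤ [ a ]) → Dec (rowB r x y ≅ 0ℤ [ a ]) → Dec (Rel Q a r x y)
      decide (yes e) (yes e₁) (yes e₂) = yes (record { form≡a = e ; row₁ = e₁ ; row₂ = e₂ })
      decide (no ¬e) _ _ = no (¬e ∘ Rel.form≡a)
      decide (yes _) (no ¬e) _ = no (¬e ∘ Rel.row₁)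
      decide (yes _) (yes _) (no ¬e) = no (¬e ∘ Rel.row₂)

    Coprimeᶻ : ℤ → ℤ → Set
    Coprimeᶻ x y = ∃[ u ] ∃[ w ] u * x + w * y ≡ 1ℤ

    -- A common factor k of x and y divides the rows twice over, since
    -- form = det(v, (W − r)v): then k · form divides form.

    Rel⇒coprime : ∀ {a r x y} → 1 ℕ.≤ a → Rel Q a r x y → ∀ k x′ y′ → x ≡ x′ * + k → y ≡ y′ * + k → k ≡ 1
    Rel⇒coprime {a} {r} {x} {y} 1≤a rel k x′ y′ refl refl = build (Rel.row₁ rel) (Rel.row₂ rel)
      where
      f′ = f x′ y′
      a≡ : + a ≡ + k * + k * f′
      a≡ = trans (sym (Rel.form≡a rel)) (form-scale (+ k) x′ y′)
      a≢0 : + a ≢ 0ℤ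
      a≢0 eq = ℕ.<⇒≢ 1≤a (sym (+-injective eq))
      k≢0 : + k ≢ 0ℤ
      k≢0 eq = a≢0 (trans a≡ (trans (cong (λ z → z * z * f′) eq) (*-zeroˡ f′)))
      f′≢0 : f′ ≢ 0ℤ
      f′≢0 eq = a≢0 (trans a≡ (trans (cong (+ k * + k *_) eq) (*-zeroʳ (+ k * + k))))
      instance
        k-nonZero : NonZero k
        k-nonZero = ℕ.≢-nonZero λ e → k≢0 (cong +_ e)
        f′-nonZero : NonZero ∣ f′ ∣
        f′-nonZero = ℕ.≢-nonZero λ e → f′≢0 (∣i∣≡0⇒i≡0 e)
      build : rowA r (x′ * + k) (y′ * + k) ≅ 0ℤ [ a ] → rowB r (x′ * + k) (y′ * + k) ≅ 0ℤ [ a ] → k ≡ 1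
      build (cg u e₁) (cg v e₂) = ℕ.m*n≡1⇒m≡1 k ∣ x′ * v - y′ * u ∣
          (trans (sym (abs-* (+ k) (x′ * v - y′ * u))) (cong ∣_∣ unit))
        where
        reduced₁ : rowA r x′ y′ ≡ u * (+ k * f′)
        reduced₁ = *-cancelʳ-≡ _ _ (+ k) (trans (l₁ (R - r) C x′ y′ (+ k)) (trans e₁ (trans (cong (λ z → 0ℤ + u * z) a≡) (l₂ u (+ k) f′))))
          where
          l₁ : ∀ m c x y k → (m * x - c * y) * k ≡ m * (x * k) - c * (y * k)
          l₁ = solve-∀
          l₂ : ∀ u k f → + 0 + u * (k * k * f) ≡ u * (k * f) * k
          l₂ = solve-∀
        reduced₂ : rowB r x′ y′ ≡ v * (+ k * f′)
        reduced₂ = *-cancelʳ-≡ _ _ (+ k) (trans (l₁ (+ A) (s - R - r) x′ y′ (+ k)) (trans e₂ (trans (cong (λ z → 0ℤ + v * z) a≡) (l₂ v (+ k) f′))))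
          where
          l₁ : ∀ m c x y k → (m * x + c * y) * k ≡ m * (x * k) + c * (y * k)
          l₁ = solve-∀
          l₂ : ∀ u k f → + 0 + u * (k * k * f) ≡ u * (k * f) * k
          l₂ = solve-∀
        unit : + k * (x′ * v - y′ * u) ≡ 1ℤ
        unit = *-cancelʳ-≡ _ _ f′ (trans (l (+ k) x′ y′ u v f′) (trans (cong₂ (λ p q → x′ * q - y′ * p) (sym reduced₁) (sym reduced₂))
          (trans (sym (form-det Q r x′ y′)) (sym (*-identityˡ f′)))))
          where
          l : ∀ k x y u v f → k * (x * v - y * u) * f ≡ x * (v * (k * f)) - y * (u * (k * f))
          l = solve-∀

    Rel-gcd : ∀ {a r x y} → 1 ℕ.≤ a → Rel Q a r x y → ∀ g → gcd ∣ x * + g ∣ ∣ y * + g ∣ ≡ g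
    Rel-gcd {a} {r} {x} {y} 1≤a rel g = trans (cong₂ gcd (trans (abs-* x (+ g)) (ℕ.*-comm ∣ x ∣ g)) (trans (abs-* y (+ g)) (ℕ.*-comm ∣ y ∣ g)))
      (trans (sym (c*gcd[m,n]≡gcd[cm,cn] g ∣ x ∣ ∣ y ∣)) (trans (cong (g ℕ.*_) (coprime⇒gcd≡1 cop)) (ℕ.*-identityʳ g)))
      where
      cop : Coprime ∣ x ∣ ∣ y ∣
      cop {d} (d∣x , d∣y) with ∣ᵤ⇒∣ {+ d} {x} d∣x | ∣ᵤ⇒∣ {+ d} {y} d∣y
      ... | divides x′ x≡ | divides y′ y≡ = Rel⇒coprime 1≤a rel d x′ y′ x≡ y≡

    Rel⇒Coprimeᶻ : ∀ {a r x y} → 1 ℕ.≤ a → Rel Q a r x y → Coprimeᶻ x y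
    Rel⇒Coprimeᶻ {a} {r} {x} {y} 1≤a rel = cases (x ≟ 0ℤ)
      where
      cases : Dec (x ≡ 0ℤ) → Coprimeᶻ x y
      cases (yes refl) = from-sign (signed y)
        where
        from-sign : ∃[ σ ] σ * σ ≡ 1ℤ × y ≡ σ * + ∣ y ∣ → Coprimeᶻ 0ℤ y
        from-sign (σ , σ²≡1 , y≡) = 0ℤ , σ , trans (l (0ℤ) σ y) (trans (cong (σ *_) (trans y≡ (trans
            (cong (λ k → σ * + k) (Rel⇒coprime 1≤a rel ∣ y ∣ 0ℤ σ (sym (*-zeroˡ (+ ∣ y ∣))) y≡)) (*-identityʳ σ)))) σ²≡1)
          where
          l : ∀ z σ y → + 0 * z + σ * y ≡ σ * y
          l = solve-∀
      cases (no x≢0) = from-bezout (bezout x y x≢0)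
        where
        from-bezout : ∃[ e ] ∃[ x′ ] ∃[ y′ ] ∃[ u ] ∃[ w ] e ≢ 0ℤ × x ≡ e * x′ × y ≡ e * y′ × u * x′ + w * y′ ≡ 1ℤ → Coprimeᶻ x y
        from-bezout (e , x′ , y′ , u , w , _ , x≡ , y≡ , unit) = from-sign (signed e)
          where
          from-sign : ∃[ σ ] σ * σ ≡ 1ℤ × e ≡ σ * + ∣ e ∣ → Coprimeᶻ x y
          from-sign (σ , σ²≡1 , e≡) = σ * u , σ * w , trans
              (cong₂ (λ p q → σ * u * p + σ * w * q) x≡′ y≡′)
              (trans (l σ u w x′ y′) (trans (cong₂ _*_ σ²≡1 unit) refl))
            where
            abs≡1 : ∣ e ∣ ≡ 1
            abs≡1 = Rel⇒coprime 1≤a rel ∣ e ∣ (σ * x′) (σ * y′) (trans x≡ (trans (cong (_* x′) e≡) (l₂ σ (+ ∣ e ∣) x′)))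
              (trans y≡ (trans (cong (_* y′) e≡) (l₂ σ (+ ∣ e ∣) y′)))
              where
              l₂ : ∀ σ k x → σ * k * x ≡ σ * x * k
              l₂ = solve-∀
            e≡σ : e ≡ σ
            e≡σ = trans e≡ (trans (cong (λ k → σ * + k) abs≡1) (*-identityʳ σ))
            x≡′ : x ≡ σ * x′
            x≡′ = trans x≡ (cong (_* x′) e≡σ)
            y≡′ : y ≡ σ * y′
            y≡′ = trans y≡ (cong (_* y′) e≡σ)
            l : ∀ σ u w x y → σ * u * (σ * x) + σ * w * (σ * y) ≡ σ * σ * (u * x + w * y)
            l = solve-∀

    -- The rows of `Rel` say that modulo a the vector (x, y) is an eigenvector of multiplication by
    -- ω with eigenvalue r. Coprime coordinates determine the eigenvalue modulo a.
    Rel-r-unique : ∀ {a r r′ x y} → 1 ℕ.≤ a → Rel Q a r x y → Rel Q a r′ x y → r ≅ r′ [ a ]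
    Rel-r-unique {a} {r} {r′} {x} {y} 1≤a rel rel′ = conclude (Rel⇒Coprimeᶻ 1≤a rel)
      where
      conclude : Coprimeᶻ x y → r ≅ r′ [ a ]
      conclude (u , w , unit) = ≅-trans (≅-reflexive (trans (l₀ r r′) (trans (cong (λ z → r′ + (r - r′) * z) (sym unit)) (l₁ R C s (+ A) r r′ x y u w))))
        (≅-trans (≅-+ (≅-refl {x = r′}) (≅-+ (≅-* (≅-refl {x = u}) (≅-- (Rel.row₁ rel′) (Rel.row₁ rel)))
          (≅-* (≅-refl {x = w}) (≅-- (Rel.row₂ rel′) (Rel.row₂ rel))))) (≅-reflexive (l₂ r′ u w)))
        where
        l₀ : ∀ r r′ → r ≡ r′ + (r - r′) * + 1
        l₀ = solve-∀
        l₁ : ∀ R C s A r r′ x y u w → r′ + (r - r′) * (u * x + w * y) ≡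
          r′ + (u * (((R - r′) * x - C * y) - ((R - r) * x - C * y)) + w * ((A * x + (s - R - r′) * y) - (A * x + (s - R - r) * y)))
        l₁ = solve-∀
        l₂ : ∀ r u w → r + (u * (+ 0 - + 0) + w * (+ 0 - + 0)) ≡ r
        l₂ = solve-∀

    -- P annihilates multiplication by ω, hence P(r) annihilates the eigenvector (x, y) modulo a;
    -- its coordinates are coprime, so P(r) ≡ 0.
    Rel⇒root : ∀ {a r x y} → 1 ℕ.≤ a → Rel Q a r x y → P r ≅ 0ℤ [ a ]
    Rel⇒root {a} {r} {x} {y} 1≤a rel = conclude (Rel⇒Coprimeᶻ 1≤a rel)
      where
      conclude : Coprimeᶻ x y → P r ≅ 0ℤ [ a ]
      conclude (u , w , unit) = ≅-trans (≅-reflexive (trans (sym (*-identityʳ (P r))) (trans (cong (P r *_) (sym unit))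
          (trans (l₁ s t R r x y u w) (trans (cong (λ z → u * ((s - R - r) * ((R - r) * x) + z * x) + w * ((R - r) * ((s - R - r) * y) + z * y)) PR≡)
            (l₂ R C s (+ A) r x y u w))))))
        (≅-trans (≅-+ (≅-* (≅-refl {x = u}) (≅-+ (≅-* (≅-refl {x = s - R - r}) (Rel.row₁ rel)) (≅-* (≅-refl {x = C}) (Rel.row₂ rel))))
                      (≅-* (≅-refl {x = w}) (≅-- (≅-* (≅-refl {x = R - r}) (Rel.row₂ rel)) (≅-* (≅-refl {x = + A}) (Rel.row₁ rel)))))
          (≅-reflexive (l₃ (s - R - r) C u w (R - r) (+ A))))
        where
        l₁ : ∀ s t R r x y u w → (r * r - s * r + t) * (u * x + w * y) ≡
          u * ((s - R - r) * ((R - r) * x) + (R * R - s * R + t) * x) + w * ((R - r) * ((s - R - r) * y) + (R * R - s * R + t) * y)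
        l₁ = solve-∀
        l₂ : ∀ R C s A r x y u w →
          u * ((s - R - r) * ((R - r) * x) + A * C * x) + w * ((R - r) * ((s - R - r) * y) + A * C * y) ≡
          u * ((s - R - r) * ((R - r) * x - C * y) + C * (A * x + (s - R - r) * y)) +
          w * ((R - r) * (A * x + (s - R - r) * y) - A * ((R - r) * x - C * y))
        l₂ = solve-∀
        l₃ : ∀ m c u w n a → u * (m * + 0 + c * + 0) + w * (n * + 0 - a * + 0) ≡ + 0
        l₃ = solve-∀

    coprime⇒Rel : ∀ {a x y} → Coprimeᶻ x y → f x y ≡ + a → .{{_ : NonZero a}} → ∃[ r ] r ℕ.< a × Rel Q a (+ r) x y
    coprime⇒Rel {a} {x} {y} (u , w , unit) form≡ = r , n%ℕd<d r₀ a , record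
        { form≡a = form≡
        ; row₁ = ≅-trans (≅-- (≅-* (≅-- (≅-refl {x = R}) (≅-sym (residue r₀ a))) (≅-refl {x = x})) (≅-refl {x = C * y})) exact₁
        ; row₂ = ≅-trans (≅-+ (≅-refl {x = + A * x}) (≅-* (≅-- (≅-refl {x = s - R}) (≅-sym (residue r₀ a))) (≅-refl {x = y}))) exact₂ }
      where
      -- Pairing ω v ≡ r v with (u, w), where u x + w y = 1, forces r ≡ r₀. That r₀ works follows
      -- from det(v, ω v) = f(v) = a.
      r₀ = u * (R * x - C * y) + w * (+ A * x + (s - R) * y)
      r = r₀ %ℕ a
      det : x * (+ A * x + (s - R) * y) - y * (R * x - C * y) ≡ + a
      det = trans (l (+ A) R C s x y) form≡
        where
        l : ∀ A R C s x y → x * (A * x + (s - R) * y) - y * (R * x - C * y) ≡ A * (x * x) + (s - + 2 * R) * (x * y) + C * (y * y)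
        l = solve-∀
      exact₁ : rowA r₀ x y ≅ 0ℤ [ a ]
      exact₁ = cg (- w) (trans (l₀ R C x y r₀) (trans (cong (λ z → (R * x - C * y) * z - r₀ * x) (sym unit))
        (trans (l₁ u w x y (R * x - C * y) (+ A * x + (s - R) * y)) (cong (λ z → 0ℤ + - w * z) det))))
        where
        l₀ : ∀ R C x y r → (R - r) * x - C * y ≡ (R * x - C * y) * + 1 - r * x
        l₀ = solve-∀
        l₁ : ∀ u w x y p q → p * (u * x + w * y) - (u * p + w * q) * x ≡ + 0 + - w * (x * q - y * p)
        l₁ = solve-∀
      exact₂ : rowB r₀ x y ≅ 0ℤ [ a ]
      exact₂ = cg u (trans (l₀ (+ A) s R x y r₀) (trans (cong (λ z → (+ A * x + (s - R) * y) * z - r₀ * y) (sym unit))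
        (trans (l₁ u w x y (R * x - C * y) (+ A * x + (s - R) * y)) (cong (λ z → 0ℤ + u * z) det))))
        where
        l₀ : ∀ A s R x y r → A * x + (s - R - r) * y ≡ (A * x + (s - R) * y) * + 1 - r * y
        l₀ = solve-∀
        l₁ : ∀ u w x y p q → q * (u * x + w * y) - (u * p + w * q) * y ≡ + 0 + u * (x * q - y * p)
        l₁ = solve-∀

    polar : ℤ → ℤ → ℤ → ℤ → ℤ
    polar x y x′ y′ = + 2 * + A * x * x′ + (s - + 2 * R) * (x * y′ + x′ * y) + + 2 * C * y * y′

    -- The only units are ±1, because |D| > 4.

    Rel-±-unique : ∀ {a r x y x′ y′} → 1 ℕ.≤ a → Rel Q a r x y → Rel Q a r x′ y′ →
                   (x′ ≡ x × y′ ≡ y) ⊎ (x′ ≡ - x × y′ ≡ - y)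
    Rel-±-unique {a} {r} {x} {y} {x′} {y′} 1≤a rel rel′ = [ same , opposite ]′ (i*j≡0⇒i≡0∨j≡0 (+ 2 * + a - b) product≡0)
      where
      open ≡-Reasoning
      B = s - + 2 * R
      b = polar x y x′ y′
      d = x * y′ - x′ * y
      Nd = + 4 * + A * C - B * B
      Nd≡ : Nd ≡ - D
      Nd≡ = trans (l₁ (+ A) C (s - + 2 * R)) (trans (cong (λ z → + 4 * z - B * B) (sym PR≡)) (l₂ s t R))
        where
        l₁ : ∀ A C B → + 4 * A * C - B * B ≡ + 4 * (A * C) - B * B
        l₁ = solve-∀
        l₂ : ∀ s t R → + 4 * (R * R - s * R + t) - (s - + 2 * R) * (s - + 2 * R) ≡ - (s * s - + 4 * t)
        l₂ = solve-∀
      -- Both vectors are eigenvectors modulo a for the same r, and by primitivity of the form this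
      -- gives a ∣ d. If d were not 0, the identity 4 a² = b² - D d² would give -D ≤ 4. So d = 0 and
      -- b = ±2a, which makes the form vanish at the difference or the sum of the vectors.
      identity : + 4 * f x y * f x′ y′ ≡ b * b + Nd * (d * d)
      identity = l (+ A) (s - + 2 * R) C x y x′ y′
        where
        l : ∀ A B C x y x′ y′ → + 4 * (A * (x * x) + B * (x * y) + C * (y * y)) * (A * (x′ * x′) + B * (x′ * y′) + C * (y′ * y′)) ≡
          (+ 2 * A * x * x′ + B * (x * y′ + x′ * y) + + 2 * C * y * y′) * (+ 2 * A * x * x′ + B * (x * y′ + x′ * y) + + 2 * C * y * y′)
          + (+ 4 * A * C - B * B) * ((x * y′ - x′ * y) * (x * y′ - x′ * y))
        l = solve-∀
      d≅0 : d ≅ 0ℤ [ a ]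
      d≅0 = primitive-cancel s t fund (+ A) R C PR≡ a d 1≤a
          (≅-trans (≅-reflexive (l₁ (+ A) s R r x y x′ y′)) (≅-trans (≅-- (≅-* (≅-refl {x = y′}) (Rel.row₂ rel)) (≅-* (≅-refl {x = y}) (Rel.row₂ rel′))) (≅-reflexive (l₀ y′ y))))
          (≅-trans (≅-reflexive (l₂ (+ A) C s R r x y x′ y′)) (≅-trans (≅-- (≅-- (≅-* (≅-refl {x = x}) (Rel.row₂ rel′)) (≅-* (≅-refl {x = x′}) (Rel.row₂ rel)))
            (≅-- (≅-* (≅-refl {x = y′}) (Rel.row₁ rel)) (≅-* (≅-refl {x = y}) (Rel.row₁ rel′)))) (≅-reflexive (l₀′ x x′ y′ y))))
          (≅-trans (≅-reflexive (l₃ C R r x y x′ y′)) (≅-trans (≅-- (≅-* (≅-refl {x = x′}) (Rel.row₁ rel)) (≅-* (≅-refl {x = x}) (Rel.row₁ rel′))) (≅-reflexive (l₀ x′ x))))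
        where
        l₀ : ∀ u v → u * + 0 - v * + 0 ≡ + 0
        l₀ = solve-∀
        l₀′ : ∀ u v w z → u * + 0 - v * + 0 - (w * + 0 - z * + 0) ≡ + 0
        l₀′ = solve-∀
        l₁ : ∀ A s R r x y x′ y′ → (x * y′ - x′ * y) * A ≡ y′ * (A * x + (s - R - r) * y) - y * (A * x′ + (s - R - r) * y′)
        l₁ = solve-∀
        l₂ : ∀ A C s R r x y x′ y′ → (x * y′ - x′ * y) * (s - + 2 * R) ≡
          x * (A * x′ + (s - R - r) * y′) - x′ * (A * x + (s - R - r) * y) - (y′ * ((R - r) * x - C * y) - y * ((R - r) * x′ - C * y′))
        l₂ = solve-∀
        l₃ : ∀ C R r x y x′ y′ → (x * y′ - x′ * y) * C ≡ x′ * ((R - r) * x - C * y) - x * ((R - r) * x′ - C * y′)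
        l₃ = solve-∀
      d≡0 : d ≡ 0ℤ
      d≡0 = from-quotient d≅0
        where
        from-quotient : d ≅ 0ℤ [ a ] → d ≡ 0ℤ
        from-quotient (cg e d≡) = cases (e ≟ 0ℤ)
          where
          cases : Dec (e ≡ 0ℤ) → d ≡ 0ℤ
          cases (yes e≡0) = trans d≡ (trans (+-identityˡ (e * + a)) (trans (cong (_* + a) e≡0) (*-zeroˡ (+ a))))
          cases (no e≢0) = ⊥-elim (<⇒≱ (neg-mono-< D<-4) (≤-trans (≤-reflexive (sym Nd≡)) Nd≤4))
            where
            aa = + a * + a
            0<aa : 0ℤ < aa
            0<aa = subst (0ℤ <_) (pos-* a a) (+<+ (ℕ.*-mono-≤ 1≤a 1≤a))
            1≤e² : 1ℤ ≤ e * e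
            1≤e² = i<j⇒suc[i]≤j (≤∧≢⇒< (square-nonNeg e) λ eq → e≢0 (square≡0 e (sym eq)))
            0≤Nd : 0ℤ ≤ Nd
            0≤Nd = ≤-trans (<⇒≤ (neg-mono-< D<0)) (≤-reflexive (sym Nd≡))
            Nd≤4 : Nd ≤ + 4
            Nd≤4 = *-cancelʳ-≤-pos Nd (+ 4) aa {{positive 0<aa}} (
              (≤-trans (≤-reflexive (l₁ Nd aa))
              (≤-trans (*-monoˡ-≤-nonNeg (Nd * aa) {{nonNegative (*-nonNeg 0≤Nd (<⇒≤ 0<aa))}} 1≤e²)
              (≤-trans (≤-reflexive (trans (l₂ Nd (+ a) e) (cong (λ z → Nd * (z * z)) (sym (trans d≡ (+-identityˡ (e * + a)))))))
              (≤-trans (≤-reflexive (sym (+-identityˡ (Nd * (d * d)))))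
              (≤-trans (+-monoˡ-≤ (Nd * (d * d)) (square-nonNeg b))
              (≤-reflexive (trans (sym identity) (trans (cong₂ (λ p q → + 4 * p * q) (Rel.form≡a rel) (Rel.form≡a rel′)) (*-assoc (+ 4) (+ a) (+ a)))))))))))
              where
              *-nonNeg : ∀ {i j} → 0ℤ ≤ i → 0ℤ ≤ j → 0ℤ ≤ i * j
              *-nonNeg {i} {j} p q = ≤-trans (≤-reflexive (sym (*-zeroʳ i))) (*-monoˡ-≤-nonNeg i {{nonNegative p}} q)
              l₁ : ∀ n a → n * a ≡ n * a * + 1
              l₁ = solve-∀
              l₂ : ∀ n a e → n * (a * a) * (e * e) ≡ n * (e * a * (e * a))
              l₂ = solve-∀
      product≡0 : (+ 2 * + a - b) * (+ 2 * + a + b) ≡ 0ℤ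
      product≡0 = trans (l (+ a) b) (trans (cong (_- b * b) (trans (cong₂ (λ p q → + 4 * p * q) (sym (Rel.form≡a rel)) (sym (Rel.form≡a rel′))) identity))
        (trans (cong (λ z → b * b + Nd * (z * z) - b * b) d≡0) (l₂ b Nd)))
        where
        l : ∀ a b → (+ 2 * a - b) * (+ 2 * a + b) ≡ + 4 * a * a - b * b
        l = solve-∀
        l₂ : ∀ b n → b * b + n * (+ 0 * + 0) - b * b ≡ + 0
        l₂ = solve-∀
      same : + 2 * + a - b ≡ 0ℤ → (x′ ≡ x × y′ ≡ y) ⊎ (x′ ≡ - x × y′ ≡ - y)
      same eq = inj₁ (i-j≡0⇒i≡j x′ x (proj₁ zeros) , i-j≡0⇒i≡j y′ y (proj₂ zeros))
        where
        zeros : x′ - x ≡ 0ℤ × y′ - y ≡ 0ℤ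
        zeros = form-definite (x′ - x) (y′ - y) (trans (l (+ A) (s - + 2 * R) C x y x′ y′)
          (trans (cong₂ (λ p q → p + q - b) (Rel.form≡a rel) (Rel.form≡a rel′)) (trans (l₂ (+ a) b) eq)))
          where
          l : ∀ A B C x y x′ y′ → A * ((x′ - x) * (x′ - x)) + B * ((x′ - x) * (y′ - y)) + C * ((y′ - y) * (y′ - y)) ≡
            (A * (x * x) + B * (x * y) + C * (y * y)) + (A * (x′ * x′) + B * (x′ * y′) + C * (y′ * y′))
            - (+ 2 * A * x * x′ + B * (x * y′ + x′ * y) + + 2 * C * y * y′)
          l = solve-∀
          l₂ : ∀ a b → a + a - b ≡ + 2 * a - b
          l₂ = solve-∀
      opposite : + 2 * + a + b ≡ 0ℤ → (x′ ≡ x × y′ ≡ y) ⊎ (x′ ≡ - x × y′ ≡ - y)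
      opposite eq = inj₂ (negate (proj₁ zeros) , negate (proj₂ zeros))
        where
        negate : ∀ {u v} → u + v ≡ 0ℤ → u ≡ - v
        negate {u} {v} e = i-j≡0⇒i≡j u (- v) (trans (cong (_+_ u) (neg-involutive v)) e)
        zeros : x′ + x ≡ 0ℤ × y′ + y ≡ 0ℤ
        zeros = form-definite (x′ + x) (y′ + y) (trans (l (+ A) (s - + 2 * R) C x y x′ y′)
          (trans (cong₂ (λ p q → p + q + b) (Rel.form≡a rel) (Rel.form≡a rel′)) (trans (l₂ (+ a) b) eq)))
          where
          l : ∀ A B C x y x′ y′ → A * ((x′ + x) * (x′ + x)) + B * ((x′ + x) * (y′ + y)) + C * ((y′ + y) * (y′ + y)) ≡
            (A * (x * x) + B * (x * y) + C * (y * y)) + (A * (x′ * x′) + B * (x′ * y′) + C * (y′ * y′))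
            + (+ 2 * A * x * x′ + B * (x * y′ + x′ * y) + + 2 * C * y * y′)
          l = solve-∀
          l₂ : ∀ a b → a + a + b ≡ + 2 * a + b
          l₂ = solve-∀

    -- Attaches a triple (g, a, r) to a vector (u, v): g is its content, a the value of the form at
    -- its primitive part, r the eigenvalue of ω on that part modulo a.
    record Match (g a : ℕ) (r u v : ℤ) : Set where
      field
        1≤g : 1 ℕ.≤ g
        x y : ℤ
        u≡  : u ≡ x * + g
        v≡  : v ≡ y * + g
        rel : Rel Q a r x y

    Match? : ∀ g a r u v → Dec (Match g a r u v)
    Match? g a r u v = positive? (1 ℕ.≤? g)
      where
      positive? : Dec (1 ℕ.≤ g) → Dec (Match g a r u v)
      positive? (no 1≰g) = no (1≰g ∘ Match.1≤g)
      positive? (yes 1≤g) = divisible? (+ g ℤ∣.∣? u) (+ g ℤ∣.∣? v)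
        where
        quotient-unique : ∀ x x′ → x * + g ≡ x′ * + g → x ≡ x′
        quotient-unique x x′ eq = *-cancelʳ-≡ x x′ (+ g) {{ℕ.>-nonZero 1≤g}} eq
        divisible? : Dec (+ g ∣ᶻ u) → Dec (+ g ∣ᶻ v) → Dec (Match g a r u v)
        divisible? (no ∤u) _ = no λ m → ∤u (divides (Match.x m) (Match.u≡ m))
        divisible? (yes _) (no ∤v) = no λ m → ∤v (divides (Match.y m) (Match.v≡ m))
        divisible? (yes (divides x u≡)) (yes (divides y v≡)) = related? (Rel? a r x y)
          where
          related? : Dec (Rel Q a r x y) → Dec (Match g a r u v)
          related? (yes rel) = yes (record { 1≤g = 1≤g ; x = x ; y = y ; u≡ = u≡ ; v≡ = v≡ ; rel = rel })
          related? (no ¬rel) = no λ m → ¬rel (subst₂ (Rel Q a r)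
            (quotient-unique (Match.x m) x (trans (sym (Match.u≡ m)) u≡))
            (quotient-unique (Match.y m) y (trans (sym (Match.v≡ m)) v≡)) (Match.rel m))

    Match-form : ∀ {g a r u v} → Match g a r u v → f u v ≡ + (g ℕ.* g ℕ.* a)
    Match-form {g} {a} {r} m = trans (cong₂ f u≡ v≡) (trans (form-scale (+ g) x y)
        (trans (cong (_*_ (+ g * + g)) (Rel.form≡a rel)) (trans (cong (_* + a) (sym (pos-* g g))) (sym (pos-* (g ℕ.* g) a)))))
      where open Match m

    Match-unique : ∀ {n g g′ a a′ r r′ u v} → 1 ℕ.≤ a → 1 ℕ.≤ a′ → Match g a (+ r) u v → Match g′ a′ (+ r′) u v →
      g ℕ.* g ℕ.* a ≡ n → g′ ℕ.* g′ ℕ.* a′ ≡ n → r ℕ.< a → r′ ℕ.< a′ → g ≡ g′ × a ≡ a′ × r ≡ r′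
    Match-unique {n} {g} {g′} {a} {a′} {r} {r′} {u} {v} 1≤a 1≤a′ m m′ eq eq′ r<a r′<a′ = finish g≡g′ m′ eq′
      where
      gcd≡ : ∀ {g a r} → 1 ℕ.≤ a → Match g a r u v → gcd ∣ u ∣ ∣ v ∣ ≡ g
      gcd≡ {g} 1≤a m = trans (cong₂ (λ p q → gcd ∣ p ∣ ∣ q ∣) (Match.u≡ m) (Match.v≡ m)) (Rel-gcd 1≤a (Match.rel m) g)
      g≡g′ : g ≡ g′
      g≡g′ = trans (sym (gcd≡ 1≤a m)) (gcd≡ 1≤a′ m′)
      finish : g ≡ g′ → Match g′ a′ (+ r′) u v → g′ ℕ.* g′ ℕ.* a′ ≡ n → g ≡ g′ × a ≡ a′ × r ≡ r′
      finish refl m′ eq′ = refl , with-a a≡a′ r′<a′ m′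
        where
        instance
          gg≢0 : NonZero (g ℕ.* g)
          gg≢0 = ℕ.>-nonZero (ℕ.*-mono-≤ (Match.1≤g m) (Match.1≤g m))
        cancel-g : ∀ x x′ → x * + g ≡ x′ * + g → x ≡ x′
        cancel-g x x′ e = *-cancelʳ-≡ x x′ (+ g) {{ℕ.>-nonZero (Match.1≤g m)}} e
        a≡a′ : a ≡ a′
        a≡a′ = ℕ.*-cancelˡ-≡ a a′ (g ℕ.* g) (trans eq (sym eq′))
        with-a : a ≡ a′ → r′ ℕ.< a′ → Match g a′ (+ r′) u v → a ≡ a′ × r ≡ r′
        with-a refl r′<a m′ = refl , ≅-small (Rel-r-unique 1≤a (Match.rel m) (subst₂ (Rel Q a (+ r′))
          (cancel-g (Match.x m′) (Match.x m) (trans (sym (Match.u≡ m′)) (Match.u≡ m)))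
          (cancel-g (Match.y m′) (Match.y m) (trans (sym (Match.v≡ m′)) (Match.v≡ m))) (Match.rel m′))) r<a r′<a

    represented⇒Match : ∀ {n u v} → 1 ℕ.≤ n → f u v ≡ + n →
      ∃[ g ] ∃[ a ] ∃[ r ] 1 ℕ.≤ a × g ℕ.* g ℕ.* a ≡ n × r ℕ.< a × Match g a (+ r) u v
    represented⇒Match {n} {u} {v} 1≤n form≡n = from-primitive (reduced (u ≟ 0ℤ))
      where
      Primitive : Set
      Primitive = ∃[ g ] ∃[ x ] ∃[ y ] Coprimeᶻ x y × u ≡ x * + g × v ≡ y * + g
      n≢0 : + n ≢ 0ℤ
      n≢0 eq = ℕ.<⇒≢ 1≤n (sym (+-injective eq))
      reduced : Dec (u ≡ 0ℤ) → Primitive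
      reduced (yes refl) = build (signed v)
        where
        build : ∃[ σ ] σ * σ ≡ 1ℤ × v ≡ σ * + ∣ v ∣ → Primitive
        build (σ , σ²≡1 , v≡) = ∣ v ∣ , 0ℤ , σ , (0ℤ , σ , trans (+-identityˡ (σ * σ)) σ²≡1) , sym (*-zeroˡ (+ ∣ v ∣)) , v≡
      reduced (no u≢0) = build (bezout u v u≢0)
        where
        build : ∃[ e ] ∃[ x ] ∃[ y ] ∃[ p ] ∃[ q ] e ≢ 0ℤ × u ≡ e * x × v ≡ e * y × p * x + q * y ≡ 1ℤ → Primitive
        build (e , x , y , p , q , _ , u≡ , v≡ , unit) = sign (signed e)
          where
          sign : ∃[ σ ] σ * σ ≡ 1ℤ × e ≡ σ * + ∣ e ∣ → Primitive
          sign (σ , σ²≡1 , e≡) = ∣ e ∣ , σ * x , σ * y , (σ * p , σ * q , trans (l σ p q x y) (cong₂ _*_ σ²≡1 unit)) ,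
              trans u≡ (trans (cong (_* x) e≡) (l₂ σ (+ ∣ e ∣) x)) , trans v≡ (trans (cong (_* y) e≡) (l₂ σ (+ ∣ e ∣) y))
            where
            l : ∀ σ p q x y → σ * p * (σ * x) + σ * q * (σ * y) ≡ σ * σ * (p * x + q * y)
            l = solve-∀
            l₂ : ∀ σ k x → σ * k * x ≡ σ * x * k
            l₂ = solve-∀
      from-primitive : Primitive → ∃[ g ] ∃[ a ] ∃[ r ] 1 ℕ.≤ a × g ℕ.* g ℕ.* a ≡ n × r ℕ.< a × Match g a (+ r) u v
      from-primitive (g , x , y , cop , u≡ , v≡) = attach (coprime⇒Rel cop form≡a {{ℕ.>-nonZero 1≤a}})
        where
        a = ∣ f x y ∣
        form≡a : f x y ≡ + a
        form≡a = sym (0≤i⇒+∣i∣≡i (form-nonNeg x y))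
        gga≡n : g ℕ.* g ℕ.* a ≡ n
        gga≡n = +-injective (trans (pos-* (g ℕ.* g) a) (trans (cong₂ _*_ (pos-* g g) (sym form≡a))
          (trans (sym (form-scale (+ g) x y)) (trans (cong₂ f (sym u≡) (sym v≡)) form≡n))))
        1≤a : 1 ℕ.≤ a
        1≤a = ℕ.n≢0⇒n>0 λ a≡0 → ℕ.<⇒≢ 1≤n (sym (trans (sym gga≡n) (trans (cong (g ℕ.* g ℕ.*_) a≡0) (ℕ.*-zeroʳ (g ℕ.* g)))))
        1≤g : 1 ℕ.≤ g
        1≤g = ℕ.n≢0⇒n>0 λ g≡0 → ℕ.<⇒≢ 1≤n (sym (trans (sym gga≡n) (cong (λ k → k ℕ.* k ℕ.* a) g≡0)))
        attach : ∃[ r ] r ℕ.< a × Rel Q a (+ r) x y →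
          ∃[ g ] ∃[ a ] ∃[ r ] 1 ℕ.≤ a × g ℕ.* g ℕ.* a ≡ n × r ℕ.< a × Match g a (+ r) u v
        attach (r , r<a , rel) = g , a , r , 1≤a , gga≡n , r<a , record { 1≤g = 1≤g ; x = x ; y = y ; u≡ = u≡ ; v≡ = v≡ ; rel = rel }

  quadratic-at : ∀ a → 1 ℕ.≤ a → ∀ r → P r ≅ 0ℤ [ a ] → ∃[ Q ] Quadratic.a Q ≡ a × Quadratic.r Q ≡ r
  quadratic-at a 1≤a r (cg c P≡) = build (ι-inverse (+ a) λ eq → ℕ.<⇒≢ 1≤a (sym (+-injective eq)))
    where
    build : ∃[ x ] ι (+ a) ⊗ x ≡ 𝟏 → ∃[ Q ] Quadratic.a Q ≡ a × Quadratic.r Q ≡ r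
    build (x , ax≡1) = record
      { a = a ; 1≤a = 1≤a ; r = r ; c = c ; P≡ = trans P≡ (trans (+-identityˡ (c * + a)) (*-comm c (+ a)))
      ; θ = x ⊗ (ω ⊕ ⊝ ι r)
      ; aθ = trans (sym (⊗-assoc (ι (+ a)) x _)) (trans (cong (_⊗ (ω ⊕ ⊝ ι r)) ax≡1) (⊗-identityˡ _)) } , refl , refl

  -- Counting representations by all classes

  module _ {h : ℕ} (Qs : Fin h → Quadratic)
    (every-class : ∀ Q → ∃[ j ] ∃[ x ] ∃[ y ] Rel (Qs j) (Quadratic.a Q) (Quadratic.r Q) x y)
    (distinct-classes : ∀ Q j k {x y x′ y′} → Rel (Qs j) (Quadratic.a Q) (Quadratic.r Q) x y →
                        Rel (Qs k) (Quadratic.a Q) (Quadratic.r Q) x′ y′ → j ≡ k) where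

    ideal-count : ℕ → ℤ
    ideal-count n = Σ< (suc n) λ g → Σ< (suc n) λ a → 𝟙 (g ℕ.* g ℕ.* a ℕ.≟ n) * ρ a

    module _ (X : Fin h → ℕ) (n : ℕ) (1≤n : 1 ℕ.≤ n)
      (bounded : ∀ j u v → quadForm (Qs j) u v ≡ + n → ∣ u ∣ ℕ.≤ X j × ∣ v ∣ ℕ.≤ X j) where

      open Boxes X
      open OneForm using (Match; Match?; Match-form; Match-unique; represented⇒Match; Rel-neg; Rel-±-unique; form-scale; Rel⇒root)

      term : ℕ → ℕ → ℕ → Fin h → ℤ → ℤ → ℤ
      term g a r j u v = 𝟙 (g ℕ.* g ℕ.* a ℕ.≟ n) * (𝟙 (P (+ r) ≅? 0ℤ [ a ]) * 𝟙 (Match? (Qs j) g a (+ r) u v))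

      part≤n : ∀ g a → g ℕ.* g ℕ.* a ≡ n → 1 ℕ.≤ g × 1 ℕ.≤ a
      part≤n zero    a       refl = ⊥-elim (ℕ.<⇒≢ 1≤n refl)
      part≤n (suc g) (suc a) _    = s≤s z≤n , s≤s z≤n
      part≤n (suc g) zero    eq   = ⊥-elim (ℕ.<⇒≢ 1≤n (trans (sym (ℕ.*-zeroʳ (suc g ℕ.* suc g))) eq))

      g≤n : ∀ g a → g ℕ.* g ℕ.* a ≡ n → 1 ℕ.≤ g → 1 ℕ.≤ a → g ℕ.≤ n
      g≤n g a eq 1≤g 1≤a = ℕ.≤-trans (ℕ.m≤m*n g (g ℕ.* a) {{ℕ.>-nonZero (ℕ.*-mono-≤ 1≤g 1≤a)}})
        (ℕ.≤-reflexive (trans (sym (ℕ.*-assoc g g a)) eq))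

      a≤n : ∀ g a → g ℕ.* g ℕ.* a ≡ n → 1 ℕ.≤ g → a ℕ.≤ n
      a≤n g a eq 1≤g = ℕ.≤-trans (ℕ.m≤n*m a (g ℕ.* g) {{ℕ.>-nonZero (ℕ.*-mono-≤ 1≤g 1≤g)}}) (ℕ.≤-reflexive eq)

      per-vector : ∀ j u v → Dec (quadForm (Qs j) u v ≡ + n) →
        Σ< (suc n) (λ g → Σ< (suc n) λ a → Σ< a λ r → term g a r j u v) ≡ 𝟙 (quadForm (Qs j) u v ≟ + n)
      per-vector j u v (no ≢n) = trans (Σ-zero (suc n) λ g _ → Σ-zero (suc n) λ a _ → Σ-zero a λ r _ →
          𝟙-product (g ℕ.* g ℕ.* a ℕ.≟ n) (P (+ r) ≅? 0ℤ [ a ]) (Match? (Qs j) g a (+ r) u v)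
            λ (eq , _ , m) → ≢n (trans (Match-form (Qs j) m) (cong (λ k → + k) eq)))
        (sym (𝟙-no (quadForm (Qs j) u v ≟ + n) ≢n))
      per-vector j u v (yes ≡n) = from-match (represented⇒Match (Qs j) 1≤n ≡n)
        where
        from-match : ∃[ g ] ∃[ a ] ∃[ r ] 1 ℕ.≤ a × g ℕ.* g ℕ.* a ≡ n × r ℕ.< a × Match (Qs j) g a (+ r) u v →
          Σ< (suc n) (λ g → Σ< (suc n) λ a → Σ< a λ r → term g a r j u v) ≡ 𝟙 (quadForm (Qs j) u v ≟ + n)
        from-match (g , a , r , 1≤a , eq , r<a , m) = trans
          (Σ-𝟙-single₃ (suc n) (suc n) (λ a → a) (λ g a r → term g a r j u v) g a r
            (s≤s (g≤n g a eq (Match.1≤g m) 1≤a)) (s≤s (a≤n g a eq (Match.1≤g m))) r<a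
            (cong₂ _*_ (𝟙-yes (g ℕ.* g ℕ.* a ℕ.≟ n) eq)
              (cong₂ _*_ (𝟙-yes (P (+ r) ≅? 0ℤ [ a ]) (Rel⇒root (Qs j) 1≤a (Match.rel m))) (𝟙-yes (Match? (Qs j) g a (+ r) u v) m)))
            λ g′ a′ r′ r′<a′ ≢ → 𝟙-product (g′ ℕ.* g′ ℕ.* a′ ℕ.≟ n) (P (+ r′) ≅? 0ℤ [ a′ ]) (Match? (Qs j) g′ a′ (+ r′) u v)
              λ (eq′ , _ , m′) → ≢ (Match-unique (Qs j) 1≤a (proj₂ (part≤n g′ a′ eq′)) m m′ eq eq′ r<a r′<a′))
          (sym (𝟙-yes (quadForm (Qs j) u v ≟ + n) ≡n))

      -- The lattice belonging to (a, r) is similar to exactly one of the chosen ones, so only one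
      -- form contributes, and by `Rel-±-unique` it does so with two opposite vectors.
      per-ideal : ∀ g a r → g ℕ.* g ℕ.* a ≡ n → P (+ r) ≅ 0ℤ [ a ] → box (λ j u v → 𝟙 (Match? (Qs j) g a (+ r) u v)) ≡ + 2
      per-ideal g a r eq P≅0 = from-quadratic (quadratic-at a 1≤a (+ r) P≅0)
        where
        1≤g = proj₁ (part≤n g a eq)
        1≤a = proj₂ (part≤n g a eq)
        from-quadratic : ∃[ Q ] Quadratic.a Q ≡ a × Quadratic.r Q ≡ + r → box (λ j u v → 𝟙 (Match? (Qs j) g a (+ r) u v)) ≡ + 2
        from-quadratic (Q , refl , r≡) = from-class (every-class Q)
          where
          from-class : ∃[ j ] ∃[ x ] ∃[ y ] Rel (Qs j) a (Quadratic.r Q) x y → box (λ j u v → 𝟙 (Match? (Qs j) g a (+ r) u v)) ≡ + 2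
          from-class (j , x , y , rel₀) = trans
            (sum-single j λ k k≢j → ΣZ-zero (X k) λ u _ → ΣZ-zero (X k) λ v _ → 𝟙-no (Match? (Qs k) g a (+ r) u v)
              λ m → k≢j (distinct-classes Q k j (subst (λ z → Rel (Qs k) a z (Match.x m) (Match.y m)) (sym r≡) (Match.rel m)) rel₀))
            (box-pair (X j) (λ u v → 𝟙 (Match? (Qs j) g a (+ r) u v)) (x * + g) (y * + g) (- x * + g) (- y * + g)
              (proj₁ in-box) (proj₂ in-box) (proj₁ in-box′) (proj₂ in-box′) ≢-opposite
              (𝟙-yes (Match? (Qs j) g a (+ r) (x * + g) (y * + g)) match) (𝟙-yes (Match? (Qs j) g a (+ r) (- x * + g) (- y * + g)) match′)
              λ u v ≢₁ ≢₂ → 𝟙-no (Match? (Qs j) g a (+ r) u v) λ m → only u v ≢₁ ≢₂ m)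
            where
            rel : Rel (Qs j) a (+ r) x y
            rel = subst (λ z → Rel (Qs j) a z x y) r≡ rel₀
            match : Match (Qs j) g a (+ r) (x * + g) (y * + g)
            match = record { 1≤g = 1≤g ; x = x ; y = y ; u≡ = refl ; v≡ = refl ; rel = rel }
            match′ : Match (Qs j) g a (+ r) (- x * + g) (- y * + g)
            match′ = record { 1≤g = 1≤g ; x = - x ; y = - y ; u≡ = refl ; v≡ = refl ; rel = Rel-neg (Qs j) rel }
            form≡n : ∀ {u v} → Match (Qs j) g a (+ r) u v → quadForm (Qs j) u v ≡ + n
            form≡n m = trans (Match-form (Qs j) m) (cong (λ k → + k) eq)
            in-box  = bounded j (x * + g) (y * + g) (form≡n {x * + g} {y * + g} match)
            in-box′ = bounded j (- x * + g) (- y * + g) (form≡n {(- x) * + g} {(- y) * + g} match′)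
            ≢-opposite : ¬ (x * + g ≡ - x * + g × y * + g ≡ - y * + g)
            ≢-opposite (ex , ey) = ℕ.<⇒≢ 1≤n (+-injective (trans (sym origin) (form≡n {x * + g} {y * + g} match)))
              where
              zero-of : ∀ x → x * + g ≡ - x * + g → x * + g ≡ 0ℤ
              zero-of x e = neg-fixed (trans e (sym (neg-distribˡ-* x (+ g))))
              origin : quadForm (Qs j) (x * + g) (y * + g) ≡ 0ℤ
              origin = trans (cong₂ (quadForm (Qs j)) (trans (zero-of x ex) (sym (*-zeroʳ 0ℤ))) (trans (zero-of y ey) (sym (*-zeroʳ 0ℤ))))
                (trans (form-scale (Qs j) 0ℤ 0ℤ 0ℤ) (*-zeroˡ (quadForm (Qs j) 0ℤ 0ℤ)))
            only : ∀ u v → ¬ (u ≡ x * + g × v ≡ y * + g) → ¬ (u ≡ - x * + g × v ≡ - y * + g) → Match (Qs j) g a (+ r) u v → ⊥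
            only u v ≢₁ ≢₂ m = [ (λ (ex , ey) → ≢₁ (trans (Match.u≡ m) (cong (_* + g) ex) , trans (Match.v≡ m) (cong (_* + g) ey)))
                               , (λ (ex , ey) → ≢₂ (trans (Match.u≡ m) (cong (_* + g) ex) , trans (Match.v≡ m) (cong (_* + g) ey))) ]′
              (Rel-±-unique (Qs j) 1≤a rel (Match.rel m))

      -- A double count of the incidences between vectors of value n and triples (g, a, r): each
      -- vector meets exactly one triple, and each triple two vectors.
      representation-count : box (λ j u v → 𝟙 (quadForm (Qs j) u v ≟ + n)) ≡ + 2 * ideal-count n
      representation-count = begin
        box (λ j u v → 𝟙 (quadForm (Qs j) u v ≟ + n))
          ≡⟨ box-cong (λ j u v → sym (per-vector j u v (quadForm (Qs j) u v ≟ + n))) ⟩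
        box (λ j u v → Σ< (suc n) (λ g → Σ< (suc n) λ a → Σ< a λ r → term g a r j u v))
          ≡⟨ trans (box-Σ (suc n) (λ g j u v → Σ< (suc n) λ a → Σ< a λ r → term g a r j u v)) (Σ-cong′ (suc n) λ g →
             trans (box-Σ (suc n) (λ a j u v → Σ< a λ r → term g a r j u v)) (Σ-cong′ (suc n) λ a → box-Σ a (λ r → term g a r))) ⟩
        Σ< (suc n) (λ g → Σ< (suc n) λ a → Σ< a λ r → box (term g a r))
          ≡⟨ Σ-cong′ (suc n) (λ g → Σ-cong′ (suc n) λ a → count g a) ⟩
        Σ< (suc n) (λ g → Σ< (suc n) λ a → + 2 * (𝟙 (g ℕ.* g ℕ.* a ℕ.≟ n) * ρ a))
          ≡⟨ trans (Σ-cong′ (suc n) λ g → Σ-*ˡ (suc n) (+ 2) _) (Σ-*ˡ (suc n) (+ 2) _) ⟩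
        + 2 * ideal-count n ∎
        where
        open ≡-Reasoning
        swap : ∀ a b → a * (b * + 2) ≡ + 2 * (a * b)
        swap = solve-∀
        count : ∀ g a → Σ< a (λ r → box (term g a r)) ≡ + 2 * (𝟙 (g ℕ.* g ℕ.* a ℕ.≟ n) * ρ a)
        count g a = begin
          Σ< a (λ r → box (term g a r))
            ≡⟨ Σ-cong′ a (λ r → trans (box-*ˡ (𝟙 (g ℕ.* g ℕ.* a ℕ.≟ n)) (inner r)) (cong (_*_ (𝟙 (g ℕ.* g ℕ.* a ℕ.≟ n))) (box-*ˡ (𝟙 (P (+ r) ≅? 0ℤ [ a ])) λ j u v → 𝟙 (Match? (Qs j) g a (+ r) u v)))) ⟩
          Σ< a (λ r → 𝟙 (g ℕ.* g ℕ.* a ℕ.≟ n) * (𝟙 (P (+ r) ≅? 0ℤ [ a ]) * box (λ j u v → 𝟙 (Match? (Qs j) g a (+ r) u v))))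
            ≡⟨ Σ-cong′ a (λ r → 𝟙* (g ℕ.* g ℕ.* a ℕ.≟ n) λ eq → 𝟙* (P (+ r) ≅? 0ℤ [ a ]) λ P≅0 → per-ideal g a r eq P≅0) ⟩
          Σ< a (λ r → 𝟙 (g ℕ.* g ℕ.* a ℕ.≟ n) * (𝟙 (P (+ r) ≅? 0ℤ [ a ]) * + 2))
            ≡⟨ trans (Σ-*ˡ a (𝟙 (g ℕ.* g ℕ.* a ℕ.≟ n)) _) (cong (_*_ (𝟙 (g ℕ.* g ℕ.* a ℕ.≟ n))) (Σ-*ʳ a (+ 2) _)) ⟩
          𝟙 (g ℕ.* g ℕ.* a ℕ.≟ n) * (ρ a * + 2)
            ≡⟨ swap (𝟙 (g ℕ.* g ℕ.* a ℕ.≟ n)) (ρ a) ⟩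
          + 2 * (𝟙 (g ℕ.* g ℕ.* a ℕ.≟ n) * ρ a) ∎
          where
          inner : ℕ → Fin h → ℤ → ℤ → ℤ
          inner r j u v = 𝟙 (P (+ r) ≅? 0ℤ [ a ]) * 𝟙 (Match? (Qs j) g a (+ r) u v)

-- Imaginary quadratic fields

fraction : ℤ → ℚ
fraction n = n ℚ./ 1

fraction-unique : ∀ n {p} → mkℚᵘ n 0 ℚᵘ.≃ toℚᵘ p → fraction n ≡ p
fraction-unique n {p} eq = trans (ℚ.fromℚᵘ-cong eq) (ℚ.fromℚᵘ-toℚᵘ p)

toℚᵘ-fraction : ∀ n → toℚᵘ (fraction n) ℚᵘ.≃ mkℚᵘ n 0
toℚᵘ-fraction n = ℚ.toℚᵘ-fromℚᵘ (mkℚᵘ n 0)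

fraction-+ : ∀ u v → fraction (u + v) ≡ fraction u ℚ.+ fraction v
fraction-+ u v = fraction-unique (u + v) (ℚᵘ.≃-trans (*≡* (l u v))
    (ℚᵘ.≃-trans (ℚᵘ.+-cong (ℚᵘ.≃-sym (toℚᵘ-fraction u)) (ℚᵘ.≃-sym (toℚᵘ-fraction v)))
      (ℚᵘ.≃-sym (ℚ.toℚᵘ-homo-+ (fraction u) (fraction v)))))
  where
  l : ∀ u v → (u + v) * + 1 ≡ (u * + 1 + v * + 1) * + 1
  l = solve-∀

fraction-* : ∀ u v → fraction (u * v) ≡ fraction u ℚ.* fraction v
fraction-* u v = fraction-unique (u * v) (ℚᵘ.≃-trans (*≡* refl)
    (ℚᵘ.≃-trans (ℚᵘ.*-cong (ℚᵘ.≃-sym (toℚᵘ-fraction u)) (ℚᵘ.≃-sym (toℚᵘ-fraction v)))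
      (ℚᵘ.≃-sym (ℚ.toℚᵘ-homo-* (fraction u) (fraction v)))))

fraction-neg : ∀ u → fraction (- u) ≡ ℚ.- fraction u
fraction-neg u = fraction-unique (- u) (ℚᵘ.≃-trans (*≡* refl)
    (ℚᵘ.≃-trans (ℚᵘ.-‿cong (ℚᵘ.≃-sym (toℚᵘ-fraction u))) (ℚᵘ.≃-sym (ℚ.toℚᵘ-homo‿- (fraction u)))))

fraction-injective : ∀ {u v} → fraction u ≡ fraction v → u ≡ v
fraction-injective {u} {v} eq = drop (ℚᵘ.≃-trans (ℚᵘ.≃-sym (toℚᵘ-fraction u))
    (ℚᵘ.≃-trans (ℚᵘ.≃-reflexive (cong toℚᵘ eq)) (toℚᵘ-fraction v)))
  where
  drop : mkℚᵘ u 0 ℚᵘ.≃ mkℚᵘ v 0 → u ≡ v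
  drop (*≡* e) = trans (sym (*-identityʳ u)) (trans e (*-identityʳ v))

fraction-↧ : ∀ p → fraction (↧ p) ℚ.* p ≡ fraction (↥ p)
fraction-↧ p = sym (fraction-unique (↥ p) (ℚᵘ.≃-trans (cross p)
    (ℚᵘ.≃-trans (ℚᵘ.*-cong (ℚᵘ.≃-sym (toℚᵘ-fraction (↧ p))) (ℚᵘ.≃-refl {toℚᵘ p}))
      (ℚᵘ.≃-sym (ℚ.toℚᵘ-homo-* (fraction (↧ p)) p)))))
  where
  cross : ∀ p → mkℚᵘ (↥ p) 0 ℚᵘ.≃ mkℚᵘ (↧ p) 0 ℚᵘ.* toℚᵘ p
  cross (ℚ.mkℚ n d _) = *≡* (trans (cong (λ k → n * + suc k) (ℕ.+-identityʳ d)) (l n (+ suc d)))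
    where
    l : ∀ n d → n * d ≡ d * n * + 1
    l = solve-∀

fraction-inverse : ∀ n → n ≢ 0ℤ → ∃[ p ] fraction n ℚ.* p ≡ 1ℚ
fraction-inverse n n≢0 = (ℚ.1/ fraction n) {{nz}} , ℚ.*-inverseʳ (fraction n) {{nz}}
  where
  nz : ℚ.NonZero (fraction n)
  nz = ℚ.≢-nonZero λ eq → n≢0 (fraction-injective eq)

fraction-cancel : ∀ n {p} → n ≢ 0ℤ → fraction n ℚ.* p ≡ 0ℚ → p ≡ 0ℚ
fraction-cancel n {p} n≢0 eq = undo (fraction-inverse n n≢0)
  where
  undo : ∃[ x ] fraction n ℚ.* x ≡ 1ℚ → p ≡ 0ℚ
  undo (x , nx≡1) = trans (sym (ℚ.*-identityˡ p)) (trans (cong (ℚ._* p) (sym nx≡1))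
    (trans (+-*-Solver.solve 3 (λ n x p → n :* x :* p := x :* (n :* p)) refl (fraction n) x p) (trans (cong (x ℚ.*_) eq) (ℚ.*-zeroʳ x))))
    where open +-*-Solver

-- The order ℤ[ω] with 2ω = s + k√m.

module HalfInteger (m s t k : ℤ) (k≢0 : k ≢ 0ℤ) (D≡ : Roots.D s t ≡ k * k * m) where

  private module QF = QuadraticField m
  open QF using (K; _+_√m; m/1; 0K)
  open +-*-Solver using (solve; _:+_; _:*_; _:=_; :-_; con)

  private
    s/1 = fraction s
    t/1 = fraction t
    k/1 = fraction k

  ω : K
  ω = _+_√m (s/1 ℚ.* ½) (k/1 ℚ.* ½)

  private
    discriminant : s/1 ℚ.* s/1 ≡ fraction (+ 4) ℚ.* t/1 ℚ.+ k/1 ℚ.* k/1 ℚ.* m/1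
    discriminant = trans (sym (fraction-* s s)) (trans (cong fraction s²≡) (trans (fraction-+ (+ 4 * t) (k * k * m))
        (cong₂ ℚ._+_ (fraction-* (+ 4) t) (trans (fraction-* (k * k) m) (cong (ℚ._* m/1) (fraction-* k k))))))
      where
      s²≡ : s * s ≡ + 4 * t + k * k * m
      s²≡ = trans (l (s * s) (+ 4 * t)) (cong (_+_ (+ 4 * t)) D≡)
        where
        l : ∀ x y → x ≡ y + (x - y)
        l = solve-∀

    re-ιω : ∀ u v → K.re (QF.fromℤ u QF.+ QF.fromℤ v QF.* ω) ≡ fraction u ℚ.+ fraction v ℚ.* s/1 ℚ.* ½
    re-ιω u v = solve 5 (λ u v s k m → u :+ (v :* (s :* con ½) :+ m :* (con 0ℚ :* (k :* con ½))) := u :+ v :* s :* con ½) refl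
      (fraction u) (fraction v) s/1 k/1 m/1

    im-ιω : ∀ u v → K.im (QF.fromℤ u QF.+ QF.fromℤ v QF.* ω) ≡ fraction v ℚ.* k/1 ℚ.* ½
    im-ιω u v = solve 4 (λ u v s k → con 0ℚ :+ (v :* (k :* con ½) :+ con 0ℚ :* (s :* con ½)) := v :* k :* con ½) refl
      (fraction u) (fraction v) s/1 k/1

  orderField : OrderField s t
  orderField = record
    { K = K ; _⊕_ = QF._+_ ; _⊗_ = QF._*_ ; ⊝_ = QF.-_ ; 𝟎 = QF.0K ; 𝟏 = QF.1K
    ; isCommutativeRing = CommutativeRing.isCommutativeRing QF.commutativeRing
    ; _≟𝟎 = λ (_+_√m a b) → is-zero a b (a ℚ.≟ 0ℚ) (b ℚ.≟ 0ℚ)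
    ; ι = QF.fromℤ
    ; ι-+ = λ u v → cong (λ x → _+_√m x 0ℚ) (fraction-+ u v)
    ; ι-* = λ u v → cong₂ _+_√m (trans (fraction-* u v) (solve 3 (λ u v m → u :* v := u :* v :+ m :* (con 0ℚ :* con 0ℚ)) refl (fraction u) (fraction v) m/1))
        (solve 2 (λ u v → con 0ℚ := u :* con 0ℚ :+ con 0ℚ :* v) refl (fraction u) (fraction v))
    ; ι-neg = λ u → cong (λ x → _+_√m x 0ℚ) (fraction-neg u)
    ; ι-0 = refl
    ; ι-1 = refl
    ; ι-inverse = λ n n≢0 → ι-inverse n (fraction-inverse n n≢0)
    ; ω = ω
    ; ω² = cong₂ _+_√m re-ω² im-ω²
    ; independent = λ u v eq → independent u v (cong K.re eq) (cong K.im eq)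
    -- Obtained from √m = (2ω - s) / k by clearing the denominators of a and b.
    ; denominator = λ (_+_√m a b) → ↧ a * ↧ b * k , ↥ a * ↧ b * k - ↥ b * ↧ a * s , + 2 * (↥ b * ↧ a) , den≢0 a b , cong₂ _+_√m (den-re a b) (den-im a b)
    }
    where
    is-zero : ∀ a b → Dec (a ≡ 0ℚ) → Dec (b ≡ 0ℚ) → Dec (_+_√m a b ≡ 0K)
    is-zero a b (yes refl) (yes refl) = yes refl
    is-zero a b (no ≢0) _ = no λ eq → ≢0 (cong K.re eq)
    is-zero a b (yes _) (no ≢0) = no λ eq → ≢0 (cong K.im eq)

    ι-inverse : ∀ n → ∃[ p ] fraction n ℚ.* p ≡ 1ℚ → ∃[ x ] QF.fromℤ n QF.* x ≡ QF.1K
    ι-inverse n (p , np≡1) = _+_√m p 0ℚ , cong₂ _+_√m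
      (trans (solve 3 (λ n p m → n :* p :+ m :* (con 0ℚ :* con 0ℚ) := n :* p) refl (fraction n) p m/1) np≡1)
      (solve 2 (λ n p → n :* con 0ℚ :+ con 0ℚ :* p := con 0ℚ) refl (fraction n) p)

    re-ω² : K.re (ω QF.* ω) ≡ K.re (QF.fromℤ s QF.* ω QF.+ (QF.- QF.fromℤ t))
    re-ω² = trans (solve 3 (λ s k m → s :* con ½ :* (s :* con ½) :+ m :* (k :* con ½ :* (k :* con ½)) :=
          con ½ :* con ½ :* (s :* s) :+ con ½ :* con ½ :* (k :* k :* m)) refl s/1 k/1 m/1)
      (trans (solve 4 (λ x s k m → con ½ :* con ½ :* x :+ con ½ :* con ½ :* (k :* k :* m) :=
          con ½ :* con ½ :* (x :+ k :* k :* m)) refl (s/1 ℚ.* s/1) s/1 k/1 m/1)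
      (trans (cong (λ x → ½ ℚ.* ½ ℚ.* x) (trans (solve 3 (λ x t y → x :+ y := con (fraction (+ 2)) :* x :+ (:- x :+ (con (fraction (+ 4)) :* t :+ y)) :+ :- (con (fraction (+ 4)) :* t))
            refl (s/1 ℚ.* s/1) t/1 (k/1 ℚ.* k/1 ℚ.* m/1))
          (trans (cong (λ x → fraction (+ 2) ℚ.* (s/1 ℚ.* s/1) ℚ.+ (ℚ.- (s/1 ℚ.* s/1) ℚ.+ x) ℚ.+ (ℚ.- (fraction (+ 4) ℚ.* t/1))) (sym discriminant))
            (solve 2 (λ x t → con (fraction (+ 2)) :* x :+ (:- x :+ x) :+ :- (con (fraction (+ 4)) :* t) := con (fraction (+ 2)) :* x :+ :- (con (fraction (+ 4)) :* t)) refl (s/1 ℚ.* s/1) t/1))))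
      (solve 4 (λ s t k m → con ½ :* con ½ :* (con (fraction (+ 2)) :* (s :* s) :+ :- (con (fraction (+ 4)) :* t)) :=
          s :* (s :* con ½) :+ m :* (con 0ℚ :* (k :* con ½)) :+ :- t) refl s/1 t/1 k/1 m/1)))

    im-ω² : K.im (ω QF.* ω) ≡ K.im (QF.fromℤ s QF.* ω QF.+ (QF.- QF.fromℤ t))
    im-ω² = solve 2 (λ s k → s :* con ½ :* (k :* con ½) :+ k :* con ½ :* (s :* con ½) :=
        s :* (k :* con ½) :+ con 0ℚ :* (s :* con ½) :+ con 0ℚ) refl s/1 k/1

    independent : ∀ u v → K.re (QF.fromℤ u QF.+ QF.fromℤ v QF.* ω) ≡ 0ℚ → K.im (QF.fromℤ u QF.+ QF.fromℤ v QF.* ω) ≡ 0ℚ → u ≡ 0ℤ × v ≡ 0ℤ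
    independent u v re≡0 im≡0 = fraction-injective u≡0 , fraction-injective v≡0
      where
      v≡0 : fraction v ≡ 0ℚ
      v≡0 = fraction-cancel k k≢0 (trans (solve 2 (λ v k → k :* v := con (fraction (+ 2)) :* (v :* k :* con ½)) refl (fraction v) k/1)
        (cong (fraction (+ 2) ℚ.*_) (trans (sym (im-ιω u v)) im≡0)))
      u≡0 : fraction u ≡ 0ℚ
      u≡0 = trans (solve 2 (λ u s → u := u :+ con 0ℚ :* s :* con ½) refl (fraction u) s/1)
        (trans (cong (λ x → fraction u ℚ.+ x ℚ.* s/1 ℚ.* ½) (sym v≡0)) (trans (sym (re-ιω u v)) re≡0))

    den≢0 : ∀ a b → ↧ a * ↧ b * k ≢ 0ℤ
    den≢0 a b eq = [ (λ e → [ (λ ()) , (λ ()) ]′ (i*j≡0⇒i≡0∨j≡0 (↧ a) {↧ b} e)) , k≢0 ]′ (i*j≡0⇒i≡0∨j≡0 (↧ a * ↧ b) {k} eq)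

    den-re : ∀ a b → K.re (QF.fromℤ (↧ a * ↧ b * k) QF.* (_+_√m a b)) ≡
             K.re (QF.fromℤ (↥ a * ↧ b * k - ↥ b * ↧ a * s) QF.+ QF.fromℤ (+ 2 * (↥ b * ↧ a)) QF.* ω)
    den-re a b = sym (trans (re-ιω (↥ a * ↧ b * k - ↥ b * ↧ a * s) (+ 2 * (↥ b * ↧ a)))
      (trans (cong₂ (λ x y → x ℚ.+ y ℚ.* s/1 ℚ.* ½) expand-u expand-v)
      (trans (solve 6 (λ a′ a₂ b′ b₂ k s → a′ :* b₂ :* k :+ :- (b′ :* a₂ :* s) :+ con (fraction (+ 2)) :* (b′ :* a₂) :* s :* con ½ := a′ :* (b₂ :* k)) refl
          (fraction (↥ a)) (fraction (↧ a)) (fraction (↥ b)) (fraction (↧ b)) k/1 s/1)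
      (trans (cong (ℚ._* (fraction (↧ b) ℚ.* k/1)) (sym (fraction-↧ a)))
      (trans (solve 6 (λ a a₂ b b₂ k m → a₂ :* a :* (b₂ :* k) := a₂ :* b₂ :* k :* a :+ m :* (con 0ℚ :* b)) refl
          a (fraction (↧ a)) b (fraction (↧ b)) k/1 m/1)
        (cong (λ w → w ℚ.* a ℚ.+ m/1 ℚ.* (0ℚ ℚ.* b)) (sym expand-w)))))))
      where
      expand-w : fraction (↧ a * ↧ b * k) ≡ fraction (↧ a) ℚ.* fraction (↧ b) ℚ.* k/1
      expand-w = trans (fraction-* (↧ a * ↧ b) k) (cong (ℚ._* k/1) (fraction-* (↧ a) (↧ b)))
      expand-u : fraction (↥ a * ↧ b * k - ↥ b * ↧ a * s) ≡ fraction (↥ a) ℚ.* fraction (↧ b) ℚ.* k/1 ℚ.+ (ℚ.- (fraction (↥ b) ℚ.* fraction (↧ a) ℚ.* s/1))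
      expand-u = trans (fraction-+ (↥ a * ↧ b * k) (- (↥ b * ↧ a * s))) (cong₂ ℚ._+_
        (trans (fraction-* (↥ a * ↧ b) k) (cong (ℚ._* k/1) (fraction-* (↥ a) (↧ b))))
        (trans (fraction-neg (↥ b * ↧ a * s)) (cong ℚ.-_ (trans (fraction-* (↥ b * ↧ a) s) (cong (ℚ._* s/1) (fraction-* (↥ b) (↧ a)))))))
      expand-v : fraction (+ 2 * (↥ b * ↧ a)) ≡ fraction (+ 2) ℚ.* (fraction (↥ b) ℚ.* fraction (↧ a))
      expand-v = trans (fraction-* (+ 2) (↥ b * ↧ a)) (cong (fraction (+ 2) ℚ.*_) (fraction-* (↥ b) (↧ a)))

    den-im : ∀ a b → K.im (QF.fromℤ (↧ a * ↧ b * k) QF.* (_+_√m a b)) ≡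
             K.im (QF.fromℤ (↥ a * ↧ b * k - ↥ b * ↧ a * s) QF.+ QF.fromℤ (+ 2 * (↥ b * ↧ a)) QF.* ω)
    den-im a b = sym (trans (im-ιω (↥ a * ↧ b * k - ↥ b * ↧ a * s) (+ 2 * (↥ b * ↧ a)))
      (trans (cong (λ y → y ℚ.* k/1 ℚ.* ½) expand-v)
      (trans (solve 3 (λ b′ a₂ k → con (fraction (+ 2)) :* (b′ :* a₂) :* k :* con ½ := b′ :* (a₂ :* k)) refl (fraction (↥ b)) (fraction (↧ a)) k/1)
      (trans (cong (ℚ._* (fraction (↧ a) ℚ.* k/1)) (sym (fraction-↧ b)))
      (trans (solve 5 (λ a b a₂ b₂ k → b₂ :* b :* (a₂ :* k) := a₂ :* b₂ :* k :* b :+ con 0ℚ :* a) refl a b (fraction (↧ a)) (fraction (↧ b)) k/1)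
        (cong (λ w → w ℚ.* b ℚ.+ 0ℚ ℚ.* a) (sym expand-w)))))))
      where
      expand-w : fraction (↧ a * ↧ b * k) ≡ fraction (↧ a) ℚ.* fraction (↧ b) ℚ.* k/1
      expand-w = trans (fraction-* (↧ a * ↧ b) k) (cong (ℚ._* k/1) (fraction-* (↧ a) (↧ b)))
      expand-v : fraction (+ 2 * (↥ b * ↧ a)) ≡ fraction (+ 2) ℚ.* (fraction (↥ b) ℚ.* fraction (↧ a))
      expand-v = trans (fraction-* (+ 2) (↥ b * ↧ a)) (cong (fraction (+ 2) ℚ.*_) (fraction-* (↥ b) (↧ a)))

-- The choice of ω and the class group

square-free⇒p²∤ : ∀ m → SquareFree m → ∀ p → Prime p → ¬ p ℕ.* p ∣ ∣ m ∣
square-free⇒p²∤ m squareFree p pr p²∣m = ℕ.<⇒≢ (prime>1 pr) (sym (squareFree p p²∣m))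

square-mod-4 : ∀ r → r * r ≅ 0ℤ [ 4 ] ⊎ r * r ≅ 1ℤ [ 4 ]
square-mod-4 r = at (r %ℕ 4) (n%ℕd<d r 4) (≅-* (residue r 4) (residue r 4))
  where
  at : ∀ i → i ℕ.< 4 → r * r ≅ + i * + i [ 4 ] → r * r ≅ 0ℤ [ 4 ] ⊎ r * r ≅ 1ℤ [ 4 ]
  at 0 _ e = inj₁ e
  at 1 _ e = inj₂ e
  at 2 _ e = inj₁ (≅-trans e (cg 1ℤ refl))
  at 3 _ e = inj₂ (≅-trans e (cg (+ 2) refl))
  at (suc (suc (suc (suc _)))) (s≤s (s≤s (s≤s (s≤s ())))) _

D≅0 : ∀ s t p r → + 2 * r - s ≅ 0ℤ [ p ] → Roots.P s t r ≅ 0ℤ [ p ℕ.* p ] → Roots.D s t ≅ 0ℤ [ p ℕ.* p ]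
D≅0 s t p r (cg a e₁) (cg b e₂) = cg (a * a - + 4 * b) (trans (l₁ s t r) (trans (cong₂ (λ x y → x * x - + 4 * y) e₁ e₂)
    (trans (l₂ a b (+ p) (+ (p ℕ.* p))) (trans (cong (λ z → a * a * z - + 4 * b * + (p ℕ.* p)) (sym (pos-* p p))) (l₃ a b (+ (p ℕ.* p)))))))
  where
  l₁ : ∀ s t r → s * s - + 4 * t ≡ (+ 2 * r - s) * (+ 2 * r - s) - + 4 * (r * r - s * r + t)
  l₁ = solve-∀
  l₂ : ∀ a b p q → (+ 0 + a * p) * (+ 0 + a * p) - + 4 * (+ 0 + b * q) ≡ a * a * (p * p) - + 4 * b * q
  l₂ = solve-∀
  l₃ : ∀ a b q → a * a * q - + 4 * b * q ≡ + 0 + (a * a - + 4 * b) * q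
  l₃ = solve-∀

RingParameters : ℤ → Set
RingParameters m = ∃[ s ] ∃[ t ] ∃[ k ] k ≢ 0ℤ × Roots.D s t ≡ k * k * m × Roots.D s t ≡ disc m × Roots.Fundamental s t

-- ω is (1 + √m) / 2 or √m. A violation of `Fundamental` at p gives p² ∣ D, hence p² ∣ m unless p =
-- 2 and D = 4m. In that case P(r) = r² - m gives m ≡ r² modulo 4, so m would be 0 or 1 modulo 4.
ring-parameters : ∀ m → SquareFree m → RingParameters m
ring-parameters m squareFree with m %ℕ 4 ℕ.≟ 1 | a≡a%ℕn+[a/ℕn]*n m 4
... | yes m%4≡1 | m≡ = 1ℤ , - q , 1ℤ , (λ ()) , trans D≡m (sym (l₁ m)) , trans D≡m (sym (disc-1 m m%4≡1)) ,
      λ p pr r e₁ e₂ → square-free⇒p²∤ m squareFree p pr (≅0⇒∣ (≅-trans (≅-reflexive (sym D≡m)) (D≅0 1ℤ (- q) p r e₁ e₂)))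
  where
  q = m /ℕ 4
  l₁ : ∀ m → + 1 * + 1 * m ≡ m
  l₁ = solve-∀
  D≡m : Roots.D 1ℤ (- q) ≡ m
  D≡m = trans (l q) (sym (trans m≡ (cong (λ i → + i + q * + 4) m%4≡1)))
    where
    l : ∀ q → + 1 * + 1 - + 4 * - q ≡ + 1 + q * + 4
    l = solve-∀
... | no m%4≢1 | m≡ = 0ℤ , - m , + 2 , (λ ()) , D≡ m , trans (D≡ m) (sym (disc-4 m m%4≢1)) , λ p pr r e₁ e₂ → absurd p pr r e₁ e₂ (p ℕ.≟ 2)
  where
  D≡ : ∀ m → 0ℤ * 0ℤ - + 4 * - m ≡ + 4 * m
  D≡ m = l m
    where
    l : ∀ m → + 0 * + 0 - + 4 * - m ≡ + 4 * m
    l = solve-∀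
  absurd : ∀ p → Prime p → ∀ r → + 2 * r - 0ℤ ≅ 0ℤ [ p ] → Roots.P 0ℤ (- m) r ≅ 0ℤ [ p ℕ.* p ] → Dec (p ≡ 2) → ⊥
  absurd p pr r e₁ e₂ (no p≢2) = square-free⇒p²∤ m squareFree p pr (coprime-divisor p²⊥4
      (subst (p ℕ.* p ∣_) (trans (cong ∣_∣ (D≡ m)) (abs-* (+ 4) m)) (≅0⇒∣ (D≅0 0ℤ (- m) p r e₁ e₂))))
    where
    p∤2 : ¬ p ∣ 2
    p∤2 d = [ (λ eq → ℕ.<⇒≢ (prime>1 pr) (sym eq)) , p≢2 ]′ (prime⇒irreducible prime[2] d)
    product-coprime : ∀ {a b c} → Coprime a c → Coprime b c → Coprime (a ℕ.* b) c
    product-coprime ca cb {d} (d∣ab , d∣c) = cb (coprime-divisor (λ (e∣d , e∣a) → ca (e∣a , ℕ∣.∣-trans e∣d d∣c)) d∣ab , d∣c)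
    p⊥2 : Coprime p 2
    p⊥2 = Coprime.sym (∤⇒coprime pr λ p∣2 → p∤2 p∣2)
    p⊥4 : Coprime p 4
    p⊥4 = Coprime.sym (product-coprime {2} {2} (Coprime.sym p⊥2) (Coprime.sym p⊥2))
    p²⊥4 : Coprime (p ℕ.* p) 4
    p²⊥4 = product-coprime p⊥4 p⊥4
  absurd p pr r e₁ e₂ (yes refl) = [ (λ e → bad₀ (≅-trans m≅r² e)) , (λ e → bad₁ (≅-trans m≅r² e)) ]′ (square-mod-4 r)
    where
    m≅r² : m ≅ r * r [ 4 ]
    m≅r² = ≅-sym (≅-trans (≅-reflexive (l r m)) (≅-trans (≅-+ e₂ (≅-refl {x = m})) (≅-reflexive (+-identityˡ m))))
      where
      l : ∀ r m → r * r ≡ (r * r - + 0 * r + - m) + m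
      l = solve-∀
    bad₀ : ¬ m ≅ 0ℤ [ 4 ]
    bad₀ e = square-free⇒p²∤ m squareFree 2 prime[2] (≅0⇒∣ e)
    bad₁ : ¬ m ≅ 1ℤ [ 4 ]
    bad₁ e = m%4≢1 (residue-cong e)

module ClassGroup (m s t k : ℤ) (k≢0 : k ≢ 0ℤ) (D≡ : Roots.D s t ≡ k * k * m) (fund : Roots.Fundamental s t)
  (D<-4 : Roots.D s t < - + 4) where

  F : OrderField s t
  F = HalfInteger.orderField m s t k k≢0 D≡

  open OrderField F using (_⊕_; _⊗_; 𝟎; 𝟏)
  open Order F fund D<-4
  private module QF = QuadraticField m
  open QF using (FractionalIdeal; Integral; _∈⟨_⟩; _∈_; _∼_)

  evalM≡evalMonic : ∀ cs α → evalM cs α ≡ QF.evalMonic cs α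
  evalM≡evalMonic []       α = refl
  evalM≡evalMonic (c ∷ cs) α = cong (λ z → QF.fromℤ c ⊕ α ⊗ z) (evalM≡evalMonic cs α)

  integral⇒E : ∀ {α} → Integral α → ∃[ u ] ∃[ v ] α ≡ E u v
  integral⇒E {α} (cs , eq) = integrally-closed α cs (trans (evalM≡evalMonic cs α) eq)

  E-integral : ∀ u v → Integral (E u v)
  E-integral u v = proj₁ (E-root u v) , trans (sym (evalM≡evalMonic (proj₁ (E-root u v)) (E u v))) (proj₂ (E-root u v))

  ∈⇒OSpan : ∀ gs {x} → x ∈⟨ gs ⟩ → OSpan gs x
  ∈⇒OSpan []       x≡ = x≡
  ∈⇒OSpan (g ∷ gs) (c , y , int , y∈ , x≡) = with-E (integral⇒E int)
    where
    with-E : ∃[ u ] ∃[ v ] c ≡ E u v → OSpan (g ∷ gs) _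
    with-E (u , v , c≡) = u , v , y , ∈⇒OSpan gs y∈ , trans x≡ (cong (λ z → z ⊗ g ⊕ y) c≡)

  OSpan⇒∈ : ∀ gs {x} → OSpan gs x → x ∈⟨ gs ⟩
  OSpan⇒∈ []       x≡ = x≡
  OSpan⇒∈ (g ∷ gs) (u , v , y , y∈ , x≡) = E u v , y , E-integral u v , OSpan⇒∈ gs y∈ , x≡

  ideal-structure : ∀ I → Structure (_∈ I)
  ideal-structure I = from-basis (basis-or-zero gs)
    where
    gs = FractionalIdeal.generators I
    member : ∀ {gs} → Any (_≢ 𝟎) gs → ∃[ g ] OSpan gs g × g ≢ 𝟎
    member {g ∷ gs} (here g≢0)  = g , OSpan-here g gs , g≢0
    member {g ∷ gs} (there any) = later (member any)
      where
      later : ∃[ y ] OSpan gs y × y ≢ 𝟎 → ∃[ y ] OSpan (g ∷ gs) y × y ≢ 𝟎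
      later (y , y∈ , y≢0) = y , OSpan-skip g gs y∈ , y≢0
    nonzero : ∃[ g ] OSpan gs g × g ≢ 𝟎
    nonzero = member (FractionalIdeal.nonzero I)
    from-basis : (∀ {x} → OSpan gs x → x ≡ 𝟎) ⊎ Basis (OSpan gs) → Structure (_∈ I)
    from-basis (inj₁ null) = ⊥-elim (proj₂ (proj₂ nonzero) (null (proj₁ (proj₂ nonzero))))
    from-basis (inj₂ B)    = record { quadratic = S.quadratic ; b = S.b ; b⁻¹ = S.b⁻¹ ; b-inverse = S.b-inverse
                                    ; to = λ {y} y∈ → S.to (∈⇒OSpan gs y∈) ; from = λ y∈ → OSpan⇒∈ gs (S.from y∈) }
      where module S = Structure (structure B (OSpan-ω gs))

  quadratic-ideal : Quadratic → FractionalIdeal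
  quadratic-ideal Q = record { generators = 𝟏 ∷ Quadratic.θ Q ∷ [] ; nonzero = here 𝟏≢𝟎 }

  module Representatives (h : ℕ) (bij : IsClassNumber m h) where
    open Bijection bij using (injective; surjective) renaming (to to ideal)

    structures : ∀ j → Structure (_∈ ideal j)
    structures j = ideal-structure (ideal j)

    Qs : Fin h → Quadratic
    Qs j = Structure.quadratic (structures j)

    -- The ideal generated by 1 and θ is equivalent to a listed one; equivalence of ideals amounts
    -- to similarity of their lattices, and this to a vector satisfying `Rel`.
    every-class : ∀ Q → ∃[ j ] ∃[ x ] ∃[ y ] Rel (Qs j) (Quadratic.a Q) (Quadratic.r Q) x y
    every-class Q = from-class (proj₁ (surjective 𝔍)) (proj₂ (surjective 𝔍) refl)
      where
      𝔍 = quadratic-ideal Q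
      from-class : ∀ j → ideal j ∼ 𝔍 → ∃[ j ] ∃[ x ] ∃[ y ] Rel (Qs j) (Quadratic.a Q) (Quadratic.r Q) x y
      from-class j (α , β , αβ≡1 , α⇔) = j , similar⇒rel (Qs j) Q (≈⇒similar (structures j) Q (record
          { α = α ; β = β ; unit = αβ≡1
          ; to = λ x x∈ → ∈⇒OSpan (FractionalIdeal.generators 𝔍) (Equivalence.to (α⇔ x) x∈)
          ; from = λ x αx∈ → Equivalence.from (α⇔ x) (OSpan⇒∈ (FractionalIdeal.generators 𝔍) αx∈) }))

    distinct-classes : ∀ Q j k {x y x′ y′} → Rel (Qs j) (Quadratic.a Q) (Quadratic.r Q) x y →
                       Rel (Qs k) (Quadratic.a Q) (Quadratic.r Q) x′ y′ → j ≡ k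
    distinct-classes Q j k {x} {y} {x′} {y′} rel rel′ = injective (α , β , unit , λ z → mk⇔ (to z) (from z))
      where
      open _≈_ (similar⇒≈ (structures j) (structures k) Q (rel⇒similar (Qs j) Q x y rel) (rel⇒similar (Qs k) Q x′ y′ rel′))

-- The class number formula

Σ-multiples-of : ∀ d → 1 ℕ.≤ d → ∀ T M (G : ℕ → ℤ) → suc T ℕ.≤ M → (∀ n → suc T ℕ.≤ n → G n ≡ 0ℤ) →
  Σ< M (λ k → G (d ℕ.* suc k)) ≡ Σ< T (λ n → 𝟙 (d ∣? suc n) * G (suc n))
Σ-multiples-of d 1≤d T M G T<M far = +-cancelˡ (G 0) (begin
  G 0 + Σ< M (λ k → G (d ℕ.* suc k))
    ≡⟨ cong (_+_ (G 0)) (Σ-cong′ M λ k → cong G (ℕ.*-comm d (suc k))) ⟩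
  G 0 + Σ< M (λ k → G (suc k ℕ.* d))
    ≡⟨ sym (Σ-head M (λ e → G (e ℕ.* d))) ⟩
  Σ< (suc M) (λ e → G (e ℕ.* d))
    ≡⟨ sym (Σ-multiples d {{ℕ.>-nonZero 1≤d}} (suc M) G) ⟩
  Σ< (suc M ℕ.* d) (λ n → 𝟙 (d ∣? n) * G n)
    ≡⟨ Σ-extend T<Md (λ n T<n → trans (cong (𝟙 (d ∣? n) *_) (far n T<n)) (*-zeroʳ (𝟙 (d ∣? n)))) ⟩
  Σ< (suc T) (λ n → 𝟙 (d ∣? n) * G n)
    ≡⟨ Σ-head T (λ n → 𝟙 (d ∣? n) * G n) ⟩
  𝟙 (d ∣? 0) * G 0 + Σ< T (λ n → 𝟙 (d ∣? suc n) * G (suc n))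
    ≡⟨ cong (_+ Σ< T (λ n → 𝟙 (d ∣? suc n) * G (suc n))) (trans (cong (_* G 0) (𝟙-yes (d ∣? 0) (d ℕ∣.∣0))) (*-identityˡ (G 0))) ⟩
  G 0 + Σ< T (λ n → 𝟙 (d ∣? suc n) * G (suc n)) ∎)
  where
  open ≡-Reasoning
  T<Md : suc T ℕ.≤ suc M ℕ.* d
  T<Md = ℕ.≤-trans T<M (ℕ.≤-trans (ℕ.n≤1+n M) (ℕ.m≤m*n (suc M) d {{ℕ.>-nonZero 1≤d}}))

sum-const : ∀ n c → sum {n} (λ _ → c) ≡ + n * c
sum-const zero    c = sym (*-zeroˡ c)
sum-const (suc n) c = trans (cong (_+_ c) (sum-const n c)) (l (+ n) c)
  where
  l : ∀ n c → c + n * c ≡ (+ 1 + n) * c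
  l = solve-∀

total : ∀ {n} → (Fin n → ℕ) → ℕ
total {zero}  K = 0
total {suc n} K = K Fin.zero ℕ.+ total (λ i → K (Fin.suc i))

sum-≼ : ∀ {n} (F : Fin n → ℤ) K L → (∀ i → F i ≼ K i ℕ.* L) → sum F ≼ total K ℕ.* L
sum-≼ {zero}  F K L F≼ = z≤n
sum-≼ {suc n} F K L F≼ = ℕ.≤-trans (≼-+ {F Fin.zero} {sum λ i → F (Fin.suc i)} (F≼ Fin.zero)
    (sum-≼ (λ i → F (Fin.suc i)) (λ i → K (Fin.suc i)) L λ i → F≼ (Fin.suc i)))
  (ℕ.≤-reflexive (sym (ℕ.*-distribʳ-+ L (K Fin.zero) _)))

sum-- : ∀ {n} (F G : Fin n → ℤ) → sum (λ i → F i - G i) ≡ sum F - sum G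
sum-- F G = trans (sum-+ F (λ i → - G i)) (cong (_+_ (sum F)) (trans (sum-cong λ i → l (G i)) (trans (sum-*ˡ -1ℤ G) (sym (l (sum G))))))
  where
  l : ∀ x → - x ≡ - + 1 * x
  l = solve-∀

Σ-partial-sums : ∀ M (g : ℕ → ℤ) → Σ< M (λ d → Σ< (suc d) g) ≡ + M * Σ< M g - Σ< M (λ j → + j * g j)
Σ-partial-sums zero    g = refl
Σ-partial-sums (suc M) g = trans (cong (_+ (Σ< M g + g M)) (Σ-partial-sums M g)) (l (+ M) (Σ< M g) (Σ< M (λ j → + j * g j)) (g M))
  where
  l : ∀ m s j g → m * s - j + (s + g) ≡ (+ 1 + m) * (s + g) - (j + m * g)
  l = solve-∀

-- The substitute for a limit: at t = K + 1 the hypothesis reads ∣ c ∣ (K + 1) ≤ K.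
dominated⇒0 : ∀ e c K → (∀ t → 1 ℕ.≤ t → ∣ c ∣ ℕ.* t ℕ.^ suc e ℕ.≤ K ℕ.* t ℕ.^ e) → c ≡ 0ℤ
dominated⇒0 e c K bound = ∣i∣≡0⇒i≡0 (small ∣ c ∣ (ℕ.*-cancelʳ-≤ (∣ c ∣ ℕ.* suc K) K (suc K ℕ.^ e) {{ℕ.m^n≢0 (suc K) e}}
    (ℕ.≤-trans (ℕ.≤-reflexive (ℕ.*-assoc ∣ c ∣ (suc K) (suc K ℕ.^ e))) (bound (suc K) (s≤s z≤n)))))
  where
  small : ∀ n → n ℕ.* suc K ℕ.≤ K → n ≡ 0
  small zero    _  = refl
  small (suc n) le = ⊥-elim (ℕ.<⇒≱ (s≤s (ℕ.m≤m+n K (n ℕ.* suc K))) le)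

module ClassNumberFormula {s t : ℤ} (F : OrderField s t) (fund : Roots.Fundamental s t) (D<-4 : Roots.D s t < - + 4)
  (X : ℤ → ℤ) (kron : Kronecker (Roots.D s t) X) where

  open Roots s t using (D)
  open Order F fund D<-4
  open Kronecker kron
  open IdealCount s t X kron fund using (χ⁺; χ-Trit; R; R-range; A; A≡R)

  N : ℕ
  N = ∣ D ∣

  4<N : 4 ℕ.< N
  4<N = bound D D<-4
    where
    bound : ∀ D → D < - + 4 → 4 ℕ.< ∣ D ∣
    bound -[1+ n ] (-<- 3<n) = s≤s 3<n

  instance
    N-nonZero : NonZero N
    N-nonZero = ℕ.>-nonZero (ℕ.<-trans (s≤s z≤n) 4<N)

  χ0≡0 : χ⁺ 0 ≡ 0ℤ
  χ0≡0 = χ-zero {0ℤ} λ coprime → ℕ.<⇒≢ (ℕ.<-trans (s≤s (s≤s z≤n)) 4<N) (sym (coprime (N ℕ∣.∣0 , ℕ∣.∣-refl)))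

  χ-periodic : Periodic N χ⁺
  χ-periodic d = χ-cong (cg 1ℤ (trans (pos-+ d N) (cong (_+_ (+ d)) (sym (*-identityˡ (+ N))))))

  ∣χ∣≤1 : ∀ d → χ⁺ d ≼ 1
  ∣χ∣≤1 d = trit (χ-Trit d)
    where
    trit : ∀ {c} → Trit c → c ≼ 1
    trit (inj₁ refl)        = z≤n
    trit (inj₂ (inj₁ refl)) = s≤s z≤n
    trit (inj₂ (inj₂ refl)) = s≤s z≤n

  χ-neg : ∀ x → X (- x) ≡ - X x
  χ-neg x = trans (cong X (sym (-1*i≡-i x))) (trans (χ-* -1ℤ x) (trans (cong (_* X x) χ-neg1) (-1*i≡-i (X x))))

  -- χ is odd: x ↦ N - x reverses its sign, and the residue 0 contributes nothing.
  Σχ≡0 : Σ< N χ⁺ ≡ 0ℤ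
  Σχ≡0 = neg-fixed (trans (sym (Σ-reindex N N π χ⁺ into onto injective)) (trans (Σ-cong N reflected) (Σ-neg N χ⁺)))
    where
    π : ℕ → ℕ
    π zero    = 0
    π (suc i) = N ℕ.∸ suc i
    into : ∀ i → i ℕ.< N → π i ℕ.< N
    into zero    i<N = i<N
    into (suc i) i<N = ℕ.∸-monoʳ-< (s≤s z≤n) (ℕ.<⇒≤ i<N)
    involutive : ∀ i → i ℕ.< N → π (π i) ≡ i
    involutive zero    i<N = refl
    involutive (suc i) i<N = at (N ℕ.∸ suc i) refl
      where
      at : ∀ k → N ℕ.∸ suc i ≡ k → π k ≡ suc i
      at zero    eq = ⊥-elim (ℕ.m>n⇒m∸n≢0 i<N eq)
      at (suc k) eq = trans (cong (N ℕ.∸_) (sym eq)) (ℕ.m∸[m∸n]≡n (ℕ.<⇒≤ i<N))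
    onto : ∀ j → j ℕ.< N → ∃[ i ] i ℕ.< N × π i ≡ j
    onto j j<N = π j , into j j<N , involutive j j<N
    injective : ∀ i j → i ℕ.< N → j ℕ.< N → π i ≡ π j → i ≡ j
    injective i j i<N j<N eq = trans (sym (involutive i i<N)) (trans (cong π eq) (involutive j j<N))
    reflected : ∀ i → i ℕ.< N → χ⁺ (π i) ≡ - χ⁺ i
    reflected zero    _   = trans χ0≡0 (sym (cong -_ χ0≡0))
    reflected (suc i) i<N = trans (χ-cong (cg 1ℤ (trans (sym (⊖-≥ (ℕ.<⇒≤ i<N))) (trans (sym (m-n≡m⊖n N (suc i))) (l (+ N) (+ suc i))))))
        (χ-neg (+ suc i))
      where
      l : ∀ n i → n - i ≡ - i + + 1 * n
      l = solve-∀

  open DivisorSum N χ⁺ χ-periodic Σχ≡0 χ0≡0 ∣χ∣≤1 using (Ψ; Ψ′; σ₁; N³; divisorConst; divisor-bound)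

  moment : ℤ
  moment = Σ< N λ x → + x * χ⁺ x

  σ₁≡ : σ₁ ≡ - (+ N * moment)
  σ₁≡ = trans (Σ-partial-sums N (λ j → + N * χ⁺ j - Σ< N χ⁺))
      (trans (cong₂ (λ a b → + N * a - b) vanishing weighted) (l (+ N) moment))
    where
    drop : ∀ j → + N * χ⁺ j - Σ< N χ⁺ ≡ + N * χ⁺ j
    drop j = trans (cong (λ z → + N * χ⁺ j - z) Σχ≡0) (+-identityʳ (+ N * χ⁺ j))
    vanishing : Σ< N (λ j → + N * χ⁺ j - Σ< N χ⁺) ≡ 0ℤ
    vanishing = trans (Σ-cong′ N drop) (trans (Σ-*ˡ N (+ N) χ⁺) (trans (cong (_*_ (+ N)) Σχ≡0) (*-zeroʳ (+ N))))
    weighted : Σ< N (λ j → + j * (+ N * χ⁺ j - Σ< N χ⁺)) ≡ + N * moment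
    weighted = trans (Σ-cong′ N λ j → trans (cong (_*_ (+ j)) (drop j)) (swap (+ j) (+ N) (χ⁺ j))) (Σ-*ˡ N (+ N) λ x → + x * χ⁺ x)
      where
      swap : ∀ j n c → j * (n * c) ≡ n * (j * c)
      swap = solve-∀
    l : ∀ n m → n * + 0 - n * m ≡ - (n * m)
    l = solve-∀

  -- Regroups the pairs (d, k) by n = d (k + 1), which brings out the sum of χ over the divisors of
  -- n. The factor c is 1 or 4, the two scales of the weight.
  Ψ-sum : ∀ T M c → suc T ℕ.≤ M → 1 ℕ.≤ c →
    Σ< M (λ k → Ψ (suc T) (suc k ℕ.* c)) ≡ Σ< T (λ n → R (suc n) * weight (suc T) (+ (suc n ℕ.* c)))
  Ψ-sum T M c T<M 1≤c = begin
    Σ< M (λ k → Σ< (suc (suc T)) λ d → χ⁺ d * weight (suc T) (+ (d ℕ.* (suc k ℕ.* c))))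
      ≡⟨ Σ-swap M (suc (suc T)) (λ k d → χ⁺ d * weight (suc T) (+ (d ℕ.* (suc k ℕ.* c)))) ⟩
    Σ< (suc (suc T)) (λ d → Σ< M λ k → χ⁺ d * weight (suc T) (+ (d ℕ.* (suc k ℕ.* c))))
      ≡⟨ Σ-cong′ (suc (suc T)) (λ d → trans (Σ-cong′ M λ k → cong (λ n → χ⁺ d * weight (suc T) (+ n)) (sym (ℕ.*-assoc d (suc k) c)))
           (Σ-*ˡ M (χ⁺ d) λ k → G (d ℕ.* suc k))) ⟩
    Σ< (suc (suc T)) (λ d → χ⁺ d * Σ< M λ k → G (d ℕ.* suc k))
      ≡⟨ Σ-cong′ (suc (suc T)) per-divisor ⟩
    Σ< (suc (suc T)) (λ d → χ⁺ d * Σ< T λ n → 𝟙 (d ∣? suc n) * G (suc n))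
      ≡⟨ Σ-cong′ (suc (suc T)) (λ d → sym (Σ-*ˡ T (χ⁺ d) λ n → 𝟙 (d ∣? suc n) * G (suc n))) ⟩
    Σ< (suc (suc T)) (λ d → Σ< T λ n → χ⁺ d * (𝟙 (d ∣? suc n) * G (suc n)))
      ≡⟨ Σ-swap (suc (suc T)) T (λ d n → χ⁺ d * (𝟙 (d ∣? suc n) * G (suc n))) ⟩
    Σ< T (λ n → Σ< (suc (suc T)) λ d → χ⁺ d * (𝟙 (d ∣? suc n) * G (suc n)))
      ≡⟨ Σ-cong T (λ n n<T → trans (Σ-cong′ (suc (suc T)) λ d → l (χ⁺ d) (𝟙 (d ∣? suc n)) (G (suc n)))
           (trans (Σ-*ʳ (suc (suc T)) (G (suc n)) λ d → 𝟙 (d ∣? suc n) * χ⁺ d)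
             (cong (_* G (suc n)) (R-range (suc n) (suc (suc T)) (s≤s z≤n) (s≤s (s≤s (ℕ.<⇒≤ n<T))))))) ⟩
    Σ< T (λ n → R (suc n) * G (suc n)) ∎
    where
    open ≡-Reasoning
    G : ℕ → ℤ
    G n = weight (suc T) (+ (n ℕ.* c))
    l : ∀ a b c → a * (b * c) ≡ b * a * c
    l = solve-∀
    far : ∀ n → suc T ℕ.≤ n → G n ≡ 0ℤ
    far n T<n = weight-far (suc T) (+ (n ℕ.* c)) (+≤+ (ℕ.≤-trans T<n (ℕ.m≤m*n n c {{ℕ.>-nonZero 1≤c}})))
    per-divisor : ∀ d → χ⁺ d * Σ< M (λ k → G (d ℕ.* suc k)) ≡ χ⁺ d * Σ< T (λ n → 𝟙 (d ∣? suc n) * G (suc n))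
    per-divisor zero = trans (cong (_* Σ< M (λ k → G 0)) χ0≡0) (trans (*-zeroˡ (Σ< M λ k → G 0))
      (sym (trans (cong (_* Σ< T (λ n → 𝟙 (0 ∣? suc n) * G (suc n))) χ0≡0) (*-zeroˡ (Σ< T λ n → 𝟙 (0 ∣? suc n) * G (suc n))))))
    per-divisor d@(suc _) = cong (_*_ (χ⁺ d)) (Σ-multiples-of d (s≤s z≤n) T M G T<M far)

  smoothed : ℕ → ℤ
  smoothed T = Σ< T λ n → R (suc n) * (+ 4 * weight (suc T) (+ (suc n ℕ.* 4)) - weight (suc T) (+ suc n))

  smoothed≡ : ∀ T → Σ< (suc T ℕ.* 4) (λ k → c₄ k * Ψ′ (suc T) k) ≡ smoothed T
  smoothed≡ T = begin
    Σ< (suc T ℕ.* 4) (λ k → c₄ k * Ψ (suc T) (suc k))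
      ≡⟨ c₄-sum (suc T) (Ψ (suc T)) ⟩
    + 4 * Σ< (suc T) (λ j → Ψ (suc T) (suc j ℕ.* 4)) - Σ< (suc T ℕ.* 4) (λ k → Ψ (suc T) (suc k))
      ≡⟨ cong₂ (λ a b → + 4 * a - b) (Ψ-sum T (suc T) 4 ℕ.≤-refl (s≤s z≤n))
           (trans (Σ-cong′ (suc T ℕ.* 4) λ k → cong (Ψ (suc T)) (sym (ℕ.*-identityʳ (suc k))))
             (trans (Ψ-sum T (suc T ℕ.* 4) 1 (ℕ.m≤m*n (suc T) 4) (s≤s z≤n))
               (Σ-cong′ T λ n → cong (λ k → R (suc n) * weight (suc T) (+ k)) (ℕ.*-identityʳ (suc n))))) ⟩
    + 4 * Σ< T (λ n → R (suc n) * w₄ n) - Σ< T (λ n → R (suc n) * w₁ n)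
      ≡⟨ cong (_- Σ< T (λ n → R (suc n) * w₁ n)) (sym (Σ-*ˡ T (+ 4) λ n → R (suc n) * w₄ n)) ⟩
    Σ< T (λ n → + 4 * (R (suc n) * w₄ n)) - Σ< T (λ n → R (suc n) * w₁ n)
      ≡⟨ sym (Σ-- T (λ n → + 4 * (R (suc n) * w₄ n)) λ n → R (suc n) * w₁ n) ⟩
    Σ< T (λ n → + 4 * (R (suc n) * w₄ n) - R (suc n) * w₁ n)
      ≡⟨ Σ-cong′ T (λ n → l (R (suc n)) (w₄ n) (w₁ n)) ⟩
    smoothed T ∎
    where
    open ≡-Reasoning
    w₄ w₁ : ℕ → ℤ
    w₄ n = weight (suc T) (+ (suc n ℕ.* 4))
    w₁ n = weight (suc T) (+ suc n)
    l : ∀ r a b → + 4 * (r * a) - r * b ≡ r * (+ 4 * a - b)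
    l = solve-∀

  module _ {h : ℕ} (Qs : Fin h → Quadratic)
    (every-class : ∀ Q → ∃[ j ] ∃[ x ] ∃[ y ] Rel (Qs j) (Quadratic.a Q) (Quadratic.r Q) x y)
    (distinct-classes : ∀ Q j k {x y x′ y′} → Rel (Qs j) (Quadratic.a Q) (Quadratic.r Q) x y →
                        Rel (Qs k) (Quadratic.a Q) (Quadratic.r Q) x′ y′ → j ≡ k) where

    module Form (j : Fin h) = Definite (Qs j)

    f : Fin h → ℤ → ℤ → ℤ
    f j = quadForm (Qs j)

    module _ (Z : Fin h → ℕ) (T : ℕ)
      (bounded : ∀ j u v → f j u v < + suc T → ∣ u ∣ ℕ.≤ Z j × ∣ v ∣ ℕ.≤ Z j) where

      open Boxes Z

      count : ℕ → ℤ
      count n = box λ j u v → 𝟙 (f j u v ≟ + n)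

      count-0 : count 0 ≡ + h
      count-0 = trans (sum-cong λ j → trans
          (ΣZ-single (Z j) 0ℤ z≤n λ u _ u≢0 → ΣZ-zero (Z j) λ v _ → 𝟙-no (f j u v ≟ 0ℤ) λ eq → u≢0 (proj₁ (Form.form-definite j u v eq)))
          (trans (ΣZ-single (Z j) 0ℤ z≤n λ v _ v≢0 → 𝟙-no (f j 0ℤ v ≟ 0ℤ) λ eq → v≢0 (proj₂ (Form.form-definite j 0ℤ v eq)))
            (𝟙-yes (f j 0ℤ 0ℤ ≟ 0ℤ) (origin j))))
        (trans (sum-const h 1ℤ) (*-identityʳ (+ h)))
        where
        origin : ∀ j → f j 0ℤ 0ℤ ≡ 0ℤ
        origin j = l (+ Quadratic.a (Qs j)) (s - + 2 * Quadratic.r (Qs j)) (Quadratic.c (Qs j))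
          where
          l : ∀ a b c → a * (+ 0 * + 0) + b * (+ 0 * + 0) + c * (+ 0 * + 0) ≡ + 0
          l = solve-∀

      count-suc : ∀ n → n ℕ.< T → count (suc n) ≡ + 2 * R (suc n)
      count-suc n n<T = trans (representation-count Qs every-class distinct-classes Z (suc n) (s≤s z≤n)
          (λ j u v eq → bounded j u v (≤-<-trans (≤-reflexive eq) (+<+ (s≤s n<T)))))
        (cong (_*_ (+ 2)) (A≡R (suc n) (s≤s z≤n)))

      module _ (G : ℤ → ℤ) (far : ∀ z → + suc T ≤ z → G z ≡ 0ℤ) where

        by-value : ∀ j u v → G (f j u v) ≡ Σ< (suc T) λ n → G (+ n) * 𝟙 (f j u v ≟ + n)
        by-value j u v = at (f j u v) (Form.form-nonNeg j u v)
          where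
          at : ∀ z → 0ℤ ≤ z → G z ≡ Σ< (suc T) λ n → G (+ n) * 𝟙 (z ≟ + n)
          at (+ k) _ = split (ℕ.<-≤-connex k (suc T))
            where
            off : ∀ n → n ≢ k → G (+ n) * 𝟙 (+ k ≟ + n) ≡ 0ℤ
            off n n≢k = trans (cong (G (+ n) *_) (𝟙-no (+ k ≟ + n) λ eq → n≢k (sym (+-injective eq)))) (*-zeroʳ (G (+ n)))
            split : k ℕ.< suc T ⊎ suc T ℕ.≤ k → G (+ k) ≡ Σ< (suc T) λ n → G (+ n) * 𝟙 (+ k ≟ + n)
            split (inj₁ k≤T) = sym (trans (Σ-single (suc T) k k≤T λ n _ n≢k → off n n≢k)
              (trans (cong (G (+ k) *_) (𝟙-yes (+ k ≟ + k) refl)) (*-identityʳ (G (+ k)))))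
            split (inj₂ T<k) = trans (far (+ k) (+≤+ T<k)) (sym (Σ-zero (suc T) λ n n≤T → off n λ { refl → ℕ.<⇒≱ n≤T T<k }))

        box-by-value : box (λ j u v → G (f j u v)) ≡ + h * G 0ℤ + Σ< T λ n → + 2 * (R (suc n) * G (+ suc n))
        box-by-value = begin
          box (λ j u v → G (f j u v))
            ≡⟨ box-cong by-value ⟩
          box (λ j u v → Σ< (suc T) λ n → G (+ n) * 𝟙 (f j u v ≟ + n))
            ≡⟨ box-Σ (suc T) (λ n j u v → G (+ n) * 𝟙 (f j u v ≟ + n)) ⟩
          Σ< (suc T) (λ n → box λ j u v → G (+ n) * 𝟙 (f j u v ≟ + n))
            ≡⟨ Σ-cong′ (suc T) (λ n → box-*ˡ (G (+ n)) λ j u v → 𝟙 (f j u v ≟ + n)) ⟩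
          Σ< (suc T) (λ n → G (+ n) * count n)
            ≡⟨ Σ-head T (λ n → G (+ n) * count n) ⟩
          G 0ℤ * count 0 + Σ< T (λ n → G (+ suc n) * count (suc n))
            ≡⟨ cong₂ _+_ (trans (cong (G 0ℤ *_) count-0) (*-comm (G 0ℤ) (+ h)))
                 (Σ-cong T λ n n<T → trans (cong (G (+ suc n) *_) (count-suc n n<T)) (l (G (+ suc n)) (R (suc n)))) ⟩
          + h * G 0ℤ + Σ< T (λ n → + 2 * (R (suc n) * G (+ suc n))) ∎
          where
          open ≡-Reasoning
          l : ∀ g r → g * (+ 2 * r) ≡ + 2 * (r * g)
          l = solve-∀

    latticeConst : ℕ
    latticeConst = total Form.latticeConst

    -- The boxes contain every vector with f(v) < T, so the sums over them can be taken by values.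
    -- For each class the vector 0 contributes T³ - 4 T³, which gives 3 h T³ after the change of
    -- sign.
    lattice-side : ∀ T τ → suc T ≡ τ ℕ.* τ → 1 ℕ.≤ τ →
      + 3 * (+ h * (+ suc T * + suc T * + suc T)) + + 2 * smoothed T ≼ latticeConst ℕ.* pow5 τ
    lattice-side T τ T≡ 1≤τ = subst (_≼ latticeConst ℕ.* pow5 τ) (trans (cong -_ value) (l₁ (+ h * cube) (smoothed T)))
        (≼-neg {sum difference} (sum-≼ difference Form.latticeConst (pow5 τ) bounds))
      where
      open ≡-Reasoning
      cube = + suc T * + suc T * + suc T
      Z₂ Z₁ : Fin h → ℕ
      Z₂ j = Form.κ j ℕ.* τ ℕ.+ Form.κ j ℕ.* τ
      Z₁ j = Form.κ j ℕ.* τ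
      W W₄ : ℤ → ℤ
      W  = weight (suc T)
      W₄ z = weight (suc T) (+ 4 * z)
      difference : Fin h → ℤ
      difference j = Form.boxSum j (Z₂ j) W - + 4 * Form.boxSum j (Z₁ j) W₄
      bounds : ∀ j → difference j ≼ Form.latticeConst j ℕ.* pow5 τ
      bounds j = subst (λ k → Form.boxSum j (Z₂ j) (weight k) - + 4 * Form.boxSum j (Z₁ j) (λ z → weight k (+ 4 * z)) ≼
                              Form.latticeConst j ℕ.* pow5 τ) (sym T≡) (Form.lattice-bound j τ 1≤τ)
      bounded₁ : ∀ j u v → f j u v < + suc T → ∣ u ∣ ℕ.≤ Z₁ j × ∣ v ∣ ℕ.≤ Z₁ j
      bounded₁ j u v f<T = ℕ.≮⇒≥ (λ lt → near (inj₁ (ℕ.<⇒≤ lt))) , ℕ.≮⇒≥ (λ lt → near (inj₂ (ℕ.<⇒≤ lt)))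
        where
        near : Form.κ j ℕ.* τ ℕ.≤ ∣ u ∣ ⊎ Form.κ j ℕ.* τ ℕ.≤ ∣ v ∣ → ⊥
        near le = <⇒≱ f<T (≤-trans (≤-reflexive (cong (λ k → + k) T≡)) (Form.form-far j τ u v le))
      bounded₂ : ∀ j u v → f j u v < + suc T → ∣ u ∣ ℕ.≤ Z₂ j × ∣ v ∣ ℕ.≤ Z₂ j
      bounded₂ j u v f<T = ℕ.≤-trans (proj₁ (bounded₁ j u v f<T)) (ℕ.m≤m+n (Z₁ j) (Z₁ j)) ,
                           ℕ.≤-trans (proj₂ (bounded₁ j u v f<T)) (ℕ.m≤m+n (Z₁ j) (Z₁ j))
      W0 : W 0ℤ ≡ cube
      W0 = cong cub (+-identityʳ (+ suc T))
      W₄-far : ∀ z → + suc T ≤ z → W₄ z ≡ 0ℤ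
      W₄-far (+ k) (+≤+ T<k) = weight-far (suc T) (+ 4 * + k) (≤-trans (+≤+ (ℕ.≤-trans T<k (ℕ.m≤n*m k 4))) (≤-reflexive (pos-* 4 k)))
      l₁ : ∀ x y → - (- + 3 * x - + 2 * y) ≡ + 3 * x + + 2 * y
      l₁ = solve-∀
      value : sum difference ≡ - + 3 * (+ h * cube) - + 2 * smoothed T
      value = begin
        sum difference
          ≡⟨ trans (sum-- (λ j → Form.boxSum j (Z₂ j) W) (λ j → + 4 * Form.boxSum j (Z₁ j) W₄))
               (cong (λ z → Boxes.box Z₂ (λ j u v → W (f j u v)) - z) (sum-*ˡ (+ 4) λ j → Form.boxSum j (Z₁ j) W₄)) ⟩
        Boxes.box Z₂ (λ j u v → W (f j u v)) - + 4 * Boxes.box Z₁ (λ j u v → W₄ (f j u v))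
          ≡⟨ cong₂ (λ a b → a - + 4 * b) (box-by-value Z₂ T bounded₂ W (weight-far (suc T))) (box-by-value Z₁ T bounded₁ W₄ W₄-far) ⟩
        (+ h * W 0ℤ + S₂) - + 4 * (+ h * W 0ℤ + S₁)
          ≡⟨ cong (λ z → (+ h * z + S₂) - + 4 * (+ h * z + S₁)) W0 ⟩
        (+ h * cube + S₂) - + 4 * (+ h * cube + S₁)
          ≡⟨ l₂ (+ h * cube) S₂ S₁ ⟩
        - + 3 * (+ h * cube) - (+ 4 * S₁ - S₂)
          ≡⟨ cong (_-_ (- + 3 * (+ h * cube))) combined ⟩
        - + 3 * (+ h * cube) - + 2 * smoothed T ∎
        where
        S₁ = Σ< T λ n → + 2 * (R (suc n) * W₄ (+ suc n))
        S₂ = Σ< T λ n → + 2 * (R (suc n) * W (+ suc n))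
        l₂ : ∀ x a b → (x + a) - + 4 * (x + b) ≡ - + 3 * x - (+ 4 * b - a)
        l₂ = solve-∀
        combined : + 4 * S₁ - S₂ ≡ + 2 * smoothed T
        combined = begin
          + 4 * S₁ - S₂
            ≡⟨ cong (_- S₂) (sym (Σ-*ˡ T (+ 4) λ n → + 2 * (R (suc n) * W₄ (+ suc n)))) ⟩
          Σ< T (λ n → + 4 * (+ 2 * (R (suc n) * W₄ (+ suc n)))) - S₂
            ≡⟨ sym (Σ-- T (λ n → + 4 * (+ 2 * (R (suc n) * W₄ (+ suc n)))) λ n → + 2 * (R (suc n) * W (+ suc n))) ⟩
          Σ< T (λ n → + 4 * (+ 2 * (R (suc n) * W₄ (+ suc n))) - + 2 * (R (suc n) * W (+ suc n)))
            ≡⟨ Σ-cong′ T (λ n → trans (cong (λ z → + 4 * (+ 2 * (R (suc n) * weight (suc T) z)) - + 2 * (R (suc n) * W (+ suc n)))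
                 (trans (sym (pos-* 4 (suc n))) (cong (λ k → + k) (ℕ.*-comm 4 (suc n))))) (l₃ (R (suc n)) (weight (suc T) (+ (suc n ℕ.* 4))) (W (+ suc n)))) ⟩
          Σ< T (λ n → + 2 * (R (suc n) * (+ 4 * weight (suc T) (+ (suc n ℕ.* 4)) - W (+ suc n))))
            ≡⟨ Σ-*ˡ T (+ 2) (λ n → R (suc n) * (+ 4 * weight (suc T) (+ (suc n ℕ.* 4)) - W (+ suc n))) ⟩
          + 2 * smoothed T ∎
          where
          l₃ : ∀ r a b → + 4 * (+ 2 * (r * a)) - + 2 * (r * b) ≡ + 2 * (r * (+ 4 * a - b))
          l₃ = solve-∀

    -- 8 N³ times the lattice estimate minus the divisor estimate eliminates `smoothed`; what is
    -- left is this number times T³.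
    excess : ℤ
    excess = + 24 * (N³ * + h - + N * σ₁)

    excessConst : ℕ
    excessConst = ∣ + 8 * N³ ∣ ℕ.* latticeConst ℕ.+ divisorConst

    excess-bound : ∀ T′ T τ p q → T′ ≡ suc T → T′ ≡ τ ℕ.* τ → 1 ℕ.≤ τ → T′ ℕ.* T′ ℕ.* T′ ≡ q → pow5 τ ℕ.≤ p →
      + 16 * (N³ * Σ< (T′ ℕ.* 4) (λ k → c₄ k * Ψ′ T′ k)) + + 24 * (+ N * σ₁ * (+ T′ * + T′ * + T′)) ≼ divisorConst ℕ.* p →
      ∣ excess ∣ ℕ.* q ℕ.≤ excessConst ℕ.* p
    excess-bound T′ T τ p q refl T≡ 1≤τ refl pow5≤p divisor-side =
      subst₂ ℕ._≤_ (trans (cong ∣_∣ identity) (trans (abs-* excess cube) (cong (∣ excess ∣ ℕ.*_) ∣cube∣)))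
        (trans (cong (ℕ._+ divisorConst ℕ.* p) (sym (ℕ.*-assoc ∣ + 8 * N³ ∣ latticeConst p))) (sym (ℕ.*-distribʳ-+ p (∣ + 8 * N³ ∣ ℕ.* latticeConst) divisorConst)))
        (≼-- {+ 8 * N³ * a} {b} (≼-* {+ 8 * N³} {a} ℕ.≤-refl
            (ℕ.≤-trans (lattice-side T τ T≡ 1≤τ) (ℕ.*-monoʳ-≤ latticeConst pow5≤p))) divisor-side)
      where
      S = Σ< (suc T ℕ.* 4) (λ k → c₄ k * Ψ′ (suc T) k)
      cube = + suc T * + suc T * + suc T
      a = + 3 * (+ h * cube) + + 2 * smoothed T
      b = + 16 * (N³ * S) + + 24 * (+ N * σ₁ * cube)
      ∣cube∣ : ∣ cube ∣ ≡ suc T ℕ.* suc T ℕ.* suc T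
      ∣cube∣ = trans (abs-* (+ suc T * + suc T) (+ suc T)) (cong (ℕ._* suc T) (abs-* (+ suc T) (+ suc T)))
      identity : + 8 * N³ * a - b ≡ excess * cube
      identity = trans (cong (λ z → + 8 * N³ * a - (+ 16 * (N³ * z) + + 24 * (+ N * σ₁ * cube))) (smoothed≡ T))
          (l N³ (+ h) cube (smoothed T) (+ N * σ₁))
        where
        l : ∀ n h c s x → + 8 * n * (+ 3 * (h * c) + + 2 * s) - (+ 16 * (n * s) + + 24 * (x * c)) ≡ + 24 * (n * h - x) * c
        l = solve-∀

    -- T = t¹⁰ = τ² with τ = t⁵, so the lattice error τ⁵ = t²⁵ stays below the divisor error t²⁹,
    -- and T³ = t³⁰ outgrows both.
    excess≡0 : excess ≡ 0ℤ
    excess≡0 = dominated⇒0 29 excess excessConst λ t 1≤t →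
        excess-bound (t ℕ.^ 10) (ℕ.pred (t ℕ.^ 10)) (t ℕ.^ 5) (t ℕ.^ 29) (t ℕ.^ 30)
          (sym (ℕ.suc-pred (t ℕ.^ 10) {{ℕ.>-nonZero (1≤^ t 10 1≤t)}})) (ℕ.^-distribˡ-+-* t 5 5) (1≤^ t 5 1≤t)
          (trans (cong (ℕ._* t ℕ.^ 10) (sym (ℕ.^-distribˡ-+-* t 10 10))) (sym (ℕ.^-distribˡ-+-* t 20 10)))
          (ℕ.≤-trans (ℕ.≤-reflexive (25-th t)) (ℕ.^-monoʳ-≤ t {{ℕ.>-nonZero 1≤t}} {25} {29} (ℕ.m≤m+n 25 4)))
          (divisor-bound t 1≤t)
      where
      1≤^ : ∀ t e → 1 ℕ.≤ t → 1 ℕ.≤ t ℕ.^ e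
      1≤^ t e 1≤t = ℕ.m^n>0 t {{ℕ.>-nonZero 1≤t}} e
      25-th : ∀ t → pow5 (t ℕ.^ 5) ≡ t ℕ.^ 25
      25-th t = trans (cong (λ z → z ℕ.* τ ℕ.* τ ℕ.* τ) (sym (ℕ.^-distribˡ-+-* t 5 5)))
        (trans (cong (λ z → z ℕ.* τ ℕ.* τ) (sym (ℕ.^-distribˡ-+-* t 10 5)))
        (trans (cong (ℕ._* τ) (sym (ℕ.^-distribˡ-+-* t 15 5))) (sym (ℕ.^-distribˡ-+-* t 20 5))))
        where τ = t ℕ.^ 5

    class-number-formula : + N * + h ≡ - moment
    class-number-formula = *-cancelˡ-≡ (+ N) (+ N * + h) (- moment) (*-cancelˡ-≡ (+ N) _ _ (begin
        + N * (+ N * (+ N * + h))   ≡⟨ l₁ (+ N) (+ h) ⟩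
        N³ * + h                    ≡⟨ i-j≡0⇒i≡j (N³ * + h) (+ N * σ₁) difference≡0 ⟩
        + N * σ₁                    ≡⟨ cong (_*_ (+ N)) σ₁≡ ⟩
        + N * - (+ N * moment)      ≡⟨ cong (_*_ (+ N)) (neg-distribʳ-* (+ N) moment) ⟩
        + N * (+ N * - moment)      ∎))
      where
      open ≡-Reasoning
      l₁ : ∀ n h → n * (n * (n * h)) ≡ n * n * n * h
      l₁ = solve-∀
      difference≡0 : N³ * + h - + N * σ₁ ≡ 0ℤ
      difference≡0 = [ (λ ()) , id ]′ (i*j≡0⇒i≡0∨j≡0 (+ 24) {N³ * + h - + N * σ₁} excess≡0)

-- Cycles

sum-toℕ : ∀ n (F : ℕ → ℤ) → sum {n} (λ i → F (toℕ i)) ≡ Σ< n F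
sum-toℕ zero    F = refl
sum-toℕ (suc n) F = trans (cong (_+_ (F 0)) (sum-toℕ n (F ∘ suc))) (sym (Σ-head n F))

sum-*ʳ : ∀ {n} c (F : Fin n → ℤ) → sum (λ i → F i * c) ≡ sum F * c
sum-*ʳ c F = trans (sum-cong λ i → *-comm (F i) c) (trans (sum-*ˡ c F) (*-comm c (sum F)))

power-≅ : ∀ {n B} → B ≢ 0 → ∀ k → n ∣ B ℕ.^ k ℕ.∸ 1 → + (B ℕ.^ k) ≅ 1ℤ [ n ]
power-≅ {n} {B} B≢0 k d = ≅-trans (≅-reflexive split) (≅-trans (≅-+ (≅-refl {x = 1ℤ}) (∣⇒≅0 {x = + (B ℕ.^ k ℕ.∸ 1)} d)) (≅-reflexive refl))
  where
  split : + (B ℕ.^ k) ≡ 1ℤ + + (B ℕ.^ k ℕ.∸ 1)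
  split = cong (λ z → + z) (sym (ℕ.m+[n∸m]≡n (ℕ.m^n>0 B {{ℕ.≢-nonZero B≢0}} k)))

≅-power : ∀ {n B} → B ≢ 0 → ∀ k → + (B ℕ.^ k) ≅ 1ℤ [ n ] → n ∣ B ℕ.^ k ℕ.∸ 1
≅-power {n} {B} B≢0 k e = subst (n ∣_) (cong ∣_∣ (trans (m-n≡m⊖n (B ℕ.^ k) 1) (⊖-≥ (ℕ.m^n>0 B {{ℕ.≢-nonZero B≢0}} k)))) (≅⇒∣- e)

module Cycles (D : ℤ) (X : ℤ → ℤ) (kron : Kronecker D X) (1<N : 1 ℕ.< ∣ D ∣)
  (B : ℕ) (B⊥N : Coprime B ∣ D ∣) (B≢0 : B ≢ 0) (e : ℕ) (order : IsMultiplicativeOrder B ∣ D ∣ e) where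

  open Kronecker kron

  N : ℕ
  N = ∣ D ∣

  χ⁺ : ℕ → ℤ
  χ⁺ y = X (+ y)

  coprime⇒∈X : ∀ {y} → y ℕ.< N → Coprime y N → y ∈X[ N ]
  coprime⇒∈X {zero}  y<N c = ⊥-elim (ℕ.<⇒≢ 1<N (sym (c (N ℕ∣.∣0 , ℕ∣.∣-refl))))
  coprime⇒∈X {suc y} y<N c = s≤s z≤n , ℕ.<⇒≤ y<N , coprime⇒gcd≡1 c

  module Cycle (C : BCycle B N) where
    open BCycle C

    x₀⊥N : Coprime (x 0) N
    x₀⊥N = gcd≡1⇒coprime (proj₂ (proj₂ initial))

    x<N : ∀ i → x i ℕ.< N
    -- X allows the element N itself, but N is coprime to N only for N = 1.
    x<N zero    = ℕ.≤∧≢⇒< (proj₁ (proj₂ initial)) λ x₀≡N → ℕ.<⇒≢ 1<N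
      (sym (x₀⊥N (subst (N ∣_) (sym x₀≡N) ℕ∣.∣-refl , ℕ∣.∣-refl)))
    x<N (suc i) = bound i

    divisionℤ : ∀ i → + B * + x i ≡ + a i * + N + + x (suc i)
    divisionℤ i = trans (sym (pos-* B (x i))) (trans (cong (λ z → + z) (division i))
      (trans (pos-+ (a i ℕ.* N) (x (suc i))) (cong (_+ + x (suc i)) (pos-* (a i) N))))

    step : ∀ i → + B * + x i ≅ + x (suc i) [ N ]
    step i = cg (+ a i) (trans (divisionℤ i) (+-comm (+ a i * + N) (+ x (suc i))))

    x≅power : ∀ i → + x i ≅ + x 0 * + (B ℕ.^ i) [ N ]
    x≅power zero    = ≅-reflexive (sym (*-identityʳ (+ x 0)))
    x≅power (suc i) = ≅-trans (≅-sym (step i)) (≅-trans (≅-* (≅-refl {x = + B}) (x≅power i))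
      (≅-reflexive (trans (l (+ B) (+ x 0) (+ (B ℕ.^ i))) (cong (_*_ (+ x 0)) (sym (pos-* B (B ℕ.^ i)))))))
      where
      l : ∀ b x p → b * (x * p) ≡ x * (b * p)
      l = solve-∀

    χ-step : ∀ i → χ⁺ (x (suc i)) ≡ χ⁺ B * χ⁺ (x i)
    χ-step i = trans (sym (χ-cong (step i))) (χ-* (+ B) (+ x i))

    χ-power : ∀ i → χ⁺ (x i) ≡ χ⁺ B ^ i * χ⁺ (x 0)
    χ-power zero    = sym (*-identityˡ (χ⁺ (x 0)))
    χ-power (suc i) = trans (χ-step i) (trans (cong (_*_ (χ⁺ B)) (χ-power i)) (sym (*-assoc (χ⁺ B) (χ⁺ B ^ i) (χ⁺ (x 0)))))

    closed : x e ≡ x 0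
    closed = ≅-small (≅-trans (x≅power e) (≅-trans (≅-* (≅-refl {x = + x 0}) (power-≅ B≢0 e (proj₁ (proj₂ order))))
      (≅-reflexive (*-identityʳ (+ x 0))))) (x<N e) (x<N 0)

    -- Equal terms would give B^{k+1} ≡ 1 modulo N after cancelling x₀ B^i, against the minimality
    -- of e.
    distinct : ∀ i k → i ℕ.+ suc k ℕ.< e → x i ≢ x (i ℕ.+ suc k)
    distinct i k lt eq = proj₂ (proj₂ order) (suc k) (s≤s z≤n) (ℕ.≤-<-trans (ℕ.m≤n+m (suc k) i) lt)
        (≅-power B≢0 (suc k) (≅-sym (≅-cancelˡ (+ (B ℕ.^ i)) Bⁱ⊥N (≅-cancelˡ (+ x 0) x₀⊥N powers))))
      where
      Bⁱ⊥N : Coprime (B ℕ.^ i) N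
      Bⁱ⊥N = power i
        where
        power : ∀ i → Coprime (B ℕ.^ i) N
        power zero    (d∣1 , _)    = ℕ∣.∣1⇒≡1 d∣1
        power (suc i) (d∣ , d∣N) = power i (Coprime.coprime-divisor (λ (c∣d , c∣B) → B⊥N (c∣B , ℕ∣.∣-trans c∣d d∣N)) d∣ , d∣N)
      powers : + x 0 * (+ (B ℕ.^ i) * 1ℤ) ≅ + x 0 * (+ (B ℕ.^ i) * + (B ℕ.^ suc k)) [ N ]
      powers = ≅-trans (≅-reflexive (cong (_*_ (+ x 0)) (*-identityʳ (+ (B ℕ.^ i))))) (≅-trans (≅-sym (x≅power i))
        (≅-trans (≅-reflexive (cong (λ z → + z) eq)) (≅-trans (x≅power (i ℕ.+ suc k))
          (≅-reflexive (cong (_*_ (+ x 0)) (trans (cong (λ z → + z) (ℕ.^-distribˡ-+-* B i (suc k))) (pos-* (B ℕ.^ i) (B ℕ.^ suc k))))))))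

    injective : ∀ i i′ → i ℕ.< e → i′ ℕ.< e → x i ≡ x i′ → i ≡ i′
    injective i i′ i< i′< eq = compare (ℕ.<-cmp i i′)
      where
      later : ∀ {i i′} → i ℕ.< i′ → i′ ℕ.< e → x i ≢ x i′
      later {i} {i′} lt i′< eq = distinct i (i′ ℕ.∸ suc i) (subst (ℕ._< e) shift i′<) (trans eq (cong x shift))
        where
        shift : i′ ≡ i ℕ.+ suc (i′ ℕ.∸ suc i)
        shift = trans (sym (ℕ.m+[n∸m]≡n lt)) (sym (ℕ.+-suc i (i′ ℕ.∸ suc i)))
      compare : Tri (i ℕ.< i′) (i ≡ i′) (i′ ℕ.< i) → i ≡ i′
      compare (tri≈ _ eq′ _) = eq′
      compare (tri< lt _ _)  = ⊥-elim (later lt i′< eq)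
      compare (tri> _ _ gt)  = ⊥-elim (later gt i< (sym eq))

    digit-sum : χ⁺ B * χ⁺ B ≡ 1ℤ → + N * Σ< e (λ i → χ⁺ (x i) * + a i) ≡ (+ B - χ⁺ B) * Σ< e (λ i → + x i * χ⁺ (x i))
    digit-sum χB²≡1 = begin
      + N * Σ< e (λ i → χ⁺ (x i) * + a i)
        ≡⟨ sym (Σ-*ˡ e (+ N) λ i → χ⁺ (x i) * + a i) ⟩
      Σ< e (λ i → + N * (χ⁺ (x i) * + a i))
        ≡⟨ Σ-cong′ e (λ i → term i) ⟩
      Σ< e (λ i → + B * G i - χ⁺ B * G (suc i))
        ≡⟨ trans (Σ-- e (λ i → + B * G i) λ i → χ⁺ B * G (suc i)) (cong₂ _-_ (Σ-*ˡ e (+ B) G) (Σ-*ˡ e (χ⁺ B) λ i → G (suc i))) ⟩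
      + B * Σ< e G - χ⁺ B * Σ< e (λ i → G (suc i))
        ≡⟨ cong (λ z → + B * Σ< e G - χ⁺ B * z) shifted ⟩
      + B * Σ< e G - χ⁺ B * Σ< e G
        ≡⟨ l (+ B) (χ⁺ B) (Σ< e G) ⟩
      (+ B - χ⁺ B) * Σ< e G ∎
      where
      open ≡-Reasoning
      G : ℕ → ℤ
      G i = + x i * χ⁺ (x i)
      l : ∀ b c g → b * g - c * g ≡ (b - c) * g
      l = solve-∀
      shifted : Σ< e (λ i → G (suc i)) ≡ Σ< e G
      shifted = +-cancelˡ (G 0) (trans (sym (Σ-head e G)) (trans (cong (_+_ (Σ< e G)) (cong (λ k → + k * χ⁺ k) closed)) (+-comm (Σ< e G) (G 0))))
      χ-back : ∀ i → χ⁺ (x i) ≡ χ⁺ B * χ⁺ (x (suc i))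
      χ-back i = sym (trans (cong (_*_ (χ⁺ B)) (χ-step i)) (trans (sym (*-assoc (χ⁺ B) (χ⁺ B) (χ⁺ (x i))))
        (trans (cong (_* χ⁺ (x i)) χB²≡1) (*-identityˡ (χ⁺ (x i))))))
      term : ∀ i → + N * (χ⁺ (x i) * + a i) ≡ + B * G i - χ⁺ B * G (suc i)
      term i = trans (l₁ (+ N) (χ⁺ (x i)) (+ a i) (+ x (suc i)))
        (trans (cong (λ z → χ⁺ (x i) * z - χ⁺ (x i) * + x (suc i)) (sym (divisionℤ i)))
        (trans (cong (λ z → χ⁺ (x i) * (+ B * + x i) - z * + x (suc i)) (χ-back i))
          (l₂ (χ⁺ (x i)) (+ B) (+ x i) (χ⁺ B) (χ⁺ (x (suc i))) (+ x (suc i)))))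
        where
        l₁ : ∀ n c a y → n * (c * a) ≡ c * (a * n + y) - c * y
        l₁ = solve-∀
        l₂ : ∀ c b x p q y → c * (b * x) - p * q * y ≡ b * (x * c) - p * (y * q)
        l₂ = solve-∀

  module _ {f : ℕ} (C : Fin f → BCycle B N) (all : AllCycles e C) where
    open AllCycles all
    module C (j : Fin f) = Cycle (C j)

    x : Fin f → ℕ → ℕ
    x j = BCycle.x (C j)

    moment : ℤ
    moment = Σ< N λ y → + y * χ⁺ y

    hits : ℕ → ℤ
    hits y = sum λ j → Σ< e λ i → 𝟙 (y ℕ.≟ x j i)

    -- Residues not prime to N are where χ vanishes. The others lie on one cycle by `covering` and
    -- `disjoint`, and at one place of it since its terms with index below e are distinct.
    hit-once : ∀ y → y ℕ.< N → hits y * (+ y * χ⁺ y) ≡ + y * χ⁺ y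
    hit-once y y<N = cases (coprime? y N)
      where
      cases : Dec (Coprime y N) → hits y * (+ y * χ⁺ y) ≡ + y * χ⁺ y
      cases (no ¬c) = trans (cong (hits y *_) y*0) (trans (*-zeroʳ (hits y)) (sym y*0))
        where
        y*0 : + y * χ⁺ y ≡ 0ℤ
        y*0 = trans (cong (_*_ (+ y)) (χ-zero {+ y} ¬c)) (*-zeroʳ (+ y))
      cases (yes c) = trans (cong (_* (+ y * χ⁺ y)) (once (covering y (coprime⇒∈X y<N c)))) (*-identityˡ (+ y * χ⁺ y))
        where
        once : ∃[ j ] ∃[ i ] x j (toℕ {e} i) ≡ y → hits y ≡ 1ℤ
        once (j , i , xji≡y) = trans
          (sum-single j λ k k≢j → Σ-zero e λ i′ i′<e → 𝟙-no (y ℕ.≟ x k i′) λ y≡ →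
            k≢j (disjoint k j (Fin.fromℕ< i′<e) i (trans (cong (x k) (Fin.toℕ-fromℕ< i′<e)) (trans (sym y≡) (sym xji≡y)))))
          (trans (Σ-single e (toℕ i) (Fin.toℕ<n i) λ i′ i′<e i′≢i → 𝟙-no (y ℕ.≟ x j i′) λ y≡ →
            i′≢i (C.injective j i′ (toℕ i) i′<e (Fin.toℕ<n i) (trans (sym y≡) (sym xji≡y))))
            (𝟙-yes (y ℕ.≟ x j (toℕ i)) (sym xji≡y)))

    cycles-moment : sum (λ j → Σ< e λ i → + x j i * χ⁺ (x j i)) ≡ moment
    cycles-moment = begin
      sum (λ j → Σ< e λ i → G (x j i))
        ≡⟨ sum-cong (λ j → Σ-cong′ e λ i → sym (Σ-δ N (x j i) (C.x<N j i) G)) ⟩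
      sum (λ j → Σ< e λ i → Σ< N λ y → 𝟙 (y ℕ.≟ x j i) * G y)
        ≡⟨ sum-cong (λ j → Σ-swap e N λ i y → 𝟙 (y ℕ.≟ x j i) * G y) ⟩
      sum (λ j → Σ< N λ y → Σ< e λ i → 𝟙 (y ℕ.≟ x j i) * G y)
        ≡⟨ sum-Σ-swap N (λ j y → Σ< e λ i → 𝟙 (y ℕ.≟ x j i) * G y) ⟩
      Σ< N (λ y → sum λ j → Σ< e λ i → 𝟙 (y ℕ.≟ x j i) * G y)
        ≡⟨ Σ-cong′ N (λ y → trans (sum-cong λ j → Σ-*ʳ e (G y) λ i → 𝟙 (y ℕ.≟ x j i)) (sum-*ʳ (G y) λ j → Σ< e λ i → 𝟙 (y ℕ.≟ x j i))) ⟩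
      Σ< N (λ y → hits y * G y)
        ≡⟨ Σ-cong N hit-once ⟩
      moment ∎
      where
      open ≡-Reasoning
      G : ℕ → ℤ
      G y = + y * χ⁺ y

    total-digit-sum : χ⁺ B * χ⁺ B ≡ 1ℤ →
      + N * sum (λ j → Σ< e λ i → χ⁺ (x j i) * + BCycle.a (C j) i) ≡ (+ B - χ⁺ B) * moment
    total-digit-sum χB²≡1 = trans (sym (sum-*ˡ (+ N) λ j → Σ< e λ i → χ⁺ (x j i) * + BCycle.a (C j) i))
      (trans (sum-cong λ j → C.digit-sum j χB²≡1) (trans (sum-*ˡ (+ B - χ⁺ B) λ j → Σ< e λ i → + x j i * χ⁺ (x j i))
        (cong (_*_ (+ B - χ⁺ B)) cycles-moment)))

class-number-formula : ∀ m → m < 0ℤ → SquareFree m → disc m < - + 4 → ∀ h → IsClassNumber m h →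
  + ∣ disc m ∣ * + h ≡ - Σ< ∣ disc m ∣ (λ x → + x * χ m (+ x))
class-number-formula m m<0 squareFree D<-4 h bij = from-parameters (ring-parameters m squareFree)
  where
  from-parameters : RingParameters m → + ∣ disc m ∣ * + h ≡ - Σ< ∣ disc m ∣ (λ x → + x * χ m (+ x))
  from-parameters (s , t , k , k≢0 , D≡ , D≡disc , fund) = subst
      (λ D → + ∣ D ∣ * + h ≡ - Σ< ∣ D ∣ (λ x → + x * χ m (+ x))) D≡disc
      (ClassNumberFormula.class-number-formula CG.F fund D<-4′ (χ m)
        (subst (λ D → Kronecker D (χ m)) (sym D≡disc) (kronecker m m<0 squareFree)) Reps.Qs Reps.every-class Reps.distinct-classes)
    where
    D<-4′ : Roots.D s t < - + 4
    D<-4′ = subst (_< - + 4) (sym D≡disc) D<-4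
    module CG = ClassGroup m s t k k≢0 D≡ fund D<-4′
    module Reps = CG.Representatives h bij

theorem2p2 :
    (m : ℤ) → m ℤ.< 0ℤ → SquareFree m → disc m ℤ.< ℤ.- (+ 4) →
    (h : ℕ) → IsClassNumber m h →
    (B : ℕ) → 1 ℕ.< B → gcd B ∣ disc m ∣ ≡ 1 →
    (e : ℕ) → IsMultiplicativeOrder B ∣ disc m ∣ e →
    (f : ℕ) (C : Fin f → BCycle B ∣ disc m ∣) → AllCycles e C →
    (χ m (+ B) ≡ -1ℤ →
      (∀ j → χ m (+ BCycle.x₁ (C j)) ≡ 1ℤ) →
      (+ B ℤ.+ 1ℤ) ℤ.* + h
        ≡ sum (λ (j : Fin f) → sum (λ (i : Fin e) →
            -1ℤ ℤ.^ suc (toℕ i) ℤ.* + BCycle.a (C j) (toℕ i))))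
    ×
    (χ m (+ B) ≡ 1ℤ →
      (+ B ℤ.- 1ℤ) ℤ.* + h
        ≡ ℤ.- sum (λ (j : Fin f) → χ-cycle m (C j) ℤ.*
            sum (λ (i : Fin e) → + BCycle.a (C j) (toℕ i))))
theorem2p2 m m<0 squareFree D<-4 h bij B 1<B B⊥D e order f C all = alternating , weighted
  where
  D = disc m
  N = ∣ D ∣
  1<N : 1 ℕ.< N
  1<N = large D D<-4
    where
    large : ∀ D → D < - + 4 → 1 ℕ.< ∣ D ∣
    large -[1+ n ] (-<- 3<n) = s≤s (ℕ.≤-trans (s≤s z≤n) 3<n)
  instance
    N≢0 : NonZero N
    N≢0 = ℕ.>-nonZero (ℕ.<⇒≤ 1<N)
  open Cycles D (χ m) (kronecker m m<0 squareFree) 1<N B (gcd≡1⇒coprime B⊥D) (ℕ.>⇒≢ (ℕ.<⇒≤ 1<B)) e order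
    using (module Cycle; moment; total-digit-sum)
  a : Fin f → ℕ → ℤ
  a j i = + BCycle.a (C j) i
  x : Fin f → ℕ → ℤ
  x j i = + BCycle.x (C j) i
  S = sum λ j → Σ< e λ i → χ m (x j i) * a j i

  -- N S = (B − χ(B)) Σ x χ(x) = −(B − χ(B)) N h
  scaled : ∀ ε → χ m (+ B) ≡ ε → ε * ε ≡ 1ℤ → (+ B - ε) * + h ≡ - S
  scaled ε χB≡ε ε²≡1 = *-cancelˡ-≡ (+ N) _ _ (begin
      + N * ((+ B - ε) * + h)        ≡⟨ l₁ (+ N) (+ B - ε) (+ h) ⟩
      (+ B - ε) * (+ N * + h)        ≡⟨ cong (_*_ (+ B - ε)) (class-number-formula m m<0 squareFree D<-4 h bij) ⟩
      (+ B - ε) * - M                ≡⟨ l₂ (+ B - ε) M ⟩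
      - ((+ B - ε) * M)              ≡⟨ cong -_ (sym digits) ⟩
      - (+ N * S)                    ≡⟨ neg-distribʳ-* (+ N) S ⟩
      + N * - S                      ∎)
    where
    open ≡-Reasoning
    M = Σ< N λ y → + y * χ m (+ y)
    digits : + N * S ≡ (+ B - ε) * M
    digits = trans (total-digit-sum C all (trans (cong₂ _*_ χB≡ε χB≡ε) ε²≡1)) (cong (λ z → (+ B - z) * M) χB≡ε)
    l₁ : ∀ n b h → n * (b * h) ≡ b * (n * h)
    l₁ = solve-∀
    l₂ : ∀ b m → b * - m ≡ - (b * m)
    l₂ = solve-∀

  alternating : χ m (+ B) ≡ -1ℤ → (∀ j → χ m (x j 0) ≡ 1ℤ) →
    (+ B + 1ℤ) * + h ≡ sum λ j → sum λ (i : Fin e) → -1ℤ ^ suc (toℕ i) * a j (toℕ i)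
  alternating χB≡-1 normalized = trans (scaled -1ℤ χB≡-1 refl) (trans (sym (-1*i≡-i S))
    (trans (sym (sum-*ˡ -1ℤ λ j → Σ< e λ i → χ m (x j i) * a j i)) (sum-cong λ j →
      trans (sym (Σ-*ˡ e -1ℤ λ i → χ m (x j i) * a j i)) (trans (Σ-cong′ e λ i → term j i)
        (sym (sum-toℕ e λ i → -1ℤ ^ suc i * a j i))))))
    where
    -- Indices start at 0 here: normalization and χ(B) = -1 give χ(xᵢ) = (-1)^i, and the sign of -S
    -- raises the exponent to i + 1.
    term : ∀ j i → -1ℤ * (χ m (x j i) * a j i) ≡ -1ℤ ^ suc i * a j i
    term j i = trans (cong (λ z → -1ℤ * (z * a j i)) (trans (Cycle.χ-power (C j) i)
        (trans (cong₂ (λ b c → b ^ i * c) χB≡-1 (normalized j)) (*-identityʳ (-1ℤ ^ i)))))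
      (sym (*-assoc -1ℤ (-1ℤ ^ i) (a j i)))

  weighted : χ m (+ B) ≡ 1ℤ → (+ B - 1ℤ) * + h ≡ - sum λ j → χ-cycle m (C j) * sum λ (i : Fin e) → a j (toℕ i)
  weighted χB≡1 = trans (scaled 1ℤ χB≡1 refl) (cong -_ (sum-cong λ j →
    trans (Σ-cong′ e λ i → cong (_* a j i) (constant j i))
      (trans (Σ-*ˡ e (χ m (x j 0)) (a j)) (cong (_*_ (χ m (x j 0))) (sym (sum-toℕ e (a j)))))))
    where
    constant : ∀ j i → χ m (x j i) ≡ χ m (x j 0)
    constant j i = trans (Cycle.χ-power (C j) i) (trans (cong (λ b → b ^ i * χ m (x j 0)) χB≡1)
      (trans (cong (_* χ m (x j 0)) (^-zeroˡ i)) (*-identityˡ (χ m (x j 0)))))
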